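{- Let $a,b,c\in\mathbb{Q}$ with $abc\neq 0$ and $4ac-b^2\neq 0$, and let \[\mathcal{E}_3:\ Y^2=X^3-3a^2c^6X-a^2c^8(2ac-b^2)\] over $\mathbb{Q}$. If $b^2\neq kac$ for each $k\in\{27/8,\,27/4\}$, then $\mathcal{E}_3(\mathbb{Q})$ has positive rank. If $b^2=kac$ for some $k\in\{27/8,\,27/4\}$, then $\mathcal{E}_3(\mathbb{Q})$ has rank $0$. -}

module Defs where

open import Data.Nat using (ℕ; zero; suc)
open import Data.Integer using (+_)
open import Data.Rational using (ℚ; 0ℚ; 1ℚ; _+_; _*_; _-_; -_; 1/_; ≢-nonZero; _/_)
open import Data.Rational.Properties using (_≟_)
open import Data.Unit using (⊤)
open import Data.Product using (Σ; _×_; ∃; _,_)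
open import Relation.Nullary using (¬_; yes; no)
open import Relation.Binary.PropositionalEquality using (_≡_; _≢_)

-- Total reciprocal on ℚ (value 0 at 0); only used where the argument is nonzero.
inv : ℚ → ℚ
inv p with p ≟ 0ℚ
... | yes _ = 0ℚ
... | no p≢0 = 1/_ p {{≢-nonZero p≢0}}

data Pt : Set where
  O   : Pt
  aff : ℚ → ℚ → Pt

OnCurve : ℚ → ℚ → Pt → Set
OnCurve A B O         = ⊤
OnCurve A B (aff x y) = y * y ≡ x * x * x + A * x + B

addPt : ℚ → ℚ → Pt → Pt → Pt
addPt A B O Q = Q
addPt A B (aff x₁ y₁) O = aff x₁ y₁
addPt A B (aff x₁ y₁) (aff x₂ y₂) with x₁ ≟ x₂
... | no _ =
  let l  = (y₂ - y₁) * inv (x₂ - x₁)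
      x₃ = l * l - x₁ - x₂
  in aff x₃ (l * (x₁ - x₃) - y₁)
... | yes _ with y₁ ≟ - y₂
...   | yes _ = O
...   | no _ =
  let l  = ((+ 3 / 1) * x₁ * x₁ + A) * inv ((+ 2 / 1) * y₁)
      x₃ = l * l - x₁ - x₂
  in aff x₃ (l * (x₁ - x₃) - y₁)

mulPt : ℚ → ℚ → ℕ → Pt → Pt
mulPt A B zero    P = O
mulPt A B (suc n) P = addPt A B P (mulPt A B n P)

Torsion : ℚ → ℚ → Pt → Set
Torsion A B P = Σ ℕ λ n → mulPt A B (suc n) P ≡ O

PositiveRank : ℚ → ℚ → Set
PositiveRank A B = Σ Pt λ P → OnCurve A B P × ¬ Torsion A B P

RankZero : ℚ → ℚ → Set
RankZero A B = (P : Pt) → OnCurve A B P → Torsion A B P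

sq : ℚ → ℚ
sq x = x * x

pow : ℚ → ℕ → ℚ
pow x zero    = 1ℚ
pow x (suc n) = x * pow x n

E3A : ℚ → ℚ → ℚ → ℚ
E3A a b c = - ((+ 3 / 1) * sq a * pow c 6)

E3B : ℚ → ℚ → ℚ → ℚ
E3B a b c = - (sq a * pow c 8 * ((+ 2 / 1) * a * c - sq b))

{-# OPTIONS --safe #-}
-- Put q = ac / b² and q⁻¹ = k = m / n in lowest terms. The curve is the quadratic twist by bc, up to scaling,
-- of k y² = x³ − 3x − 2 + k, which carries the point P = (−1, 1). Outside k ∈ {27/8, 27/4} a small multiple of P
-- fails to be integral at some prime p on an integral model, hence lies in the kernel of reduction modulo p; that kernel
-- is torsion-free, because multiplication by p raises the p-adic level of a point by exactly one. For k = 27/8 and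
-- k = 27/4 the curve is isomorphic to y² = u³ + u² − u (conductor 20) and y² = u³ − 4u² + 16 (conductor 11), whose
-- rational points are found by 2-descent: over ℤ in the first case, and in the second over ℤ[ρ], ρ³ = ρ² + ρ + 1, which
-- contains the roots of the cubic up to the prime 2, is norm-Euclidean and has unit group ±ρ^ℤ.
module Submission where

open import Defs
import Data.Integer.Solver
import Data.Rational.Solver
open import Data.Product using (_×_; _,_; ∃; ∃-syntax; proj₁; proj₂)
open import Data.Sum using (_⊎_; inj₁; inj₂; [_,_]′)
open import Data.Empty using (⊥; ⊥-elim)
open import Data.Unit using (tt)
open import Relation.Nullary using (¬_; ¬?; Dec; yes; no; contradiction)
open import Relation.Binary.PropositionalEquality

-- The exceptional values are those at which P itself is torsion: 5P = O for k = 27/4 and 6P = O for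
-- k = 27/8. Elsewhere nonintegrality has to be exhibited uniformly in m and n. Up to sign, the
-- slope f of the chord or tangent that produces 3P, 4P, 5P or 6P determines the coordinates, with x
-- = f² - c for an integer c, so a fractional f suffices. All four slopes are integral only if 3 ∣
-- m, 2 ∣ n, and both d₁ = 2m/3 - 9n/2 and d₂ = 4m/3 - 9n/2 divide (2m/3)². As m and n are coprime,
-- this forces d₁, d₂ ∣ 324, and the finitely many remaining pairs carry an explicit nonintegral
-- point each. The prime p is not under control, so the kernel of reduction must be torsion-free at
-- p = 2 as well; in short Weierstrass form z is additive up to an error of order 3r on the r-th
-- step, which is precise enough at every prime. For conductor 11 there is no rational 2-torsion to
-- split the cubic, hence the cubic ring; there every point is a double, and halving lowers the
-- height except over two values of u.

module ℤS = Data.Integer.Solver.+-*-Solver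
module ℚS = Data.Rational.Solver.+-*-Solver

-- Field arithmetic in ℚ with a total reciprocal.

module Rationals where
  open import Data.Maybe using (Maybe; just; nothing)
  open import Level using (0ℓ)
  open import Tactic.RingSolver.Core.AlmostCommutativeRing using (AlmostCommutativeRing; fromCommutativeRing)
  open import Data.Rational using (0ℚ; 1ℚ; _+_; _*_; _-_; -_; ≢-nonZero)
  open import Data.Rational.Properties
  open ℚS using (solve; con; _:+_; _:*_; _:-_; :-_; _:=_)

  isZero? : ∀ x → Maybe (0ℚ ≡ x)
  isZero? x with 0ℚ ≟ x
  ... | yes p = just p
  ... | no _  = nothing

  ring : AlmostCommutativeRing 0ℓ 0ℓ
  ring = fromCommutativeRing +-*-commutativeRing isZero?

  inv-inverseʳ : ∀ p → p ≢ 0ℚ → p * inv p ≡ 1ℚ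
  inv-inverseʳ p p≢0 with p ≟ 0ℚ
  ... | yes p≡0 = contradiction p≡0 p≢0
  ... | no p≢0′ = *-inverseʳ p {{≢-nonZero p≢0′}}

  p-q≡0⇒p≡q : ∀ {p q} → p - q ≡ 0ℚ → p ≡ q
  p-q≡0⇒p≡q {p} {q} eq = trans (lem p q) (trans (cong (_+ q) eq) (+-identityˡ q))
    where
    lem = solve 2 (λ p q → p := (p :- q) :+ q) refl

  p≡q⇒p-q≡0 : ∀ {p q} → p ≡ q → p - q ≡ 0ℚ
  p≡q⇒p-q≡0 {p} refl = +-inverseʳ p

  -- The solver proves the polynomial identity; the hypothesis enters through its multiplier.
  linear : ∀ {p q x y} k → p - q ≡ k * (x - y) → x ≡ y → p ≡ q
  linear k eq x≡y = p-q≡0⇒p≡q (trans eq (trans (cong (k *_) (p≡q⇒p-q≡0 x≡y)) (*-zeroʳ k)))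

  linear₂ : ∀ {p q x y z w} k j → p - q ≡ k * (x - y) + j * (z - w) → x ≡ y → z ≡ w → p ≡ q
  linear₂ k j eq x≡y z≡w = p-q≡0⇒p≡q (trans eq (cong₂ _+_
    (trans (cong (k *_) (p≡q⇒p-q≡0 x≡y)) (*-zeroʳ k))
    (trans (cong (j *_) (p≡q⇒p-q≡0 z≡w)) (*-zeroʳ j))))

  *-cancelˡ : ∀ {x y} p → p ≢ 0ℚ → p * x ≡ p * y → x ≡ y
  *-cancelˡ {x} {y} p p≢0 eq = trans (sym (lem x)) (trans (cong (inv p *_) eq) (lem y))
    where
    lem : ∀ x → inv p * (p * x) ≡ x
    lem x = trans (sym (*-assoc (inv p) p x))
           (trans (cong (_* x) (trans (*-comm (inv p) p) (inv-inverseʳ p p≢0))) (*-identityˡ x))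

  x*y≡0 : ∀ x y → x * y ≡ 0ℚ → x ≡ 0ℚ ⊎ y ≡ 0ℚ
  x*y≡0 x y eq with x ≟ 0ℚ
  ... | yes x≡0 = inj₁ x≡0
  ... | no x≢0  = inj₂ (*-cancelˡ x x≢0 (trans eq (sym (*-zeroʳ x))))

  p≢0∧q≢0⇒p*q≢0 : ∀ {x y} → x ≢ 0ℚ → y ≢ 0ℚ → x * y ≢ 0ℚ
  p≢0∧q≢0⇒p*q≢0 {x} {y} x≢0 y≢0 eq with x*y≡0 x y eq
  ... | inj₁ x≡0 = x≢0 x≡0
  ... | inj₂ y≡0 = y≢0 y≡0

  x+x≡0 : ∀ x → x + x ≡ 0ℚ → x ≡ 0ℚ
  x+x≡0 x eq = *-cancelˡ (1ℚ + 1ℚ) (λ ()) (trans (lem x) eq)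
    where
    lem = solve 1 (λ x → (con 1ℚ :+ con 1ℚ) :* x := x :+ x) refl

-- The embedding of ℤ into ℚ.

module IntegersInℚ where
  open Rationals
  open import Data.Nat using (suc)
  import Data.Nat.Coprimality as Coprime
  open import Data.Integer using (ℤ; +_; 0ℤ; 1ℤ)
  import Data.Integer as ℤ
  import Data.Integer.Properties as ℤ
  open import Data.Rational using (ℚ; 0ℚ; 1ℚ; _+_; _*_; _-_; -_; mkℚ; ↥_; ↧_; *≡*)
  open import Data.Rational.Properties
  import Data.Rational.Unnormalised as ℚᵘ
  import Data.Rational.Unnormalised.Properties as ℚᵘ
  open ℚS using (solve; con; _:+_; _:*_; _:-_; :-_; _:=_)
  import Data.Integer.Tactic.RingSolver as ℤSolver

  -- Abstract, so that ι m is not unfolded to a constructor form and m remains inferable from it.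
  abstract
    ι : ℤ → ℚ
    ι n = mkℚ n 0 (Coprime.sym (Coprime.1-coprimeTo _))

    ι-+ : ∀ m n → ι (m ℤ.+ n) ≡ ι m + ι n
    ι-+ m n = sym (toℚᵘ-injective (ℚᵘ.≃-trans (toℚᵘ-homo-+ (ι m) (ι n)) (ℚᵘ.*≡* (e m n))))
      where
      e : ∀ m n → (m ℤ.* (+ 1) ℤ.+ n ℤ.* (+ 1)) ℤ.* (+ 1) ≡ (m ℤ.+ n) ℤ.* (+ 1)
      e = ℤSolver.solve-∀

    ι-* : ∀ m n → ι (m ℤ.* n) ≡ ι m * ι n
    ι-* m n = sym (toℚᵘ-injective (ℚᵘ.≃-trans (toℚᵘ-homo-* (ι m) (ι n)) (ℚᵘ.*≡* refl)))

    ι-neg : ∀ n → ι (ℤ.- n) ≡ - ι n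
    ι-neg n = linear 1ℚ (e (ι n) (ι (ℤ.- n))) (trans (sym (ι-+ n (ℤ.- n))) (cong ι (ℤ.+-inverseʳ n)))
      where
      e : ∀ x y → y - - x ≡ 1ℚ * ((x + y) - 0ℚ)
      e = solve 2 (λ x y → y :- :- x := con 1ℚ :* ((x :+ y) :- con 0ℚ)) refl

    ι-- : ∀ m n → ι (m ℤ.- n) ≡ ι m - ι n
    ι-- m n = trans (ι-+ m (ℤ.- n)) (cong (λ z → ι m + z) (ι-neg n))

    ι-injective : ∀ {m n} → ι m ≡ ι n → m ≡ n
    ι-injective refl = refl

    ι≢0 : ∀ {n} → n ≢ 0ℤ → ι n ≢ 0ℚ
    ι≢0 n≢0 eq = n≢0 (ι-injective eq)

    x*↧x≡↥x : ∀ x → x * ι (↧ x) ≡ ι (↥ x)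
    x*↧x≡↥x x@(mkℚ n d _) = toℚᵘ-injective (ℚᵘ.≃-trans (toℚᵘ-homo-* x (ι (↧ x))) (ℚᵘ.*≡* (e n (+ suc d))))
      where
      e : ∀ n d → n ℤ.* d ℤ.* (+ 1) ≡ n ℤ.* (d ℤ.* (+ 1))
      e = ℤSolver.solve-∀

    ι-0 : ι 0ℤ ≡ 0ℚ
    ι-0 = refl

    ι-1 : ι 1ℤ ≡ 1ℚ
    ι-1 = refl

    ι≡mkℚ : ∀ n → ι n ≡ mkℚ n 0 (Coprime.sym (Coprime.1-coprimeTo _))
    ι≡mkℚ n = refl

  ι⟨+⟩ : ∀ {a b a′ b′} → ι a ≡ a′ → ι b ≡ b′ → ι (a ℤ.+ b) ≡ a′ + b′
  ι⟨+⟩ {a} {b} p q = trans (ι-+ a b) (cong₂ _+_ p q)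

  ι⟨-⟩ : ∀ {a b a′ b′} → ι a ≡ a′ → ι b ≡ b′ → ι (a ℤ.- b) ≡ a′ - b′
  ι⟨-⟩ {a} {b} p q = trans (ι-- a b) (cong₂ _-_ p q)

  ι⟨*⟩ : ∀ {a b a′ b′} → ι a ≡ a′ → ι b ≡ b′ → ι (a ℤ.* b) ≡ a′ * b′
  ι⟨*⟩ {a} {b} p q = trans (ι-* a b) (cong₂ _*_ p q)

  ι⟨neg⟩ : ∀ {a a′} → ι a ≡ a′ → ι (ℤ.- a) ≡ - a′
  ι⟨neg⟩ {a} p = trans (ι-neg a) (cong -_ p)

-- The chord-and-tangent group law, including associativity.

module GroupLaw where
  open Rationals
  open import Data.Nat using (ℕ; zero; suc)
  import Data.Nat as ℕ
  open import Data.Integer using () renaming (+_ to pos)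
  open import Data.Rational using (ℚ; 0ℚ; 1ℚ; ½; _+_; _*_; _-_; -_; _/_)
  open import Data.Rational.Properties
  open ℚS using (solve; con; _:+_; _:*_; _:-_; :-_; _:=_)

  -- x³ + A x + B − (l x + m)² = (x − x₁)(x − x₂)(x − x₃)
  record Collinear (A B x₁ x₂ x₃ l m : ℚ) : Set where
    constructor collinear
    field
      sum≡   : x₃ ≡ l * l - x₁ - x₂
      coeff≡ : A ≡ x₁ * x₂ + (x₁ + x₂) * x₃ + (l * m + l * m)
      const≡ : B ≡ m * m - x₁ * x₂ * x₃

  infix 4 _∈[_,_]
  _∈[_,_] : ℚ × ℚ → ℚ → ℚ → Set
  (x , y) ∈[ l , m ] = y ≡ l * x + m

  module _ {A B x₁ x₂ x₃ l m : ℚ} where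
    swap₁₂ : Collinear A B x₁ x₂ x₃ l m → Collinear A B x₂ x₁ x₃ l m
    swap₁₂ (collinear refl refl refl) = collinear (s x₁ x₂ l) (c x₁ x₂ l m) (k x₁ x₂ l m)
      where
      s = solve 3 (λ x₁ x₂ l → l :* l :- x₁ :- x₂ := l :* l :- x₂ :- x₁) refl
      c = solve 4 (λ x₁ x₂ l m → x₁ :* x₂ :+ (x₁ :+ x₂) :* (l :* l :- x₁ :- x₂) :+ (l :* m :+ l :* m)
                      := x₂ :* x₁ :+ (x₂ :+ x₁) :* (l :* l :- x₁ :- x₂) :+ (l :* m :+ l :* m)) refl
      k = solve 4 (λ x₁ x₂ l m → m :* m :- x₁ :* x₂ :* (l :* l :- x₁ :- x₂) := m :* m :- x₂ :* x₁ :* (l :* l :- x₁ :- x₂)) refl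

    swap₂₃ : Collinear A B x₁ x₂ x₃ l m → Collinear A B x₁ x₃ x₂ l m
    swap₂₃ (collinear refl refl refl) = collinear (s x₁ x₂ l) (c x₁ x₂ l m) (k x₁ x₂ l m)
      where
      s = solve 3 (λ x₁ x₂ l → x₂ := l :* l :- x₁ :- (l :* l :- x₁ :- x₂)) refl
      c = solve 4 (λ x₁ x₂ l m → x₁ :* x₂ :+ (x₁ :+ x₂) :* (l :* l :- x₁ :- x₂) :+ (l :* m :+ l :* m)
                      := x₁ :* (l :* l :- x₁ :- x₂) :+ (x₁ :+ (l :* l :- x₁ :- x₂)) :* x₂ :+ (l :* m :+ l :* m)) refl
      k = solve 4 (λ x₁ x₂ l m → m :* m :- x₁ :* x₂ :* (l :* l :- x₁ :- x₂) := m :* m :- x₁ :* (l :* l :- x₁ :- x₂) :* x₂) refl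

    mirror : Collinear A B x₁ x₂ x₃ l m → Collinear A B x₁ x₂ x₃ (- l) (- m)
    mirror (collinear refl refl refl) = collinear (s x₁ x₂ l) (c x₁ x₂ l m) (k x₁ x₂ l m)
      where
      s = solve 3 (λ x₁ x₂ l → l :* l :- x₁ :- x₂ := :- l :* :- l :- x₁ :- x₂) refl
      c = solve 4 (λ x₁ x₂ l m → x₁ :* x₂ :+ (x₁ :+ x₂) :* (l :* l :- x₁ :- x₂) :+ (l :* m :+ l :* m)
                      := x₁ :* x₂ :+ (x₁ :+ x₂) :* (l :* l :- x₁ :- x₂) :+ (:- l :* :- m :+ :- l :* :- m)) refl
      k = solve 4 (λ x₁ x₂ l m → m :* m :- x₁ :* x₂ :* (l :* l :- x₁ :- x₂) := :- m :* :- m :- x₁ :* x₂ :* (l :* l :- x₁ :- x₂)) refl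

    first-onCurve : Collinear A B x₁ x₂ x₃ l m → ∀ {y} → (x₁ , y) ∈[ l , m ] → OnCurve A B (aff x₁ y)
    first-onCurve (collinear refl refl refl) refl = c x₁ x₂ l m
      where
      c = solve 4 (λ x₁ x₂ l m → (l :* x₁ :+ m) :* (l :* x₁ :+ m) := x₁ :* x₁ :* x₁
        :+ (x₁ :* x₂ :+ (x₁ :+ x₂) :* (l :* l :- x₁ :- x₂) :+ (l :* m :+ l :* m)) :* x₁ :+ (m :* m :- x₁ :* x₂ :* (l :* l :- x₁ :- x₂))) refl


  -- The data behind associativity. With S and T the third points on the lines P₁P₂ and P₂P₃, the
  -- line through -S and P₃ gives (P₁ + P₂) + P₃, the line through P₁ and -T gives P₁ + (P₂ + P₃),
  -- and both meet the curve again over the same `r`.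
  record MeetingLines (A B x₁ x₃ s t l m l′ m′ : ℚ) : Set where
    field
      {r μ₁ m₁ μ₂ m₂} : ℚ
      line₁  : Collinear A B s x₃ r μ₁ m₁
      s-on₁  : (s , - (l * s + m)) ∈[ μ₁ , m₁ ]
      x₃-on₁ : (x₃ , l′ * x₃ + m′) ∈[ μ₁ , m₁ ]
      line₂  : Collinear A B x₁ t r μ₂ m₂
      x₁-on₂ : (x₁ , l * x₁ + m) ∈[ μ₂ , m₂ ]
      t-on₂  : (t , - (l′ * t + m′)) ∈[ μ₂ , m₂ ]
      meet   : - (μ₁ * r + m₁) ≡ - (μ₂ * r + m₂)

  -- A curve through P₂ on which P₁ P₂ S lie on a line of slope l and P₂ P₃ T on one of slope l′ is
  -- parametrised by x₂, x₃, l, l′ and ν = (x₁ − x₃)/(l − l′). The lines through −S, P₃ and through P₁, −T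
  -- have slopes ν − l and ν − l′, and they meet the curve in the same third point.
  module TwoLines (x₂ x₃ l l′ ν : ℚ) where
    D x₁ u y₂ m m′ s t A B μ₁ m₁ μ₂ m₂ r : ℚ
    D = l - l′
    x₁ = x₃ + ν * D
    u = x₃ - x₂
    y₂ = ½ * (ν * (u + u + ν * D) - u * (l + l′) - ν * (l * l - (x₂ + x₂ + x₂)))
    m = y₂ - l * x₂
    m′ = y₂ - l′ * x₂
    s = l * l - x₁ - x₂
    t = l′ * l′ - x₂ - x₃
    A = x₁ * x₂ + (x₁ + x₂) * s + (l * m + l * m)
    B = m * m - x₁ * x₂ * s
    μ₁ = ν - l
    m₁ = - (ν * s) - m
    μ₂ = ν - l′
    m₂ = - (ν * t) - m′
    r = μ₁ * μ₁ - s - x₃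
    coeff₁ : A ≡ s * x₃ + (s + x₃) * r + (μ₁ * m₁ + μ₁ * m₁)
    coeff₁ = e x₂ x₃ l l′ ν
      where
      e = solve 5 (λ x₂ x₃ l l′ ν → let D = l :- l′ ; x₁ = x₃ :+ ν :* D ; u = x₃ :- x₂ ; y₂ = con ½ :* (ν :* (u :+ u :+ ν :* D) :- u :* (l :+ l′) :- ν :* (l :* l :- (x₂ :+ x₂ :+ x₂))) ; m = y₂ :- l :* x₂ ; m′ = y₂ :- l′ :* x₂ ; s = l :* l :- x₁ :- x₂ ; t = l′ :* l′ :- x₂ :- x₃ ; A = x₁ :* x₂ :+ (x₁ :+ x₂) :* s :+ (l :* m :+ l :* m) ; B = m :* m :- x₁ :* x₂ :* s ; μ₁ = ν :- l ; m₁ = :- (ν :* s) :- m ; μ₂ = ν :- l′ ; m₂ = :- (ν :* t) :- m′ ; r = μ₁ :* μ₁ :- s :- x₃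
        in A := s :* x₃ :+ (s :+ x₃) :* r :+ (μ₁ :* m₁ :+ μ₁ :* m₁)) refl
    const₁ : B ≡ m₁ * m₁ - s * x₃ * r
    const₁ = e x₂ x₃ l l′ ν
      where
      e = solve 5 (λ x₂ x₃ l l′ ν → let D = l :- l′ ; x₁ = x₃ :+ ν :* D ; u = x₃ :- x₂ ; y₂ = con ½ :* (ν :* (u :+ u :+ ν :* D) :- u :* (l :+ l′) :- ν :* (l :* l :- (x₂ :+ x₂ :+ x₂))) ; m = y₂ :- l :* x₂ ; m′ = y₂ :- l′ :* x₂ ; s = l :* l :- x₁ :- x₂ ; t = l′ :* l′ :- x₂ :- x₃ ; A = x₁ :* x₂ :+ (x₁ :+ x₂) :* s :+ (l :* m :+ l :* m) ; B = m :* m :- x₁ :* x₂ :* s ; μ₁ = ν :- l ; m₁ = :- (ν :* s) :- m ; μ₂ = ν :- l′ ; m₂ = :- (ν :* t) :- m′ ; r = μ₁ :* μ₁ :- s :- x₃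
        in B := m₁ :* m₁ :- s :* x₃ :* r) refl
    x₃-on₁ : l′ * x₃ + m′ ≡ μ₁ * x₃ + m₁
    x₃-on₁ = e x₂ x₃ l l′ ν
      where
      e = solve 5 (λ x₂ x₃ l l′ ν → let D = l :- l′ ; x₁ = x₃ :+ ν :* D ; u = x₃ :- x₂ ; y₂ = con ½ :* (ν :* (u :+ u :+ ν :* D) :- u :* (l :+ l′) :- ν :* (l :* l :- (x₂ :+ x₂ :+ x₂))) ; m = y₂ :- l :* x₂ ; m′ = y₂ :- l′ :* x₂ ; s = l :* l :- x₁ :- x₂ ; t = l′ :* l′ :- x₂ :- x₃ ; A = x₁ :* x₂ :+ (x₁ :+ x₂) :* s :+ (l :* m :+ l :* m) ; B = m :* m :- x₁ :* x₂ :* s ; μ₁ = ν :- l ; m₁ = :- (ν :* s) :- m ; μ₂ = ν :- l′ ; m₂ = :- (ν :* t) :- m′ ; r = μ₁ :* μ₁ :- s :- x₃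
        in l′ :* x₃ :+ m′ := μ₁ :* x₃ :+ m₁) refl
    sum₂ : r ≡ μ₂ * μ₂ - x₁ - t
    sum₂ = e x₂ x₃ l l′ ν
      where
      e = solve 5 (λ x₂ x₃ l l′ ν → let D = l :- l′ ; x₁ = x₃ :+ ν :* D ; u = x₃ :- x₂ ; y₂ = con ½ :* (ν :* (u :+ u :+ ν :* D) :- u :* (l :+ l′) :- ν :* (l :* l :- (x₂ :+ x₂ :+ x₂))) ; m = y₂ :- l :* x₂ ; m′ = y₂ :- l′ :* x₂ ; s = l :* l :- x₁ :- x₂ ; t = l′ :* l′ :- x₂ :- x₃ ; A = x₁ :* x₂ :+ (x₁ :+ x₂) :* s :+ (l :* m :+ l :* m) ; B = m :* m :- x₁ :* x₂ :* s ; μ₁ = ν :- l ; m₁ = :- (ν :* s) :- m ; μ₂ = ν :- l′ ; m₂ = :- (ν :* t) :- m′ ; r = μ₁ :* μ₁ :- s :- x₃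
        in r := μ₂ :* μ₂ :- x₁ :- t) refl
    coeff₂ : A ≡ x₁ * t + (x₁ + t) * r + (μ₂ * m₂ + μ₂ * m₂)
    coeff₂ = e x₂ x₃ l l′ ν
      where
      e = solve 5 (λ x₂ x₃ l l′ ν → let D = l :- l′ ; x₁ = x₃ :+ ν :* D ; u = x₃ :- x₂ ; y₂ = con ½ :* (ν :* (u :+ u :+ ν :* D) :- u :* (l :+ l′) :- ν :* (l :* l :- (x₂ :+ x₂ :+ x₂))) ; m = y₂ :- l :* x₂ ; m′ = y₂ :- l′ :* x₂ ; s = l :* l :- x₁ :- x₂ ; t = l′ :* l′ :- x₂ :- x₃ ; A = x₁ :* x₂ :+ (x₁ :+ x₂) :* s :+ (l :* m :+ l :* m) ; B = m :* m :- x₁ :* x₂ :* s ; μ₁ = ν :- l ; m₁ = :- (ν :* s) :- m ; μ₂ = ν :- l′ ; m₂ = :- (ν :* t) :- m′ ; r = μ₁ :* μ₁ :- s :- x₃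
        in A := x₁ :* t :+ (x₁ :+ t) :* r :+ (μ₂ :* m₂ :+ μ₂ :* m₂)) refl
    const₂ : B ≡ m₂ * m₂ - x₁ * t * r
    const₂ = e x₂ x₃ l l′ ν
      where
      e = solve 5 (λ x₂ x₃ l l′ ν → let D = l :- l′ ; x₁ = x₃ :+ ν :* D ; u = x₃ :- x₂ ; y₂ = con ½ :* (ν :* (u :+ u :+ ν :* D) :- u :* (l :+ l′) :- ν :* (l :* l :- (x₂ :+ x₂ :+ x₂))) ; m = y₂ :- l :* x₂ ; m′ = y₂ :- l′ :* x₂ ; s = l :* l :- x₁ :- x₂ ; t = l′ :* l′ :- x₂ :- x₃ ; A = x₁ :* x₂ :+ (x₁ :+ x₂) :* s :+ (l :* m :+ l :* m) ; B = m :* m :- x₁ :* x₂ :* s ; μ₁ = ν :- l ; m₁ = :- (ν :* s) :- m ; μ₂ = ν :- l′ ; m₂ = :- (ν :* t) :- m′ ; r = μ₁ :* μ₁ :- s :- x₃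
        in B := m₂ :* m₂ :- x₁ :* t :* r) refl
    x₁-on₂ : l * x₁ + m ≡ μ₂ * x₁ + m₂
    x₁-on₂ = e x₂ x₃ l l′ ν
      where
      e = solve 5 (λ x₂ x₃ l l′ ν → let D = l :- l′ ; x₁ = x₃ :+ ν :* D ; u = x₃ :- x₂ ; y₂ = con ½ :* (ν :* (u :+ u :+ ν :* D) :- u :* (l :+ l′) :- ν :* (l :* l :- (x₂ :+ x₂ :+ x₂))) ; m = y₂ :- l :* x₂ ; m′ = y₂ :- l′ :* x₂ ; s = l :* l :- x₁ :- x₂ ; t = l′ :* l′ :- x₂ :- x₃ ; A = x₁ :* x₂ :+ (x₁ :+ x₂) :* s :+ (l :* m :+ l :* m) ; B = m :* m :- x₁ :* x₂ :* s ; μ₁ = ν :- l ; m₁ = :- (ν :* s) :- m ; μ₂ = ν :- l′ ; m₂ = :- (ν :* t) :- m′ ; r = μ₁ :* μ₁ :- s :- x₃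
        in l :* x₁ :+ m := μ₂ :* x₁ :+ m₂) refl
    meet : - (μ₁ * r + m₁) ≡ - (μ₂ * r + m₂)
    meet = e x₂ x₃ l l′ ν
      where
      e = solve 5 (λ x₂ x₃ l l′ ν → let D = l :- l′ ; x₁ = x₃ :+ ν :* D ; u = x₃ :- x₂ ; y₂ = con ½ :* (ν :* (u :+ u :+ ν :* D) :- u :* (l :+ l′) :- ν :* (l :* l :- (x₂ :+ x₂ :+ x₂))) ; m = y₂ :- l :* x₂ ; m′ = y₂ :- l′ :* x₂ ; s = l :* l :- x₁ :- x₂ ; t = l′ :* l′ :- x₂ :- x₃ ; A = x₁ :* x₂ :+ (x₁ :+ x₂) :* s :+ (l :* m :+ l :* m) ; B = m :* m :- x₁ :* x₂ :* s ; μ₁ = ν :- l ; m₁ = :- (ν :* s) :- m ; μ₂ = ν :- l′ ; m₂ = :- (ν :* t) :- m′ ; r = μ₁ :* μ₁ :- s :- x₃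
        in :- (μ₁ :* r :+ m₁) := :- (μ₂ :* r :+ m₂)) refl

    meetingLines : MeetingLines A B x₁ x₃ s t l m l′ m′
    meetingLines = record
      { r = r ; μ₁ = μ₁ ; m₁ = m₁ ; μ₂ = μ₂ ; m₂ = m₂
      ; line₁ = collinear refl coeff₁ const₁ ; s-on₁ = e₁ ν l s m ; x₃-on₁ = x₃-on₁
      ; line₂ = collinear sum₂ coeff₂ const₂ ; x₁-on₂ = x₁-on₂ ; t-on₂ = e₁ ν l′ t m′ ; meet = meet }
      where
      e₁ = solve 4 (λ ν l s m → :- (l :* s :+ m) := (ν :- l) :* s :+ (:- (ν :* s) :- m)) refl

  -- Equating the two expressions for `A` that the lines provide gives an equation linear in `y₂`
  -- with coefficient l - l′. It fixes `y₂`, so any two distinct lines through P₂ are an instance of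
  -- `TwoLines`.
  meetingLines : ∀ {A B x₁ x₂ x₃ s t l m l′ m′ y₂} → Collinear A B x₁ x₂ s l m → Collinear A B x₂ x₃ t l′ m′
               → (x₂ , y₂) ∈[ l , m ] → (x₂ , y₂) ∈[ l′ , m′ ] → l ≢ l′ → MeetingLines A B x₁ x₃ s t l m l′ m′
  meetingLines {A} {B} {x₁} {x₂} {x₃} {s} {t} {l} {m} {l′} {m′} {y₂} col₁ col₂ on₁ on₂ l≢l′ =
    transport x₁≡ y₂≡ (linear (- 1ℚ) (e₁ y₂ l x₂ m) on₁) (linear (- 1ℚ) (e₁ y₂ l′ x₂ m′) on₂) col₁ (Collinear.sum≡ col₂)
    where
    D = l - l′
    D≢0 : D ≢ 0ℚ
    D≢0 eq = l≢l′ (p-q≡0⇒p≡q eq)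
    ν = (x₁ - x₃) * inv D
    module T = TwoLines x₂ x₃ l l′ ν
    e₁ = solve 4 (λ y l x m → m :- (y :- l :* x) := :- con 1ℚ :* (y :- (l :* x :+ m))) refl
    νD : ν * D ≡ x₁ - x₃
    νD = trans (*-assoc (x₁ - x₃) (inv D) D)
        (trans (cong ((x₁ - x₃) *_) (trans (*-comm (inv D) D) (inv-inverseʳ D D≢0))) (*-identityʳ _))
    x₁≡ : x₁ ≡ T.x₁
    x₁≡ = linear (- 1ℚ) (e x₁ x₃ (ν * D)) νD
      where
      e = solve 3 (λ x₁ x₃ d → x₁ :- (x₃ :+ d) := :- con 1ℚ :* (d :- (x₁ :- x₃))) refl
    D*2y₂ : ∀ {x₁ s t y₂ m m′} → x₁ ≡ T.x₁ → m ≡ y₂ - l * x₂ → m′ ≡ y₂ - l′ * x₂ → s ≡ l * l - x₁ - x₂ → t ≡ l′ * l′ - x₂ - x₃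
          → x₁ * x₂ + (x₁ + x₂) * s + (l * m + l * m) ≡ x₂ * x₃ + (x₂ + x₃) * t + (l′ * m′ + l′ * m′)
          → D * y₂ ≡ D * T.y₂
    D*2y₂ {y₂ = y₂} refl refl refl refl refl eq = linear ½ (e x₂ x₃ l l′ ν y₂) eq
      where
      e = solve 6 (λ x₂ x₃ l l′ ν y₂ → let D = l :- l′ ; x₁ = x₃ :+ ν :* D ; u = x₃ :- x₂ ; m = y₂ :- l :* x₂ ; m′ = y₂ :- l′ :* x₂
        in D :* y₂ :- D :* (con ½ :* (ν :* (u :+ u :+ ν :* D) :- u :* (l :+ l′) :- ν :* (l :* l :- (x₂ :+ x₂ :+ x₂))))
        := con ½ :* (x₁ :* x₂ :+ (x₁ :+ x₂) :* (l :* l :- x₁ :- x₂) :+ (l :* m :+ l :* m)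
          :- (x₂ :* x₃ :+ (x₂ :+ x₃) :* (l′ :* l′ :- x₂ :- x₃) :+ (l′ :* m′ :+ l′ :* m′)))) refl
    y₂≡ : y₂ ≡ T.y₂
    y₂≡ = *-cancelˡ D D≢0 (D*2y₂ x₁≡ (linear (- 1ℚ) (e₁ y₂ l x₂ m) on₁) (linear (- 1ℚ) (e₁ y₂ l′ x₂ m′) on₂)
      (Collinear.sum≡ col₁) (Collinear.sum≡ col₂) (trans (sym (Collinear.coeff≡ col₁)) (Collinear.coeff≡ col₂)))
    transport : ∀ {A B x₁ s t m m′ y₂} → x₁ ≡ T.x₁ → y₂ ≡ T.y₂ → m ≡ y₂ - l * x₂ → m′ ≡ y₂ - l′ * x₂
              → Collinear A B x₁ x₂ s l m → t ≡ l′ * l′ - x₂ - x₃ → MeetingLines A B x₁ x₃ s t l m l′ m′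
    transport refl refl refl refl (collinear refl refl refl) refl = T.meetingLines


  mirror-∈ : ∀ l m {x y} → (x , y) ∈[ l , m ] → (x , - y) ∈[ - l , - m ]
  mirror-∈ l m {x} refl = c l m x
    where
    c = solve 3 (λ l m x → :- (l :* x :+ m) := :- l :* x :+ :- m) refl

  neg : Pt → Pt
  neg O         = O
  neg (aff x y) = aff x (- y)

  neg-involutive : ∀ P → neg (neg P) ≡ P
  neg-involutive O         = refl
  neg-involutive (aff x y) = cong (aff x) (neg-neg y)
    where
    neg-neg = solve 1 (λ y → :- (:- y) := y) refl

  module _ {A B : ℚ} where
    -- Either the sum is O, or the two points lie on a non-vertical line which is tangent if they coincide.
    data SumView (x₁ y₁ x₂ y₂ : ℚ) : Set where
      opposite : x₁ ≡ x₂ → y₁ ≡ - y₂ → SumView x₁ y₁ x₂ y₂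
      line     : ∀ x₃ l m → Collinear A B x₁ x₂ x₃ l m → (x₁ , y₁) ∈[ l , m ] → (x₂ , y₂) ∈[ l , m ] → SumView x₁ y₁ x₂ y₂

    private
      -- Common to chord and tangent: the hypothesis on `A` is the difference of the two curve
      -- equations after division by x₂ - x₁, a form that still makes sense when the points
      -- coincide.
      line-from : ∀ {x₁ y₁ x₂ y₂ l} → OnCurve A B (aff x₁ y₁) → A ≡ l * (y₁ + y₂) - (x₁ * x₁ + x₁ * x₂ + x₂ * x₂)
                → y₂ ≡ l * x₂ + (y₁ - l * x₁) → SumView x₁ y₁ x₂ y₂
      line-from {x₁} {y₁} {x₂} {_} {l} on refl refl = line _ l (y₁ - l * x₁)
        (collinear refl (a x₁ y₁ x₂ l) (linear (- 1ℚ) (b B x₁ y₁ x₂ l) on)) (c x₁ y₁ l) refl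
        where
        a = solve 4 (λ x₁ y₁ x₂ l → l :* (y₁ :+ (l :* x₂ :+ (y₁ :- l :* x₁))) :- (x₁ :* x₁ :+ x₁ :* x₂ :+ x₂ :* x₂)
          := x₁ :* x₂ :+ (x₁ :+ x₂) :* (l :* l :- x₁ :- x₂) :+ (l :* (y₁ :- l :* x₁) :+ l :* (y₁ :- l :* x₁))) refl
        b = solve 5 (λ B x₁ y₁ x₂ l → B :- ((y₁ :- l :* x₁) :* (y₁ :- l :* x₁) :- x₁ :* x₂ :* (l :* l :- x₁ :- x₂))
          := :- con 1ℚ :* (y₁ :* y₁ :- (x₁ :* x₁ :* x₁ :+ (l :* (y₁ :+ (l :* x₂ :+ (y₁ :- l :* x₁))) :- (x₁ :* x₁ :+ x₁ :* x₂ :+ x₂ :* x₂)) :* x₁ :+ B))) refl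
        c = solve 3 (λ x₁ y₁ l → y₁ := l :* x₁ :+ (y₁ :- l :* x₁)) refl

    chordView : ∀ x₁ y₁ x₂ y₂ → OnCurve A B (aff x₁ y₁) → OnCurve A B (aff x₂ y₂) → x₁ ≢ x₂ → SumView x₁ y₁ x₂ y₂
    chordView x₁ y₁ x₂ y₂ on₁ on₂ x₁≢x₂ = line-from {l = l} on₁
      (*-cancelˡ h h≢0 (linear₂ 1ℚ (- (y₁ + y₂)) (a A B x₁ y₁ x₂ y₂ l)
        (cong₂ _-_ on₁ on₂) slope))
      (linear (- 1ℚ) (b x₁ y₁ x₂ y₂ l) slope)
      where
      h = x₂ - x₁
      l = (y₂ - y₁) * inv h
      h≢0 : h ≢ 0ℚ
      h≢0 eq = x₁≢x₂ (sym (p-q≡0⇒p≡q eq))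
      slope : l * h ≡ y₂ - y₁
      slope = trans (trans (*-assoc (y₂ - y₁) (inv h) h) (cong ((y₂ - y₁) *_) (trans (*-comm (inv h) h) (inv-inverseʳ h h≢0))))
                    (*-identityʳ _)
      a = solve 7 (λ A B x₁ y₁ x₂ y₂ l → (x₂ :- x₁) :* A :- (x₂ :- x₁) :* (l :* (y₁ :+ y₂) :- (x₁ :* x₁ :+ x₁ :* x₂ :+ x₂ :* x₂))
        := con 1ℚ :* ((y₁ :* y₁ :- y₂ :* y₂) :- ((x₁ :* x₁ :* x₁ :+ A :* x₁ :+ B) :- (x₂ :* x₂ :* x₂ :+ A :* x₂ :+ B))) :+ (:- (y₁ :+ y₂)) :* (l :* (x₂ :- x₁) :- (y₂ :- y₁))) refl
      b = solve 5 (λ x₁ y₁ x₂ y₂ l → y₂ :- (l :* x₂ :+ (y₁ :- l :* x₁)) := :- con 1ℚ :* (l :* (x₂ :- x₁) :- (y₂ :- y₁))) refl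

    tangentView : ∀ x y → OnCurve A B (aff x y) → y + y ≢ 0ℚ → SumView x y x y
    tangentView x y on y≢0 = line-from {l = l} on (linear (- 1ℚ) (a A x y l) slope) (b x y l)
      where
      l = (x * x + x * x + x * x + A) * inv (y + y)
      slope : l * (y + y) ≡ x * x + x * x + x * x + A
      slope = trans (trans (*-assoc (x * x + x * x + x * x + A) (inv (y + y)) (y + y))
                           (cong ((x * x + x * x + x * x + A) *_) (trans (*-comm (inv (y + y)) (y + y)) (inv-inverseʳ (y + y) y≢0))))
                    (*-identityʳ _)
      a = solve 4 (λ A x y l → A :- (l :* (y :+ y) :- (x :* x :+ x :* x :+ x :* x)) := :- con 1ℚ :* (l :* (y :+ y) :- (x :* x :+ x :* x :+ x :* x :+ A))) refl
      b = solve 3 (λ x y l → y := l :* x :+ (y :- l :* x)) refl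

    sumView : ∀ x₁ y₁ x₂ y₂ → OnCurve A B (aff x₁ y₁) → OnCurve A B (aff x₂ y₂) → SumView x₁ y₁ x₂ y₂
    sumView x₁ y₁ x₂ y₂ on₁ on₂ with x₁ ≟ x₂
    ... | no x₁≢x₂ = chordView x₁ y₁ x₂ y₂ on₁ on₂ x₁≢x₂
    ... | yes refl with y₁ ≟ - y₂
    ...   | yes y₁≡-y₂ = opposite refl y₁≡-y₂
    ...   | no y₁≢-y₂ = tangent (x*y≡0 (y₁ - y₂) (y₁ + y₂) (trans (a y₁ y₂) (p≡q⇒p-q≡0 (trans on₁ (sym on₂)))))
      where
      a = solve 2 (λ y₁ y₂ → (y₁ :- y₂) :* (y₁ :+ y₂) := y₁ :* y₁ :- y₂ :* y₂) refl
      b = solve 2 (λ y₁ y₂ → y₁ :- :- y₂ := y₁ :+ y₂) refl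
      tangent : y₁ - y₂ ≡ 0ℚ ⊎ y₁ + y₂ ≡ 0ℚ → SumView x₁ y₁ x₁ y₂
      tangent (inj₂ s≡0) = contradiction (p-q≡0⇒p≡q (trans (b y₁ y₂) s≡0)) y₁≢-y₂
      tangent (inj₁ d≡0) = subst (SumView x₁ y₁ x₁) y₁≡y₂
        (tangentView x₁ y₁ on₁ λ 2y≡0 → y₁≢-y₂ (p-q≡0⇒p≡q (trans (b y₁ y₂) (trans (cong (y₁ +_) (sym y₁≡y₂)) 2y≡0))))
        where
        y₁≡y₂ = p-q≡0⇒p≡q d≡0

    addPt-opposite : ∀ {x y} → addPt A B (aff x (- y)) (aff x y) ≡ O
    addPt-opposite {x} {y} with x ≟ x
    ... | no x≢x = contradiction refl x≢x
    ... | yes _ with - y ≟ - y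
    ...   | yes _ = refl
    ...   | no ≢ = contradiction refl ≢

    addPt-identityʳ : ∀ P → addPt A B P O ≡ P
    addPt-identityʳ O         = refl
    addPt-identityʳ (aff _ _) = refl

  -- A cubic X³ + AX + B with double root x equals (X - x)²(X + 2x). Naming the root lets the
  -- degenerate tangent in `addPt-line` be refuted directly, without a discriminant.
  Nonsingular : ℚ → ℚ → Set
  Nonsingular A B = ∀ x → A ≡ - (x * x + x * x + x * x) → B ≡ x * x * x + x * x * x → ⊥

  module _ {A B : ℚ} (nonsingular : Nonsingular A B) where
    private
      third-y : ∀ {x₁ y₁ x₃ l m l′} → l′ ≡ l → y₁ ≡ l * x₁ + m → l′ * (x₁ - x₃) - y₁ ≡ - (l * x₃ + m)
      third-y {x₁} {_} {x₃} {l} {m} refl refl = a x₁ x₃ l m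
        where
        a = solve 4 (λ x₁ x₃ l m → l :* (x₁ :- x₃) :- (l :* x₁ :+ m) := :- (l :* x₃ :+ m)) refl

      aff-cong : ∀ {x₁ y₁ x₂ x₃ x₃′ l m l′} → l′ ≡ l → y₁ ≡ l * x₁ + m → x₃ ≡ l * l - x₁ - x₂
               → x₃′ ≡ l′ * l′ - x₁ - x₂ → aff x₃′ (l′ * (x₁ - x₃′) - y₁) ≡ aff x₃ (- (l * x₃ + m))
      aff-cong {x₁} {_} {x₂} {l = l} {m} refl y₁≡ refl refl = cong (aff _) (third-y {x₁} {_} {l * l - x₁ - x₂} {l} {m} refl y₁≡)

    -- Replaces the case distinctions of `addPt` by one rule. If x₁ = x₂, then y₁ = y₂ because both
    -- points lie on the line, so y₁ = -y₂ would mean y₁ = 0; a double intersection at such a point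
    -- makes x₁ a double root of the cubic.
    addPt-line : ∀ {x₁ y₁ x₂ y₂ x₃ l m} → Collinear A B x₁ x₂ x₃ l m → (x₁ , y₁) ∈[ l , m ] → (x₂ , y₂) ∈[ l , m ]
               → addPt A B (aff x₁ y₁) (aff x₂ y₂) ≡ aff x₃ (- (l * x₃ + m))
    addPt-line {x₁} {y₁} {x₂} {y₂} {x₃} {l} {m} col on₁ on₂ with x₁ ≟ x₂
    ... | no x₁≢x₂ = aff-cong slope on₁ (Collinear.sum≡ col) refl
      where
      h = x₂ - x₁
      h≢0 : h ≢ 0ℚ
      h≢0 eq = x₁≢x₂ (sym (p-q≡0⇒p≡q eq))
      a = solve 4 (λ x₁ x₂ l m → (l :* x₂ :+ m) :- (l :* x₁ :+ m) := l :* (x₂ :- x₁)) refl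
      slope : (y₂ - y₁) * inv h ≡ l
      slope = trans (cong (_* inv h) (trans (cong₂ _-_ on₂ on₁) (a x₁ x₂ l m)))
             (trans (*-assoc l h (inv h)) (trans (cong (l *_) (inv-inverseʳ h h≢0)) (*-identityʳ l)))
    addPt-line {x₁} {y₁} {x₂} {y₂} {x₃} {l} {m} col@(collinear refl refl refl) refl refl | yes refl with y₁ ≟ - y₂
    ... | yes y≡-y = contradiction (f x₁ l m (p-q≡0⇒p≡q {m} { - (l * x₁)} (trans (b x₁ l m) y≡0))) λ (p , q) → nonsingular x₁ p q
      where
      a = solve 1 (λ y → y :+ y := y :- :- y) refl
      b = solve 3 (λ x₁ l m → m :- :- (l :* x₁) := l :* x₁ :+ m) refl
      y≡0 : y₁ ≡ 0ℚ
      y≡0 = x+x≡0 y₁ (trans (a y₁) (p≡q⇒p-q≡0 y≡-y))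
      c = solve 2 (λ x l → x :* x :+ (x :+ x) :* (l :* l :- x :- x) :+ (l :* :- (l :* x) :+ l :* :- (l :* x)) := :- (x :* x :+ x :* x :+ x :* x)) refl
      d = solve 2 (λ x l → :- (l :* x) :* :- (l :* x) :- x :* x :* (l :* l :- x :- x) := x :* x :* x :+ x :* x :* x) refl
      f : ∀ x l m → m ≡ - (l * x) → (x * x + (x + x) * (l * l - x - x) + (l * m + l * m) ≡ - (x * x + x * x + x * x))
          × (m * m - x * x * (l * l - x - x) ≡ x * x * x + x * x * x)
      f x l _ refl = c x l , d x l
    ... | no y≢-y = aff-cong slope refl refl refl
      where
      two = solve 1 (λ y → (con (pos 2 / 1)) :* y := y :- :- y) refl
      h = (pos 2 / 1) * y₁
      h≢0 : h ≢ 0ℚ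
      h≢0 eq = y≢-y (p-q≡0⇒p≡q (trans (sym (two y₁)) eq))
      a = solve 3 (λ x l m → ((con (pos 3 / 1)) :* x :* x :+ (x :* x :+ (x :+ x) :* (l :* l :- x :- x) :+ (l :* m :+ l :* m))) := l :* ((con (pos 2 / 1)) :* (l :* x :+ m))) refl
      slope : ((pos 3 / 1) * x₁ * x₁ + A) * inv h ≡ l
      slope = trans (cong (_* inv h) (a x₁ l m))
             (trans (*-assoc l h (inv h)) (trans (cong (l *_) (inv-inverseʳ h h≢0)) (*-identityʳ l)))


    private
      _⊞_ : Pt → Pt → Pt
      _⊞_ = addPt A B

      _∈E : Pt → Set
      P ∈E = OnCurve A B P

    neg-onCurve : ∀ P → P ∈E → neg P ∈E
    neg-onCurve O _           = tt
    neg-onCurve (aff x y) on = trans (e y) on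
      where
      e = solve 1 (λ y → :- y :* :- y := y :* y) refl

    add-onCurve : ∀ P Q → P ∈E → Q ∈E → (P ⊞ Q) ∈E
    add-onCurve O Q _ onQ = onQ
    add-onCurve (aff _ _) O onP _ = onP
    add-onCurve (aff x₁ y₁) (aff x₂ y₂) onP onQ with sumView x₁ y₁ x₂ y₂ onP onQ
    ... | opposite refl refl = subst _∈E (sym (addPt-opposite {A} {B} {x₁} {y₂})) tt
    ... | line x₃ l m col on₁ on₂ = subst _∈E (sym (addPt-line col on₁ on₂))
      (first-onCurve (mirror (swap₁₂ (swap₂₃ col))) (mirror-∈ l m refl))

    add-comm : ∀ P Q → P ∈E → Q ∈E → P ⊞ Q ≡ Q ⊞ P
    add-comm O Q _ _ = sym (addPt-identityʳ {A} {B} Q)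
    add-comm (aff _ _) O _ _ = refl
    add-comm (aff x₁ y₁) (aff x₂ y₂) onP onQ with sumView x₁ y₁ x₂ y₂ onP onQ
    ... | opposite refl refl = trans (addPt-opposite {A} {B} {x₁} {y₂})
      (sym (subst (λ y → aff x₁ y ⊞ aff x₁ (- y₂) ≡ O) (e y₂) (addPt-opposite {A} {B} {x₁} { - y₂})))
      where
      e = solve 1 (λ y → :- (:- y) := y) refl
    ... | line x₃ l m col on₁ on₂ = trans (addPt-line col on₁ on₂) (sym (addPt-line (swap₁₂ col) on₂ on₁))

    add-negʳ : ∀ P → P ⊞ neg P ≡ O
    add-negʳ O = refl
    add-negʳ (aff x y) = subst (λ z → aff x z ⊞ aff x (- y) ≡ O) (e y) (addPt-opposite {A} {B} {x} { - y})
      where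
      e = solve 1 (λ y → :- (:- y) := y) refl

    -- The fragment of associativity in which one of the two inner sums is O; `add-assoc` falls back
    -- on it in its degenerate cases.
    add-neg-cancelˡ : ∀ P Q → P ∈E → Q ∈E → P ⊞ (neg P ⊞ Q) ≡ Q
    add-neg-cancelˡ O Q _ _ = refl
    add-neg-cancelˡ P@(aff _ _) O _ _ = add-negʳ P
    add-neg-cancelˡ P@(aff x₁ y₁) (aff x₂ y₂) onP onQ with sumView x₁ (- y₁) x₂ y₂ (neg-onCurve P onP) onQ
    ... | opposite refl eq = trans (cong (P ⊞_) (subst (λ z → aff x₁ z ⊞ aff x₁ y₂ ≡ O) (sym eq) (addPt-opposite {A} {B} {x₁} {y₂})))
                                   (cong (aff x₁) (linear (- 1ℚ) (e y₁ y₂) eq))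
      where
      e = solve 2 (λ y₁ y₂ → y₁ :- y₂ := :- con 1ℚ :* (:- y₁ :- :- y₂)) refl
    ... | line x₃ l m col on₁ on₂ = trans (cong (P ⊞_) (addPt-line col on₁ on₂))
      (trans (addPt-line (mirror (swap₂₃ col)) (trans (e₁ y₁) (mirror-∈ l m on₁)) (mirror-∈ l m refl))
             (cong (aff x₂) (trans (e₂ l m x₂) (sym on₂))))
      where
      e₁ = solve 1 (λ y → y := :- (:- y)) refl
      e₂ = solve 3 (λ l m x → :- (:- l :* x :+ :- m) := l :* x :+ m) refl

    private
      -- Both triples are the roots of one cubic and share x₂, so the remaining pairs {x₁, s} and
      -- {x₃, t} agree.
      parallel : ∀ {x₁ x₂ x₃ s t l m} → Collinear A B x₁ x₂ s l m → Collinear A B x₂ x₃ t l m → (x₁ ≡ x₃ × s ≡ t) ⊎ (s ≡ x₃ × x₁ ≡ t)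
      parallel {x₁} {x₂} {x₃} {s} {t} {l} {m} (collinear refl a₁ _) (collinear refl a₂ _)
        = cases (x*y≡0 (x₁ - x₃) (s - x₃) (trans (e₁ x₁ x₂ x₃ l m) (p≡q⇒p-q≡0 (trans (sym a₁) a₂))))
        where
        e₁ = solve 5 (λ x₁ x₂ x₃ l m → (x₁ :- x₃) :* ((l :* l :- x₁ :- x₂) :- x₃)
           := x₁ :* x₂ :+ (x₁ :+ x₂) :* (l :* l :- x₁ :- x₂) :+ (l :* m :+ l :* m) :- (x₂ :* x₃ :+ (x₂ :+ x₃) :* (l :* l :- x₂ :- x₃) :+ (l :* m :+ l :* m))) refl
        e₂ = solve 4 (λ x₁ x₂ x₃ l → (l :* l :- x₁ :- x₂) :- (l :* l :- x₂ :- x₃) := :- con 1ℚ :* (x₁ :- x₃)) refl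
        e₃ = solve 4 (λ x₁ x₂ x₃ l → x₁ :- (l :* l :- x₂ :- x₃) := :- con 1ℚ :* ((l :* l :- x₁ :- x₂) :- x₃)) refl
        cases : x₁ - x₃ ≡ 0ℚ ⊎ s - x₃ ≡ 0ℚ → (x₁ ≡ x₃ × s ≡ t) ⊎ (s ≡ x₃ × x₁ ≡ t)
        cases (inj₁ eq) = inj₁ (p-q≡0⇒p≡q eq , linear {x = x₁} {x₃} (- 1ℚ) (e₂ x₁ x₂ x₃ l) (p-q≡0⇒p≡q eq))
        cases (inj₂ eq) = inj₂ (p-q≡0⇒p≡q eq , linear {x = s} {x₃} (- 1ℚ) (e₃ x₁ x₂ x₃ l) (p-q≡0⇒p≡q eq))

      same-intercept : ∀ {l m m′ x y} → (x , y) ∈[ l , m ] → (x , y) ∈[ l , m′ ] → m ≡ m′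
      same-intercept {l} {m} {m′} {x} on₁ on₂ = linear 1ℚ (e l m m′ x) (trans (sym on₁) on₂)
        where
        e = solve 4 (λ l m m′ x → m :- m′ := con 1ℚ :* ((l :* x :+ m) :- (l :* x :+ m′))) refl

    add-assoc : ∀ P Q R → P ∈E → Q ∈E → R ∈E → (P ⊞ Q) ⊞ R ≡ P ⊞ (Q ⊞ R)
    add-assoc O Q R _ _ _ = refl
    add-assoc (aff _ _) O R _ _ _ = refl
    add-assoc P@(aff _ _) Q@(aff _ _) O _ _ _ = addPt-identityʳ {A} {B} (P ⊞ Q)
    add-assoc P@(aff x₁ y₁) Q@(aff x₂ y₂) R@(aff x₃ y₃) onP onQ onR
      with sumView x₁ y₁ x₂ y₂ onP onQ | sumView x₂ y₂ x₃ y₃ onQ onR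
    ... | opposite refl refl | _ = trans (cong (_⊞ R) (addPt-opposite {A} {B} {x₁} {y₂}))
      (sym (trans (cong (λ z → P ⊞ (z ⊞ R)) (sym (neg-involutive Q))) (add-neg-cancelˡ P R onP onR)))
    ... | _ | opposite refl refl = trans (trans (add-comm (P ⊞ Q) R (add-onCurve P Q onP onQ) onR)
        (trans (cong (R ⊞_) (add-comm P Q onP onQ)) (add-neg-cancelˡ R P onR onP)))
      (sym (cong (P ⊞_) (addPt-opposite {A} {B} {x₂} {y₃})))
    ... | line s l m col₁ on₁ on₂ | line t l′ m′ col₂ on₂′ on₃ with l ≟ l′
    ...   | no l≢l′ = trans (cong (_⊞ R) (addPt-line col₁ on₁ on₂))
        (trans (addPt-line line₁ s-on₁ (trans on₃ x₃-on₁))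
        (trans (cong (aff r) meet)
        (sym (trans (cong (P ⊞_) (addPt-line col₂ on₂′ on₃)) (addPt-line line₂ (trans on₁ x₁-on₂) t-on₂)))))
      where open MeetingLines (meetingLines col₁ col₂ on₂ on₂′ l≢l′)
    -- Equal slopes through P₂ mean a single line, so the third summand is either the first one or
    -- the negative of P₁ + P₂.
    ...   | yes refl = subst₂ _≡_ (cong (_⊞ R) (sym (addPt-line col₁ on₁ on₂))) (cong (P ⊞_) (sym (addPt-line col₂ on₂′ on₃)))
                         (cases (same-intercept {l} {m} {m′} {x₂} on₂ on₂′))
      where
      cases : m ≡ m′ → aff s (- (l * s + m)) ⊞ R ≡ P ⊞ aff t (- (l * t + m′))
      cases refl with parallel col₁ col₂
      ... | inj₁ (refl , refl) = trans (cong (aff s (- (l * s + m)) ⊞_) (cong (aff x₁) (trans on₃ (sym on₁))))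
        (add-comm (aff s (- (l * s + m))) P (first-onCurve (mirror (swap₁₂ (swap₂₃ col₁))) (mirror-∈ l m refl)) onP)
      ... | inj₂ (refl , refl) = trans (subst (λ y → aff s (- y) ⊞ R ≡ O) on₃ (addPt-opposite {A} {B} {x₃} {y₃}))
        (sym (subst (λ y → P ⊞ aff x₁ (- y) ≡ O) on₁ (add-negʳ P)))

    mul-onCurve : ∀ n P → P ∈E → mulPt A B n P ∈E
    mul-onCurve zero P _ = tt
    mul-onCurve (suc n) P on = add-onCurve P (mulPt A B n P) on (mul-onCurve n P on)

    mul-+ : ∀ i j P → P ∈E → mulPt A B (i ℕ.+ j) P ≡ mulPt A B i P ⊞ mulPt A B j P
    mul-+ zero j P on = refl
    mul-+ (suc i) j P on = trans (cong (P ⊞_) (mul-+ i j P on))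
      (sym (add-assoc P (mulPt A B i P) (mulPt A B j P) on (mul-onCurve i P on) (mul-onCurve j P on)))

    mul-* : ∀ i j P → P ∈E → mulPt A B (i ℕ.* j) P ≡ mulPt A B i (mulPt A B j P)
    mul-* zero j P on = refl
    mul-* (suc i) j P on = trans (mul-+ j (i ℕ.* j) P on) (cong (mulPt A B j P ⊞_) (mul-* i j P on))

-- The isomorphisms (x, y) ↦ (k²x, k³y).

module Scaling where
  open Rationals
  open import Data.Nat using (zero; suc)
  open import Data.Integer using () renaming (+_ to pos)
  open import Data.Rational using (ℚ; 0ℚ; _+_; _*_; _-_; -_; _/_; 1/_; ≢-nonZero)
  open import Data.Rational.Properties
  open ℚS using (solve; con; _:+_; _:*_; _:-_; :-_; _:=_)

  module _ (k : ℚ) (k≢0 : k ≢ 0ℚ) where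
    private
      k² k³ : ℚ
      k² = k * k
      k³ = k * k * k
      k²≢0 = p≢0∧q≢0⇒p*q≢0 k≢0 k≢0
      k³≢0 = p≢0∧q≢0⇒p*q≢0 k²≢0 k≢0

    scale : Pt → Pt
    scale O         = O
    scale (aff x y) = aff (k * k * x) (k * k * k * y)

    module _ {A B A′ B′ : ℚ} (A′≡ : A′ ≡ k * k * k * k * A) (B′≡ : B′ ≡ k * k * k * k * k * k * B) where
      scale-onCurve : ∀ P → OnCurve A B P → OnCurve A′ B′ (scale P)
      scale-onCurve O _ = tt
      scale-onCurve (aff x y) on = trans (linear (k³ * k³) (e A B k x y) on) (cong₂ (λ a b → k² * x * (k² * x) * (k² * x) + a * (k² * x) + b) (sym A′≡) (sym B′≡))
        where
        e = solve 5 (λ A B k x y → (k :* k :* k :* y) :* (k :* k :* k :* y)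
          :- ((k :* k :* x) :* (k :* k :* x) :* (k :* k :* x) :+ (k :* k :* k :* k :* A) :* (k :* k :* x) :+ k :* k :* k :* k :* k :* k :* B)
          := (k :* k :* k) :* (k :* k :* k) :* (y :* y :- (x :* x :* x :+ A :* x :+ B))) refl

      private
        -- Because `inv 0ℚ` is 0, the formula survives h = 0. Hence `scale-addPt` needs no proof
        -- that the denominators inside `addPt` are nonzero, and holds for arbitrary pairs, on the
        -- curve or not.
        quotient : ∀ {c} u h → c ≢ 0ℚ → k * c * u * inv (c * h) ≡ k * (u * inv h)
        quotient {c} u h c≢0 with h ≟ 0ℚ
        ... | yes refl = trans (cong (λ z → k * c * u * inv z) (*-zeroʳ c)) (e k c u)
          where
          e = solve 3 (λ k c u → k :* c :* u :* con 0ℚ := k :* (u :* con 0ℚ)) refl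
        ... | no h≢0 = *-cancelˡ (c * h) ch≢0 (trans (e₁ k c u h (inv (c * h))) (trans (cong (k * c * u *_) (inv-inverseʳ (c * h) ch≢0))
            (trans (cong (k * c * u *_) (sym (*-inverseʳ h {{≢-nonZero h≢0}}))) (e₂ k c u h (1/_ h {{≢-nonZero h≢0}})))))
          where
          ch≢0 = p≢0∧q≢0⇒p*q≢0 c≢0 h≢0
          e₁ = solve 5 (λ k c u h i → c :* h :* (k :* c :* u :* i) := k :* c :* u :* (c :* h :* i)) refl
          e₂ = solve 5 (λ k c u h i → k :* c :* u :* (h :* i) := c :* h :* (k :* (u :* i))) refl

        third : ∀ {l l′ x₁ y₁ x₂} → l′ ≡ k * l →
          aff (l′ * l′ - k² * x₁ - k² * x₂) (l′ * (k² * x₁ - (l′ * l′ - k² * x₁ - k² * x₂)) - k³ * y₁)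
          ≡ scale (aff (l * l - x₁ - x₂) (l * (x₁ - (l * l - x₁ - x₂)) - y₁))
        third {l} {_} {x₁} {y₁} {x₂} refl = cong₂ aff (e₁ k l x₁ x₂) (e₂ k l x₁ x₂ y₁)
          where
          e₁ = solve 4 (λ k l x₁ x₂ → (k :* l) :* (k :* l) :- k :* k :* x₁ :- k :* k :* x₂ := k :* k :* (l :* l :- x₁ :- x₂)) refl
          e₂ = solve 5 (λ k l x₁ x₂ y₁ → (k :* l) :* (k :* k :* x₁ :- ((k :* l) :* (k :* l) :- k :* k :* x₁ :- k :* k :* x₂)) :- k :* k :* k :* y₁
             := k :* k :* k :* (l :* (x₁ :- (l :* l :- x₁ :- x₂)) :- y₁)) refl

        k³-neg : ∀ y → k³ * - y ≡ - (k³ * y)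
        k³-neg y = e k y
          where
          e = solve 2 (λ k y → k :* k :* k :* :- y := :- (k :* k :* k :* y)) refl

      scale-addPt : ∀ P Q → addPt A′ B′ (scale P) (scale Q) ≡ scale (addPt A B P Q)
      scale-addPt O Q = refl
      scale-addPt (aff _ _) O = refl
      scale-addPt (aff x₁ y₁) (aff x₂ y₂) with x₁ ≟ x₂ | k * k * x₁ ≟ k * k * x₂
      ... | yes refl | no ≢ = contradiction refl ≢
      ... | no x₁≢x₂ | yes eq = contradiction (*-cancelˡ k² k²≢0 eq) x₁≢x₂
      ... | no x₁≢x₂ | no _ = third (trans (cong₂ (λ u h → u * inv h) (sub₃ k y₁ y₂) (sub₂ k x₁ x₂)) (quotient (y₂ - y₁) (x₂ - x₁) k²≢0))
        where
        sub₃ = solve 3 (λ k y₁ y₂ → k :* k :* k :* y₂ :- k :* k :* k :* y₁ := k :* (k :* k) :* (y₂ :- y₁)) refl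
        sub₂ = solve 3 (λ k y₁ y₂ → k :* k :* y₂ :- k :* k :* y₁ := k :* k :* (y₂ :- y₁)) refl
      ... | yes refl | yes _ with y₁ ≟ - y₂ | k * k * k * y₁ ≟ - (k * k * k * y₂)
      ...   | yes _ | yes _ = refl
      ...   | yes y₁≡-y₂ | no ≢ = contradiction (trans (cong (k³ *_) y₁≡-y₂) (k³-neg y₂)) ≢
      ...   | no y₁≢-y₂ | yes eq = contradiction (*-cancelˡ k³ k³≢0 (trans eq (sym (k³-neg y₂)))) y₁≢-y₂
      ...   | no _ | no _ = third (trans (cong₂ (λ u h → u * inv h)
          (trans (cong (λ a → (pos 3 / 1) * (k * k * x₁) * (k * k * x₁) + a) A′≡) (num k x₁ A)) (den k y₁))
          (quotient ((pos 3 / 1) * x₁ * x₁ + A) ((pos 2 / 1) * y₁) k³≢0))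
        where
        num = solve 3 (λ k x A → (con (pos 3 / 1)) :* (k :* k :* x) :* (k :* k :* x) :+ k :* k :* k :* k :* A := k :* (k :* k :* k) :* ((con (pos 3 / 1)) :* x :* x :+ A)) refl
        den = solve 2 (λ k y → (con (pos 2 / 1)) :* (k :* k :* k :* y) := k :* k :* k :* ((con (pos 2 / 1)) :* y)) refl

      scale-mulPt : ∀ n P → mulPt A′ B′ n (scale P) ≡ scale (mulPt A B n P)
      scale-mulPt zero P    = refl
      scale-mulPt (suc n) P = trans (cong (addPt A′ B′ (scale P)) (scale-mulPt n P)) (scale-addPt P (mulPt A B n P))

      torsion-unscale : ∀ P → Torsion A′ B′ (scale P) → Torsion A B P
      torsion-unscale P (n , eq) = n , scale-injective-O (trans (sym (scale-mulPt (suc n) P)) eq)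
        where
        scale-injective-O : ∀ {Q} → scale Q ≡ O → Q ≡ O
        scale-injective-O {O} _ = refl

      positiveRank-scale : PositiveRank A B → PositiveRank A′ B′
      positiveRank-scale (P , on , ¬torsion) = scale P , scale-onCurve P on , λ t → ¬torsion (torsion-unscale P t)

      rankZero-unscale : RankZero A′ B′ → RankZero A B
      rankZero-unscale rank0 P on = torsion-unscale P (rank0 (scale P) (scale-onCurve P on))

-- The local ring ℤ₍ₚ₎ and its filtration by powers of p.

module PadicIntegers where
  open Rationals
  open IntegersInℚ
  open import Data.Nat using (ℕ; zero; suc)
  import Data.Nat as ℕ
  import Data.Nat.Properties as ℕ
  import Data.Nat.Divisibility as ℕ
  open import Data.Nat.Primality using (Prime; euclidsLemma; prime⇒nonZero; prime⇒nonTrivial)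
  open import Data.Integer using (ℤ; 0ℤ; 1ℤ; ∣_∣; _^_) renaming (+_ to pos)
  import Data.Integer as ℤ hiding (+_)
  import Data.Integer.Properties as ℤ
  import Data.Integer.Divisibility.Signed as ℤ
  open import Data.Rational using (ℚ; 0ℚ; 1ℚ; _+_; _*_; _-_; -_)
  open import Data.Rational.Properties hiding (_≤?_)
  open ℚS using (solve; con; _:+_; _:*_; _:-_; :-_; _:=_)

  module Localisation (p : ℕ) (prime : Prime p) where
    private
      instance
        p-nonZero : ℕ.NonZero p
        p-nonZero = prime⇒nonZero prime

    π : ℤ
    π = pos p

    Unit : ℤ → Set
    Unit d = ∀ k → d ≢ k ℤ.* π

    π≢0 : ι π ≢ 0ℚ
    π≢0 eq = ℕ.≢-nonZero⁻¹ p (ℤ.+-injective (ι-injective (trans eq (sym ι-0))))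

    unit-1 : Unit 1ℤ
    unit-1 k eq = ℕ.nonTrivial⇒≢1 {{prime⇒nonTrivial prime}} (ℕ.∣1⇒≡1 (ℕ.divides ∣ k ∣ (trans (cong ∣_∣ eq) (ℤ.abs-* k π))))

    multiple : ∀ {d} → p ℕ.∣ ∣ d ∣ → ∃[ k ] d ≡ k ℤ.* π
    multiple p∣d = let ℤ.divides k eq = ℤ.∣ᵤ⇒∣ {π} p∣d in k , eq

    unit-* : ∀ {d e} → Unit d → Unit e → Unit (d ℤ.* e)
    unit-* {d} {e} d∤ e∤ k eq = [ (λ h → let j , q = multiple h in d∤ j q) , (λ h → let j , q = multiple h in e∤ j q) ]′
      (euclidsLemma ∣ d ∣ ∣ e ∣ prime (ℕ.divides ∣ k ∣ (trans (sym (ℤ.abs-* d e)) (trans (cong ∣_∣ eq) (ℤ.abs-* k π)))))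

    -- x ∈ pʳ ℤ₍ₚ₎
    record I (r : ℕ) (x : ℚ) : Set where
      constructor frac
      field
        {num den} : ℤ
        den-unit  : Unit den
        den*x≡num : x * ι den ≡ ι num * ι (π ^ r)

    π^-+ : ∀ r s → ι (π ^ (r ℕ.+ s)) ≡ ι (π ^ r) * ι (π ^ s)
    π^-+ r s = trans (cong ι (ℤ.^-distribˡ-+-* π r s)) (ι-* (π ^ r) (π ^ s))

    I-ι : ∀ n → I 0 (ι n)
    I-ι n = frac {num = n} unit-1 refl

    I-0 : ∀ {r} → I r 0ℚ
    I-0 {r} = frac {num = 0ℤ} unit-1 (trans (*-zeroˡ (ι 1ℤ)) (sym (trans (cong (_* ι (π ^ r)) ι-0) (*-zeroˡ (ι (π ^ r))))))

    I-+ : ∀ {r x y} → I r x → I r y → I r (x + y)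
    I-+ {r} {x} {y} (frac {n} {d} ud p) (frac {m} {e} ue q) = frac {num = n ℤ.* e ℤ.+ m ℤ.* d} (unit-* ud ue)
      (trans (cong ((x + y) *_) (ι-* d e))
      (trans (linear₂ (ι e) (ι d) (lem x y (ι d) (ι e) (ι n) (ι m) (ι (π ^ r))) p q)
             (cong (_* ι (π ^ r)) (sym (trans (ι-+ (n ℤ.* e) (m ℤ.* d)) (cong₂ _+_ (ι-* n e) (ι-* m d)))))))
      where
      lem = solve 7 (λ x y d e n m P → (x :+ y) :* (d :* e) :- (n :* e :+ m :* d) :* P := e :* (x :* d :- n :* P) :+ d :* (y :* e :- m :* P)) refl

    I-* : ∀ {r s x y} → I r x → I s y → I (r ℕ.+ s) (x * y)
    I-* {r} {s} {x} {y} (frac {n} {d} ud p) (frac {m} {e} ue q) = frac {num = n ℤ.* m} (unit-* ud ue)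
      (trans (cong ((x * y) *_) (ι-* d e))
      (trans (linear₂ (y * ι e) (ι n * ι (π ^ r)) (lem x y (ι d) (ι e) (ι n) (ι m) (ι (π ^ r)) (ι (π ^ s))) p q)
             (sym (cong₂ _*_ (ι-* n m) (π^-+ r s)))))
      where
      lem = solve 8 (λ x y d e n m P Q → (x :* y) :* (d :* e) :- (n :* m) :* (P :* Q) := (y :* e) :* (x :* d :- n :* P) :+ (n :* P) :* (y :* e :- m :* Q)) refl

    I-neg : ∀ {r x} → I r x → I r (- x)
    I-neg {r} {x} (frac {n} {d} ud p) = frac {num = ℤ.- n} ud
      (trans (linear (- 1ℚ) (lem x (ι d) (ι n) (ι (π ^ r))) p) (cong (_* ι (π ^ r)) (sym (ι-neg n))))
      where
      lem = solve 4 (λ x d n P → :- x :* d :- :- n :* P := :- con 1ℚ :* (x :* d :- n :* P)) refl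

    I-- : ∀ {r x y} → I r x → I r y → I r (x - y)
    I-- p q = I-+ p (I-neg q)

    I-weaken : ∀ {r s x} → r ℕ.≤ s → I s x → I r x
    I-weaken {r} {s} {x} r≤s (frac {n} {d} ud p) = frac {num = n ℤ.* π ^ (s ℕ.∸ r)} ud
      (trans p (trans (cong (λ k → ι n * ι (π ^ k)) (sym (ℕ.m∸n+n≡m r≤s)))
      (trans (cong (ι n *_) (π^-+ (s ℕ.∸ r) r))
      (trans (sym (*-assoc (ι n) (ι (π ^ (s ℕ.∸ r))) (ι (π ^ r)))) (cong (_* ι (π ^ r)) (sym (ι-* n _)))))))

    I-cong : ∀ {r x y} → x ≡ y → I r x → I r y
    I-cong refl h = h

    I-π : I 1 (ι π)
    I-π = frac {num = 1ℤ} unit-1 (trans (*-comm (ι π) (ι 1ℤ)) (cong (ι 1ℤ *_) (cong ι (sym (ℤ.^-identityʳ π)))))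

    unit-cancel : ∀ {r d x} → Unit d → I r (ι d * x) → I r x
    unit-cancel {r} {d} {x} ud (frac {n} {e} ue p) = frac {num = n} (unit-* ud ue)
      (trans (cong (x *_) (ι-* d e)) (trans (lem x (ι d) (ι e)) p))
      where
      lem = solve 3 (λ x d e → x :* (d :* e) := d :* x :* e) refl

    π-cancel : ∀ {r x} → I (suc r) (ι π * x) → I r x
    π-cancel {r} {x} (frac {n} {e} ue p) = frac {num = n} ue (*-cancelˡ (ι π) π≢0
      (trans (sym (*-assoc (ι π) x (ι e))) (trans p (trans (cong (ι n *_) (ι-* π (π ^ r))) (lem (ι n) (ι π) (ι (π ^ r)))))))
      where
      lem = solve 3 (λ n q P → n :* (q :* P) := q :* (n :* P)) refl

    private
      near-one : ∀ {u} → I 1 (u - 1ℚ) → ∃[ d ] ∃[ e ] Unit e × u * ι d ≡ ι e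
      near-one {u} (frac {n} {d} ud p) = d , d ℤ.+ n ℤ.* π , unit ,
        trans (linear 1ℚ (lem u (ι d) (ι n) (ι π)) (trans p (cong (ι n *_) (cong ι (ℤ.^-identityʳ π)))))
              (sym (trans (ι-+ d (n ℤ.* π)) (cong (ι d +_) (ι-* n π))))
        where
        lem = solve 4 (λ u d n q → u :* d :- (d :+ n :* q) := con 1ℚ :* ((u :- con 1ℚ) :* d :- n :* q)) refl
        rearrange = ℤS.solve 4 (λ d n q k → d ℤS.:= (d ℤS.:+ n ℤS.:* q) ℤS.:- n ℤS.:* q) refl
        factor = ℤS.solve 3 (λ k n q → k ℤS.:* q ℤS.:- n ℤS.:* q ℤS.:= (k ℤS.:- n) ℤS.:* q) refl
        unit : Unit (d ℤ.+ n ℤ.* π)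
        unit k eq = ud (k ℤ.- n) (trans (rearrange d n π k) (trans (cong (ℤ._- n ℤ.* π) eq) (factor k n π)))

    -- An element of 1 + pℤ₍ₚ₎ is a quotient of two p-units. The divisions that the formal
    -- filtration requires are by such elements.
    near-one-cancel : ∀ {r u x} → I 1 (u - 1ℚ) → I r (u * x) → I r x
    near-one-cancel {r} {u} {x} u≈1 h = let d , e , ue , eq = near-one {u} u≈1 in
      unit-cancel ue (I-cong {r} (trans (lem (ι d) u x) (cong (_* x) eq)) (I-* (I-ι d) h))
      where
      lem = solve 3 (λ d u x → d :* (u :* x) := u :* d :* x) refl

    near-one≢0 : ∀ {u} → I 1 (u - 1ℚ) → u ≢ 0ℚ
    near-one≢0 {u} u≈1 refl = let d , e , ue , eq = near-one {u} u≈1 in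
      ue 0ℤ (ι-injective (trans (sym eq) (trans (*-zeroˡ (ι d)) (sym ι-0))))

    -- This is the p-adic valuation. Each factor p removed from the numerator lowers its absolute
    -- value, which bounds the search.
    exact-level : ∀ {x} → x ≢ 0ℚ → I 0 x → ∃[ r ] I r x × ¬ I (suc r) x
    exact-level {x} x≢0 (frac {n} {d} ud x*d≡n) = search ∣ n ∣ 0 n ℕ.≤-refl x*d≡n
      where
      not-next : ∀ {r m} → Unit m → x * ι d ≡ ι m * ι (π ^ r) → ¬ I (suc r) x
      not-next {r} {m} um eq (frac {k} {e} ue q) = unit-* um ue (k ℤ.* d) (ι-injective (*-cancelˡ (ι (π ^ r)) πʳ≢0
        (trans (cong (ι (π ^ r) *_) (ι-* m e)) (trans (linear₂ (- ι e) (ι d) (lem x (ι d) (ι e) (ι m) (ι k) (ι π) (ι (π ^ r))) eq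
          (trans q (cong (ι k *_) (ι-* π (π ^ r)))))
          (cong (ι (π ^ r) *_) (sym (trans (ι-* (k ℤ.* d) π) (cong (_* ι π) (ι-* k d)))))))))
        where
        lem = solve 7 (λ x d e m k q P → P :* (m :* e) :- P :* (k :* d :* q) := :- e :* (x :* d :- m :* P) :+ d :* (x :* e :- k :* (q :* P))) refl
        ^≢0 : ∀ r → ι (π ^ r) ≢ 0ℚ
        ^≢0 zero eq = contradiction (trans (sym ι-1) eq) λ ()
        ^≢0 (suc r) eq = p≢0∧q≢0⇒p*q≢0 π≢0 (^≢0 r) (trans (sym (ι-* π (π ^ r))) eq)
        πʳ≢0 = ^≢0 r
      search : ∀ fuel r m → ∣ m ∣ ℕ.≤ fuel → x * ι d ≡ ι m * ι (π ^ r) → ∃[ r ] I r x × ¬ I (suc r) x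
      search fuel r m m≤ eq with p ℕ.∣? ∣ m ∣
      ... | no p∤m = r , frac ud eq , not-next {r} (λ k q → p∤m (ℕ.divides ∣ k ∣ (trans (cong ∣_∣ q) (ℤ.abs-* k π)))) eq
      ... | yes p∣m = next fuel m≤ (multiple p∣m)
        where
        m≢0 : m ≢ 0ℤ
        m≢0 refl = ud 0ℤ (ι-injective (*-cancelˡ x x≢0 (trans eq
          (trans (trans (cong (_* ι (π ^ r)) ι-0) (*-zeroˡ (ι (π ^ r)))) (sym (trans (cong (x *_) ι-0) (*-zeroʳ x)))))))
        lem = solve 3 (λ k q P → k :* q :* P := k :* (q :* P)) refl
        next : ∀ fuel → ∣ m ∣ ℕ.≤ fuel → ∃[ k ] m ≡ k ℤ.* π → ∃[ r ] I r x × ¬ I (suc r) x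
        next zero m≤0 _ = contradiction (ℤ.∣i∣≡0⇒i≡0 (ℕ.n≤0⇒n≡0 m≤0)) m≢0
        next (suc fuel) m≤ (k , m≡kπ) = search fuel (suc r) k
          (ℕ.≤-pred (ℕ.≤-trans (subst (∣ k ∣ ℕ.<_) (sym (trans (cong ∣_∣ m≡kπ) (ℤ.abs-* k π)))
            (ℕ.m<m*n ∣ k ∣ p {{ℕ.≢-nonZero (λ k≡0 → m≢0 (trans m≡kπ (cong (ℤ._* π) (ℤ.∣i∣≡0⇒i≡0 {k} k≡0))))}}
              (ℕ.nonTrivial⇒n>1 p {{prime⇒nonTrivial prime}}))) m≤))
          (trans eq (trans (cong (λ z → ι z * ι (π ^ r)) m≡kπ) (trans (cong (_* ι (π ^ r)) (ι-* k π))
            (trans (lem (ι k) (ι π) (ι (π ^ r))) (cong (ι k *_) (sym (ι-* π (π ^ r))))))))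

-- The kernel of reduction modulo p and its torsion-freeness.

module ReductionKernel where
  open Rationals
  open IntegersInℚ
  open GroupLaw
  open PadicIntegers
  open import Data.Nat using (ℕ; zero; suc; s≤s; z≤n)
  import Data.Nat as ℕ
  import Data.Nat.Properties as ℕ
  import Data.Nat.Divisibility as ℕ
  open import Data.Nat.Primality using (Prime; prime⇒nonTrivial)
  open import Data.Integer using (ℤ; 1ℤ; ∣_∣) renaming (+_ to pos)
  import Data.Integer as ℤ hiding (+_)
  import Data.Integer.Properties as ℤ
  open import Data.Rational using (ℚ; 0ℚ; 1ℚ; _+_; _*_; _-_; -_)
  open import Data.Rational.Properties hiding (_≤?_)
  open ℚS using (solve; con; _:+_; _:*_; _:-_; :-_; _:=_)

  module Reduction (p : ℕ) (prime : Prime p) {A B : ℚ} (nonsingular : Nonsingular A B)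
                   (A-integral : Localisation.I p prime 0 A) (B-integral : Localisation.I p prime 0 B) where
    open Localisation p prime

    private
      _⊞_ : Pt → Pt → Pt
      _⊞_ = addPt A B

      3· : ℕ → ℕ
      3· r = r ℕ.+ (r ℕ.+ r)

    -- The points of the r-th step of the formal filtration at p, with the parameter z = x / y (and w = 1 / y).
    data Ker (r : ℕ) : Pt → ℚ → Set where
      ker-O   : Ker r O 0ℚ
      ker-aff : ∀ {x y w} → y * w ≡ 1ℚ → I r (x * w) → I (3· r) w → Ker r (aff x y) (x * w)

    private
      -- The Weierstrass equation divided by y³: the affine chart around O, in which O is the
      -- origin.
      w-equation : ∀ {x y w} → OnCurve A B (aff x y) → y * w ≡ 1ℚ
        → w ≡ (x * w) * (x * w) * (x * w) + (A * (x * w) * w * w + B * w * w * w)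
      w-equation {x} {y} {w} on yw≡1 = linear₂ (w * w * w) (- w - w * y * w) (lem A B x y w) on yw≡1
        where
        lem = solve 5 (λ A B x y w → w :- ((x :* w) :* (x :* w) :* (x :* w) :+ (A :* (x :* w) :* w :* w :+ B :* w :* w :* w))
            := w :* w :* w :* (y :* y :- (x :* x :* x :+ A :* x :+ B)) :+ (:- w :- w :* y :* w) :* (y :* w :- con 1ℚ)) refl

    -- In the chart at O one has w(1 - Azw - Bw²) = z³ with the bracket in 1 + pℤ₍ₚ₎, so w is as
    -- divisible as z³.
    ker-raise : ∀ {r P z} → OnCurve A B P → Ker (suc r) P z → I (suc (suc r)) z → Ker (suc (suc r)) P z
    ker-raise _ ker-O _ = ker-O
    ker-raise {r} on (ker-aff {x} {y} {w} yw≡1 Iz Iw) Iz⁺ = ker-aff yw≡1 Iz⁺ (near-one-cancel {u = 1ℚ - (A * (x * w) * w + B * w * w)}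
      (I-cong (lem₁ A B x w) (I-neg (I-+
        (I-weaken (s≤s z≤n) (I-* (I-* A-integral Iz) Iw)) (I-weaken (s≤s z≤n) (I-* (I-* B-integral Iw) Iw)))))
      (I-cong (linear (- 1ℚ) (lem₂ A B x w) (w-equation {x} {y} {w} on yw≡1)) (I-* Iz⁺ (I-* Iz⁺ Iz⁺))))
      where
      lem₁ = solve 4 (λ A B x w → :- (A :* (x :* w) :* w :+ B :* w :* w) := (con 1ℚ :- (A :* (x :* w) :* w :+ B :* w :* w)) :- con 1ℚ) refl
      lem₂ = solve 4 (λ A B x w → (x :* w) :* ((x :* w) :* (x :* w)) :- (con 1ℚ :- (A :* (x :* w) :* w :+ B :* w :* w)) :* w
        := :- con 1ℚ :* (w :- ((x :* w) :* (x :* w) :* (x :* w) :+ (A :* (x :* w) :* w :* w :+ B :* w :* w :* w)))) refl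

    private
      module Sum {r′ : ℕ} {x₁ y₁ w₁ x₂ y₂ w₂ x₃ l m : ℚ} (col : Collinear A B x₁ x₂ x₃ l m)
        (on₁ : (x₁ , y₁) ∈[ l , m ]) (on₂ : (x₂ , y₂) ∈[ l , m ]) (yw₁ : y₁ * w₁ ≡ 1ℚ) (yw₂ : y₂ * w₂ ≡ 1ℚ)
        (Iz₁ : I (suc r′) (x₁ * w₁)) (Iw₁ : I (3· (suc r′)) w₁) (Iz₂ : I (suc r′) (x₂ * w₂)) (Iw₂ : I (3· (suc r′)) w₂) where

        r : ℕ
        r = suc r′

        -- In the chart at O the line is w = λ′z + ν. Subtracting the chart equations of the two
        -- points gives (w₁ - w₂)d = (z₁ - z₂)n, so λ′ = n/d, and in that form also for a tangent.
        -- Substituting the line into the chart equation leaves a cubic in z with leading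
        -- coefficient `c`.
        z₁ z₂ d n c λ′ ν y₃ : ℚ
        z₁ = x₁ * w₁
        z₂ = x₂ * w₂
        d  = 1ℚ - (A * z₁ * (w₁ + w₂) + B * (w₁ * w₁ + w₁ * w₂ + w₂ * w₂))
        n  = z₁ * z₁ + z₁ * z₂ + z₂ * z₂ + A * w₂ * w₂
        ν  = inv m
        λ′ = - l * ν
        c  = 1ℚ + (A * λ′ * λ′ + B * λ′ * λ′ * λ′)
        y₃ = l * x₃ + m

        d≈1 : I 1 (d - 1ℚ)
        d≈1 = I-cong (lem (A * z₁ * (w₁ + w₂)) (B * (w₁ * w₁ + w₁ * w₂ + w₂ * w₂))) (I-neg (I-+
          (I-weaken (s≤s z≤n) (I-* (I-* A-integral Iz₁) (I-+ Iw₁ Iw₂)))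
          (I-weaken (s≤s z≤n) (I-* B-integral (I-+ (I-+ (I-* Iw₁ Iw₁) (I-* Iw₁ Iw₂)) (I-* Iw₂ Iw₂))))))
          where
          lem = solve 2 (λ u v → :- (u :+ v) := (con 1ℚ :- (u :+ v)) :- con 1ℚ) refl

        In : I (r ℕ.+ r) n
        In = I-+ (I-+ (I-+ (I-* Iz₁ Iz₁) (I-* Iz₁ Iz₂)) (I-* Iz₂ Iz₂))
                 (I-weaken (ℕ.m≤n⇒m≤o+n (3· r) (ℕ.m≤n+m (r ℕ.+ r) r)) (I-* (I-* A-integral Iw₂) Iw₂))

        -- Multiplied by (y₁ y₂)², the slope relation becomes a polynomial identity in x₁, x₂, l, m.
        ld≡-mn : l * d + m * n ≡ 0ℚ
        ld≡-mn = *-cancelˡ (y₁ * y₂ * (y₁ * y₂)) (p≢0∧q≢0⇒p*q≢0 y₁y₂≢0 y₁y₂≢0)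
          (trans (homogenise A B x₁ y₁ w₁ x₂ y₂ w₂ l m) (trans (cong₂ G yw₁ yw₂) (trans (G-11 col on₁ on₂) (sym (*-zeroʳ (y₁ * y₂ * (y₁ * y₂)))))))
          where
          unit≢0 : ∀ y w → y * w ≡ 1ℚ → y ≢ 0ℚ
          unit≢0 _ w eq refl = contradiction (trans (sym (*-zeroˡ w)) eq) λ ()
          y₁y₂≢0 : y₁ * y₂ ≢ 0ℚ
          y₁y₂≢0 = p≢0∧q≢0⇒p*q≢0 (unit≢0 y₁ w₁ yw₁) (unit≢0 y₂ w₂ yw₂)
          G : ℚ → ℚ → ℚ
          G a b = l * (y₁ * y₁ * y₂ * y₂ - (A * x₁ * (a * a * y₂ * y₂ + a * b * y₁ * y₂) + B * (a * a * y₂ * y₂ + a * b * y₁ * y₂ + b * b * y₁ * y₁)))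
                + m * (x₁ * x₁ * a * a * y₂ * y₂ + x₁ * x₂ * a * b * y₁ * y₂ + x₂ * x₂ * b * b * y₁ * y₁ + A * b * b * y₁ * y₁)
          homogenise = solve 10 (λ A B x₁ y₁ w₁ x₂ y₂ w₂ l m → let z₁ = x₁ :* w₁ ; z₂ = x₂ :* w₂ ; a = y₁ :* w₁ ; b = y₂ :* w₂
            in y₁ :* y₂ :* (y₁ :* y₂) :* (l :* (con 1ℚ :- (A :* z₁ :* (w₁ :+ w₂) :+ B :* (w₁ :* w₁ :+ w₁ :* w₂ :+ w₂ :* w₂)))
                                     :+ m :* (z₁ :* z₁ :+ z₁ :* z₂ :+ z₂ :* z₂ :+ A :* w₂ :* w₂))
            := l :* (y₁ :* y₁ :* y₂ :* y₂ :- (A :* x₁ :* (a :* a :* y₂ :* y₂ :+ a :* b :* y₁ :* y₂) :+ B :* (a :* a :* y₂ :* y₂ :+ a :* b :* y₁ :* y₂ :+ b :* b :* y₁ :* y₁)))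
                :+ m :* (x₁ :* x₁ :* a :* a :* y₂ :* y₂ :+ x₁ :* x₂ :* a :* b :* y₁ :* y₂ :+ x₂ :* x₂ :* b :* b :* y₁ :* y₁ :+ A :* b :* b :* y₁ :* y₁)) refl
          G-11 : Collinear A B x₁ x₂ x₃ l m → (x₁ , y₁) ∈[ l , m ] → (x₂ , y₂) ∈[ l , m ] → G 1ℚ 1ℚ ≡ 0ℚ
          G-11 (collinear refl refl refl) refl refl = lem x₁ x₂ l m
            where
            lem = solve 4 (λ x₁ x₂ l m → let y₁ = l :* x₁ :+ m ; y₂ = l :* x₂ :+ m ; x₃ = l :* l :- x₁ :- x₂ ; A = x₁ :* x₂ :+ (x₁ :+ x₂) :* x₃ :+ (l :* m :+ l :* m) ; B = m :* m :- x₁ :* x₂ :* x₃ ; a = con 1ℚ ; b = con 1ℚ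
              in l :* (y₁ :* y₁ :* y₂ :* y₂ :- (A :* x₁ :* (a :* a :* y₂ :* y₂ :+ a :* b :* y₁ :* y₂) :+ B :* (a :* a :* y₂ :* y₂ :+ a :* b :* y₁ :* y₂ :+ b :* b :* y₁ :* y₁)))
                :+ m :* (x₁ :* x₁ :* a :* a :* y₂ :* y₂ :+ x₁ :* x₂ :* a :* b :* y₁ :* y₂ :+ x₂ :* x₂ :* b :* b :* y₁ :* y₁ :+ A :* b :* b :* y₁ :* y₁) := con 0ℚ) refl

        l*z+m*w≡1 : ∀ x y w → (x , y) ∈[ l , m ] → y * w ≡ 1ℚ → l * (x * w) + m * w ≡ 1ℚ
        l*z+m*w≡1 x _ w refl eq = trans (lem l m x w) eq
          where
          lem = solve 4 (λ l m x w → l :* (x :* w) :+ m :* w := (l :* x :+ m) :* w) refl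

        -- The line misses O: with m = 0 the slope relation and d ≠ 0 give l = 0, against l z₁ + m
        -- w₁ = 1.
        m≢0 : m ≢ 0ℚ
        m≢0 refl = contradiction (trans (sym (trans (cong (λ l → l * z₁ + 0ℚ * w₁) l≡0) (zero-sum z₁ w₁))) (l*z+m*w≡1 x₁ y₁ w₁ on₁ yw₁)) λ ()
          where
          zero-sum = solve 2 (λ z w → con 0ℚ :* z :+ con 0ℚ :* w := con 0ℚ) refl
          lem = solve 3 (λ l d n → d :* l := l :* d :+ con 0ℚ :* n) refl
          l≡0 : l ≡ 0ℚ
          l≡0 = *-cancelˡ d (near-one≢0 {d} d≈1) (trans (lem l d n) (trans ld≡-mn (sym (*-zeroʳ d))))

        mν≡1 : m * ν ≡ 1ℚ
        mν≡1 = inv-inverseʳ m m≢0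

        Iλ : I (r ℕ.+ r) λ′
        Iλ = near-one-cancel {u = d} {λ′} d≈1 (I-cong (linear₂ ν (- n) (lem l m ν d n) ld≡-mn mν≡1) In)
          where
          lem = solve 5 (λ l m ν d n → n :- d :* (:- l :* ν) := ν :* ((l :* d :+ m :* n) :- con 0ℚ) :+ :- n :* (m :* ν :- con 1ℚ)) refl

        w-from-z : ∀ z w → l * z + m * w ≡ 1ℚ → w ≡ λ′ * z + ν
        w-from-z z w eq = linear₂ ν (- w) (lem l m ν z w) eq mν≡1
          where
          lem = solve 5 (λ l m ν z w → w :- (:- l :* ν :* z :+ ν) := ν :* ((l :* z :+ m :* w) :- con 1ℚ) :+ :- w :* (m :* ν :- con 1ℚ)) refl

        Iν : I (3· r) ν
        Iν = I-cong (lem λ′ z₁ ν (w-from-z z₁ w₁ (l*z+m*w≡1 x₁ y₁ w₁ on₁ yw₁))) (I-- Iw₁ (I-weaken (ℕ.≤-reflexive (ℕ.+-comm r (r ℕ.+ r))) (I-* Iλ Iz₁)))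
          where
          e = solve 2 (λ a ν → a :+ ν :- a := ν) refl
          lem : ∀ λ′ z₁ ν → w₁ ≡ λ′ * z₁ + ν → w₁ - λ′ * z₁ ≡ ν
          lem λ′ z₁ ν eq = trans (cong (_- λ′ * z₁) eq) (e (λ′ * z₁) ν)

        c≈1 : I 1 (c - 1ℚ)
        c≈1 = I-cong (lem (A * λ′ * λ′) (B * λ′ * λ′ * λ′)) (I-+
          (I-weaken (s≤s z≤n) (I-* (I-* A-integral Iλ) Iλ)) (I-weaken (s≤s z≤n) (I-* (I-* (I-* B-integral Iλ) Iλ) Iλ)))
          where
          lem = solve 2 (λ u v → u :+ v := (con 1ℚ :+ (u :+ v)) :- con 1ℚ) refl

        -- The product of the values l xᵢ + m is -l³ times the cubic at -m/l, that is m³ + Aml² -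
        -- Bl³. Since c is a unit, the third point has y₃ ≠ 0 and therefore lies in the chart at O.
        m³c≡y₁y₂y₃ : m * m * m * c ≡ y₁ * y₂ * y₃
        m³c≡y₁y₂y₃ = trans (lem₁ A B l m ν) (trans (cong (λ b → m * m * m + (A * m * (l * b) * (l * b) - B * (l * b) * (l * b) * (l * b))) mν≡1)
                           (at-1 col on₁ on₂))
          where
          lem₁ = solve 5 (λ A B l m ν → m :* m :* m :* (con 1ℚ :+ (A :* (:- l :* ν) :* (:- l :* ν) :+ B :* (:- l :* ν) :* (:- l :* ν) :* (:- l :* ν)))
               := m :* m :* m :+ (A :* m :* (l :* (m :* ν)) :* (l :* (m :* ν)) :- B :* (l :* (m :* ν)) :* (l :* (m :* ν)) :* (l :* (m :* ν)))) refl
          at-1 : Collinear A B x₁ x₂ x₃ l m → (x₁ , y₁) ∈[ l , m ] → (x₂ , y₂) ∈[ l , m ]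
               → m * m * m + (A * m * (l * 1ℚ) * (l * 1ℚ) - B * (l * 1ℚ) * (l * 1ℚ) * (l * 1ℚ)) ≡ y₁ * y₂ * y₃
          at-1 (collinear refl refl refl) refl refl = lem₂ x₁ x₂ l m
            where
            lem₂ = solve 4 (λ x₁ x₂ l m → let x₃ = l :* l :- x₁ :- x₂ ; A = x₁ :* x₂ :+ (x₁ :+ x₂) :* x₃ :+ (l :* m :+ l :* m) ; B = m :* m :- x₁ :* x₂ :* x₃
              in m :* m :* m :+ (A :* m :* (l :* con 1ℚ) :* (l :* con 1ℚ) :- B :* (l :* con 1ℚ) :* (l :* con 1ℚ) :* (l :* con 1ℚ)) := (l :* x₁ :+ m) :* (l :* x₂ :+ m) :* (l :* x₃ :+ m)) refl

        m³≢0 : m * m * m ≢ 0ℚ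
        m³≢0 = p≢0∧q≢0⇒p*q≢0 (p≢0∧q≢0⇒p*q≢0 m≢0 m≢0) m≢0

        y₃≢0 : y₃ ≢ 0ℚ
        y₃≢0 eq = p≢0∧q≢0⇒p*q≢0 m³≢0 (near-one≢0 {c} c≈1) (trans m³c≡y₁y₂y₃ (trans (cong (y₁ * y₂ *_) eq) (*-zeroʳ (y₁ * y₂))))

        w₃ z₃ Z : ℚ
        w₃ = inv y₃
        z₃ = x₃ * w₃
        Z  = z₁ + z₂ + z₃

        yw₃ : y₃ * w₃ ≡ 1ℚ
        yw₃ = inv-inverseʳ y₃ y₃≢0

        -- The sum of the roots of Z³ + A Z w² + B w³ − w, w = λ′ Z + ν.
        c*Z≡ : c * Z ≡ - (A * λ′ * ν + A * λ′ * ν + (B * λ′ * λ′ * ν + B * λ′ * λ′ * ν + B * λ′ * λ′ * ν))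
        c*Z≡ = *-cancelˡ (m * m * m) m³≢0 (trans (sym (*-assoc (m * m * m) c Z)) (trans (cong (_* Z) m³c≡y₁y₂y₃)
          (trans (lem₁ x₁ y₁ w₁ x₂ y₂ w₂ x₃ y₃ w₃) (trans (cong₂ (λ a b → x₁ * a * y₂ * y₃ + x₂ * b * y₁ * y₃ + x₃ * (y₃ * w₃) * y₁ * y₂) yw₁ yw₂)
          (trans (cong (λ a → x₁ * 1ℚ * y₂ * y₃ + x₂ * 1ℚ * y₁ * y₃ + x₃ * a * y₁ * y₂) yw₃)
          (trans (at-1 col on₁ on₂) (trans (cong (λ b → - (A * m * (- l * b) * b + A * m * (- l * b) * b
            + (B * (l * b) * (l * b) * b + B * (l * b) * (l * b) * b + B * (l * b) * (l * b) * b))) (sym mν≡1)) (lem₃ A B l m ν))))))))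
          where
          lem₁ = solve 9 (λ x₁ y₁ w₁ x₂ y₂ w₂ x₃ y₃ w₃ → y₁ :* y₂ :* y₃ :* (x₁ :* w₁ :+ x₂ :* w₂ :+ x₃ :* w₃)
               := x₁ :* (y₁ :* w₁) :* y₂ :* y₃ :+ x₂ :* (y₂ :* w₂) :* y₁ :* y₃ :+ x₃ :* (y₃ :* w₃) :* y₁ :* y₂) refl
          at-1 : Collinear A B x₁ x₂ x₃ l m → (x₁ , y₁) ∈[ l , m ] → (x₂ , y₂) ∈[ l , m ]
               → x₁ * 1ℚ * y₂ * y₃ + x₂ * 1ℚ * y₁ * y₃ + x₃ * 1ℚ * y₁ * y₂
               ≡ - (A * m * (- l * 1ℚ) * 1ℚ + A * m * (- l * 1ℚ) * 1ℚ
                 + (B * (l * 1ℚ) * (l * 1ℚ) * 1ℚ + B * (l * 1ℚ) * (l * 1ℚ) * 1ℚ + B * (l * 1ℚ) * (l * 1ℚ) * 1ℚ))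
          at-1 (collinear refl refl refl) refl refl = lem₂ x₁ x₂ l m
            where
            lem₂ = solve 4 (λ x₁ x₂ l m → let x₃ = l :* l :- x₁ :- x₂ ; y₁ = l :* x₁ :+ m ; y₂ = l :* x₂ :+ m ; y₃ = l :* x₃ :+ m ; A = x₁ :* x₂ :+ (x₁ :+ x₂) :* x₃ :+ (l :* m :+ l :* m) ; B = m :* m :- x₁ :* x₂ :* x₃
              in x₁ :* con 1ℚ :* y₂ :* y₃ :+ x₂ :* con 1ℚ :* y₁ :* y₃ :+ x₃ :* con 1ℚ :* y₁ :* y₂
               := :- (A :* m :* (:- l :* con 1ℚ) :* con 1ℚ :+ A :* m :* (:- l :* con 1ℚ) :* con 1ℚ
                 :+ (B :* (l :* con 1ℚ) :* (l :* con 1ℚ) :* con 1ℚ :+ B :* (l :* con 1ℚ) :* (l :* con 1ℚ) :* con 1ℚ :+ B :* (l :* con 1ℚ) :* (l :* con 1ℚ) :* con 1ℚ))) refl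
          lem₃ = solve 5 (λ A B l m ν → let b = m :* ν in
                 :- (A :* m :* (:- l :* b) :* b :+ A :* m :* (:- l :* b) :* b :+ (B :* (l :* b) :* (l :* b) :* b :+ B :* (l :* b) :* (l :* b) :* b :+ B :* (l :* b) :* (l :* b) :* b))
               := m :* m :* m :* :- (A :* (:- l :* ν) :* ν :+ A :* (:- l :* ν) :* ν
                 :+ (B :* (:- l :* ν) :* (:- l :* ν) :* ν :+ B :* (:- l :* ν) :* (:- l :* ν) :* ν :+ B :* (:- l :* ν) :* (:- l :* ν) :* ν))) refl

        -- Every term of the z²-coefficient contains the factor ν, which already has order 3r. This
        -- is the cubic accuracy of the short Weierstrass form.
        IZ : I (3· r) Z
        IZ = near-one-cancel {u = c} {Z} c≈1 (I-cong (sym c*Z≡) (I-neg (I-+ (I-+ IAλν IAλν) (I-+ (I-+ IBλλν IBλλν) IBλλν))))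
          where
          IAλν : I (3· r) (A * λ′ * ν)
          IAλν = I-weaken (ℕ.m≤n+m (3· r) (r ℕ.+ r)) (I-* (I-* A-integral Iλ) Iν)
          IBλλν : I (3· r) (B * λ′ * λ′ * ν)
          IBλλν = I-weaken (ℕ.m≤n+m (3· r) (r ℕ.+ r ℕ.+ (r ℕ.+ r))) (I-* (I-* (I-* B-integral Iλ) Iλ) Iν)

        Iz₃ : I r z₃
        Iz₃ = I-cong (lem z₁ z₂ z₃) (I-- (I-weaken (ℕ.m≤m+n r (r ℕ.+ r)) IZ) (I-+ Iz₁ Iz₂))
          where
          lem = solve 3 (λ z₁ z₂ z₃ → z₁ :+ z₂ :+ z₃ :- (z₁ :+ z₂) := z₃) refl

        Iw₃ : I (3· r) w₃
        Iw₃ = I-cong (sym (w-from-z z₃ w₃ (l*z+m*w≡1 x₃ y₃ w₃ refl yw₃)))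
          (I-+ (I-weaken (ℕ.≤-reflexive (ℕ.+-comm r (r ℕ.+ r))) (I-* Iλ Iz₃)) Iν)

        ker-sum : Ker r (aff x₃ (- y₃)) (x₃ * - w₃)
        ker-sum = ker-aff (trans (lem₁ y₃ w₃) yw₃) (I-cong (lem₂ x₃ w₃) (I-neg Iz₃)) (I-neg Iw₃)
          where
          lem₁ = solve 2 (λ y w → :- y :* :- w := y :* w) refl
          lem₂ = solve 2 (λ x w → :- (x :* w) := x :* :- w) refl

        additive : I (3· r) (x₃ * - w₃ - (z₁ + z₂))
        additive = I-cong (lem z₁ z₂ x₃ w₃) (I-neg IZ)
          where
          lem = solve 4 (λ z₁ z₂ x w → :- (z₁ :+ z₂ :+ x :* w) := x :* :- w :- (z₁ :+ z₂)) refl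

    ker-add : ∀ {r P Q z z′} → OnCurve A B P → OnCurve A B Q → Ker (suc r) P z → Ker (suc r) Q z′
            → ∃[ z″ ] Ker (suc r) (P ⊞ Q) z″ × I (3· (suc r)) (z″ - (z + z′))
    ker-add {z′ = z′} _ _ ker-O kQ = z′ , kQ , I-cong (lem z′) I-0
      where
      lem = solve 1 (λ z → con 0ℚ := z :- (con 0ℚ :+ z)) refl
    ker-add {z = z} _ _ kP@(ker-aff _ _ _) ker-O = z , kP , I-cong (lem z) I-0
      where
      lem = solve 1 (λ z → con 0ℚ := z :- (z :+ con 0ℚ)) refl
    ker-add {r} onP onQ (ker-aff {x₁} {y₁} {w₁} yw₁ Iz₁ Iw₁) (ker-aff {x₂} {y₂} {w₂} yw₂ Iz₂ Iw₂) with sumView x₁ y₁ x₂ y₂ onP onQ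
    ... | opposite refl refl = 0ℚ , subst (λ R → Ker (suc r) R 0ℚ) (sym (addPt-opposite {A} {B} {x₁} {y₂})) ker-O ,
      I-cong (linear₂ {0ℚ} {0ℚ - (x₁ * w₁ + x₁ * w₂)} (- (x₁ * w₂)) (- (x₁ * w₁)) (lem x₁ y₂ w₁ w₂) yw₁ yw₂) I-0
      where
      lem = solve 4 (λ x y w₁ w₂ → con 0ℚ :- (con 0ℚ :- (x :* w₁ :+ x :* w₂)) := :- (x :* w₂) :* (:- y :* w₁ :- con 1ℚ) :+ :- (x :* w₁) :* (y :* w₂ :- con 1ℚ)) refl
    ... | line x₃ l m col on₁ on₂ = x₃ * - S.w₃ , subst (λ R → Ker (suc r) R (x₃ * - S.w₃)) (sym (addPt-line nonsingular col on₁ on₂)) S.ker-sum , S.additive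
      where module S = Sum {r} col on₁ on₂ yw₁ yw₂ Iz₁ Iw₁ Iz₂ Iw₂

    ker-mul : ∀ {r P z} n → OnCurve A B P → Ker (suc r) P z
            → ∃[ z′ ] Ker (suc r) (mulPt A B n P) z′ × I (3· (suc r)) (z′ - ι (pos n) * z)
    ker-mul {z = z} zero _ _ = 0ℚ , ker-O , I-cong (trans (lem z) (cong (λ u → 0ℚ - u * z) (sym ι-0))) I-0
      where
      lem = solve 1 (λ z → con 0ℚ := con 0ℚ :- con 0ℚ :* z) refl
    ker-mul {P = P} {z} (suc n) on k with ker-mul n on k
    ... | z₁ , k₁ , h₁ with ker-add on (mul-onCurve nonsingular n P on) k k₁
    ...   | z₂ , k₂ , h₂ = z₂ , k₂ , I-cong (trans (lem z z₁ z₂ (ι (pos n))) (cong (λ u → z₂ - u * z) (sym ι-suc))) (I-+ h₂ h₁)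
      where
      ι-suc : ι (pos (suc n)) ≡ 1ℚ + ι (pos n)
      ι-suc = trans (ι-+ 1ℤ (pos n)) (cong (_+ ι (pos n)) ι-1)
      lem = solve 4 (λ z z₁ z₂ n → (z₂ :- (z :+ z₁)) :+ (z₁ :- n :* z) := z₂ :- (con 1ℚ :+ n) :* z) refl

    private
      ker-O⇒z≡0 : ∀ {r Q z} → Q ≡ O → Ker r Q z → z ≡ 0ℚ
      ker-O⇒z≡0 refl ker-O = refl

    private
      -- At level s = r + 1 the additivity error has order 3s ≥ s + 2, so it cannot disturb pz,
      -- whose order is exactly s + 1. An error of order 2s would be too coarse at s = 1.
      level : ∀ r → suc (suc (suc r)) ℕ.≤ 3· (suc r)
      level r = s≤s (ℕ.≤-trans (ℕ.≤-reflexive (ℕ.+-comm 2 r)) (ℕ.+-monoʳ-≤ r (s≤s (ℕ.≤-trans (s≤s z≤n) (ℕ.m≤n+m (suc r) r)))))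

      multiple-at-prime-to-p : ∀ {r z N Q} → ¬ p ℕ.∣ suc N → ¬ I (suc (suc r)) z
        → ∃[ z′ ] Ker (suc r) Q z′ × I (3· (suc r)) (z′ - ι (pos (suc N)) * z) → Q ≢ O
      multiple-at-prime-to-p {r} {z} {N} p∤N Iz⁺ (z′ , k′ , h) Q≡O = Iz⁺ (unit-cancel {suc (suc r)} {pos (suc N)} {z}
        (λ j eq → p∤N (ℕ.divides ∣ j ∣ (trans (cong ∣_∣ eq) (ℤ.abs-* j π))))
        (I-weaken (ℕ.≤-trans (ℕ.n≤1+n _) (level r)) (I-cong (trans (cong (λ u → - (u - ι (pos (suc N)) * z)) (ker-O⇒z≡0 Q≡O k′)) (lem (ι (pos (suc N)) * z))) (I-neg h))))
        where
        lem = solve 1 (λ u → :- (con 0ℚ :- u) := u) refl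

      multiple-at-p : ∀ {r P z Q} → Ker (suc r) P z → ¬ I (suc (suc r)) z → OnCurve A B Q
        → ∃[ z′ ] Ker (suc r) Q z′ × I (3· (suc r)) (z′ - ι π * z) → ∃[ z′ ] Ker (suc (suc r)) Q z′ × ¬ I (suc (suc (suc r))) z′
      multiple-at-p {r} {P} {z} {Q} k Iz⁺ onQ (z′ , k′ , h) = z′ ,
        ker-raise onQ k′ (I-cong (lem z′ (ι π * z)) (I-+ (I-weaken (ℕ.≤-trans (ℕ.n≤1+n _) (level r)) h) Ipz)) ,
        λ Iz′ → Iz⁺ (π-cancel (I-cong (lem′ z′ (ι π * z)) (I-- Iz′ (I-weaken (level r) h))))
        where
        Iz : ∀ {P z} → Ker (suc r) P z → I (suc r) z
        Iz ker-O = I-0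
        Iz (ker-aff _ h _) = h
        Ipz : I (suc (suc r)) (ι π * z)
        Ipz = I-* I-π (Iz k)
        lem = solve 2 (λ z′ u → (z′ :- u) :+ u := z′) refl
        lem′ = solve 2 (λ z′ u → z′ :- (z′ :- u) := u) refl

    -- If p ∤ N then z(NP) ≡ N z(P) is nonzero; multiplication by p raises the level of z by exactly one.
    ker-torsionFree : ∀ fuel {r P z} N → suc N ℕ.≤ fuel → OnCurve A B P → Ker (suc r) P z → ¬ I (suc (suc r)) z
                    → mulPt A B (suc N) P ≢ O
    ker-torsionFree (suc fuel) {r} {P} {z} N N<fuel on k Iz⁺ = case (p ℕ.∣? suc N)
      where
      onQ = mul-onCurve nonsingular p P on
      case : Dec (p ℕ.∣ suc N) → mulPt A B (suc N) P ≢ O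
      case (no p∤N) = multiple-at-prime-to-p p∤N Iz⁺ (ker-mul (suc N) on k)
      case (yes (ℕ.divides (suc M) N≡Mp)) NP≡O = let _ , k′ , Iz′ = multiple-at-p k Iz⁺ onQ (ker-mul p on k) in
        ker-torsionFree fuel M
          (ℕ.≤-pred (ℕ.≤-trans (subst (suc M ℕ.<_) (sym N≡Mp) (ℕ.m<m*n (suc M) p (ℕ.nonTrivial⇒n>1 p {{prime⇒nonTrivial prime}}))) N<fuel))
          onQ k′ Iz′
          (trans (sym (mul-* nonsingular (suc M) p P on)) (trans (cong (λ j → mulPt A B j P) (sym N≡Mp)) NP≡O))

    -- A nonzero z has a finite exact level, and the point can be raised to that level; this
    -- supplies the sharpness hypothesis of `ker-torsionFree`.
    nontorsion : ∀ {x y w} → OnCurve A B (aff x y) → y * w ≡ 1ℚ → x * w ≢ 0ℚ → I 1 (x * w) → I 3 w → ¬ Torsion A B (aff x y)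
    nontorsion {x} {y} {w} on yw≡1 z≢0 Iz Iw (N , NP≡O) = from (exact-level z≢0 (I-weaken z≤n Iz))
      where
      raise : ∀ r → I (suc r) (x * w) → Ker (suc r) (aff x y) (x * w)
      raise zero _ = ker-aff yw≡1 Iz Iw
      raise (suc r) h = ker-raise on (raise r (I-weaken (ℕ.n≤1+n (suc r)) h)) h
      from : ∃[ r ] I r (x * w) × ¬ I (suc r) (x * w) → ⊥
      from (zero , _ , ¬I) = ¬I Iz
      from (suc r , Ir , ¬I) = ker-torsionFree (suc N) N ℕ.≤-refl on (raise r Ir) ¬I NP≡O

-- Nonintegral points on integral models have infinite order.

module IntegralModels where
  open Rationals
  open IntegersInℚ
  open GroupLaw
  open PadicIntegers
  open ReductionKernel
  open import Data.Nat using (ℕ)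
  import Data.Nat as ℕ
  import Data.Nat.Properties as ℕ
  import Data.Nat.Divisibility as ℕ
  open import Data.Nat.Coprimality using (Coprime; coprime-Bézout)
  import Data.Nat.Coprimality as Coprime
  open import Data.Nat.GCD using (module Bézout)
  open import Data.Nat.Primality using (Prime; prime⇒nonTrivial)
  open import Data.Nat.Primality.Factorisation using (factorise)
  open import Data.Integer using (ℤ; 0ℤ; 1ℤ; ∣_∣; _^_) renaming (+_ to pos)
  import Data.Integer as ℤ hiding (+_)
  import Data.Integer.Properties as ℤ
  open import Data.Rational using (ℚ; mkℚ; 0ℚ; 1ℚ; _+_; _*_; _-_; -_; ↥_; ↧_; ↧ₙ_)
  open import Data.Rational.Properties hiding (_≤?_)
  open import Data.List.Base using ([]; _∷_)
  open import Data.Nat.ListAction using (product)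
  open import Data.List.Relation.Unary.All using ([]; _∷_)
  open ℚS using (solve; con; _:+_; _:*_; _:-_; :-_; _:=_)

  prime-divisor : ∀ n → .{{ℕ.NonZero n}} → n ≢ 1 → ∃[ p ] Prime p × p ℕ.∣ n
  prime-divisor n n≢1 with factorise n
  ... | record { factors = [] ; isFactorisation = eq } = contradiction eq n≢1
  ... | record { factors = p ∷ ps ; isFactorisation = eq ; factorsPrime = isPrime ∷ _ } = p , isPrime , ℕ.divides (product ps) (trans eq (ℕ.*-comm p (product ps)))

  bézout : ∀ m n → Coprime (∣ m ∣) (∣ n ∣) → ∃[ u ] ∃[ v ] u ℤ.* m ℤ.+ v ℤ.* n ≡ 1ℤ
  bézout m n coprime = let u , v , eq = natural (coprime-Bézout coprime) in
    u ℤ.* s , v ℤ.* t , trans (cong₂ ℤ._+_ (trans (ℤ.*-assoc u s m) (cong (u ℤ.*_) s*m)) (trans (ℤ.*-assoc v t n) (cong (v ℤ.*_) t*n))) eq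
    where
    sign-abs : ∀ i → ∃[ s ] s ℤ.* i ≡ pos ∣ i ∣
    sign-abs (pos n)      = 1ℤ , ℤ.*-identityˡ (pos n)
    sign-abs ℤ.-[1+ n ] = ℤ.- 1ℤ , ℤ.-1*i≡-i ℤ.-[1+ n ]
    s = proj₁ (sign-abs m)
    t = proj₁ (sign-abs n)
    s*m = proj₂ (sign-abs m)
    t*n = proj₂ (sign-abs n)
    lift : ∀ x a y b → 1 ℕ.+ y ℕ.* b ≡ x ℕ.* a → pos x ℤ.* pos a ≡ 1ℤ ℤ.+ pos y ℤ.* pos b
    lift x a y b eq = trans (sym (ℤ.pos-* x a)) (trans (cong pos (sym eq)) (trans (ℤ.pos-+ 1 (y ℕ.* b)) (cong (λ z → 1ℤ ℤ.+ z) (ℤ.pos-* y b))))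
    natural : Bézout.Identity 1 (∣ m ∣) (∣ n ∣) → ∃[ u ] ∃[ v ] (u ℤ.* pos ∣ m ∣) ℤ.+ (v ℤ.* pos ∣ n ∣) ≡ 1ℤ
    natural (Bézout.+- x y eq) = pos x , ℤ.- pos y , trans (cong (ℤ._+ ℤ.- pos y ℤ.* pos ∣ n ∣) (lift x (∣ m ∣) y (∣ n ∣) eq)) (e (pos y) (pos ∣ n ∣))
      where
      e = ℤS.solve 2 (λ y b → ℤS.con 1ℤ ℤS.:+ y ℤS.:* b ℤS.:+ ℤS.:- y ℤS.:* b ℤS.:= ℤS.con 1ℤ) refl
    natural (Bézout.-+ x y eq) = ℤ.- pos x , pos y , trans (cong (λ z → ℤ.- pos x ℤ.* pos ∣ m ∣ ℤ.+ z) (lift y (∣ n ∣) x (∣ m ∣) eq)) (e (pos x) (pos ∣ m ∣))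
      where
      e = ℤS.solve 2 (λ x a → ℤS.:- x ℤS.:* a ℤS.:+ (ℤS.con 1ℤ ℤS.:+ x ℤS.:* a) ℤS.:= ℤS.con 1ℤ) refl

  Integer : ℚ → Set
  Integer f = ∃[ j ] f ≡ ι j

  denominator≡1⇒Integer : ∀ f → ↧ₙ f ≡ 1 → Integer f
  denominator≡1⇒Integer f eq = ↥ f , trans (sym (*-identityʳ f)) (trans (cong (f *_) (sym (trans (cong (λ d → ι (pos d)) eq) ι-1))) (x*↧x≡↥x f))

  numerator-coprime : ∀ f → Coprime (∣ ↥ f ∣) (↧ₙ f)
  numerator-coprime (mkℚ _ _ coprime) = Coprime.recompute coprime

  module Points {A B : ℚ} (nonsingular : Nonsingular A B) (A-integral : Integer A) (B-integral : Integer B) where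

    -- As p divides neither `a` nor `M`, the chart coordinates z = ae/M and w = e³/M lie in pℤ₍ₚ₎
    -- and p³ℤ₍ₚ₎, and z ≠ 0.
    non-integral-at : ∀ {p} → Prime p → ∀ {x y} a M e → OnCurve A B (aff x y)
      → x * (ι e * ι e) ≡ ι a → y * (ι e * ι e * ι e) ≡ ι M → p ℕ.∣ ∣ e ∣ → ¬ p ℕ.∣ ∣ a ∣ → ¬ p ℕ.∣ ∣ M ∣ → ¬ Torsion A B (aff x y)
    non-integral-at {p} isPrime {x} {y} a M e on xe² ye³ p∣e p∤a p∤M = from (multiple {e} p∣e)
      where
      open Localisation p isPrime
      integral : ∀ {q} → Integer q → I 0 q
      integral (j , refl) = I-ι j
      open Reduction p isPrime nonsingular (integral A-integral) (integral B-integral) using (nontorsion)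
      ∤⇒unit : ∀ {d} → ¬ p ℕ.∣ ∣ d ∣ → Unit d
      ∤⇒unit p∤d k eq = p∤d (ℕ.divides ∣ k ∣ (trans (cong ∣_∣ eq) (ℤ.abs-* k π)))
      unit⇒ι≢0 : ∀ {d} → Unit d → ι d ≢ 0ℚ
      unit⇒ι≢0 ud eq = ud 0ℤ (ι-injective (trans eq (sym ι-0)))
      ua = ∤⇒unit p∤a
      uM = ∤⇒unit p∤M
      w = ι e * ι e * ι e * inv (ι M)
      M*w : ι M * inv (ι M) ≡ 1ℚ
      M*w = inv-inverseʳ (ι M) (unit⇒ι≢0 uM)
      wM : w * ι M ≡ ι e * ι e * ι e
      wM = trans (l (ι e * ι e * ι e) (inv (ι M)) (ι M)) (trans (cong (ι e * ι e * ι e *_) M*w) (*-identityʳ _))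
        where
        l = solve 3 (λ a i m → a :* i :* m := a :* (m :* i)) refl
      yw≡1 : y * w ≡ 1ℚ
      yw≡1 = trans (sym (*-assoc y (ι e * ι e * ι e) (inv (ι M)))) (trans (cong (_* inv (ι M)) ye³) M*w)
      zM : x * w * ι M ≡ ι a * ι e
      zM = trans (*-assoc x w (ι M)) (trans (cong (x *_) wM) (trans (l x (ι e)) (cong (_* ι e) xe²)))
        where
        l = solve 2 (λ x e → x :* (e :* e :* e) := x :* (e :* e) :* e) refl
      e≢0 : ι e ≢ 0ℚ
      e≢0 eq = contradiction (trans (sym yw≡1) (trans (cong (λ u → y * (u * u * u * inv (ι M))) eq) (l y (inv (ι M))))) λ ()
        where
        l = solve 2 (λ y i → y :* (con 0ℚ :* con 0ℚ :* con 0ℚ :* i) := con 0ℚ) refl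
      from : ∃[ k ] e ≡ k ℤ.* π → ¬ Torsion A B (aff x y)
      from (k , e≡kπ) = nontorsion on yw≡1
        (λ z≡0 → p≢0∧q≢0⇒p*q≢0 (unit⇒ι≢0 ua) e≢0 (trans (sym zM) (trans (cong (_* ι M) z≡0) (*-zeroˡ (ι M)))))
        (frac {num = a ℤ.* k} uM (trans zM (trans (cong (ι a *_) e≡) (trans (l₁ (ι a) (ι k) (ι π))
          (sym (cong₂ _*_ (ι-* a k) π¹))))))
        (frac {num = k ℤ.* k ℤ.* k} uM (trans wM (trans (cong (λ u → u * u * u) e≡) (trans (l₃ (ι k) (ι π))
          (sym (cong₂ _*_ (trans (ι-* (k ℤ.* k) k) (cong (_* ι k) (ι-* k k)))
            (trans (ι-* π (π ^ 2)) (cong (ι π *_) (trans (ι-* π (π ^ 1)) (cong (ι π *_) π¹))))))))))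
        where
        e≡ : ι e ≡ ι k * ι π
        e≡ = trans (cong ι e≡kπ) (ι-* k π)
        π¹ : ι (π ^ 1) ≡ ι π
        π¹ = cong ι (ℤ.^-identityʳ π)
        l₁ = solve 3 (λ a k q → a :* (k :* q) := a :* k :* q) refl
        l₃ = solve 2 (λ k q → k :* q :* (k :* q) :* (k :* q) := k :* k :* k :* (q :* (q :* q))) refl

    -- At a prime dividing the denominator of f = N/e, the numerators of x and y reduce to N² and
    -- N³, which are prime to p because f is in lowest terms. In the applications f is, up to sign,
    -- the slope of the line that produces the point.
    non-integer-parameter : ∀ f c b g → ↧ₙ f ≢ 1 → OnCurve A B (aff (f * f - ι c) (f * f * f + ι b * f + ι g)) → PositiveRank A B
    non-integer-parameter f c b g f∉ℤ on = at (prime-divisor (↧ₙ f) f∉ℤ)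
      where
      N = ↥ f
      e = ↧ f
      x = f * f - ι c
      y = f * f * f + ι b * f + ι g
      fe = x*↧x≡↥x f
      a = N ℤ.* N ℤ.- c ℤ.* (e ℤ.* e)
      M = N ℤ.* N ℤ.* N ℤ.+ b ℤ.* N ℤ.* (e ℤ.* e) ℤ.+ g ℤ.* (e ℤ.* e ℤ.* e)
      at : ∃[ p ] Prime p × p ℕ.∣ ↧ₙ f → PositiveRank A B
      at (p , isPrime , p∣d) = aff x y , on , non-integral-at isPrime {x} {y} a M e on
          (trans (linear (f * ι e + ι N) (l₂ f (ι e) (ι N) (ι c)) fe)
            (sym (trans (ι-- (N ℤ.* N) _) (cong₂ _-_ (ι-* N N) (trans (ι-* c _) (cong (ι c *_) (ι-* e e)))))))
          (trans (linear (f * ι e * (f * ι e) + f * ι e * ι N + ι N * ι N + ι b * (ι e * ι e)) (l₃ f (ι e) (ι N) (ι b) (ι g)) fe)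
            (sym (trans (ι-+ (N ℤ.* N ℤ.* N ℤ.+ b ℤ.* N ℤ.* (e ℤ.* e)) _) (cong₂ _+_
              (trans (ι-+ (N ℤ.* N ℤ.* N) _) (cong₂ _+_ (trans (ι-* (N ℤ.* N) N) (cong (_* ι N) (ι-* N N)))
                (trans (ι-* (b ℤ.* N) _) (cong₂ _*_ (ι-* b N) (ι-* e e)))))
              (trans (ι-* g _) (cong (ι g *_) (trans (ι-* (e ℤ.* e) e) (cong (_* ι e) (ι-* e e)))))))))
          p∣d (λ h → uN*uN (unmultiple a (N ℤ.* N) c e (multiple {a} h) eq-a)) (λ h → uN*uN*uN (M-multiple (multiple {M} h)))
        where
        open Localisation p isPrime
        uN : Unit N
        uN k eq = ℕ.nonTrivial⇒≢1 {{prime⇒nonTrivial isPrime}} (numerator-coprime f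
          (ℕ.divides ∣ k ∣ (trans (cong ∣_∣ eq) (ℤ.abs-* k π)) , p∣d))
        uN*uN : ¬ (∃[ k ] N ℤ.* N ≡ k ℤ.* π)
        uN*uN (k , eq) = unit-* uN uN k eq
        uN*uN*uN : ¬ (∃[ k ] N ℤ.* N ℤ.* N ≡ k ℤ.* π)
        uN*uN*uN (k , eq) = unit-* (unit-* uN uN) uN k eq
        k = proj₁ (multiple {e} p∣d)
        e≡kπ : e ≡ k ℤ.* π
        e≡kπ = proj₂ (multiple {e} p∣d)
        eq-a : ∀ j → a ≡ j ℤ.* π → N ℤ.* N ≡ j ℤ.* π ℤ.+ c ℤ.* (e ℤ.* (k ℤ.* π))
        eq-a j eq = trans (l N c e) (cong₂ (λ u v → u ℤ.+ c ℤ.* (e ℤ.* v)) eq e≡kπ)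
          where
          l = ℤS.solve 3 (λ N c e → N ℤS.:* N ℤS.:= (N ℤS.:* N ℤS.:- c ℤS.:* (e ℤS.:* e)) ℤS.:+ c ℤS.:* (e ℤS.:* e)) refl
        unmultiple : ∀ a N² c e → ∃[ j ] a ≡ j ℤ.* π → (∀ j → a ≡ j ℤ.* π → N² ≡ j ℤ.* π ℤ.+ c ℤ.* (e ℤ.* (k ℤ.* π))) → ∃[ j ] N² ≡ j ℤ.* π
        unmultiple a N² c e (j , eq) h = j ℤ.+ c ℤ.* e ℤ.* k , trans (h j eq) (l j c e k π)
          where
          l = ℤS.solve 5 (λ j c e k q → j ℤS.:* q ℤS.:+ c ℤS.:* (e ℤS.:* (k ℤS.:* q)) ℤS.:= (j ℤS.:+ c ℤS.:* e ℤS.:* k) ℤS.:* q) refl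
        M-multiple : ∃[ j ] M ≡ j ℤ.* π → ∃[ j ] N ℤ.* N ℤ.* N ≡ j ℤ.* π
        M-multiple (j , eq) = j ℤ.- (b ℤ.* N ℤ.+ g ℤ.* e) ℤ.* e ℤ.* k ,
          trans (l N b g e) (trans (cong₂ (λ u v → u ℤ.- (b ℤ.* N ℤ.+ g ℤ.* e) ℤ.* e ℤ.* v) eq e≡kπ) (l′ j ((b ℤ.* N ℤ.+ g ℤ.* e) ℤ.* e) k π))
          where
          l = ℤS.solve 4 (λ N b g e → N ℤS.:* N ℤS.:* N ℤS.:= (N ℤS.:* N ℤS.:* N ℤS.:+ b ℤS.:* N ℤS.:* (e ℤS.:* e) ℤS.:+ g ℤS.:* (e ℤS.:* e ℤS.:* e)) ℤS.:- (b ℤS.:* N ℤS.:+ g ℤS.:* e) ℤS.:* e ℤS.:* e) refl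
          l′ = ℤS.solve 4 (λ j u k q → j ℤS.:* q ℤS.:- u ℤS.:* (k ℤS.:* q) ℤS.:= (j ℤS.:- u ℤS.:* k) ℤS.:* q) refl
        l₂ = solve 4 (λ f e N c → (f :* f :- c) :* (e :* e) :- (N :* N :- c :* (e :* e)) := (f :* e :+ N) :* (f :* e :- N)) refl
        l₃ = solve 5 (λ f e N b g → (f :* f :* f :+ b :* f :+ g) :* (e :* e :* e) :- (N :* N :* N :+ b :* N :* (e :* e) :+ g :* (e :* e :* e))
           := (f :* e :* (f :* e) :+ f :* e :* N :+ N :* N :+ b :* (e :* e)) :* (f :* e :- N)) refl

-- Points of infinite order on the family of twists.

module TwistFamily where
  open Rationals
  open IntegersInℚ
  open GroupLaw
  open IntegralModels
  open import Data.Nat using (ℕ; s≤s)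
  import Data.Nat as ℕ
  import Data.Nat.Properties as ℕ
  import Data.Nat.Divisibility as ℕ
  open import Data.Nat.Coprimality using (Coprime)
  open import Data.Nat.Primality using (Prime; prime?)
  open import Data.Integer using (ℤ; 0ℤ; 1ℤ; ∣_∣) renaming (+_ to pos)
  import Data.Integer as ℤ hiding (+_)
  import Data.Integer.Properties as ℤ
  import Data.Integer.Divisibility.Signed as ℤ
  open import Data.Rational using (ℚ; 0ℚ; 1ℚ; ½; _+_; _*_; _-_; -_; _/_; ↧ₙ_)
  open import Data.Rational.Properties hiding (_≤?_)
  open import Data.List.Base using (List; []; _∷_; upTo)
  open import Data.List.Relation.Unary.All as All using (All; []; _∷_; all?)
  open import Data.List.Relation.Unary.Any as Any using (Any; any?)
  open import Data.List.Membership.Propositional using (_∈_)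
  open import Data.List.Membership.Propositional.Properties using (∈-upTo⁺)
  open import Data.List.Membership.DecPropositional ℕ._≟_ using (_∈?_)
  open import Relation.Nullary.Decidable using (_⊎-dec_; _×-dec_; from-yes)
  open ℚS using (solve; con; _:+_; _:*_; _:-_; :-_; _:=_)

  -- The curve k y² = x³ − 3 x − 2 + k, k = m / n, in an integral short Weierstrass form.
  coeffA coeffB : ℚ → ℚ → ℚ
  coeffA m n = - (m * m * (n * n) + m * m * (n * n) + m * m * (n * n))
  coeffB m n = m * m * m * (m - (n + n)) * (n * n)

  coeffAℤ coeffBℤ : ℤ → ℤ → ℤ
  coeffAℤ m n = ℤ.- (m ℤ.* m ℤ.* (n ℤ.* n) ℤ.+ m ℤ.* m ℤ.* (n ℤ.* n) ℤ.+ m ℤ.* m ℤ.* (n ℤ.* n))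
  coeffBℤ m n = m ℤ.* m ℤ.* m ℤ.* (m ℤ.- (n ℤ.+ n)) ℤ.* (n ℤ.* n)

  coeffA-ι : ∀ m n → coeffA (ι m) (ι n) ≡ ι (coeffAℤ m n)
  coeffA-ι m n = sym (trans (ι-neg _) (cong -_ (trans (ι-+ _ t) (cong₂ _+_ (trans (ι-+ t t) (cong₂ _+_ t≡ t≡)) t≡))))
    where
    t = m ℤ.* m ℤ.* (n ℤ.* n)
    t≡ : ι t ≡ ι m * ι m * (ι n * ι n)
    t≡ = trans (ι-* _ _) (cong₂ _*_ (ι-* m m) (ι-* n n))

  coeffB-ι : ∀ m n → coeffB (ι m) (ι n) ≡ ι (coeffBℤ m n)
  coeffB-ι m n = sym (trans (ι-* _ _) (cong₂ _*_ (trans (ι-* _ _) (cong₂ _*_ (trans (ι-* _ _) (cong (_* ι m) (ι-* m m)))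
    (trans (ι-- m _) (cong (λ z → ι m - z) (ι-+ n n))))) (ι-* n n)))

  -- A = -3x² leaves only x = ±mn as a double root, and B = 2x³ then says m = 4n or m = 0.
  family-nonsingular : ∀ m n → m ≢ 0ℚ → n ≢ 0ℚ → m ≢ n + n + n + n → Nonsingular (coeffA m n) (coeffB m n)
  family-nonsingular m n m≢0 n≢0 m≢4n x A≡ B≡ = [ plus , minus ]′ (x*y≡0 (x - m * n) (x + m * n)
    (*-cancelˡ (1ℚ + 1ℚ + 1ℚ) (λ ()) (linear 1ℚ (e₁ m n x) A≡)))
    where
    e₁ = solve 3 (λ m n x → (con 1ℚ :+ con 1ℚ :+ con 1ℚ) :* ((x :- m :* n) :* (x :+ m :* n)) :- (con 1ℚ :+ con 1ℚ :+ con 1ℚ) :* con 0ℚ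
       := con 1ℚ :* (:- (m :* m :* (n :* n) :+ m :* m :* (n :* n) :+ m :* m :* (n :* n)) :- :- (x :* x :+ x :* x :+ x :* x))) refl
    m³n²≢0 : m * m * m * (n * n) ≢ 0ℚ
    m³n²≢0 = p≢0∧q≢0⇒p*q≢0 (p≢0∧q≢0⇒p*q≢0 (p≢0∧q≢0⇒p*q≢0 m≢0 m≢0) m≢0) (p≢0∧q≢0⇒p*q≢0 n≢0 n≢0)
    plus : x - m * n ≡ 0ℚ → ⊥
    plus eq = m≢4n (p-q≡0⇒p≡q {m} {n + n + n + n} (*-cancelˡ (m * m * m * (n * n)) m³n²≢0 (trans (e m n) (trans (p≡q⇒p-q≡0 (trans B≡
      (cong (λ x → x * x * x + x * x * x) (p-q≡0⇒p≡q {x} {m * n} eq)))) (sym (*-zeroʳ (m * m * m * (n * n))))))))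
      where
      e = solve 2 (λ m n → m :* m :* m :* (n :* n) :* (m :- (n :+ n :+ n :+ n)) := m :* m :* m :* (m :- (n :+ n)) :* (n :* n)
        :- (m :* n :* (m :* n) :* (m :* n) :+ m :* n :* (m :* n) :* (m :* n))) refl
    minus : x + m * n ≡ 0ℚ → ⊥
    minus eq = m≢0 (*-cancelˡ (m * m * m * (n * n)) m³n²≢0 (trans (e m n) (trans (p≡q⇒p-q≡0 (trans B≡
      (cong (λ x → x * x * x + x * x * x) (p-q≡0⇒p≡q {x} { - (m * n)} (trans (e′ x (m * n)) eq))))) (sym (*-zeroʳ (m * m * m * (n * n)))))))
      where
      e′ = solve 2 (λ x y → x :- :- y := x :+ y) refl
      e = solve 2 (λ m n → m :* m :* m :* (n :* n) :* m := m :* m :* m :* (m :- (n :+ n)) :* (n :* n)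
        :- (:- (m :* n) :* :- (m :* n) :* :- (m :* n) :+ :- (m :* n) :* :- (m :* n) :* :- (m :* n))) refl

  -- The multiples 3P, 4P of P = (−mn, m²n) have x-coordinates f² − c with f = 2m/3, 9n/2.
  onCurve-3P : ∀ f n → let m = f * (pos 3 / 2) in
    OnCurve (coeffA m n) (coeffB m n) (aff (f * f - m * n) (f * f * f + 0ℚ * f + - (m * m * n)))
  onCurve-3P = e
    where
    e = solve 2 (λ f n → let m = f :* (con (pos 3 / 2)) ; x = f :* f :- m :* n ; y = f :* f :* f :+ con 0ℚ :* f :+ :- (m :* m :* n) in
      y :* y := x :* x :* x :+ :- (m :* m :* (n :* n) :+ m :* m :* (n :* n) :+ m :* m :* (n :* n)) :* x :+ m :* m :* m :* (m :- (n :+ n)) :* (n :* n)) refl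

  onCurve-4P : ∀ f m → let n = f * (pos 2 / 9) ; mn = m * n in
    OnCurve (coeffA m n) (coeffB m n) (aff (f * f - (mn + mn + mn + mn)) (f * f * f + - (mn + mn + mn + mn + mn + mn) * f + m * m * n))
  onCurve-4P = e
    where
    e = solve 2 (λ f m → let n = f :* (con (pos 2 / 9)) ; mn = m :* n ; x = f :* f :- (mn :+ mn :+ mn :+ mn) ; y = f :* f :* f :+ :- (mn :+ mn :+ mn :+ mn :+ mn :+ mn) :* f :+ m :* m :* n in
      y :* y := x :* x :* x :+ :- (m :* m :* (n :* n) :+ m :* m :* (n :* n) :+ m :* m :* (n :* n)) :* x :+ m :* m :* m :* (m :- (n :+ n)) :* (n :* n)) refl

  -- For m = 3μ, n = 2η put d = 2μ − 9η and 2μ = d t; then x(5P) = f² − c with f = d t² = 4μ² / d.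
  onCurve-5P : ∀ d t → let μ = d * t * ½ ; η = (d * t - d) * (pos 1 / 9) ; m = μ + μ + μ ; n = η + η
                           f = d * t * t ; μμ = μ * μ + μ * μ + μ * μ + μ * μ ; μη = μ * η + μ * η + μ * η + μ * η + μ * η + μ * η in
    OnCurve (coeffA m n) (coeffB m n) (aff (f * f - (μη + μμ)) (f * f * f + - (μη + μη + μη + μμ) * f + - (μ * (μη + μη + μη))))
  onCurve-5P = e
    where
    e = solve 2 (λ d t → let μ = d :* t :* con ½ ; η = (d :* t :- d) :* (con (pos 1 / 9)) ; m = μ :+ μ :+ μ ; n = η :+ η ; f = d :* t :* t ; μμ = μ :* μ :+ μ :* μ :+ μ :* μ :+ μ :* μ ; μη = μ :* η :+ μ :* η :+ μ :* η :+ μ :* η :+ μ :* η :+ μ :* η ; x = f :* f :- (μη :+ μμ) ; y = f :* f :* f :+ :- (μη :+ μη :+ μη :+ μμ) :* f :+ :- (μ :* (μη :+ μη :+ μη)) in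
      y :* y := x :* x :* x :+ :- (m :* m :* (n :* n) :+ m :* m :* (n :* n) :+ m :* m :* (n :* n)) :* x :+ m :* m :* m :* (m :- (n :+ n)) :* (n :* n)) refl

  -- Likewise with d = 4μ − 9η, μ = d t and f = 4 d t (1 − t) = 12 μ (μ − 3η) / d for 6P.
  onCurve-6P : ∀ d t → let μ = d * t ; η = (μ + μ + μ + μ - d) * (pos 1 / 9) ; m = μ + μ + μ ; n = η + η
                           h = μ * (1ℚ - t) ; f = h + h + h + h ; c = μ * (μ + μ - (η + η + η)) + μ * (μ + μ - (η + η + η)) ; q = μ * μ * (μ + μ + μ + μ - (η + η + η + η + η + η + η + η + η)) in
    OnCurve (coeffA m n) (coeffB m n) (aff (f * f - (c + c)) (f * f * f + - (c + c + c) * f + (q + q)))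
  onCurve-6P = e
    where
    e = solve 2 (λ d t → let μ = d :* t ; η = (μ :+ μ :+ μ :+ μ :- d) :* (con (pos 1 / 9)) ; m = μ :+ μ :+ μ ; n = η :+ η ; h = μ :* (con 1ℚ :- t) ; f = h :+ h :+ h :+ h ; c = μ :* (μ :+ μ :- (η :+ η :+ η)) :+ μ :* (μ :+ μ :- (η :+ η :+ η)) ; q = μ :* μ :* (μ :+ μ :+ μ :+ μ :- (η :+ η :+ η :+ η :+ η :+ η :+ η :+ η :+ η)) ; x = f :* f :- (c :+ c) ; y = f :* f :* f :+ :- (c :+ c :+ c) :* f :+ (q :+ q) in
      y :* y := x :* x :* x :+ :- (m :* m :* (n :* n) :+ m :* m :* (n :* n) :+ m :* m :* (n :* n)) :* x :+ m :* m :* m :* (m :- (n :+ n)) :* (n :* n)) refl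

  -- A point on the curve m = 3 m′, n = 2 n′ with x = a / e², y = M / e³ and a prime p dividing e.
  record Row : Set where
    constructor row
    field
      m′ n′ a M e : ℤ
      p           : ℕ

    m n : ℤ
    m = m′ ℤ.+ m′ ℤ.+ m′
    n = n′ ℤ.+ n′

    Valid : Set
    Valid = Prime p × e ≢ 0ℤ × p ℕ.∣ ∣ e ∣ × (¬ p ℕ.∣ ∣ a ∣) × (¬ p ℕ.∣ ∣ M ∣)
      × M ℤ.* M ≡ a ℤ.* a ℤ.* a ℤ.+ coeffAℤ m n ℤ.* a ℤ.* (e ℤ.* e ℤ.* e ℤ.* e) ℤ.+ coeffBℤ m n ℤ.* (e ℤ.* e ℤ.* e ℤ.* e ℤ.* e ℤ.* e)

    valid? : Dec Valid
    valid? = prime? p ×-dec ¬? (e ℤ.≟ 0ℤ) ×-dec (p ℕ.∣? ∣ e ∣) ×-dec ¬? (p ℕ.∣? ∣ a ∣) ×-dec ¬? (p ℕ.∣? ∣ M ∣) ×-dec (_ ℤ.≟ _)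

  -- These cover the pairs that `Excluded` leaves over. For m = 9, n = 2, for instance, P, ..., 7P
  -- are all integral and the entry is 8P. How a point was found does not matter: only the decidable
  -- `Valid` is used.
  rows : List Row
  rows = row (ℤ.- pos 9) (pos 2) (pos 8856) (pos 1116828) (pos 7) 7
       ∷ row (pos 3) (pos 1) (pos 9) (pos 891) (pos 2) 2
       ∷ row (pos 3) (pos 2) (ℤ.- pos 144) (pos 23004) (pos 5) 5
       ∷ row (pos 9) (pos 1) (pos 5049) (pos 357939) (pos 2) 2
       ∷ row (pos 9) (pos 5) (ℤ.- pos 9990) (pos 7443090) (pos 11) 11
       ∷ row (pos 9) (pos 8) (ℤ.- pos 8208) (pos 4700592) (pos 11) 11
       ∷ row (pos 27) (pos 8) (pos 46656) (pos 17927568) (pos 7) 7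
       ∷ row (pos 27) (pos 10) (pos 2025) (pos 557685) (pos 2) 2
       ∷ row (pos 45) (pos 8) (pos 4532544) (pos 9217744272) (pos 23) 23
       ∷ row (pos 45) (pos 11) (pos 42765921) (pos 264244485681) (pos 98) 2
       ∷ row (pos 45) (pos 14) (pos 579096) (pos 1341333756) (pos 17) 17
       ∷ row (pos 45) (pos 16) (ℤ.- pos 152064) (pos 194858784) (pos 7) 7
       ∷ row (pos 45) (pos 19) (ℤ.- pos 35402130) (pos 231317932950) (pos 71) 71
       ∷ row (pos 45) (pos 22) (ℤ.- pos 5797440) (pos 51016076100) (pos 41) 41
       ∷ row (pos 63) (pos 10) (pos 36561240) (pos 215302291380) (pos 41) 41
       ∷ row (pos 63) (pos 16) (pos 17777664) (pos 73580641056) (pos 47) 47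
       ∷ row (pos 63) (pos 26) (ℤ.- pos 13012272) (pos 37237142124) (pos 29) 29
       ∷ row (pos 63) (pos 32) (ℤ.- pos 51758784) (pos 1718080652736) (pos 95) 5
       ∷ row (pos 99) (pos 26) (pos 235346904) (pos 3747309554196) (pos 113) 113
       ∷ row (pos 99) (pos 40) (ℤ.- pos 147003120) (pos 899442474480) (pos 59) 59
       ∷ row (pos 153) (pos 32) (pos 5806895616) (pos 408757154559552) (pos 287) 7
       ∷ row (pos 153) (pos 70) (ℤ.- pos 6295680720) (pos 1156906073684340) (pos 341) 11
       ∷ row (pos 171) (pos 40) (pos 9067014720) (pos 798347015021520) (pos 359) 359
       ∷ row (pos 171) (pos 74) (ℤ.- pos 8304870816) (pos 1089317048292252) (pos 305) 5 ∷ []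

  rows-valid : All Row.Valid rows
  rows-valid = from-yes (all? Row.valid? rows)

  row-positiveRank : ∀ r → Row.Valid r → let open Row r in
    Nonsingular (coeffA (ι m) (ι n)) (coeffB (ι m) (ι n)) → PositiveRank (coeffA (ι m) (ι n)) (coeffB (ι m) (ι n))
  row-positiveRank r (isPrime , e≢0 , p∣e , p∤a , p∤M , eq) nonsingular =
    aff (ι a * (i * i)) (ι M * (i * i * i)) , on , Points.non-integral-at nonsingular (_ , coeffA-ι m n) (_ , coeffB-ι m n) isPrime a M e on
      (trans (l₂ (ι a) i (ι e)) (trans (cong (λ u → ι a * (u * u)) ei≡1) (*-identityʳ (ι a))))
      (trans (l₃ (ι M) i (ι e)) (trans (cong (λ u → ι M * (u * u * u)) ei≡1) (*-identityʳ (ι M)))) p∣e p∤a p∤M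
    where
    open Row r
    i = inv (ι e)
    ei≡1 : ι e * i ≡ 1ℚ
    ei≡1 = inv-inverseʳ (ι e) λ ιe≡0 → e≢0 (ι-injective (trans ιe≡0 (sym ι-0)))
    l₂ = solve 3 (λ a i e → a :* (i :* i) :* (e :* e) := a :* (e :* i :* (e :* i))) refl
    l₃ = solve 3 (λ a i e → a :* (i :* i :* i) :* (e :* e :* e) := a :* (e :* i :* (e :* i) :* (e :* i))) refl
    eqℚ : ι M * ι M ≡ ι a * ι a * ι a + coeffA (ι m) (ι n) * ι a * (ι e * ι e * ι e * ι e) + coeffB (ι m) (ι n) * (ι e * ι e * ι e * ι e * ι e * ι e)
    eqℚ = trans (sym (ι-* M M)) (trans (cong ι eq) (ι⟨+⟩ (ι⟨+⟩ (ι⟨*⟩ (ι⟨*⟩ refl refl) refl) (ι⟨*⟩ (ι⟨*⟩ (sym (coeffA-ι m n)) refl) (ι⟨*⟩ (ι⟨*⟩ (ι⟨*⟩ refl refl) refl) refl)))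
      (ι⟨*⟩ (sym (coeffB-ι m n)) (ι⟨*⟩ (ι⟨*⟩ (ι⟨*⟩ (ι⟨*⟩ (ι⟨*⟩ refl refl) refl) refl) refl) refl))))
    on : OnCurve (coeffA (ι m) (ι n)) (coeffB (ι m) (ι n)) (aff (ι a * (i * i)) (ι M * (i * i * i)))
    on = trans (l (ι M) i) (trans (cong (_* (i * i * i * i * i * i)) eqℚ)
      (trans (g (ι a) i (ι e) (coeffA (ι m) (ι n)) (coeffB (ι m) (ι n))) (trans (cong (λ u → ι a * (i * i) * (ι a * (i * i)) * (ι a * (i * i))
        + coeffA (ι m) (ι n) * (ι a * (i * i)) * (u * u * u * u) + coeffB (ι m) (ι n) * (u * u * u * u * u * u)) ei≡1)
        (one (ι a * (i * i)) (coeffA (ι m) (ι n)) (coeffB (ι m) (ι n))))))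
      where
      l = solve 2 (λ M i → M :* (i :* i :* i) :* (M :* (i :* i :* i)) := M :* M :* (i :* i :* i :* i :* i :* i)) refl
      g = solve 5 (λ a i e A B → (a :* a :* a :+ A :* a :* (e :* e :* e :* e) :+ B :* (e :* e :* e :* e :* e :* e)) :* (i :* i :* i :* i :* i :* i)
        := a :* (i :* i) :* (a :* (i :* i)) :* (a :* (i :* i)) :+ A :* (a :* (i :* i)) :* (e :* i :* (e :* i) :* (e :* i) :* (e :* i)) :+ B :* (e :* i :* (e :* i) :* (e :* i) :* (e :* i) :* (e :* i) :* (e :* i))) refl
      one = solve 3 (λ x A B → x :* x :* x :+ A :* x :* (con 1ℚ :* con 1ℚ :* con 1ℚ :* con 1ℚ) :+ B :* (con 1ℚ :* con 1ℚ :* con 1ℚ :* con 1ℚ :* con 1ℚ :* con 1ℚ) := x :* x :* x :+ A :* x :+ B) refl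

  -- d₁ = 2 m′ − 9 n′ and d₂ = 4 m′ − 9 n′, so that d₂ − d₁ = 2 m′ and d₂ − 2 d₁ = 9 n′.
  Match : ℤ → ℤ → Row → Set
  Match d₁ d₂ r = Row.m′ r ℤ.+ Row.m′ r ≡ d₂ ℤ.- d₁ × pos 9 ℤ.* Row.n′ r ≡ d₂ ℤ.- (d₁ ℤ.+ d₁)

  -- The disjuncts contradict in turn: m′ is an integer, m′ is odd, n′ is an integer, 3 ∤ n′ (the
  -- oddness and 3 ∤ n′ by coprimality of 3m′ and 2n′), n′ > 0, m ≠ 4n, and finally d₁ ∣ d₂² and d₂
  -- ∣ d₁², which hold because both numbers divide (2m′)² and differ by 2m′.
  Excluded : ℤ → ℤ → Set
  Excluded d₁ d₂ = (¬ pos 2 ℤ.∣ d₂ ℤ.- d₁) ⊎ pos 4 ℤ.∣ d₂ ℤ.- d₁ ⊎ (¬ pos 9 ℤ.∣ d₂ ℤ.- (d₁ ℤ.+ d₁)) ⊎ pos 27 ℤ.∣ d₂ ℤ.- (d₁ ℤ.+ d₁)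
    ⊎ d₂ ℤ.- (d₁ ℤ.+ d₁) ℤ.≤ 0ℤ ⊎ pos 27 ℤ.* (d₂ ℤ.- d₁) ≡ pos 16 ℤ.* (d₂ ℤ.- (d₁ ℤ.+ d₁))
    ⊎ (¬ d₁ ℤ.∣ d₂ ℤ.* d₂) ⊎ (¬ d₂ ℤ.∣ d₁ ℤ.* d₁)

  Covered : ℤ → ℤ → Set
  Covered d₁ d₂ = Excluded d₁ d₂ ⊎ Any (Match d₁ d₂) rows

  covered? : ∀ d₁ d₂ → Dec (Covered d₁ d₂)
  covered? d₁ d₂ = (¬? (pos 2 ℤ.∣? _) ⊎-dec (pos 4 ℤ.∣? _) ⊎-dec ¬? (pos 9 ℤ.∣? _) ⊎-dec (pos 27 ℤ.∣? _) ⊎-dec (_ ℤ.≤? _) ⊎-dec (_ ℤ.≟ _)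
    ⊎-dec ¬? (d₁ ℤ.∣? _) ⊎-dec ¬? (d₂ ℤ.∣? _)) ⊎-dec any? (λ r → (_ ℤ.≟ _) ×-dec (_ ℤ.≟ _)) rows

  divisors : List ℕ
  divisors = 1 ∷ 2 ∷ 3 ∷ 4 ∷ 6 ∷ 9 ∷ 12 ∷ 18 ∷ 27 ∷ 36 ∷ 54 ∷ 81 ∷ 108 ∷ 162 ∷ 324 ∷ []

  ∣324⇒∈divisors : ∀ {d} → d ℕ.∣ 324 → d ∈ divisors
  ∣324⇒∈divisors {d} d∣324 = [ contradiction d∣324 , (λ h → h) ]′
    (All.lookup (from-yes (all? (λ k → ¬? (k ℕ.∣? 324) ⊎-dec (k ∈? divisors)) (upTo 325))) (∈-upTo⁺ (s≤s (ℕ.∣⇒≤ d∣324))))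

  BothSigns : (ℤ → Set) → ℕ → Set
  BothSigns P k = P (pos k) × P (ℤ.- pos k)

  bothSigns? : ∀ {P : ℤ → Set} → (∀ i → Dec (P i)) → ∀ k → Dec (BothSigns P k)
  bothSigns? P? k = P? (pos k) ×-dec P? (ℤ.- pos k)

  bothSigns : ∀ {P : ℤ → Set} d → BothSigns P ∣ d ∣ → P d
  bothSigns (pos k)      = proj₁
  bothSigns ℤ.-[1+ k ] = proj₂

  -- A finite search: thirty signed divisors for each of d₁ and d₂.
  all-covered : All (BothSigns λ d₁ → All (BothSigns (Covered d₁)) divisors) divisors
  all-covered = from-yes (all? (bothSigns? λ d₁ → all? (bothSigns? (covered? d₁)) divisors) divisors)

  covered : ∀ d₁ d₂ → d₁ ℤ.∣ pos 324 → d₂ ℤ.∣ pos 324 → Covered d₁ d₂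
  covered d₁ d₂ h₁ h₂ = bothSigns {Covered d₁} d₂ (All.lookup (bothSigns {λ d → All (BothSigns (Covered d)) divisors} d₁
    (All.lookup all-covered (∣324⇒∈divisors (ℤ.∣⇒∣ᵤ h₁)))) (∣324⇒∈divisors (ℤ.∣⇒∣ᵤ h₂)))

  private
    three-ι : ∀ m′ → ι (m′ ℤ.+ m′ ℤ.+ m′) ≡ ι m′ + ι m′ + ι m′
    three-ι m′ = ι⟨+⟩ (ι⟨+⟩ refl refl) refl

    *-cancel-ℤ : ∀ k {i j} → .{{ℤ.NonZero k}} → k ℤ.* i ≡ k ℤ.* j → i ≡ j
    *-cancel-ℤ k {i} {j} = ℤ.*-cancelˡ-≡ k i j

  -- `j₁` and `j₂` are the slopes of 5P and 6P, here integers. Their equations bound d₁ and d₂ in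
  -- terms of m′ only; the Bézout relation turns this into an absolute bound.
  match : ∀ m′ n′ {d₁ d₂ j₁ j₂ u v} → d₁ ≡ m′ ℤ.+ m′ ℤ.- pos 9 ℤ.* n′ → d₂ ≡ pos 4 ℤ.* m′ ℤ.- pos 9 ℤ.* n′
    → d₁ ℤ.* j₁ ≡ (m′ ℤ.+ m′) ℤ.* (m′ ℤ.+ m′) → d₂ ℤ.* j₂ ≡ pos 4 ℤ.* m′ ℤ.* (d₂ ℤ.- m′)
    → u ℤ.* (m′ ℤ.+ m′ ℤ.+ m′) ℤ.+ v ℤ.* (n′ ℤ.+ n′) ≡ 1ℤ → 0ℤ ℤ.< n′ → pos 3 ℤ.* m′ ≢ pos 8 ℤ.* n′ → Any (Match d₁ d₂) rows
  match m′ n′ {d₁} {d₂} {j₁} {j₂} {u} {v} refl refl e₁ e₂ bez n′>0 m≢4n = [ excluded , (λ h → h) ]′ (covered d₁ d₂ d₁∣324 d₂∣324)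
    where
    d₁∣324 : d₁ ℤ.∣ pos 324
    -- Modulo d₁ one has 9n′ ≡ 2m′, so 18 = 18(3m′u + 2n′v) ≡ 2m′(27u + 4v); squaring brings in
    -- (2m′)², a multiple of d₁.
    d₁∣324 = ℤ.divides (j₁ ℤ.* w ℤ.+ r) (trans (cong (λ z → pos 324 ℤ.* (z ℤ.* z)) (sym bez)) (trans (l m′ n′ u v)
      (trans (cong (λ z → z ℤ.* w ℤ.+ r ℤ.* d₁) (sym e₁)) (l′ d₁ j₁ w r))))
      where
      w = (pos 27 ℤ.* u ℤ.+ pos 4 ℤ.* v) ℤ.* (pos 27 ℤ.* u ℤ.+ pos 4 ℤ.* v)
      r = pos 16 ℤ.* v ℤ.* v ℤ.* d₁ ℤ.- pos 16 ℤ.* v ℤ.* m′ ℤ.* (pos 27 ℤ.* u ℤ.+ pos 4 ℤ.* v)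
      l = ℤS.solve 4 (λ m n u v → ℤS.con (pos 324) ℤS.:* ((u ℤS.:* (m ℤS.:+ m ℤS.:+ m) ℤS.:+ v ℤS.:* (n ℤS.:+ n)) ℤS.:* (u ℤS.:* (m ℤS.:+ m ℤS.:+ m) ℤS.:+ v ℤS.:* (n ℤS.:+ n)))
        ℤS.:= (m ℤS.:+ m) ℤS.:* (m ℤS.:+ m) ℤS.:* ((ℤS.con (pos 27) ℤS.:* u ℤS.:+ ℤS.con (pos 4) ℤS.:* v) ℤS.:* (ℤS.con (pos 27) ℤS.:* u ℤS.:+ ℤS.con (pos 4) ℤS.:* v))
          ℤS.:+ (ℤS.con (pos 16) ℤS.:* v ℤS.:* v ℤS.:* (m ℤS.:+ m ℤS.:- ℤS.con (pos 9) ℤS.:* n) ℤS.:- ℤS.con (pos 16) ℤS.:* v ℤS.:* m ℤS.:* (ℤS.con (pos 27) ℤS.:* u ℤS.:+ ℤS.con (pos 4) ℤS.:* v)) ℤS.:* (m ℤS.:+ m ℤS.:- ℤS.con (pos 9) ℤS.:* n)) refl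
      l′ = ℤS.solve 4 (λ d j a b → d ℤS.:* j ℤS.:* a ℤS.:+ b ℤS.:* d ℤS.:= (j ℤS.:* a ℤS.:+ b) ℤS.:* d) refl
    4m′m′ : pos 4 ℤ.* m′ ℤ.* m′ ≡ d₂ ℤ.* (pos 4 ℤ.* m′ ℤ.- j₂)
    4m′m′ = trans (l m′ d₂) (trans (cong (λ z → pos 4 ℤ.* m′ ℤ.* d₂ ℤ.- z) (sym e₂)) (l′ m′ d₂ j₂))
      where
      l = ℤS.solve 2 (λ m d → ℤS.con (pos 4) ℤS.:* m ℤS.:* m ℤS.:= ℤS.con (pos 4) ℤS.:* m ℤS.:* d ℤS.:- ℤS.con (pos 4) ℤS.:* m ℤS.:* (d ℤS.:- m)) refl
      l′ = ℤS.solve 3 (λ m d j → ℤS.con (pos 4) ℤS.:* m ℤS.:* d ℤS.:- d ℤS.:* j ℤS.:= d ℤS.:* (ℤS.con (pos 4) ℤS.:* m ℤS.:- j)) refl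
    d₂∣324 : d₂ ℤ.∣ pos 324
    -- Now 9n′ ≡ 4m′ modulo d₂, so 18 ≡ 2m′(27u + 8v), and again (2m′)² is a multiple of d₂.
    d₂∣324 = ℤ.divides ((pos 4 ℤ.* m′ ℤ.- j₂) ℤ.* w ℤ.+ r) (trans (cong (λ z → pos 324 ℤ.* (z ℤ.* z)) (sym bez)) (trans (l m′ n′ u v)
      (trans (cong (λ z → z ℤ.* w ℤ.+ r ℤ.* d₂) 4m′m′) (l′ d₂ (pos 4 ℤ.* m′ ℤ.- j₂) w r))))
      where
      w = (pos 27 ℤ.* u ℤ.+ pos 8 ℤ.* v) ℤ.* (pos 27 ℤ.* u ℤ.+ pos 8 ℤ.* v)
      r = pos 16 ℤ.* v ℤ.* v ℤ.* d₂ ℤ.- pos 16 ℤ.* v ℤ.* m′ ℤ.* (pos 27 ℤ.* u ℤ.+ pos 8 ℤ.* v)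
      l = ℤS.solve 4 (λ m n u v → ℤS.con (pos 324) ℤS.:* ((u ℤS.:* (m ℤS.:+ m ℤS.:+ m) ℤS.:+ v ℤS.:* (n ℤS.:+ n)) ℤS.:* (u ℤS.:* (m ℤS.:+ m ℤS.:+ m) ℤS.:+ v ℤS.:* (n ℤS.:+ n)))
        ℤS.:= ℤS.con (pos 4) ℤS.:* m ℤS.:* m ℤS.:* ((ℤS.con (pos 27) ℤS.:* u ℤS.:+ ℤS.con (pos 8) ℤS.:* v) ℤS.:* (ℤS.con (pos 27) ℤS.:* u ℤS.:+ ℤS.con (pos 8) ℤS.:* v))
          ℤS.:+ (ℤS.con (pos 16) ℤS.:* v ℤS.:* v ℤS.:* (ℤS.con (pos 4) ℤS.:* m ℤS.:- ℤS.con (pos 9) ℤS.:* n) ℤS.:- ℤS.con (pos 16) ℤS.:* v ℤS.:* m ℤS.:* (ℤS.con (pos 27) ℤS.:* u ℤS.:+ ℤS.con (pos 8) ℤS.:* v)) ℤS.:* (ℤS.con (pos 4) ℤS.:* m ℤS.:- ℤS.con (pos 9) ℤS.:* n)) refl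
      l′ = ℤS.solve 4 (λ d j a b → d ℤS.:* j ℤS.:* a ℤS.:+ b ℤS.:* d ℤS.:= (j ℤS.:* a ℤS.:+ b) ℤS.:* d) refl
    t≡ : d₂ ℤ.- d₁ ≡ pos 2 ℤ.* m′
    t≡ = l m′ n′
      where
      l = ℤS.solve 2 (λ m n → (ℤS.con (pos 4) ℤS.:* m ℤS.:- ℤS.con (pos 9) ℤS.:* n) ℤS.:- (m ℤS.:+ m ℤS.:- ℤS.con (pos 9) ℤS.:* n) ℤS.:= ℤS.con (pos 2) ℤS.:* m) refl
    s≡ : d₂ ℤ.- (d₁ ℤ.+ d₁) ≡ pos 9 ℤ.* n′
    s≡ = l m′ n′
      where
      l = ℤS.solve 2 (λ m n → (ℤS.con (pos 4) ℤS.:* m ℤS.:- ℤS.con (pos 9) ℤS.:* n) ℤS.:- ((m ℤS.:+ m ℤS.:- ℤS.con (pos 9) ℤS.:* n) ℤS.:+ (m ℤS.:+ m ℤS.:- ℤS.con (pos 9) ℤS.:* n)) ℤS.:= ℤS.con (pos 9) ℤS.:* n) refl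
    k∤1 : ∀ k → ¬ (2 ℕ.+ k) ℕ.∣ 1
    k∤1 k h = contradiction (ℕ.∣⇒≤ h) λ { (s≤s ()) }
    excluded : Excluded d₁ d₂ → Any (Match d₁ d₂) rows
    excluded (inj₁ h) = contradiction (ℤ.divides m′ (trans t≡ (ℤ.*-comm (pos 2) m′))) h
    excluded (inj₂ (inj₁ (ℤ.divides k eq))) = ⊥-elim (k∤1 0 (ℤ.∣⇒∣ᵤ {pos 2} (ℤ.divides (u ℤ.* (k ℤ.+ k ℤ.+ k) ℤ.+ v ℤ.* n′) (trans (sym bez) (l m′ k n′ u v m′≡2k)))))
      where
      m′≡2k : m′ ≡ pos 2 ℤ.* k
      m′≡2k = *-cancel-ℤ (pos 2) (trans (sym t≡) (trans eq (l₀ k)))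
        where
        l₀ = ℤS.solve 1 (λ k → k ℤS.:* ℤS.con (pos 4) ℤS.:= ℤS.con (pos 2) ℤS.:* (ℤS.con (pos 2) ℤS.:* k)) refl
      l : ∀ m k n u v → m ≡ pos 2 ℤ.* k → u ℤ.* (m ℤ.+ m ℤ.+ m) ℤ.+ v ℤ.* (n ℤ.+ n) ≡ (u ℤ.* (k ℤ.+ k ℤ.+ k) ℤ.+ v ℤ.* n) ℤ.* pos 2
      l _ k n u v refl = l₁ k n u v
        where
        l₁ = ℤS.solve 4 (λ k n u v → u ℤS.:* (ℤS.con (pos 2) ℤS.:* k ℤS.:+ ℤS.con (pos 2) ℤS.:* k ℤS.:+ ℤS.con (pos 2) ℤS.:* k) ℤS.:+ v ℤS.:* (n ℤS.:+ n) ℤS.:= (u ℤS.:* (k ℤS.:+ k ℤS.:+ k) ℤS.:+ v ℤS.:* n) ℤS.:* ℤS.con (pos 2)) refl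
    excluded (inj₂ (inj₂ (inj₁ h))) = contradiction (ℤ.divides n′ (trans s≡ (ℤ.*-comm (pos 9) n′))) h
    excluded (inj₂ (inj₂ (inj₂ (inj₁ (ℤ.divides k eq))))) = ⊥-elim (k∤1 1 (ℤ.∣⇒∣ᵤ {pos 3} (ℤ.divides (u ℤ.* m′ ℤ.+ v ℤ.* (k ℤ.+ k)) (trans (sym bez) (l m′ k n′ u v n′≡3k)))))
      where
      n′≡3k : n′ ≡ pos 3 ℤ.* k
      n′≡3k = *-cancel-ℤ (pos 9) (trans (sym s≡) (trans eq (l₀ k)))
        where
        l₀ = ℤS.solve 1 (λ k → k ℤS.:* ℤS.con (pos 27) ℤS.:= ℤS.con (pos 9) ℤS.:* (ℤS.con (pos 3) ℤS.:* k)) refl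
      l : ∀ m k n u v → n ≡ pos 3 ℤ.* k → u ℤ.* (m ℤ.+ m ℤ.+ m) ℤ.+ v ℤ.* (n ℤ.+ n) ≡ (u ℤ.* m ℤ.+ v ℤ.* (k ℤ.+ k)) ℤ.* pos 3
      l m k _ u v refl = l₁ m k u v
        where
        l₁ = ℤS.solve 4 (λ m k u v → u ℤS.:* (m ℤS.:+ m ℤS.:+ m) ℤS.:+ v ℤS.:* (ℤS.con (pos 3) ℤS.:* k ℤS.:+ ℤS.con (pos 3) ℤS.:* k) ℤS.:= (u ℤS.:* m ℤS.:+ v ℤS.:* (k ℤS.:+ k)) ℤS.:* ℤS.con (pos 3)) refl
    excluded (inj₂ (inj₂ (inj₂ (inj₂ (inj₁ h))))) = contradiction (ℤ.*-cancelˡ-≤-pos n′ 0ℤ (pos 9) (subst (ℤ._≤ 0ℤ) s≡ h)) (ℤ.<⇒≱ n′>0)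
    excluded (inj₂ (inj₂ (inj₂ (inj₂ (inj₂ (inj₁ h)))))) = contradiction (*-cancel-ℤ (pos 18) (trans (l₁ m′)
        (trans (cong (pos 27 ℤ.*_) (sym t≡)) (trans h (trans (cong (pos 16 ℤ.*_) s≡) (l₂ n′)))))) m≢4n
      where
      l₁ = ℤS.solve 1 (λ m → ℤS.con (pos 18) ℤS.:* (ℤS.con (pos 3) ℤS.:* m) ℤS.:= ℤS.con (pos 27) ℤS.:* (ℤS.con (pos 2) ℤS.:* m)) refl
      l₂ = ℤS.solve 1 (λ n → ℤS.con (pos 16) ℤS.:* (ℤS.con (pos 9) ℤS.:* n) ℤS.:= ℤS.con (pos 18) ℤS.:* (ℤS.con (pos 8) ℤS.:* n)) refl
    excluded (inj₂ (inj₂ (inj₂ (inj₂ (inj₂ (inj₂ (inj₁ h))))))) = contradiction (ℤ.divides (d₁ ℤ.+ pos 4 ℤ.* m′ ℤ.+ j₁)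
        (trans (cong (λ z → z ℤ.* z) (l₀ d₁ d₂)) (trans (cong (λ z → (d₁ ℤ.+ z) ℤ.* (d₁ ℤ.+ z)) t≡)
        (trans (l₁ d₁ m′) (trans (cong (λ z → d₁ ℤ.* d₁ ℤ.+ pos 4 ℤ.* m′ ℤ.* d₁ ℤ.+ z) (sym e₁)) (l₂ d₁ m′ j₁)))))) h
      where
      l₀ = ℤS.solve 2 (λ d e → e ℤS.:= d ℤS.:+ (e ℤS.:- d)) refl
      l₁ = ℤS.solve 2 (λ d m → (d ℤS.:+ ℤS.con (pos 2) ℤS.:* m) ℤS.:* (d ℤS.:+ ℤS.con (pos 2) ℤS.:* m) ℤS.:= d ℤS.:* d ℤS.:+ ℤS.con (pos 4) ℤS.:* m ℤS.:* d ℤS.:+ (m ℤS.:+ m) ℤS.:* (m ℤS.:+ m)) refl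
      l₂ = ℤS.solve 3 (λ d m j → d ℤS.:* d ℤS.:+ ℤS.con (pos 4) ℤS.:* m ℤS.:* d ℤS.:+ d ℤS.:* j ℤS.:= (d ℤS.:+ ℤS.con (pos 4) ℤS.:* m ℤS.:+ j) ℤS.:* d) refl
    excluded (inj₂ (inj₂ (inj₂ (inj₂ (inj₂ (inj₂ (inj₂ h))))))) = contradiction (ℤ.divides (d₂ ℤ.- j₂)
        (trans (cong (λ z → z ℤ.* z) (l₀ d₁ d₂)) (trans (cong (λ z → (d₂ ℤ.- z) ℤ.* (d₂ ℤ.- z)) t≡)
        (trans (l₁ d₂ m′) (trans (cong (λ z → d₂ ℤ.* d₂ ℤ.- pos 4 ℤ.* m′ ℤ.* d₂ ℤ.+ z) 4m′m′) (l₂ d₂ m′ j₂)))))) h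
      where
      l₀ = ℤS.solve 2 (λ d e → d ℤS.:= e ℤS.:- (e ℤS.:- d)) refl
      l₁ = ℤS.solve 2 (λ d m → (d ℤS.:- ℤS.con (pos 2) ℤS.:* m) ℤS.:* (d ℤS.:- ℤS.con (pos 2) ℤS.:* m) ℤS.:= d ℤS.:* d ℤS.:- ℤS.con (pos 4) ℤS.:* m ℤS.:* d ℤS.:+ ℤS.con (pos 4) ℤS.:* m ℤS.:* m) refl
      l₂ = ℤS.solve 3 (λ d m j → d ℤS.:* d ℤS.:- ℤS.con (pos 4) ℤS.:* m ℤS.:* d ℤS.:+ d ℤS.:* (ℤS.con (pos 4) ℤS.:* m ℤS.:- j) ℤS.:= (d ℤS.:- j) ℤS.:* d) refl

  private
    curve-transport : ∀ {m n m₁ n₁} → m ≡ m₁ → n ≡ n₁ → ∀ f {C B G C₁ B₁ G₁} → C ≡ C₁ → B ≡ B₁ → G ≡ G₁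
      → OnCurve (coeffA m n) (coeffB m n) (aff (f * f - C) (f * f * f + B * f + G))
      → OnCurve (coeffA m₁ n₁) (coeffB m₁ n₁) (aff (f * f - C₁) (f * f * f + B₁ * f + G₁))
    curve-transport refl refl f refl refl refl on = on

    integer-cases : ∀ {P : Set} f → (↧ₙ f ≢ 1 → P) → (Integer f → P) → P
    integer-cases f no-case yes-case with ↧ₙ f ℕ.≟ 1
    ... | yes d≡1 = yes-case (denominator≡1⇒Integer f d≡1)
    ... | no d≢1  = no-case d≢1

  module _ (m n : ℤ) (m≢0 : m ≢ 0ℤ) (n>0 : 0ℤ ℤ.< n) (coprime : Coprime (∣ m ∣) (∣ n ∣))
           (m≢4n : m ≢ pos 4 ℤ.* n) (4m≢27n : pos 4 ℤ.* m ≢ pos 27 ℤ.* n) (8m≢27n : pos 8 ℤ.* m ≢ pos 27 ℤ.* n) where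
    private
      A B : ℚ
      A = coeffA (ι m) (ι n)
      B = coeffB (ι m) (ι n)

      ι≢ : ∀ {i} → i ≢ 0ℤ → ι i ≢ 0ℚ
      ι≢ i≢0 eq = i≢0 (ι-injective (trans eq (sym ι-0)))

      nonsingular : Nonsingular A B
      nonsingular = family-nonsingular (ι m) (ι n) (ι≢ m≢0) (ι≢ λ n≡0 → ℤ.<-irrefl (sym n≡0) n>0)
        λ eq → m≢4n (trans (ι-injective (trans eq (sym (ι⟨+⟩ (ι⟨+⟩ (ι⟨+⟩ refl refl) refl) refl)))) (l n))
        where
        l = ℤS.solve 1 (λ n → n ℤS.:+ n ℤS.:+ n ℤS.:+ n ℤS.:= ℤS.con (pos 4) ℤS.:* n) refl

      open Points nonsingular (_ , coeffA-ι m n) (_ , coeffB-ι m n)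

      -- The premise on `j` says that the slope of 5P is an integer. If the slope of 6P is one too,
      -- `match` finds the curve in the table.
      sixth : ∀ m′ n′ → m ≡ m′ ℤ.+ m′ ℤ.+ m′ → n ≡ n′ ℤ.+ n′ → ∀ j → ι (m′ ℤ.+ m′ ℤ.- pos 9 ℤ.* n′) * ι j ≡ (ι m′ + ι m′) * (ι m′ + ι m′)
        → PositiveRank A B
      sixth m′ n′ m≡ n≡ j₁ e₁ = integer-cases f
        (λ f∉ℤ → non-integer-parameter f (c ℤ.+ c) (ℤ.- (c ℤ.+ c ℤ.+ c)) (q ℤ.+ q) f∉ℤ (curve-transport
          (trans (cong (λ z → z + z + z) μ≡) (sym (trans (cong ι m≡) (three-ι m′))))
          (trans (cong₂ (λ z z′ → z + z′) η≡ η≡) (sym (trans (cong ι n≡) (ι⟨+⟩ refl refl)))) f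
          (sym (ι⟨+⟩ ιc ιc)) (sym (ι⟨neg⟩ (ι⟨+⟩ (ι⟨+⟩ ιc ιc) ιc))) (sym (ι⟨+⟩ ιq ιq)) (onCurve-6P D t)))
        (λ (j , f≡j) → from-match (match m′ n′ {j₁ = j₁} {j} {u} {v} refl refl (ι-injective (trans (ι-* d₁ j₁) (trans e₁ (sym (ι⟨*⟩ (ι⟨+⟩ refl refl) (ι⟨+⟩ refl refl))))))
          (ι-injective (trans (ι-* d₂ j) (trans (cong (D *_) (sym f≡j)) (trans (lf D (ι m′) t Dt) (sym (ι⟨*⟩ (trans (ι-* (pos 4) m′) (cong (_* ι m′) ι-4)) (ι⟨-⟩ refl refl)))))))
          bez n′>0 λ eq → m≢4n (trans m≡ (trans (l₃ m′) (trans eq (trans (l₈ n′) (cong (pos 4 ℤ.*_) (sym n≡))))))))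
        where
        d₁ = m′ ℤ.+ m′ ℤ.- pos 9 ℤ.* n′
        d₂ = pos 4 ℤ.* m′ ℤ.- pos 9 ℤ.* n′
        D = ι d₂
        t = ι m′ * inv D
        l₃ = ℤS.solve 1 (λ m → m ℤS.:+ m ℤS.:+ m ℤS.:= ℤS.con (pos 3) ℤS.:* m) refl
        l₈ = ℤS.solve 1 (λ n → ℤS.con (pos 8) ℤS.:* n ℤS.:= ℤS.con (pos 4) ℤS.:* (n ℤS.:+ n)) refl
        ι-4 : ι (pos 4) ≡ pos 4 / 1
        ι-4 = ι≡mkℚ (pos 4)
        ι-9 : ι (pos 9) ≡ pos 9 / 1
        ι-9 = ι≡mkℚ (pos 9)
        D≡ : D ≡ (pos 4 / 1) * ι m′ - (pos 9 / 1) * ι n′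
        D≡ = ι⟨-⟩ (trans (ι-* (pos 4) m′) (cong (_* ι m′) ι-4)) (trans (ι-* (pos 9) n′) (cong (_* ι n′) ι-9))
        D≢0 : D ≢ 0ℚ
        D≢0 = ι≢ λ eq → 8m≢27n (trans (cong (pos 8 ℤ.*_) m≡) (trans (l m′ n′) (trans (cong (λ z → pos 6 ℤ.* z ℤ.+ pos 27 ℤ.* (n′ ℤ.+ n′)) eq)
          (trans (ℤ.+-identityˡ _) (cong (pos 27 ℤ.*_) (sym n≡))))))
          where
          l = ℤS.solve 2 (λ m n → ℤS.con (pos 8) ℤS.:* (m ℤS.:+ m ℤS.:+ m) ℤS.:= ℤS.con (pos 6) ℤS.:* (ℤS.con (pos 4) ℤS.:* m ℤS.:- ℤS.con (pos 9) ℤS.:* n) ℤS.:+ ℤS.con (pos 27) ℤS.:* (n ℤS.:+ n)) refl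
        Dt : D * t ≡ ι m′
        Dt = trans (l D (ι m′) (inv D)) (trans (cong (ι m′ *_) (inv-inverseʳ D D≢0)) (*-identityʳ (ι m′)))
          where
          l = solve 3 (λ d m i → d :* (m :* i) := m :* (d :* i)) refl
        μ = D * t
        μ≡ : μ ≡ ι m′
        μ≡ = Dt
        η = (μ + μ + μ + μ - D) * (pos 1 / 9)
        η≡ : η ≡ ι n′
        η≡ = trans (cong₂ (λ z d → (z + z + z + z - d) * (pos 1 / 9)) μ≡ D≡) (l (ι m′) (ι n′))
          where
          l = solve 2 (λ m n → (m :+ m :+ m :+ m :- ((con (pos 4 / 1)) :* m :- (con (pos 9 / 1)) :* n)) :* (con (pos 1 / 9)) := n) refl
        f = let h = μ * (1ℚ - t) in h + h + h + h
        lf : ∀ D m t → D * t ≡ m → D * (D * t * (1ℚ - t) + D * t * (1ℚ - t) + D * t * (1ℚ - t) + D * t * (1ℚ - t)) ≡ (pos 4 / 1) * m * (D - m)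
        lf D _ t refl = l D t
          where
          l = solve 2 (λ D t → D :* (D :* t :* (con 1ℚ :- t) :+ D :* t :* (con 1ℚ :- t) :+ D :* t :* (con 1ℚ :- t) :+ D :* t :* (con 1ℚ :- t)) := (con (pos 4 / 1)) :* (D :* t) :* (D :- D :* t)) refl
        c₀ = m′ ℤ.* (m′ ℤ.+ m′ ℤ.- (n′ ℤ.+ n′ ℤ.+ n′))
        c = c₀ ℤ.+ c₀
        q = m′ ℤ.* m′ ℤ.* (m′ ℤ.+ m′ ℤ.+ m′ ℤ.+ m′ ℤ.- (n′ ℤ.+ n′ ℤ.+ n′ ℤ.+ n′ ℤ.+ n′ ℤ.+ n′ ℤ.+ n′ ℤ.+ n′ ℤ.+ n′))
        ιc₀ : ι c₀ ≡ μ * (μ + μ - (η + η + η))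
        ιc₀ = ι⟨*⟩ (sym μ≡) (ι⟨-⟩ (ι⟨+⟩ (sym μ≡) (sym μ≡)) (ι⟨+⟩ (ι⟨+⟩ (sym η≡) (sym η≡)) (sym η≡)))
        ιc = ι⟨+⟩ ιc₀ ιc₀
        ιq = ι⟨*⟩ (ι⟨*⟩ (sym μ≡) (sym μ≡)) (ι⟨-⟩ (ι⟨+⟩ (ι⟨+⟩ (ι⟨+⟩ (sym μ≡) (sym μ≡)) (sym μ≡)) (sym μ≡))
          (ι⟨+⟩ (ι⟨+⟩ (ι⟨+⟩ (ι⟨+⟩ (ι⟨+⟩ (ι⟨+⟩ (ι⟨+⟩ (ι⟨+⟩ (sym η≡) (sym η≡)) (sym η≡)) (sym η≡)) (sym η≡)) (sym η≡)) (sym η≡)) (sym η≡)) (sym η≡)))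
        bz = bézout m n coprime
        u = proj₁ bz
        v = proj₁ (proj₂ bz)
        bez : u ℤ.* (m′ ℤ.+ m′ ℤ.+ m′) ℤ.+ v ℤ.* (n′ ℤ.+ n′) ≡ 1ℤ
        bez = trans (cong₂ (λ a b → u ℤ.* a ℤ.+ v ℤ.* b) (sym m≡) (sym n≡)) (proj₂ (proj₂ bz))
        n′>0 : 0ℤ ℤ.< n′
        n′>0 = ℤ.*-cancelˡ-<-nonNeg (pos 2) (subst (0ℤ ℤ.<_) (trans n≡ (l n′)) n>0)
          where
          l = ℤS.solve 1 (λ n → n ℤS.:+ n ℤS.:= ℤS.con (pos 2) ℤS.:* n) refl
        from-match : Any (Match d₁ d₂) rows → PositiveRank A B
        from-match found = let valid , m-eq , n-eq = All.lookupAny rows-valid found in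
          by-row (Any.lookup found) valid
            (*-cancel-ℤ (pos 2) (trans (l₂ _) (trans m-eq (l m′ n′))))
            (*-cancel-ℤ (pos 9) (trans n-eq (l′ m′ n′)))
          where
          l₂ = ℤS.solve 1 (λ m → ℤS.con (pos 2) ℤS.:* m ℤS.:= m ℤS.:+ m) refl
          l = ℤS.solve 2 (λ m n → (ℤS.con (pos 4) ℤS.:* m ℤS.:- ℤS.con (pos 9) ℤS.:* n) ℤS.:- (m ℤS.:+ m ℤS.:- ℤS.con (pos 9) ℤS.:* n) ℤS.:= ℤS.con (pos 2) ℤS.:* m) refl
          l′ = ℤS.solve 2 (λ m n → (ℤS.con (pos 4) ℤS.:* m ℤS.:- ℤS.con (pos 9) ℤS.:* n) ℤS.:- ((m ℤS.:+ m ℤS.:- ℤS.con (pos 9) ℤS.:* n) ℤS.:+ (m ℤS.:+ m ℤS.:- ℤS.con (pos 9) ℤS.:* n)) ℤS.:= ℤS.con (pos 9) ℤS.:* n) refl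
          by-row : ∀ r → Row.Valid r → Row.m′ r ≡ m′ → Row.n′ r ≡ n′ → PositiveRank A B
          by-row r valid m′-eq n′-eq = subst₂ (λ a b → PositiveRank (coeffA (ι a) (ι b)) (coeffB (ι a) (ι b))) m-eq n-eq
            (row-positiveRank r valid (subst₂ (λ a b → Nonsingular (coeffA (ι a) (ι b)) (coeffB (ι a) (ι b))) (sym m-eq) (sym n-eq) nonsingular))
            where
            m-eq : Row.m r ≡ m
            m-eq = trans (cong (λ z → z ℤ.+ z ℤ.+ z) m′-eq) (sym m≡)
            n-eq : Row.n r ≡ n
            n-eq = trans (cong (λ z → z ℤ.+ z) n′-eq) (sym n≡)

      fifth : ∀ m′ n′ → m ≡ m′ ℤ.+ m′ ℤ.+ m′ → n ≡ n′ ℤ.+ n′ → PositiveRank A B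
      fifth m′ n′ m≡ n≡ = integer-cases f
        (λ f∉ℤ → non-integer-parameter f (mn ℤ.+ mm) (ℤ.- (mn ℤ.+ mn ℤ.+ mn ℤ.+ mm)) (ℤ.- (m′ ℤ.* (mn ℤ.+ mn ℤ.+ mn))) f∉ℤ (curve-transport
          (trans (cong (λ z → z + z + z) μ≡) (sym (trans (cong ι m≡) (three-ι m′))))
          (trans (cong₂ (λ z z′ → z + z′) η≡ η≡) (sym (trans (cong ι n≡) (ι⟨+⟩ refl refl)))) f
          (sym (ι⟨+⟩ ιmn ιmm)) (sym (ι⟨neg⟩ (ι⟨+⟩ (ι⟨+⟩ (ι⟨+⟩ ιmn ιmn) ιmn) ιmm))) (sym (ι⟨neg⟩ (ι⟨*⟩ (sym μ≡) (ι⟨+⟩ (ι⟨+⟩ ιmn ιmn) ιmn)))) (onCurve-5P D t)))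
        (λ (j , f≡j) → sixth m′ n′ m≡ n≡ j (trans (cong (D *_) (sym f≡j)) (trans (lf D t) (cong₂ _*_ Dt Dt))))
        where
        D = ι (m′ ℤ.+ m′ ℤ.- pos 9 ℤ.* n′)
        t = (ι m′ + ι m′) * inv D
        f = D * t * t
        ι-9 : ι (pos 9) ≡ pos 9 / 1
        ι-9 = ι≡mkℚ (pos 9)
        D≡ : D ≡ ι m′ + ι m′ - (pos 9 / 1) * ι n′
        D≡ = ι⟨-⟩ (ι⟨+⟩ refl refl) (trans (ι-* (pos 9) n′) (cong (_* ι n′) ι-9))
        D≢0 : D ≢ 0ℚ
        D≢0 = ι≢ λ eq → 4m≢27n (trans (cong (pos 4 ℤ.*_) m≡) (trans (l m′ n′) (trans (cong (λ z → pos 6 ℤ.* z ℤ.+ pos 27 ℤ.* (n′ ℤ.+ n′)) eq)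
          (trans (ℤ.+-identityˡ _) (cong (pos 27 ℤ.*_) (sym n≡))))))
          where
          l = ℤS.solve 2 (λ m n → ℤS.con (pos 4) ℤS.:* (m ℤS.:+ m ℤS.:+ m) ℤS.:= ℤS.con (pos 6) ℤS.:* (m ℤS.:+ m ℤS.:- ℤS.con (pos 9) ℤS.:* n) ℤS.:+ ℤS.con (pos 27) ℤS.:* (n ℤS.:+ n)) refl
        Dt : D * t ≡ ι m′ + ι m′
        Dt = trans (l D (ι m′ + ι m′) (inv D)) (trans (cong ((ι m′ + ι m′) *_) (inv-inverseʳ D D≢0)) (*-identityʳ (ι m′ + ι m′)))
          where
          l = solve 3 (λ d m i → d :* (m :* i) := m :* (d :* i)) refl
        lf = solve 2 (λ D t → D :* (D :* t :* t) := D :* t :* (D :* t)) refl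
        μ = D * t * ½
        μ≡ : μ ≡ ι m′
        μ≡ = trans (cong (_* ½) Dt) (l (ι m′))
          where
          l = solve 1 (λ m → (m :+ m) :* con ½ := m) refl
        η = (D * t - D) * (pos 1 / 9)
        η≡ : η ≡ ι n′
        η≡ = trans (cong₂ (λ z d → (z - d) * (pos 1 / 9)) Dt D≡) (l (ι m′) (ι n′))
          where
          l = solve 2 (λ m n → (m :+ m :- (m :+ m :- (con (pos 9 / 1)) :* n)) :* (con (pos 1 / 9)) := n) refl
        mm = m′ ℤ.* m′ ℤ.+ m′ ℤ.* m′ ℤ.+ m′ ℤ.* m′ ℤ.+ m′ ℤ.* m′
        mn = m′ ℤ.* n′ ℤ.+ m′ ℤ.* n′ ℤ.+ m′ ℤ.* n′ ℤ.+ m′ ℤ.* n′ ℤ.+ m′ ℤ.* n′ ℤ.+ m′ ℤ.* n′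
        ιm² = ι⟨*⟩ (sym μ≡) (sym μ≡)
        ι1 = ι⟨*⟩ (sym μ≡) (sym η≡)
        ιmm = ι⟨+⟩ (ι⟨+⟩ (ι⟨+⟩ ιm² ιm²) ιm²) ιm²
        ιmn = ι⟨+⟩ (ι⟨+⟩ (ι⟨+⟩ (ι⟨+⟩ (ι⟨+⟩ ι1 ι1) ι1) ι1) ι1) ι1

      fourth : ∀ m′ → m ≡ m′ ℤ.+ m′ ℤ.+ m′ → PositiveRank A B
      fourth m′ m≡ = integer-cases f
        (λ f∉ℤ → non-integer-parameter f (mn ℤ.+ mn ℤ.+ mn ℤ.+ mn) (ℤ.- (mn ℤ.+ mn ℤ.+ mn ℤ.+ mn ℤ.+ mn ℤ.+ mn)) (m ℤ.* m ℤ.* n) f∉ℤ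
          (curve-transport {ι m} {_} {ι m} {ι n} refl η≡ f
            (sym (ι⟨+⟩ (ι⟨+⟩ (ι⟨+⟩ ιmn ιmn) ιmn) ιmn)) (sym (ι⟨neg⟩ (ι⟨+⟩ (ι⟨+⟩ (ι⟨+⟩ (ι⟨+⟩ (ι⟨+⟩ ιmn ιmn) ιmn) ιmn) ιmn) ιmn)))
            (sym (ι⟨*⟩ (ι-* m m) (sym η≡))) (onCurve-4P f (ι m))))
        -- From 9n = 2j one gets n = 9n - 8n = 2(j - 4n), so the half of n is j - 4n.
        (λ (j , f≡j) → fifth m′ (j ℤ.- pos 4 ℤ.* n) m≡ (l₂ n j (ι-injective (trans (ι-* (pos 9) n) (trans (cong (_* ι n) (ι≡mkℚ (pos 9)))
          (trans (l₁ (ι n)) (trans (cong ((pos 2 / 1) *_) f≡j) (sym (trans (ι-* (pos 2) j) (cong (_* ι j) (ι≡mkℚ (pos 2)))))))))))) 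
        where
        f = ι n * (pos 9 / 2)
        η≡ : f * (pos 2 / 9) ≡ ι n
        η≡ = l (ι n)
          where
          l = solve 1 (λ n → n :* (con (pos 9 / 2)) :* (con (pos 2 / 9)) := n) refl
        mn = m ℤ.* n
        ιmn : ι mn ≡ ι m * (f * (pos 2 / 9))
        ιmn = ι⟨*⟩ refl (sym η≡)
        l₁ = solve 1 (λ n → (con (pos 9 / 1)) :* n := (con (pos 2 / 1)) :* (n :* (con (pos 9 / 2)))) refl
        l₂ : ∀ n j → pos 9 ℤ.* n ≡ pos 2 ℤ.* j → n ≡ (j ℤ.- pos 4 ℤ.* n) ℤ.+ (j ℤ.- pos 4 ℤ.* n)
        l₂ n j eq = trans (a n) (trans (cong (ℤ._- pos 8 ℤ.* n) eq) (b n j))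
          where
          a = ℤS.solve 1 (λ n → n ℤS.:= ℤS.con (pos 9) ℤS.:* n ℤS.:- ℤS.con (pos 8) ℤS.:* n) refl
          b = ℤS.solve 2 (λ n j → ℤS.con (pos 2) ℤS.:* j ℤS.:- ℤS.con (pos 8) ℤS.:* n ℤS.:= (j ℤS.:- ℤS.con (pos 4) ℤS.:* n) ℤS.:+ (j ℤS.:- ℤS.con (pos 4) ℤS.:* n)) refl

    family-positiveRank : PositiveRank (coeffA (ι m) (ι n)) (coeffB (ι m) (ι n))
    family-positiveRank = integer-cases f
      (λ f∉ℤ → non-integer-parameter f (m ℤ.* n) 0ℤ (ℤ.- (m ℤ.* m ℤ.* n)) f∉ℤ
        (curve-transport {_} {ι n} {ι m} {ι n} μ≡ refl f (sym (ι⟨*⟩ (sym μ≡) refl)) (sym ι-0) (sym (ι⟨neg⟩ (ι⟨*⟩ (ι⟨*⟩ (sym μ≡) (sym μ≡)) refl))) (onCurve-3P f (ι n))))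
      -- From 2m = 3j one gets m = 3m - 2m = 3(m - j).
      (λ (j , f≡j) → fourth (m ℤ.- j) (l₂ m j (ι-injective (trans (ι-* (pos 2) m) (trans (cong (_* ι m) (ι≡mkℚ (pos 2)))
          (trans (l₁ (ι m)) (trans (cong ((pos 3 / 1) *_) f≡j) (sym (trans (ι-* (pos 3) j) (cong (_* ι j) (ι≡mkℚ (pos 3)))))))))))) 
      where
      f = ι m * (pos 2 / 3)
      μ≡ : f * (pos 3 / 2) ≡ ι m
      μ≡ = l (ι m)
        where
        l = solve 1 (λ n → n :* (con (pos 2 / 3)) :* (con (pos 3 / 2)) := n) refl
      l₁ = solve 1 (λ n → (con (pos 2 / 1)) :* n := (con (pos 3 / 1)) :* (n :* (con (pos 2 / 3)))) refl
      l₂ : ∀ n j → pos 2 ℤ.* n ≡ pos 3 ℤ.* j → n ≡ (n ℤ.- j) ℤ.+ (n ℤ.- j) ℤ.+ (n ℤ.- j)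
      l₂ n j eq = trans (a n) (trans (cong (λ z → pos 3 ℤ.* n ℤ.- z) eq) (b n j))
        where
        a = ℤS.solve 1 (λ n → n ℤS.:= ℤS.con (pos 3) ℤS.:* n ℤS.:- ℤS.con (pos 2) ℤS.:* n) refl
        b = ℤS.solve 2 (λ n j → ℤS.con (pos 3) ℤS.:* n ℤS.:- ℤS.con (pos 3) ℤS.:* j ℤS.:= (n ℤS.:- j) ℤS.:+ (n ℤS.:- j) ℤS.:+ (n ℤS.:- j)) refl

-- Coprime factorisations of squares, and rational points in lowest terms.

module IntegerArithmetic where
  open Rationals
  open IntegersInℚ
  open IntegralModels using (prime-divisor; numerator-coprime; denominator≡1⇒Integer; Integer)
  open import Data.Nat using (ℕ; zero; suc; s≤s; z≤n)
  import Data.Nat as ℕ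
  import Data.Nat.Properties as ℕ
  import Data.Nat.Divisibility as ℕ
  import Data.Nat.Tactic.RingSolver as ℕSolver
  open import Data.Nat.Coprimality using (Coprime; coprime-divisor; coprime-/gcd)
  open import Data.Nat.GCD using (gcd; gcd[m,n]∣m; gcd[m,n]∣n; gcd[m,n]≢0)
  open import Data.Nat.DivMod using (m/n*n≡m)
  import Data.Nat.Coprimality as Coprime
  open import Data.Nat.Primality using (Prime; prime[2]; euclidsLemma; prime⇒nonTrivial)
  open import Data.Integer using (ℤ; 0ℤ; 1ℤ; _+_; _*_; _-_; -_; _≤_; _<_; -[1+_]; +≤+; +<+) renaming (+_ to pos; ∣_∣ to abs)
  open import Data.Integer.Properties
  open import Data.Integer.Divisibility.Signed using (_∣_; divides; ∣ᵤ⇒∣; ∣⇒∣ᵤ)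
  open import Data.Rational using (ℚ; ↥_; ↧_; ↧ₙ_)
  import Data.Rational as ℚ
  import Data.Rational.Properties as ℚ
  open ℤS using (solve; con; _:+_; _:*_; _:-_; :-_; _:=_)

  x-y≡0⇒x≡y : ∀ x y → x - y ≡ 0ℤ → x ≡ y
  x-y≡0⇒x≡y = i-j≡0⇒i≡j

  x≡y⇒x-y≡0 : ∀ {x y} → x ≡ y → x - y ≡ 0ℤ
  x≡y⇒x-y≡0 {x} refl = +-inverseʳ x

  lin : ∀ {p q x y} k → p - q ≡ k * (x - y) → x ≡ y → p ≡ q
  lin {p} {q} k eq x≡y = x-y≡0⇒x≡y p q (trans eq (trans (cong (k *_) (x≡y⇒x-y≡0 x≡y)) (*-zeroʳ k)))

  lin₂ : ∀ {p q x y z w} k j → p - q ≡ k * (x - y) + j * (z - w) → x ≡ y → z ≡ w → p ≡ q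
  lin₂ {p} {q} k j eq x≡y z≡w = x-y≡0⇒x≡y p q (trans eq (cong₂ _+_
    (trans (cong (k *_) (x≡y⇒x-y≡0 x≡y)) (*-zeroʳ k)) (trans (cong (j *_) (x≡y⇒x-y≡0 z≡w)) (*-zeroʳ j))))

  ∣-combination : ∀ {d x y z} a b → z ≡ a * x + b * y → d ∣ x → d ∣ y → d ∣ z
  ∣-combination {d} a b refl (divides j refl) (divides k refl) = divides (a * j + b * k) (l a b j k d)
    where
    l = solve 5 (λ a b j k d → a :* (j :* d) :+ b :* (k :* d) := (a :* j :+ b :* k) :* d) refl

  ∣-multiple : ∀ {d x z} a → z ≡ a * x → d ∣ x → d ∣ z
  ∣-multiple {d} a refl (divides j refl) = divides (a * j) (sym (*-assoc a j d))

  -- Coprimality tested on primes, so that it can be refuted by Euclid's lemma, also inside squares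
  -- and fourth powers.
  Coprimeℤ : ℤ → ℤ → Set
  Coprimeℤ x y = ∀ {q} → Prime q → pos q ∣ x → pos q ∣ y → ⊥

  euclid : ∀ {q} → Prime q → ∀ x y → pos q ∣ x * y → pos q ∣ x ⊎ pos q ∣ y
  euclid {q} isPrime x y q∣xy = [ (λ h → inj₁ (∣ᵤ⇒∣ {pos q} h)) , (λ h → inj₂ (∣ᵤ⇒∣ {pos q} h)) ]′
    (euclidsLemma (abs x) (abs y) isPrime (subst (q ℕ.∣_) (abs-* x y) (∣⇒∣ᵤ q∣xy)))

  euclid² : ∀ {q} → Prime q → ∀ x → pos q ∣ x * x → pos q ∣ x
  euclid² isPrime x h = [ (λ z → z) , (λ z → z) ]′ (euclid isPrime x x h)

  coprimeℤ⇒coprime : ∀ {x y} → Coprimeℤ x y → Coprime (abs x) (abs y)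
  coprimeℤ⇒coprime {x} {y} coprime {zero} (d∣x , d∣y) = ⊥-elim (coprime prime[2]
    (∣ᵤ⇒∣ {pos 2} (ℕ.∣-trans (2 ℕ.∣0) d∣x)) (∣ᵤ⇒∣ {pos 2} (ℕ.∣-trans (2 ℕ.∣0) d∣y)))
  coprimeℤ⇒coprime {x} {y} coprime {d@(suc _)} (d∣x , d∣y) with d ℕ.≟ 1
  ... | yes d≡1 = d≡1
  ... | no d≢1 = let q , isPrime , q∣d = prime-divisor d d≢1 in
    ⊥-elim (coprime isPrime (∣ᵤ⇒∣ {pos q} (ℕ.∣-trans q∣d d∣x)) (∣ᵤ⇒∣ {pos q} (ℕ.∣-trans q∣d d∣y)))

  coprime⇒coprimeℤ : ∀ {x y} → Coprime (abs x) (abs y) → Coprimeℤ x y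
  coprime⇒coprimeℤ coprime isPrime q∣x q∣y = ℕ.nonTrivial⇒≢1 {{prime⇒nonTrivial isPrime}} (coprime (∣⇒∣ᵤ q∣x , ∣⇒∣ᵤ q∣y))

  private
    -- With g = gcd(x, z), x = x′g and z = z′g, the equation becomes x′y = g z′². Then x′ ∣ g
    -- because x′ is prime to z′, and g ∣ x′ because g is prime to y; hence x = g² and y = z′². No
    -- prime factorisation is involved.
    coprime-squaresℕ : ∀ x y z → Coprime x y → x ℕ.* y ≡ z ℕ.* z → ∃[ a ] ∃[ b ] x ≡ a ℕ.* a × y ≡ b ℕ.* b
    coprime-squaresℕ zero y z coprime _ = 0 , 1 , refl , Coprime.0-coprimeTo-m⇒m≡1 coprime
    coprime-squaresℕ x@(suc _) y z coprime eq =
      from (gcd x z) (x ℕ./ gcd x z) (z ℕ./ gcd x z) (sym (m/n*n≡m (gcd[m,n]∣m x z))) (sym (m/n*n≡m (gcd[m,n]∣n x z))) (coprime-/gcd x z)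
      where
      instance
        gcd-nonZero : ℕ.NonZero (gcd x z)
        gcd-nonZero = ℕ.≢-nonZero (gcd[m,n]≢0 x z (inj₁ λ ()))
      from : ∀ g x′ z′ .{{_ : ℕ.NonZero g}} → x ≡ x′ ℕ.* g → z ≡ z′ ℕ.* g → Coprime x′ z′ → ∃[ a ] ∃[ b ] x ≡ a ℕ.* a × y ≡ b ℕ.* b
      from g x′ z′ x≡ z≡ x′z′-coprime = g , z′ , trans x≡ (cong (ℕ._* g) x′≡g) ,
        ℕ.*-cancelˡ-≡ y (z′ ℕ.* z′) g (trans (cong (ℕ._* y) (sym x′≡g)) eq′)
        where
        l : ∀ g z′ x′ y → x′ ℕ.* g ℕ.* y ≡ g ℕ.* (x′ ℕ.* y)
        l = ℕSolver.solve-∀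
        l′ : ∀ g z′ → z′ ℕ.* g ℕ.* (z′ ℕ.* g) ≡ g ℕ.* (g ℕ.* (z′ ℕ.* z′))
        l′ = ℕSolver.solve-∀
        eq′ : x′ ℕ.* y ≡ g ℕ.* (z′ ℕ.* z′)
        eq′ = ℕ.*-cancelˡ-≡ (x′ ℕ.* y) _ g (trans (sym (l g z′ x′ y)) (trans (cong (ℕ._* y) (sym x≡)) (trans eq (trans (cong₂ ℕ._*_ z≡ z≡) (l′ g z′)))))
        x′∣g : x′ ℕ.∣ g
        x′∣g = coprime-divisor x′z′-coprime (coprime-divisor x′z′-coprime (ℕ.divides y (trans (l″ g z′) (trans (sym eq′) (ℕ.*-comm x′ y)))))
          where
          l″ : ∀ g z′ → z′ ℕ.* (z′ ℕ.* g) ≡ g ℕ.* (z′ ℕ.* z′)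
          l″ = ℕSolver.solve-∀
        g∣x′ : g ℕ.∣ x′
        g∣x′ = coprime-divisor {n = y} (λ { {d} (d∣g , d∣y) → coprime (subst (d ℕ.∣_) (sym x≡) (ℕ.∣-trans d∣g (ℕ.n∣m*n x′)) , d∣y) })
          (ℕ.divides (z′ ℕ.* z′) (trans (ℕ.*-comm y x′) (trans eq′ (ℕ.*-comm g (z′ ℕ.* z′)))))
        x′≡g : x′ ≡ g
        x′≡g = ℕ.∣-antisym x′∣g g∣x′

  coprime-squares : ∀ x y z → 0ℤ ≤ x → 0ℤ ≤ y → Coprimeℤ x y → x * y ≡ z * z → ∃[ a ] ∃[ b ] x ≡ pos a * pos a × y ≡ pos b * pos b
  coprime-squares x y z 0≤x 0≤y coprime eq = let a , b , x≡ , y≡ = coprime-squaresℕ (abs x) (abs y) (abs z) (coprimeℤ⇒coprime {x} {y} coprime)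
                                                   (trans (sym (abs-* x y)) (trans (cong abs eq) (abs-* z z))) in
    a , b , trans (sym (0≤i⇒+∣i∣≡i 0≤x)) (trans (cong pos x≡) (pos-* a a)) , trans (sym (0≤i⇒+∣i∣≡i 0≤y)) (trans (cong pos y≡) (pos-* b b))

  0≤x*x : ∀ x → 0ℤ ≤ x * x
  0≤x*x (pos n)  = subst (0ℤ ≤_) (pos-* n n) (+≤+ z≤n)
  0≤x*x -[1+ n ] = +≤+ z≤n

  x*x≡0⇒x≡0 : ∀ x → x * x ≡ 0ℤ → x ≡ 0ℤ
  x*x≡0⇒x≡0 x eq = [ (λ z → z) , (λ z → z) ]′ (i*j≡0⇒i≡0∨j≡0 x eq)

  nonneg-factors : ∀ x y → 0ℤ ≤ x * y → 0ℤ < x + y → 0ℤ ≤ x × 0ℤ ≤ y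
  nonneg-factors (pos m) (pos n) _ _ = +≤+ z≤n , +≤+ z≤n
  nonneg-factors (pos zero) -[1+ n ] _ ()
  nonneg-factors (pos (suc m)) -[1+ n ] () _
  nonneg-factors -[1+ m ] (pos zero) _ ()
  nonneg-factors -[1+ m ] (pos (suc n)) () _
  nonneg-factors -[1+ m ] -[1+ n ] _ ()

  nonneg-cofactor : ∀ x y → 0ℤ < x → 0ℤ ≤ x * y → 0ℤ ≤ y
  nonneg-cofactor (pos (suc m)) (pos n) _ _ = +≤+ z≤n
  nonneg-cofactor (pos (suc m)) -[1+ n ] _ ()
  nonneg-cofactor (pos zero) _ (+<+ ()) _

  equal-squares : ∀ x y → 0ℤ ≤ x → 0ℤ ≤ y → x * x ≡ y * y → x ≡ y
  equal-squares (pos m) (pos n) _ _ eq = cong pos (ℕ.≤-antisym (le m n (+-injective eqℕ)) (le n m (sym (+-injective eqℕ))))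
    where
    eqℕ : pos (m ℕ.* m) ≡ pos (n ℕ.* n)
    eqℕ = trans (pos-* m m) (trans eq (sym (pos-* n n)))
    le : ∀ m n → m ℕ.* m ≡ n ℕ.* n → m ℕ.≤ n
    le m n e = ℕ.≮⇒≥ λ n<m → ℕ.<-irrefl (sym e) (ℕ.*-mono-< n<m n<m)

  -- The splitting into squares, applied twice: x = α² and y = β² with αβ = z², and α, β are coprime
  -- again.
  coprime-fourth-powers : ∀ x y z → 0ℤ ≤ x → 0ℤ ≤ y → Coprimeℤ x y → x * y ≡ z * z * (z * z) →
    ∃[ a ] ∃[ b ] x ≡ pos a * pos a * (pos a * pos a) × y ≡ pos b * pos b * (pos b * pos b) × pos a * pos a * (pos b * pos b) ≡ z * z
  coprime-fourth-powers x y z 0≤x 0≤y coprime eq = step (coprime-squares x y (z * z) 0≤x 0≤y coprime eq)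
    where
    step : ∃[ a ] ∃[ b ] x ≡ pos a * pos a × y ≡ pos b * pos b → _
    step (α , β , x≡ , y≡) = finish (coprime-squares (pos α) (pos β) z (+≤+ z≤n) (+≤+ z≤n)
        (λ isPrime h h′ → coprime isPrime (∣-multiple (pos α) x≡ h) (∣-multiple (pos β) y≡ h′)) αβ≡z²)
      where
      l = solve 2 (λ a b → a :* b :* (a :* b) := a :* a :* (b :* b)) refl
      αβ≡z² : pos α * pos β ≡ z * z
      αβ≡z² = equal-squares _ _ (subst (0ℤ ≤_) (pos-* α β) (+≤+ z≤n)) (0≤x*x z) (trans (l (pos α) (pos β)) (trans (sym (cong₂ _*_ x≡ y≡)) eq))
      finish : ∃[ a ] ∃[ b ] pos α ≡ pos a * pos a × pos β ≡ pos b * pos b → _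
      finish (a , b , α≡ , β≡) = a , b , trans x≡ (cong₂ _*_ α≡ α≡) , trans y≡ (cong₂ _*_ β≡ β≡) , trans (sym (cong₂ _*_ α≡ β≡)) αβ≡z²

  parity : ∀ x → (∃[ k ] x ≡ k + k) ⊎ (∃[ k ] x ≡ k + k + 1ℤ)
  parity (pos zero) = inj₁ (0ℤ , refl)
  parity (pos (suc n)) = [ (λ (k , e) → inj₂ (k , trans (cong (1ℤ +_) e) (+-comm 1ℤ (k + k)))) ,
                           (λ (k , e) → inj₁ (k + 1ℤ , trans (cong (1ℤ +_) e) (l k))) ]′ (parity (pos n))
    where
    l = solve 1 (λ k → con 1ℤ :+ (k :+ k :+ con 1ℤ) := k :+ con 1ℤ :+ (k :+ con 1ℤ)) refl
  parity -[1+ zero ] = inj₂ (- 1ℤ , refl)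
  parity -[1+ suc n ] = [ (λ (k , e) → inj₂ (k - 1ℤ , trans (cong (- 1ℤ +_) e) (l k))) ,
                          (λ (k , e) → inj₁ (k , trans (cong (- 1ℤ +_) e) (l′ k))) ]′ (parity -[1+ n ])
    where
    l = solve 1 (λ k → :- con 1ℤ :+ (k :+ k) := k :- con 1ℤ :+ (k :- con 1ℤ) :+ con 1ℤ) refl
    l′ = solve 1 (λ k → :- con 1ℤ :+ (k :+ k :+ con 1ℤ) := k :+ k) refl

  even⇒2∣ : ∀ {x} k → x ≡ k + k → pos 2 ∣ x
  even⇒2∣ k e = divides k (trans e (l k))
    where
    l = solve 1 (λ k → k :+ k := k :* con (pos 2)) refl

  2∣⇒even : ∀ {x} → pos 2 ∣ x → ∃[ k ] x ≡ k + k
  2∣⇒even (divides k e) = k , trans e (l k)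
    where
    l = solve 1 (λ k → k :* con (pos 2) := k :+ k) refl

  even≢odd : ∀ k j → k + k ≢ j + j + 1ℤ
  even≢odd k j eq = contradiction (ℕ.∣⇒≤ (∣⇒∣ᵤ {pos 2} {1ℤ} (divides (k - j) (lin (- 1ℤ) (l k j) eq)))) λ { (s≤s ()) }
    where
    l = solve 2 (λ k j → con 1ℤ :- (k :- j) :* con (pos 2) := :- con 1ℤ :* (k :+ k :- (j :+ j :+ con 1ℤ))) refl

  rational-root : ∀ q k → q ℚ.* q ≡ ι k → Integer q
  rational-root q k eq with ↧ₙ q ℕ.≟ 1
  ... | yes d≡1 = denominator≡1⇒Integer q d≡1
  ... | no d≢1 = ⊥-elim (from (prime-divisor (↧ₙ q) d≢1))
    where
    N = ↥ q
    D = ↧ q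
    square : N * N ≡ k * (D * D)
    square = ι-injective (trans (ι-* N N) (trans (cong₂ ℚ._*_ (sym (x*↧x≡↥x q)) (sym (x*↧x≡↥x q)))
      (trans (l q (ι D)) (trans (cong (ℚ._* (ι D ℚ.* ι D)) eq) (sym (trans (ι-* k (D * D)) (cong (ι k ℚ.*_) (ι-* D D))))))))
      where
      l = ℚS.solve 2 (λ q D → q ℚS.:* D ℚS.:* (q ℚS.:* D) ℚS.:= q ℚS.:* q ℚS.:* (D ℚS.:* D)) refl
    from : ∃[ p ] Prime p × p ℕ.∣ ↧ₙ q → ⊥
    from (p , isPrime , p∣d) = coprime⇒coprimeℤ {N} {D} (numerator-coprime q) isPrime
      (euclid² isPrime N (∣-multiple (k * D) (trans square (sym (*-assoc k D D))) (∣ᵤ⇒∣ {pos p} p∣d))) (∣ᵤ⇒∣ {pos p} p∣d)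

  -- u = r / t² in lowest terms, because z² = D M with D = den u coprime to M and z = y D².
  record IntegralPoint (a b c : ℤ) (u : ℚ) : Set where
    field
      r s     : ℤ
      t       : ℕ
      t≢0     : pos t ≢ 0ℤ
      u*t²≡r  : u ℚ.* ι (pos t * pos t) ≡ ι r
      coprime : Coprimeℤ r (pos t)
      eq      : s * s ≡ r * r * r + a * (r * r) * (pos t * pos t) + b * r * (pos t * pos t * (pos t * pos t)) + c * (pos t * pos t * (pos t * pos t) * (pos t * pos t))

  integral-point : ∀ a b c u y → y ℚ.* y ≡ u ℚ.* u ℚ.* u ℚ.+ ι a ℚ.* (u ℚ.* u) ℚ.+ ι b ℚ.* u ℚ.+ ι c → IntegralPoint a b c u
  integral-point a b c u y on = with-root (rational-root (y ℚ.* (ι D ℚ.* ι D)) (D * M) root)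
    where
    N = ↥ u
    D = ↧ u
    M = N * N * N + a * (N * N) * D + b * N * (D * D) + c * (D * D * D)
    uD : u ℚ.* ι D ≡ ι N
    uD = x*↧x≡↥x u
    ιN = sym uD
    root : y ℚ.* (ι D ℚ.* ι D) ℚ.* (y ℚ.* (ι D ℚ.* ι D)) ≡ ι (D * M)
    root = trans (l y (ι D)) (trans (cong (ℚ._* (ι D ℚ.* ι D ℚ.* ι D ℚ.* ι D)) on) (trans (l′ u (ι D) (ι a) (ι b) (ι c))
      (sym (ι⟨*⟩ refl (ι⟨+⟩ (ι⟨+⟩ (ι⟨+⟩ (ι⟨*⟩ (ι⟨*⟩ ιN ιN) ιN) (ι⟨*⟩ (ι⟨*⟩ refl (ι⟨*⟩ ιN ιN)) refl)) (ι⟨*⟩ (ι⟨*⟩ refl ιN) (ι⟨*⟩ refl refl))) (ι⟨*⟩ refl (ι⟨*⟩ (ι⟨*⟩ refl refl) refl)))))))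
      where
      l = ℚS.solve 2 (λ y D → y ℚS.:* (D ℚS.:* D) ℚS.:* (y ℚS.:* (D ℚS.:* D)) ℚS.:= y ℚS.:* y ℚS.:* (D ℚS.:* D ℚS.:* D ℚS.:* D)) refl
      l′ = ℚS.solve 5 (λ u D a b c → (u ℚS.:* u ℚS.:* u ℚS.:+ a ℚS.:* (u ℚS.:* u) ℚS.:+ b ℚS.:* u ℚS.:+ c) ℚS.:* (D ℚS.:* D ℚS.:* D ℚS.:* D)
         ℚS.:= D ℚS.:* (u ℚS.:* D ℚS.:* (u ℚS.:* D) ℚS.:* (u ℚS.:* D) ℚS.:+ a ℚS.:* (u ℚS.:* D ℚS.:* (u ℚS.:* D)) ℚS.:* D ℚS.:+ b ℚS.:* (u ℚS.:* D) ℚS.:* (D ℚS.:* D) ℚS.:+ c ℚS.:* (D ℚS.:* D ℚS.:* D))) refl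
    ND-coprime : Coprimeℤ N D
    ND-coprime = coprime⇒coprimeℤ {N} {D} (numerator-coprime u)
    DM-coprime : Coprimeℤ D M
    DM-coprime {q} isPrime q∣D q∣M = [ euclid² isPrime N , (λ h → h) ]′ (euclid isPrime (N * N) N (∣-combination 1ℤ (- (a * (N * N) + b * N * D + c * (D * D))) (l N D a b c) q∣M q∣D)) |> λ h → ND-coprime isPrime h q∣D
      where
      _|>_ : ∀ {X Y : Set} → X → (X → Y) → Y
      x |> f = f x
      l = solve 5 (λ N D a b c → N :* N :* N := con 1ℤ :* (N :* N :* N :+ a :* (N :* N) :* D :+ b :* N :* (D :* D) :+ c :* (D :* D :* D)) :+ :- (a :* (N :* N) :+ b :* N :* D :+ c :* (D :* D)) :* D) refl
    with-root : Integer (y ℚ.* (ι D ℚ.* ι D)) → IntegralPoint a b c u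
    with-root (z , eq) = with-squares (coprime-squares D M z (+≤+ z≤n) (nonneg-cofactor D M (+<+ (s≤s z≤n)) (subst (0ℤ ≤_) (sym DM≡z²) (0≤x*x z))) DM-coprime DM≡z²)
      where
      DM≡z² : D * M ≡ z * z
      DM≡z² = ι-injective (trans (sym root) (trans (cong₂ ℚ._*_ eq eq) (sym (ι-* z z))))
      with-squares : ∃[ t ] ∃[ s ] D ≡ pos t * pos t × M ≡ pos s * pos s → IntegralPoint a b c u
      with-squares (t , s , D≡ , M≡) = record
        { r = N ; s = pos s ; t = t
        ; t≢0 = λ t≡0 → contradiction (trans D≡ (cong (λ z → z * z) t≡0)) λ ()
        ; u*t²≡r = trans (cong (λ d → u ℚ.* ι d) (sym D≡)) uD
        ; coprime = λ isPrime h h′ → ND-coprime isPrime h (∣-multiple (pos t) D≡ h′)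
        ; eq = trans (sym M≡) (cong (λ d → N * N * N + a * (N * N) * d + b * N * (d * d) + c * (d * d * d)) D≡) }

-- Rational points of y² = u³ + u² - u by Fermat descent.

module Curve20 where
  open Rationals using (*-cancelˡ)
  open IntegersInℚ
  open IntegerArithmetic
  open import Data.Nat using (ℕ; zero; suc; s≤s; z≤n)
  import Data.Nat as ℕ
  import Data.Nat.Properties as ℕ
  import Data.Nat.Divisibility as ℕ
  import Data.Nat.Tactic.RingSolver as ℕSolver
  open import Data.Nat.Primality using (Prime; prime?; prime[2]; prime⇒irreducible; prime⇒nonTrivial)
  open import Data.Integer using (ℤ; 0ℤ; 1ℤ; _+_; _*_; _-_; -_; _≤_; _<_; -[1+_]; +≤+; +<+) renaming (+_ to pos)
  import Data.Integer as ℤ hiding (+_)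
  open import Data.Integer.Properties
  open import Data.Integer.Divisibility.Signed using (_∣_; divides; ∣⇒∣ᵤ)
  open import Data.Rational using (ℚ; 0ℚ; 1ℚ)
  import Data.Rational as ℚ
  import Data.Rational.Properties as ℚ
  open import Relation.Nullary.Decidable using (from-yes)
  open ℤS using (solve; con; _:+_; _:*_; _:-_; :-_; _:=_)

  infix 8 _² _⁴
  _² _⁴ : ℤ → ℤ
  x ² = x * x
  x ⁴ = x * x * (x * x)

  0<x*x : ∀ x → x ≢ 0ℤ → 0ℤ < x * x
  0<x*x x x≢0 = ≤∧≢⇒< (0≤x*x x) (λ eq → x≢0 (x*x≡0⇒x≡0 x (sym eq)))

  ∣⁴ : ∀ {q} → Prime q → ∀ x → pos q ∣ x ⁴ → pos q ∣ x
  ∣⁴ isPrime x h = euclid² isPrime x (euclid² isPrime (x * x) h)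

  prime[5] : Prime 5
  prime[5] = from-yes (prime? 5)

  -- A factorisation of 5 z⁴ into coprime nonnegative factors is {a⁴, 5 b⁴} with a² b² = z².
  record FiveFourths (P Q z : ℤ) : Set where
    field
      a b     : ℕ
      sum     : P + Q ≡ pos a ⁴ + pos 5 * pos b ⁴
      product : pos a ² * pos b ² ≡ z ²
      coprime : Coprimeℤ (pos a) (pos b)

  -- The prime 5 divides one of the factors; dividing it out leaves coprime factors of z⁴. Only the
  -- sum and product are recorded, because it does not matter which factor that was.
  fiveFourths : ∀ P Q z → 0ℤ ≤ P → 0ℤ ≤ Q → Coprimeℤ P Q → P * Q ≡ pos 5 * z ⁴ → FiveFourths P Q z
  fiveFourths P Q z 0≤P 0≤Q P⊥Q eq = [ left P Q 0≤P 0≤Q P⊥Q eq ,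
      (λ h → swapped (left Q P 0≤Q 0≤P (λ isPrime h h′ → P⊥Q isPrime h′ h) (trans (*-comm Q P) eq) h)) ]′
    (euclid prime[5] P Q (divides (z ⁴) (trans eq (*-comm (pos 5) (z ⁴)))))
    where
    swapped : FiveFourths Q P z → FiveFourths P Q z
    swapped F = record { FiveFourths F ; sum = trans (+-comm P Q) (FiveFourths.sum F) }
    left : ∀ P Q → 0ℤ ≤ P → 0ℤ ≤ Q → Coprimeℤ P Q → P * Q ≡ pos 5 * z ⁴ → pos 5 ∣ P → FiveFourths P Q z
    left P Q 0≤P 0≤Q P⊥Q eq (divides k P≡) = from (coprime-fourth-powers k Q z 0≤k 0≤Q
        (λ isPrime h h′ → P⊥Q isPrime (∣-multiple (pos 5) (trans P≡ (*-comm k (pos 5))) h) h′)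
        (*-cancelˡ-≡ (pos 5) _ _ (trans (l k Q) (trans (cong (_* Q) (sym P≡)) eq))))
      where
      l = solve 2 (λ k Q → con (pos 5) :* (k :* Q) := k :* con (pos 5) :* Q) refl
      0≤k : 0ℤ ≤ k
      0≤k = nonneg-cofactor (pos 5) k (+<+ (s≤s z≤n)) (subst (0ℤ ≤_) (trans P≡ (*-comm k (pos 5))) 0≤P)
      from : ∃[ b ] ∃[ a ] k ≡ pos b ⁴ × Q ≡ pos a ⁴ × pos b ² * pos a ² ≡ z ² → FiveFourths P Q z
      from (b , a , k≡ , Q≡ , ba≡) = record
        { a = a ; b = b ; sum = trans (cong₂ _+_ (trans P≡ (cong (_* pos 5) k≡)) Q≡) (l′ (pos a ⁴) (pos b ⁴))
        ; product = trans (*-comm (pos a ²) (pos b ²)) ba≡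
        ; coprime = λ {q} isPrime h h′ → P⊥Q isPrime
            (∣-multiple (pos b * pos b * pos b * pos 5) (trans P≡ (trans (cong (_* pos 5) k≡) (l₁ (pos b)))) h′)
            (∣-multiple (pos a * pos a * pos a) (trans Q≡ (l₂ (pos a))) h) }
        where
        l′ = solve 2 (λ A B → B :* con (pos 5) :+ A := A :+ con (pos 5) :* B) refl
        l₁ = solve 1 (λ b → b :* b :* (b :* b) :* con (pos 5) := b :* b :* b :* con (pos 5) :* b) refl
        l₂ = solve 1 (λ b → b :* b :* (b :* b) := b :* b :* b :* b) refl

  private
    factor-zero : ∀ {a b z} → pos a ² * pos b ² ≡ z ² → z ≢ 0ℤ → b ≢ 0
    factor-zero {a} {z = z} eq z≢0 refl = z≢0 (x*x≡0⇒x≡0 z (trans (sym eq) (*-zeroʳ (pos a ²))))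

    ⁴-≥ : ∀ g → g ℕ.≤ g ℕ.* g ℕ.* (g ℕ.* g)
    ⁴-≥ zero = z≤n
    ⁴-≥ g@(suc _) = ℕ.≤-trans (ℕ.m≤m*n g g) (ℕ.m≤m*n (g ℕ.* g) (g ℕ.* g))

    pos-⁴ : ∀ g → pos (g ℕ.* g ℕ.* (g ℕ.* g)) ≡ pos g ⁴
    pos-⁴ g = trans (pos-* (g ℕ.* g) (g ℕ.* g)) (cong₂ _*_ (pos-* g g) (pos-* g g))

    -- The solution at which the descent stops: if g is not smaller than m, then g⁴ < 2m ≤ 2g, which
    -- leaves g = 1 and then m = h = 1.
    small-fourths : ∀ g h m → h ≢ 0 → g ℕ.* g ℕ.* (g ℕ.* g) ℕ.+ h ℕ.* h ℕ.* (h ℕ.* h) ≡ m ℕ.+ m → m ≢ 0 → m ℕ.≤ g → g ≡ 1 × h ≡ 1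
    small-fourths zero h m _ _ m≢0 m≤g = contradiction (ℕ.n≤0⇒n≡0 m≤g) m≢0
    small-fourths (suc (suc k)) h m h≢0 eq _ m≤g = contradiction (ℕ.+-mono-≤ m≤g m≤g) (ℕ.<⇒≱ (subst (suc (suc k) ℕ.+ suc (suc k) ℕ.<_) eq
      (ℕ.<-≤-trans (subst (suc (suc k) ℕ.+ suc (suc k) ℕ.<_) (sym (l k)) (ℕ.m<m+n _ (s≤s z≤n))) (ℕ.m≤m+n _ _))))
      where
      l : ∀ k → suc (suc k) ℕ.* suc (suc k) ℕ.* (suc (suc k) ℕ.* suc (suc k)) ≡ (suc (suc k) ℕ.+ suc (suc k)) ℕ.+ suc (11 ℕ.+ 30 ℕ.* k ℕ.+ 24 ℕ.* k ℕ.* k ℕ.+ 8 ℕ.* k ℕ.* k ℕ.* k ℕ.+ k ℕ.* k ℕ.* k ℕ.* k)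
      l = ℕSolver.solve-∀
    small-fourths (suc zero) zero m h≢0 _ _ _ = contradiction refl h≢0
    small-fourths (suc zero) (suc zero) m _ _ _ _ = refl , refl
    small-fourths (suc zero) (suc (suc k)) zero _ _ m≢0 _ = contradiction refl m≢0
    small-fourths (suc zero) (suc (suc k)) (suc zero) _ () _ _
    small-fourths (suc zero) (suc (suc k)) (suc (suc m)) _ _ _ (s≤s ())

    add-zero : ∀ x y → 0ℤ ≤ x → 0ℤ ≤ y → x + y ≡ 0ℤ → y ≡ 0ℤ
    add-zero (pos x) (pos y) _ _ eq = cong pos (ℕ.m+n≡0⇒n≡0 x (+-injective eq))

  -- Fermat descent: a solution with t ≠ 0 yields one with smaller m, of which it is 2 m = g⁴ + h⁴ (t odd)
  -- or m = g⁴ + h⁴ (t even).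
  quartic : ∀ fuel m t n → m ℕ.< fuel → Coprimeℤ (pos m) t → n ² + t ⁴ ≡ pos m ⁴ + pos m ² * t ² → t ≡ 0ℤ ⊎ (m ≡ 1 × t ² ≡ 1ℤ)
  quartic (suc fuel) m t n m<fuel m⊥t eq with t ℤ.≟ 0ℤ
  ... | yes t≡0 = inj₁ t≡0
  ... | no t≢0 = inj₂ ([ even , odd ]′ (parity t))
    where
    M = pos m
    m≢0 : m ≢ 0
    m≢0 refl = t≢0 (x*x≡0⇒x≡0 t (x*x≡0⇒x≡0 (t ²) (add-zero (n ²) (t ⁴) (0≤x*x n) (0≤x*x (t ²)) eq)))
    0<M : 0ℤ < M
    0<M = +<+ (ℕ.n≢0⇒n>0 m≢0)

    ∣5⇒≡5 : ∀ {q} → Prime q → pos q ∣ pos 5 → q ≡ 5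
    ∣5⇒≡5 isPrime h = [ (λ q≡1 → contradiction q≡1 (ℕ.nonTrivial⇒≢1 {{prime⇒nonTrivial isPrime}})) , (λ e → e) ]′
      (prime⇒irreducible prime[5] (∣⇒∣ᵤ h))

    -- The delicate prime is q = 5: if it divides both factors, then 25 ∣ 5z⁴ and so 5 ∣ z.
    common⇒∣z : ∀ {q} P Q z → Prime q → P * Q ≡ pos 5 * z ⁴ → pos q ∣ P → pos q ∣ Q → pos q ∣ z
    common⇒∣z {q} P Q z isPrime PQ h@(divides j P≡) (divides k Q≡) = [ five , ∣⁴ isPrime z ]′
      (euclid isPrime (pos 5) (z ⁴) (subst (pos q ∣_) PQ (∣-multiple Q (*-comm P Q) h)))
      where
      l = solve 2 (λ j k → j :* con (pos 5) :* (k :* con (pos 5)) := con (pos 5) :* (j :* k :* con (pos 5))) refl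
      five : pos q ∣ pos 5 → pos q ∣ z
      five q∣5 with ∣5⇒≡5 isPrime q∣5
      ... | refl = ∣⁴ isPrime z (divides (j * k) (*-cancelˡ-≡ (pos 5) _ _ (trans (sym PQ) (trans (cong₂ _*_ P≡ Q≡) (l j k)))))

    record Smaller : Set where
      field
        g h : ℕ
        a   : ℤ
        h≢0 : h ≢ 0
        g⊥h : Coprimeℤ (pos g) (pos h)
        eq′ : a ² + pos h ⁴ ≡ pos g ⁴ + pos g ² * pos h ²

    descend : (S : Smaller) → Smaller.g S ℕ.< m → Smaller.g S ≡ 1 × Smaller.h S ≡ 1
    descend S g<m = [ (λ h≡0 → contradiction (+-injective h≡0) h≢0) , (λ (g≡1 , h²≡1) → g≡1 , square-one h h²≡1) ]′
      (quartic fuel g (pos h) a (ℕ.≤-trans g<m (ℕ.≤-pred m<fuel)) g⊥h eq′)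
      where
      open Smaller S
      square-one : ∀ h → pos h ² ≡ 1ℤ → h ≡ 1
      square-one h e = +-injective (equal-squares (pos h) 1ℤ (+≤+ z≤n) (+≤+ z≤n) e)

    odd : ∃[ k ] t ≡ k + k + 1ℤ → m ≡ 1 × t ² ≡ 1ℤ
    odd (κ , t≡) = with-five (fiveFourths P Q t (proj₁ 0≤PQ) (proj₂ 0≤PQ) P⊥Q PQ)
      where
      -- Completing the square in m⁴ + m²t² - t⁴ = n² gives (2m² + t²)² - (2n)² = 5t⁴; `P` and `Q`
      -- are the two factors on the left.
      P Q : ℤ
      P = M ² + M ² + t ² + (n + n)
      Q = M ² + M ² + t ² - (n + n)
      PQ : P * Q ≡ pos 5 * t ⁴
      PQ = lin (- pos 4) (l M t n) eq
        where
        l = solve 3 (λ M t n → (M :* M :+ M :* M :+ t :* t :+ (n :+ n)) :* (M :* M :+ M :* M :+ t :* t :- (n :+ n)) :- con (pos 5) :* (t :* t :* (t :* t))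
          := :- con (pos 4) :* ((n :* n :+ t :* t :* (t :* t)) :- (M :* M :* (M :* M) :+ M :* M :* (t :* t)))) refl
      P+Q : P + Q ≡ t ² + t ² + (M + M) ²
      P+Q = l M t n
        where
        l = solve 3 (λ M t n → (M :* M :+ M :* M :+ t :* t :+ (n :+ n)) :+ (M :* M :+ M :* M :+ t :* t :- (n :+ n)) := t :* t :+ t :* t :+ (M :+ M) :* (M :+ M)) refl
      0≤PQ : 0ℤ ≤ P × 0ℤ ≤ Q
      0≤PQ = nonneg-factors P Q (subst (0ℤ ≤_) (trans (l (t ²)) (sym PQ)) (+-mono-≤ (0≤x*x (t ²)) (0≤x*x (t ² + t ²))))
        (subst (0ℤ <_) (sym P+Q) (+-mono-<-≤ (+-mono-< (0<x*x t t≢0) (0<x*x t t≢0)) (0≤x*x (M + M))))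
        where
        l = solve 1 (λ u → u :* u :+ (u :+ u) :* (u :+ u) := con (pos 5) :* (u :* u)) refl
      P⊥Q : Coprimeℤ P Q
      P⊥Q {q} isPrime h h′ = [ 2-case , m-case ]′ (euclid isPrime (pos 2) M (euclid² isPrime (pos 2 * M)
          (∣-combination 1ℤ (- pos 2 * t) (l M t n) (∣-combination 1ℤ 1ℤ (l₀ P Q) h h′) q∣t)))
        where
        q∣t : pos q ∣ t
        q∣t = common⇒∣z P Q t isPrime PQ h h′
        l₀ = solve 2 (λ P Q → P :+ Q := con 1ℤ :* P :+ con 1ℤ :* Q) refl
        l = solve 3 (λ M t n → con (pos 2) :* M :* (con (pos 2) :* M) := con 1ℤ :* ((M :* M :+ M :* M :+ t :* t :+ (n :+ n)) :+ (M :* M :+ M :* M :+ t :* t :- (n :+ n))) :+ :- con (pos 2) :* t :* t) refl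
        m-case : pos q ∣ M → ⊥
        m-case q∣M = m⊥t isPrime q∣M q∣t
        2-case : pos q ∣ pos 2 → ⊥
        2-case q∣2 = ℕ.nonTrivial⇒≢1 {{prime⇒nonTrivial isPrime}} (ℕ.∣1⇒≡1 (∣⇒∣ᵤ {pos q} {1ℤ}
          (∣-combination 1ℤ (- κ) (trans (l₁ κ) (cong (λ z → 1ℤ * z + - κ * pos 2) (sym t≡))) q∣t q∣2)))
          where
          l₁ = solve 1 (λ k → con 1ℤ := con 1ℤ :* (k :+ k :+ con 1ℤ) :+ :- k :* con (pos 2)) refl
      t-odd : ¬ pos 2 ∣ t
      t-odd h = let j , e = 2∣⇒even h in even≢odd j κ (trans (sym e) t≡)

      with-five : FiveFourths P Q t → m ≡ 1 × t ² ≡ 1ℤ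
      with-five F = with-odd ([ (λ (k , e) → ⊥-elim (t-odd (even-factor a b (even⇒2∣ k e) ab≡))) , (λ h → h) ]′ (parity a))
                             ([ (λ (k , e) → ⊥-elim (t-odd (even-factor b a (even⇒2∣ k e) (trans (*-comm (b ²) (a ²)) ab≡)))) , (λ h → h) ]′ (parity b))
        where
        a = pos (FiveFourths.a F)
        b = pos (FiveFourths.b F)
        ab≡ = FiveFourths.product F
        even-factor : ∀ x y → pos 2 ∣ x → x ² * y ² ≡ t ² → pos 2 ∣ t
        even-factor x y h e = euclid² prime[2] t (subst (pos 2 ∣_) e (∣-multiple (x * y ²) (l x (y ²)) h))
          where
          l = solve 2 (λ x y → x :* x :* y := x :* y :* x) refl
        with-odd : ∃[ i ] a ≡ i + i + 1ℤ → ∃[ j ] b ≡ j + j + 1ℤ → m ≡ 1 × t ² ≡ 1ℤ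
        with-odd (i , a≡) (j , b≡) = with-fourths (coprime-fourth-powers X Y b (proj₁ 0≤XY) (proj₂ 0≤XY) X⊥Y XY)
          where
          -- U = (a² - b²)/2, integral as a and b are odd. Inserting t² = a²b² into 2t² + 4M² = a⁴ +
          -- 5b⁴ gives M² = U² + b⁴, which factors into `X` and `Y`.
          U X Y : ℤ
          U = pos 2 * (i * i + i - (j * j + j))
          X = M + U
          Y = M - U
          2U : U + U ≡ a ² - b ²
          2U = trans (l i j) (cong₂ (λ a b → a ² - b ²) (sym a≡) (sym b≡))
            where
            l = solve 2 (λ i j → con (pos 2) :* (i :* i :+ i :- (j :* j :+ j)) :+ con (pos 2) :* (i :* i :+ i :- (j :* j :+ j)) := (i :+ i :+ con 1ℤ) :* (i :+ i :+ con 1ℤ) :- (j :+ j :+ con 1ℤ) :* (j :+ j :+ con 1ℤ)) refl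
          sum : t ² + t ² + (M + M) ² ≡ a ⁴ + pos 5 * b ⁴
          sum = trans (sym P+Q) (FiveFourths.sum F)
          XY : X * Y ≡ b ⁴
          XY = *-cancelˡ-≡ (pos 4) _ _ (lin₂ 1ℤ (- (U + U + (a ² - b ²))) (l M U a b t) (trans (cong (λ z → z + z + (M + M) ²) ab≡) sum) 2U)
            where
            l = solve 5 (λ M U a b t → con (pos 4) :* ((M :+ U) :* (M :- U)) :- con (pos 4) :* (b :* b :* (b :* b))
              := con 1ℤ :* ((a :* a :* (b :* b) :+ a :* a :* (b :* b) :+ (M :+ M) :* (M :+ M)) :- (a :* a :* (a :* a) :+ con (pos 5) :* (b :* b :* (b :* b))))
                :+ :- (U :+ U :+ (a :* a :- b :* b)) :* (U :+ U :- (a :* a :- b :* b))) refl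
          X+Y : X + Y ≡ M + M
          X+Y = l M U
            where
            l = solve 2 (λ M U → M :+ U :+ (M :- U) := M :+ M) refl
          0≤XY : 0ℤ ≤ X × 0ℤ ≤ Y
          0≤XY = nonneg-factors X Y (subst (0ℤ ≤_) (sym XY) (0≤x*x (b ²))) (subst (0ℤ <_) (sym X+Y) (+-mono-< 0<M 0<M))
          X⊥Y : Coprimeℤ X Y
          X⊥Y {q} isPrime h h′ = FiveFourths.coprime F isPrime q∣a q∣b
            where
            q∣b : pos q ∣ b
            q∣b = ∣⁴ isPrime b (subst (pos q ∣_) XY (∣-multiple Y (*-comm X Y) h))
            q∣a : pos q ∣ a
            q∣a = euclid² isPrime a (∣-combination 1ℤ b (trans (l₂ (a ²) b) (cong (λ z → 1ℤ * z + b * b) (sym 2U)))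
              (∣-combination 1ℤ (- 1ℤ) (l₁ M U) h h′) q∣b)
              where
              l₁ = solve 2 (λ M U → U :+ U := con 1ℤ :* (M :+ U) :+ :- con 1ℤ :* (M :- U)) refl
              l₂ = solve 2 (λ a b → a := con 1ℤ :* (a :- b :* b) :+ b :* b) refl
          with-fourths : ∃[ g ] ∃[ h ] X ≡ pos g ⁴ × Y ≡ pos h ⁴ × pos g ² * pos h ² ≡ b ² → m ≡ 1 × t ² ≡ 1ℤ
          with-fourths (g , h , X≡ , Y≡ , gh≡) = conclude (ones (m ℕ.≤? g))
            where
            b≢0 : b ≢ 0ℤ
            b≢0 e = factor-zero {FiveFourths.a F} ab≡ t≢0 (+-injective e)
            S : Smaller
            S = record { g = g ; h = h ; a = a ; h≢0 = factor-zero {g} gh≡ b≢0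
              ; g⊥h = λ isPrime u v → X⊥Y isPrime (∣-multiple (pos g * pos g * pos g) (trans X≡ (l (pos g))) u)
                                                 (∣-multiple (pos h * pos h * pos h) (trans Y≡ (l (pos h))) v)
              -- The new solution is a² = b² + 2U = g²h² + g⁴ - h⁴.
              ; eq′ = trans (cong (a ² +_) (sym Y≡)) (trans (lin (- 1ℤ) (l₁ (a ²) (b ²) M U) 2U) (cong₂ _+_ X≡ (sym gh≡))) }
              where
              l = solve 1 (λ b → b :* b :* (b :* b) := b :* b :* b :* b) refl
              l₁ = solve 4 (λ a b M U → (a :+ (M :- U)) :- (M :+ U :+ b) := :- con 1ℤ :* (U :+ U :- (a :- b))) refl
            sumℕ : g ℕ.* g ℕ.* (g ℕ.* g) ℕ.+ h ℕ.* h ℕ.* (h ℕ.* h) ≡ m ℕ.+ m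
            sumℕ = +-injective (trans (cong₂ _+_ (trans (pos-⁴ g) (sym X≡)) (trans (pos-⁴ h) (sym Y≡))) X+Y)
            ones : Dec (m ℕ.≤ g) → g ≡ 1 × h ≡ 1
            ones (yes m≤g) = small-fourths g h m (Smaller.h≢0 S) sumℕ m≢0 m≤g
            ones (no m≰g)  = descend S (ℕ.≰⇒> m≰g)
            conclude : g ≡ 1 × h ≡ 1 → m ≡ 1 × t ² ≡ 1ℤ
            conclude (refl , refl) = ℕ.*-cancelˡ-≡ m 1 2 (trans (cong (m ℕ.+_) (ℕ.+-identityʳ m)) (sym sumℕ)) ,
              trans (sym ab≡) (trans (cong (a ² *_) (sym gh≡)) (trans (*-identityʳ (a ²)) (lin 1ℤ (l (a ²)) (Smaller.eq′ S))))
              where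
              l = solve 1 (λ a → a :- con 1ℤ := con 1ℤ :* ((a :+ con 1ℤ) :- con (pos 2))) refl

    even : ∃[ k ] t ≡ k + k → m ≡ 1 × t ² ≡ 1ℤ
    even (τ , t≡) = ⊥-elim (with-odd ([ (λ (k , e) → ⊥-elim (2∤M (even⇒2∣ k e))) , (λ h → h) ]′ (parity M))
                                     ([ (λ (k , e) → ⊥-elim (2∤n k e)) , (λ h → h) ]′ (parity n)))
      where
      2∤M : ¬ pos 2 ∣ M
      2∤M h = m⊥t prime[2] h (even⇒2∣ τ t≡)
      τ≢0 : τ ≢ 0ℤ
      τ≢0 refl = t≢0 t≡
      eqτ : n ² + pos 16 * τ ⁴ ≡ M ⁴ + pos 4 * (M ² * τ ²)
      eqτ = lin 1ℤ (l n M τ) (subst (λ t → n ² + t ⁴ ≡ M ⁴ + M ² * t ²) t≡ eq)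
        where
        l = solve 3 (λ n M τ → (n :* n :+ con (pos 16) :* (τ :* τ :* (τ :* τ))) :- (M :* M :* (M :* M) :+ con (pos 4) :* (M :* M :* (τ :* τ)))
          := con 1ℤ :* ((n :* n :+ (τ :+ τ) :* (τ :+ τ) :* ((τ :+ τ) :* (τ :+ τ))) :- (M :* M :* (M :* M) :+ M :* M :* ((τ :+ τ) :* (τ :+ τ))))) refl
      2∤n : ∀ k → n ≢ k + k
      2∤n k e = 2∤M (∣⁴ prime[2] M (divides (pos 2 * (k * k) + pos 8 * τ ⁴ - pos 2 * (M ² * τ ²)) (lin (- 1ℤ) (l k τ M) (subst (λ n → n ² + pos 16 * τ ⁴ ≡ M ⁴ + pos 4 * (M ² * τ ²)) e eqτ))))
        where
        l = solve 3 (λ k τ M → M :* M :* (M :* M) :- (con (pos 2) :* (k :* k) :+ con (pos 8) :* (τ :* τ :* (τ :* τ)) :- con (pos 2) :* (M :* M :* (τ :* τ))) :* con (pos 2)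
          := :- con 1ℤ :* (((k :+ k) :* (k :+ k) :+ con (pos 16) :* (τ :* τ :* (τ :* τ))) :- (M :* M :* (M :* M) :+ con (pos 4) :* (M :* M :* (τ :* τ))))) refl
      with-odd : ∃[ i ] M ≡ i + i + 1ℤ → ∃[ j ] n ≡ j + j + 1ℤ → ⊥
      with-odd (i , M≡) (j , n≡) = with-five (fiveFourths P Q τ (proj₁ 0≤PQ) (proj₂ 0≤PQ) P⊥Q PQ)
        where
        -- These are (M² + 2τ² ± n)/2, the halves being integral because M and n are odd; the extra
        -- factor 2 against the odd case keeps them coprime.
        P Q : ℤ
        P = pos 2 * (i * i + i) + j + 1ℤ + τ ²
        Q = pos 2 * (i * i + i) - j + τ ²
        PQ : P * Q ≡ pos 5 * τ ⁴
        PQ = *-cancelˡ-≡ (pos 4) _ _ (lin (- 1ℤ) (l i j τ) (subst₂ (λ M n → n ² + pos 16 * τ ⁴ ≡ M ⁴ + pos 4 * (M ² * τ ²)) M≡ n≡ eqτ))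
          where
          l = solve 3 (λ i j τ → let M = i :+ i :+ con 1ℤ ; n = j :+ j :+ con 1ℤ in
            con (pos 4) :* ((con (pos 2) :* (i :* i :+ i) :+ j :+ con 1ℤ :+ τ :* τ) :* (con (pos 2) :* (i :* i :+ i) :- j :+ τ :* τ)) :- con (pos 4) :* (con (pos 5) :* (τ :* τ :* (τ :* τ)))
            := :- con 1ℤ :* ((n :* n :+ con (pos 16) :* (τ :* τ :* (τ :* τ))) :- (M :* M :* (M :* M) :+ con (pos 4) :* (M :* M :* (τ :* τ))))) refl
        P+Q : P + Q ≡ M ² + (τ ² + τ ²)
        P+Q = trans (l i j τ) (cong (λ M → M ² + (τ ² + τ ²)) (sym M≡))
          where
          l = solve 3 (λ i j τ → con (pos 2) :* (i :* i :+ i) :+ j :+ con 1ℤ :+ τ :* τ :+ (con (pos 2) :* (i :* i :+ i) :- j :+ τ :* τ) := (i :+ i :+ con 1ℤ) :* (i :+ i :+ con 1ℤ) :+ (τ :* τ :+ τ :* τ)) refl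
        0≤PQ : 0ℤ ≤ P × 0ℤ ≤ Q
        0≤PQ = nonneg-factors P Q (subst (0ℤ ≤_) (trans (l (τ ²)) (sym PQ)) (+-mono-≤ (0≤x*x (τ ²)) (0≤x*x (τ ² + τ ²))))
          (subst (0ℤ <_) (sym P+Q) (+-mono-≤-< (0≤x*x M) (+-mono-< (0<x*x τ τ≢0) (0<x*x τ τ≢0))))
          where
          l = solve 1 (λ u → u :* u :+ (u :+ u) :* (u :+ u) := con (pos 5) :* (u :* u)) refl
        P⊥Q : Coprimeℤ P Q
        P⊥Q {q} isPrime h h′ = m⊥t isPrime (euclid² isPrime M (∣-combination 1ℤ (- (pos 2 * τ))
            (trans (l₁ (M ²) τ) (cong (λ z → 1ℤ * z + - (pos 2 * τ) * τ) (sym P+Q))) (∣-combination 1ℤ 1ℤ (l₀ P Q) h h′) q∣τ)) (∣-multiple (pos 2) (trans t≡ (l₂ τ)) q∣τ)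
          where
          q∣τ : pos q ∣ τ
          q∣τ = common⇒∣z P Q τ isPrime PQ h h′
          l₀ = solve 2 (λ P Q → P :+ Q := con 1ℤ :* P :+ con 1ℤ :* Q) refl
          l₁ = solve 2 (λ m τ → m := con 1ℤ :* (m :+ (τ :* τ :+ τ :* τ)) :+ :- (con (pos 2) :* τ) :* τ) refl
          l₂ = solve 1 (λ τ → τ :+ τ := con (pos 2) :* τ) refl
        with-five : FiveFourths P Q τ → ⊥
        with-five F = [ U-even , U-odd ]′ (parity U)
          where
          a = pos (FiveFourths.a F)
          b = pos (FiveFourths.b F)
          ab≡ = FiveFourths.product F
          U : ℤ
          U = a ² - b ²
          M² : M ² ≡ U ² + pos 4 * b ⁴
          M² = lin₂ 1ℤ (- pos 2) (l M a b τ) (trans (sym P+Q) (FiveFourths.sum F)) (sym ab≡)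
            where
            l = solve 4 (λ M a b τ → M :* M :- ((a :* a :- b :* b) :* (a :* a :- b :* b) :+ con (pos 4) :* (b :* b :* (b :* b)))
              := con 1ℤ :* ((M :* M :+ (τ :* τ :+ τ :* τ)) :- (a :* a :* (a :* a) :+ con (pos 5) :* (b :* b :* (b :* b)))) :+ :- con (pos 2) :* (τ :* τ :- a :* a :* (b :* b))) refl
          U-even : ∃[ k ] U ≡ k + k → ⊥
          U-even (k , e) = 2∤M (euclid² prime[2] M (divides (pos 2 * (k * k) + pos 2 * b ⁴) (trans M² (trans (cong (λ U → U ² + pos 4 * b ⁴) e) (l k (b ⁴))))))
            where
            l = solve 2 (λ k B → (k :+ k) :* (k :+ k) :+ con (pos 4) :* B := (con (pos 2) :* (k :* k) :+ con (pos 2) :* B) :* con (pos 2)) refl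
          U-odd : ∃[ k ] U ≡ k + k + 1ℤ → ⊥
          U-odd (k , U≡) = with-fourths (coprime-fourth-powers X Y b (proj₁ 0≤XY) (proj₂ 0≤XY) X⊥Y XY)
            where
            -- X = (M + U)/2 and Y = (M - U)/2, integral because M and U are odd; M² = U² + 4b⁴
            -- becomes XY = b⁴.
            X Y : ℤ
            X = i + k + 1ℤ
            Y = i - k
            XY : X * Y ≡ b ⁴
            XY = *-cancelˡ-≡ (pos 4) _ _ (lin 1ℤ (l i k (b ⁴)) (subst₂ (λ M U → M ² ≡ U ² + pos 4 * b ⁴) M≡ U≡ M²))
              where
              l = solve 3 (λ i k B → con (pos 4) :* ((i :+ k :+ con 1ℤ) :* (i :- k)) :- con (pos 4) :* B := con 1ℤ :* ((i :+ i :+ con 1ℤ) :* (i :+ i :+ con 1ℤ) :- ((k :+ k :+ con 1ℤ) :* (k :+ k :+ con 1ℤ) :+ con (pos 4) :* B))) refl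
            X+Y : X + Y ≡ M
            X+Y = trans (l i k) (sym M≡)
              where
              l = solve 2 (λ i k → i :+ k :+ con 1ℤ :+ (i :- k) := i :+ i :+ con 1ℤ) refl
            X-Y : 1ℤ * X + - 1ℤ * Y ≡ U
            X-Y = trans (l i k) (sym U≡)
              where
              l = solve 2 (λ i k → con 1ℤ :* (i :+ k :+ con 1ℤ) :+ :- con 1ℤ :* (i :- k) := k :+ k :+ con 1ℤ) refl
            0≤XY : 0ℤ ≤ X × 0ℤ ≤ Y
            0≤XY = nonneg-factors X Y (subst (0ℤ ≤_) (sym XY) (0≤x*x (b ²))) (subst (0ℤ <_) (sym X+Y) 0<M)
            X⊥Y : Coprimeℤ X Y
            X⊥Y {q} isPrime h h′ = FiveFourths.coprime F isPrime q∣a q∣b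
              where
              q∣b : pos q ∣ b
              q∣b = ∣⁴ isPrime b (subst (pos q ∣_) XY (∣-multiple Y (*-comm X Y) h))
              q∣a : pos q ∣ a
              q∣a = euclid² isPrime a (∣-combination 1ℤ b (l₂ (a ²) b) (∣-combination 1ℤ (- 1ℤ) (sym X-Y) h h′) q∣b)
                where
                l₂ = solve 2 (λ a b → a := con 1ℤ :* (a :- b :* b) :+ b :* b) refl
            with-fourths : ∃[ g ] ∃[ h ] X ≡ pos g ⁴ × Y ≡ pos h ⁴ × pos g ² * pos h ² ≡ b ² → ⊥
            with-fourths (g , h , X≡ , Y≡ , gh≡) = conclude (descend S g<m)
              where
              b≢0 : b ≢ 0ℤ
              b≢0 e = factor-zero {FiveFourths.a F} ab≡ τ≢0 (+-injective e)
              S : Smaller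
              S = record { g = g ; h = h ; a = a ; h≢0 = factor-zero {g} gh≡ b≢0
                ; g⊥h = λ isPrime u v → X⊥Y isPrime (∣-multiple (pos g * pos g * pos g) (trans X≡ (l (pos g))) u)
                                                   (∣-multiple (pos h * pos h * pos h) (trans Y≡ (l (pos h))) v)
                ; eq′ = trans (cong (a ² +_) (sym Y≡)) (trans (lin (- 1ℤ) (l₁ (a ²) (b ²) X Y) X-Y) (cong₂ _+_ X≡ (sym gh≡))) }
                where
                l = solve 1 (λ b → b :* b :* (b :* b) := b :* b :* b :* b) refl
                l₁ = solve 4 (λ a b X Y → (a :+ Y) :- (X :+ b) := :- con 1ℤ :* (con 1ℤ :* X :+ :- con 1ℤ :* Y :- (a :- b))) refl
              sumℕ : g ℕ.* g ℕ.* (g ℕ.* g) ℕ.+ h ℕ.* h ℕ.* (h ℕ.* h) ≡ m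
              sumℕ = +-injective (trans (cong₂ _+_ (trans (pos-⁴ g) (sym X≡)) (trans (pos-⁴ h) (sym Y≡))) X+Y)
              g<m : g ℕ.< m
              g<m = subst (g ℕ.<_) sumℕ (ℕ.≤-<-trans (⁴-≥ g) (ℕ.m<m+n _ (ℕ.<-≤-trans (ℕ.n≢0⇒n>0 (Smaller.h≢0 S)) (⁴-≥ h))))
              conclude : g ≡ 1 × h ≡ 1 → ⊥
              -- The final solution g = h = 1 would give M = g⁴ + h⁴ = 2, but M is odd.
              conclude (refl , refl) = 2∤M (divides 1ℤ (cong pos (sym sumℕ)))

  -- For u = r/t² with r ≠ 0 the factors r and r² + rt² - t⁴ are coprime with square product, so
  -- they are squares up to a common sign. For r = m² and r = -m² this is `quartic`, with m and t
  -- exchanged in the second case.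
  curve20-points : ∀ u y → y ℚ.* y ≡ u ℚ.* u ℚ.* u ℚ.+ u ℚ.* u ℚ.- u → u ≡ 0ℚ ⊎ u ≡ 1ℚ ⊎ u ≡ ℚ.- 1ℚ
  curve20-points u y on = cases r refl
    where
    on′ : y ℚ.* y ≡ u ℚ.* u ℚ.* u ℚ.+ ι 1ℤ ℚ.* (u ℚ.* u) ℚ.+ ι (- 1ℤ) ℚ.* u ℚ.+ ι 0ℤ
    on′ = trans on (trans (l u) (sym (cong₂ (λ a b → a ℚ.+ b) (cong₂ (λ a b → u ℚ.* u ℚ.* u ℚ.+ a ℚ.* (u ℚ.* u) ℚ.+ b ℚ.* u) ι-1 (trans (ι-neg 1ℤ) (cong ℚ.-_ ι-1))) ι-0)))
      where
      l = ℚS.solve 1 (λ u → u ℚS.:* u ℚS.:* u ℚS.:+ u ℚS.:* u ℚS.:- u ℚS.:= u ℚS.:* u ℚS.:* u ℚS.:+ ℚS.con 1ℚ ℚS.:* (u ℚS.:* u) ℚS.:+ ℚS.:- ℚS.con 1ℚ ℚS.:* u ℚS.:+ ℚS.con 0ℚ) refl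
    open IntegralPoint (integral-point 1ℤ (- 1ℤ) 0ℤ u y on′)
    T = pos t
    T²≢0 : ι (T * T) ≢ 0ℚ
    T²≢0 e = t≢0 (x*x≡0⇒x≡0 T (ι-injective (trans e (sym ι-0))))
    u≡ : ∀ {v} → v ℚ.* ι (T * T) ≡ ι r → u ≡ v
    u≡ {v} e = Rationals.*-cancelˡ (ι (T * T)) T²≢0 (trans (ℚ.*-comm (ι (T * T)) u) (trans (trans u*t²≡r (sym e)) (ℚ.*-comm v (ι (T * T)))))
    Goal = u ≡ 0ℚ ⊎ u ≡ 1ℚ ⊎ u ≡ ℚ.- 1ℚ
    positive : ∀ R → r ≡ pos (suc R) → Goal
    positive R r≡ = with-squares (coprime-squares r Y s (subst (0ℤ ≤_) (sym r≡) (+≤+ z≤n)) (nonneg-cofactor r Y (subst (0ℤ <_) (sym r≡) (+<+ (s≤s z≤n))) (subst (0ℤ ≤_) (sym rY) (0≤x*x s))) r⊥Y rY)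
      where
      Y : ℤ
      Y = r * r + r * (T * T) - T * T * (T * T)
      rY : r * Y ≡ s * s
      rY = trans (l r T) (sym eq)
        where
        l = solve 2 (λ r T → r :* (r :* r :+ r :* (T :* T) :- T :* T :* (T :* T)) := r :* r :* r :+ con 1ℤ :* (r :* r) :* (T :* T) :+ :- con 1ℤ :* r :* (T :* T :* (T :* T)) :+ con 0ℤ :* (T :* T :* (T :* T) :* (T :* T))) refl
      r⊥Y : Coprimeℤ r Y
      r⊥Y isPrime h h′ = coprime isPrime h (∣⁴ isPrime T (∣-combination (r + T * T) (- 1ℤ) (l r T) h h′))
        where
        l = solve 2 (λ r T → T :* T :* (T :* T) := (r :+ T :* T) :* r :+ :- con 1ℤ :* (r :* r :+ r :* (T :* T) :- T :* T :* (T :* T))) refl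
      with-squares : ∃[ m ] ∃[ n ] r ≡ pos m * pos m × Y ≡ pos n * pos n → Goal
      with-squares (m , n , r≡m² , Y≡n²) = [ (λ t≡0 → contradiction t≡0 t≢0) , (λ (m≡1 , t²≡1) → inj₂ (inj₁ (u≡
          (trans (cong (λ z → 1ℚ ℚ.* ι z) t²≡1) (trans (ℚ.*-identityˡ (ι 1ℤ)) (cong ι (sym (trans r≡m² (cong (λ m → pos m * pos m) m≡1))))))))) ]′
        (quartic (suc m) m T (pos n) ℕ.≤-refl (λ isPrime h h′ → coprime isPrime (∣-multiple (pos m) r≡m² h) h′)
          (lin (- 1ℤ) (l (pos m) (pos n) T) (subst (λ r → r * r + r * (T * T) - T * T * (T * T) ≡ pos n * pos n) r≡m² Y≡n²)))
        where
        l = solve 3 (λ m n T → (n :* n :+ T :* T :* (T :* T)) :- (m :* m :* (m :* m) :+ m :* m :* (T :* T)) := :- con 1ℤ :* (m :* m :* (m :* m) :+ m :* m :* (T :* T) :- T :* T :* (T :* T) :- n :* n)) refl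
    negative : ∀ R → r ≡ - pos (suc R) → Goal
    negative R r≡ = with-squares (coprime-squares ρ Y s (+≤+ z≤n) (nonneg-cofactor ρ Y (+<+ (s≤s z≤n)) (subst (0ℤ ≤_) (sym ρY) (0≤x*x s))) ρ⊥Y ρY)
      where
      ρ Y : ℤ
      ρ = pos (suc R)
      Y = T * T * (T * T) + ρ * (T * T) - ρ * ρ
      ρY : ρ * Y ≡ s * s
      ρY = trans (l ρ T) (sym (subst (λ r → s * s ≡ r * r * r + 1ℤ * (r * r) * (T * T) + - 1ℤ * r * (T * T * (T * T)) + 0ℤ * (T * T * (T * T) * (T * T))) r≡ eq))
        where
        l = solve 2 (λ r T → r :* (T :* T :* (T :* T) :+ r :* (T :* T) :- r :* r) := :- r :* :- r :* :- r :+ con 1ℤ :* (:- r :* :- r) :* (T :* T) :+ :- con 1ℤ :* :- r :* (T :* T :* (T :* T)) :+ con 0ℤ :* (T :* T :* (T :* T) :* (T :* T))) refl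
      ρ∣⇒r∣ : ∀ {q} → pos q ∣ ρ → pos q ∣ r
      ρ∣⇒r∣ h = ∣-multiple (- 1ℤ) (trans r≡ (sym (-1*i≡-i ρ))) h
      ρ⊥Y : Coprimeℤ ρ Y
      ρ⊥Y isPrime h h′ = coprime isPrime (ρ∣⇒r∣ h) (∣⁴ isPrime T (∣-combination (ρ - T * T) 1ℤ (l ρ T) h h′))
        where
        l = solve 2 (λ r T → T :* T :* (T :* T) := (r :- T :* T) :* r :+ con 1ℤ :* (T :* T :* (T :* T) :+ r :* (T :* T) :- r :* r)) refl
      with-squares : ∃[ m ] ∃[ n ] ρ ≡ pos m * pos m × Y ≡ pos n * pos n → Goal
      with-squares (m , n , ρ≡m² , Y≡n²) = [ (λ m≡0 → contradiction (trans ρ≡m² (cong (λ m → m * m) m≡0)) λ ()) , (λ (t≡1 , m²≡1) → inj₂ (inj₂ (u≡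
          (trans (cong (λ t → ℚ.- 1ℚ ℚ.* ι (pos t * pos t)) t≡1) (trans (cong (ℚ.- 1ℚ ℚ.*_) ι-1) (trans (sym (trans (ι-neg 1ℤ) (cong ℚ.-_ ι-1)))
            (cong ι (sym (trans r≡ (cong -_ (trans ρ≡m² m²≡1)))))))))))  ]′
        (quartic (suc t) t (pos m) (pos n) ℕ.≤-refl (λ isPrime h h′ → coprime isPrime (ρ∣⇒r∣ (∣-multiple (pos m) ρ≡m² h′)) h)
          (lin (- 1ℤ) (l (pos m) (pos n) T) (subst (λ r → T * T * (T * T) + r * (T * T) - r * r ≡ pos n * pos n) ρ≡m² Y≡n²)))
        where
        l = solve 3 (λ m n T → (n :* n :+ m :* m :* (m :* m)) :- (T :* T :* (T :* T) :+ T :* T :* (m :* m)) := :- con 1ℤ :* (T :* T :* (T :* T) :+ m :* m :* (T :* T) :- m :* m :* (m :* m) :- n :* n)) refl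
    cases : ∀ r′ → r ≡ r′ → Goal
    cases (pos zero) r≡0 = inj₁ (u≡ (trans (ℚ.*-zeroˡ (ι (T * T))) (trans (sym ι-0) (cong ι (sym r≡0)))))
    cases (pos (suc R)) r≡ = positive R r≡
    cases -[1+ R ] r≡ = negative R r≡

-- Interval enclosures of ternary forms, and the finite checks over grids of cells.

module TernaryForms where
  open import Data.Bool using (true; false; T; if_then_else_)
  open import Data.Nat using (ℕ; zero; suc; z≤n)
  import Data.Nat as ℕ
  open import Data.Integer using (ℤ; 0ℤ; 1ℤ; _+_; _*_; _-_; -_; _≤_; _≤ᵇ_; _^_; +≤+; nonNegative; nonPositive) renaming (+_ to pos)
  open import Data.Integer.Properties
  open import Data.Bool using (T?)
  open import Data.List.Base using (List; []; _∷_; applyUpTo)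
  open import Data.List.Relation.Unary.All using (All; all?)
  open import Data.List.Relation.Unary.Any using (Any; any?)
  open import Relation.Nullary.Decidable using (from-yes; _×-dec_; _⊎-dec_)
  open ℤS using (solve; _:*_; _:-_; :-_; _:=_)

  infixl 6 _+ᶠ_ _-ᶠ_
  infixl 7 _*ᶠ_

  -- The index is the degree.
  data Form : ℕ → Set where
    X Y Z : Form 1
    _+ᶠ_ _-ᶠ_ : ∀ {d} → Form d → Form d → Form d
    _*ᶠ_ : ∀ {d e} → Form d → Form e → Form (d ℕ.+ e)

  eval : ∀ {d} → Form d → ℤ → ℤ → ℤ → ℤ
  eval X a b c = a
  eval Y a b c = b
  eval Z a b c = c
  eval (F +ᶠ G) a b c = eval F a b c + eval G a b c
  eval (F -ᶠ G) a b c = eval F a b c - eval G a b c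
  eval (F *ᶠ G) a b c = eval F a b c * eval G a b c

  record Interval : Set where
    constructor [_﹐_]
    field
      lo hi : ℤ
  open Interval public

  maxᵇ minᵇ : ℤ → ℤ → ℤ
  maxᵇ x y = if x ≤ᵇ y then y else x
  minᵇ x y = if x ≤ᵇ y then x else y

  private
    ≤-maxᵇˡ : ∀ x y → x ≤ maxᵇ x y
    ≤-maxᵇˡ x y with x ≤ᵇ y in eq
    ... | true  = ≤ᵇ⇒≤ (subst T (sym eq) _)
    ... | false = ≤-refl

    ≤-maxᵇʳ : ∀ x y → y ≤ maxᵇ x y
    ≤-maxᵇʳ x y with x ≤ᵇ y in eq
    ... | true  = ≤-refl
    ... | false = [ (λ x≤y → subst (λ b → T b → y ≤ x) (sym eq) (λ ()) (≤⇒≤ᵇ x≤y)) , (λ y≤x → y≤x) ]′ (≤-total x y)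

    minᵇ-≤ˡ : ∀ x y → minᵇ x y ≤ x
    minᵇ-≤ˡ x y with x ≤ᵇ y in eq
    ... | true  = ≤-refl
    ... | false = [ (λ x≤y → subst (λ b → T b → y ≤ x) (sym eq) (λ ()) (≤⇒≤ᵇ x≤y)) , (λ y≤x → y≤x) ]′ (≤-total x y)

    minᵇ-≤ʳ : ∀ x y → minᵇ x y ≤ y
    minᵇ-≤ʳ x y with x ≤ᵇ y in eq
    ... | true  = ≤ᵇ⇒≤ (subst T (sym eq) _)
    ... | false = ≤-refl

  max₄ min₄ : ℤ → ℤ → ℤ → ℤ → ℤ
  max₄ p q r s = maxᵇ (maxᵇ p q) (maxᵇ r s)
  min₄ p q r s = minᵇ (minᵇ p q) (minᵇ r s)

  enclose : ∀ {d} → Form d → Interval → Interval → Interval → Interval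
  enclose X i j k = i
  enclose Y i j k = j
  enclose Z i j k = k
  enclose (F +ᶠ G) i j k = let f = enclose F i j k ; g = enclose G i j k in [ lo f + lo g ﹐ hi f + hi g ]
  enclose (F -ᶠ G) i j k = let f = enclose F i j k ; g = enclose G i j k in [ lo f - hi g ﹐ hi f - lo g ]
  enclose (F *ᶠ G) i j k = product (enclose F i j k) (enclose G i j k)
    where
    product : Interval → Interval → Interval
    product [ l ﹐ u ] [ l′ ﹐ u′ ] = let p = l * l′ ; q = l * u′ ; r = u * l′ ; s = u * u′ in [ min₄ p q r s ﹐ max₄ p q r s ]

  infix 4 _∈[_]·_
  -- The quantity that is enclosed is x / w. Variables over the denominator n give a form of degree
  -- d over w = nᵈ, so rational boxes are handled without any division.
  _∈[_]·_ : ℤ → Interval → ℤ → Set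
  x ∈[ i ]· w = lo i * w ≤ x × x ≤ hi i * w

  private
    -- A bilinear function on a rectangle is largest at a corner: move x to an end according to the
    -- sign of y, then y according to the sign of that end.
    bilinear-upper : ∀ {l x u l′ y u′ p} → l ≤ x → x ≤ u → l′ ≤ y → y ≤ u′ → l * l′ ≤ p → l * u′ ≤ p → u * l′ ≤ p → u * u′ ≤ p → x * y ≤ p
    bilinear-upper {l} {x} {u} {l′} {y} {u′} {p} l≤x x≤u l′≤y y≤u′ ll lu ul uu = [ pos-y , neg-y ]′ (≤-total 0ℤ y)
      where
      pos-y : 0ℤ ≤ y → x * y ≤ p
      pos-y 0≤y = ≤-trans (*-monoʳ-≤-nonNeg y {{nonNegative 0≤y}} x≤u) ([
        (λ 0≤u → ≤-trans (*-monoˡ-≤-nonNeg u {{nonNegative 0≤u}} y≤u′) uu) ,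
        (λ u≤0 → ≤-trans (*-monoˡ-≤-nonPos u {{nonPositive u≤0}} l′≤y) ul) ]′ (≤-total 0ℤ u))
      neg-y : y ≤ 0ℤ → x * y ≤ p
      neg-y y≤0 = ≤-trans (*-monoʳ-≤-nonPos y {{nonPositive y≤0}} l≤x) ([
        (λ 0≤l → ≤-trans (*-monoˡ-≤-nonNeg l {{nonNegative 0≤l}} y≤u′) lu) ,
        (λ l≤0 → ≤-trans (*-monoˡ-≤-nonPos l {{nonPositive l≤0}} l′≤y) ll) ]′ (≤-total 0ℤ l))

    bilinear-lower : ∀ {l x u l′ y u′ p} → l ≤ x → x ≤ u → l′ ≤ y → y ≤ u′ → p ≤ l * l′ → p ≤ l * u′ → p ≤ u * l′ → p ≤ u * u′ → p ≤ x * y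
    bilinear-lower {l} {x} {u} {l′} {y} {u′} {p} l≤x x≤u l′≤y y≤u′ ll lu ul uu =
      subst₂ _≤_ (neg-involutive p) (neg-involutive (x * y)) (neg-mono-≤ (subst (_≤ - p) (sym (neg-distribˡ-* x y))
        (bilinear-upper (neg-mono-≤ x≤u) (neg-mono-≤ l≤x) l′≤y y≤u′ (flip u l′ ul) (flip u u′ uu) (flip l l′ ll) (flip l u′ lu))))
      where
      flip : ∀ a b → p ≤ a * b → - a * b ≤ - p
      flip a b h = subst (_≤ - p) (neg-distribˡ-* a b) (neg-mono-≤ h)

  module _ (n : ℕ) where
    private
      0≤nᵈ : ∀ d → 0ℤ ≤ pos n ^ d
      0≤nᵈ zero = +≤+ z≤n
      0≤nᵈ (suc d) = subst (_≤ pos n * pos n ^ d) (*-zeroʳ (pos n)) (*-monoˡ-≤-nonNeg (pos n) (0≤nᵈ d))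

      scale-≤ : ∀ d {x y} → x ≤ y → x * pos n ^ d ≤ y * pos n ^ d
      scale-≤ d = *-monoʳ-≤-nonNeg (pos n ^ d) {{nonNegative (0≤nᵈ d)}}

      corner : ∀ d e a b → a * b * pos n ^ (d ℕ.+ e) ≡ a * pos n ^ d * (b * pos n ^ e)
      corner d e a b = trans (cong (a * b *_) (^-distribˡ-+-* (pos n) d e)) (l a b (pos n ^ d) (pos n ^ e))
        where
        l = solve 4 (λ a b x y → a :* b :* (x :* y) := a :* x :* (b :* y)) refl

    enclose-sound : ∀ {d} (F : Form d) {i j k a b c} → a ∈[ i ]· pos n ^ 1 → b ∈[ j ]· pos n ^ 1 → c ∈[ k ]· pos n ^ 1
                  → eval F a b c ∈[ enclose F i j k ]· pos n ^ d
    enclose-sound X p q r = p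
    enclose-sound Y p q r = q
    enclose-sound Z p q r = r
    enclose-sound {d} (F +ᶠ G) {i} {j} {k} p q r = let f = enclose-sound F p q r ; g = enclose-sound G p q r in
      subst (_≤ _) (sym (*-distribʳ-+ (pos n ^ d) (lo (enclose F i j k)) (lo (enclose G i j k)))) (+-mono-≤ (proj₁ f) (proj₁ g)) ,
      subst (_ ≤_) (sym (*-distribʳ-+ (pos n ^ d) (hi (enclose F i j k)) (hi (enclose G i j k)))) (+-mono-≤ (proj₂ f) (proj₂ g))
    enclose-sound {d} (F -ᶠ G) {i} {j} {k} p q r = let f = enclose-sound F p q r ; g = enclose-sound G p q r in
      subst (_≤ _) (sym (l (lo (enclose F i j k)) (hi (enclose G i j k)) (pos n ^ d))) (+-mono-≤ (proj₁ f) (neg-mono-≤ (proj₂ g))) ,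
      subst (_ ≤_) (sym (l (hi (enclose F i j k)) (lo (enclose G i j k)) (pos n ^ d))) (+-mono-≤ (proj₂ f) (neg-mono-≤ (proj₁ g)))
      where
      l = solve 3 (λ a b w → (a :- b) :* w := a :* w :- b :* w) refl
    enclose-sound (_*ᶠ_ {d} {e} F G) {i} {j} {k} p q r = let f = enclose-sound F p q r ; g = enclose-sound G p q r in
      bilinear-lower (proj₁ f) (proj₂ f) (proj₁ g) (proj₂ g)
        (lower l l′ (≤-trans (minᵇ-≤ˡ (minᵇ A B) (minᵇ C D)) (minᵇ-≤ˡ A B))) (lower l u′ (≤-trans (minᵇ-≤ˡ (minᵇ A B) (minᵇ C D)) (minᵇ-≤ʳ A B)))
        (lower u l′ (≤-trans (minᵇ-≤ʳ (minᵇ A B) (minᵇ C D)) (minᵇ-≤ˡ C D))) (lower u u′ (≤-trans (minᵇ-≤ʳ (minᵇ A B) (minᵇ C D)) (minᵇ-≤ʳ C D))) ,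
      bilinear-upper (proj₁ f) (proj₂ f) (proj₁ g) (proj₂ g)
        (upper l l′ (≤-trans (≤-maxᵇˡ A B) (≤-maxᵇˡ (maxᵇ A B) (maxᵇ C D)))) (upper l u′ (≤-trans (≤-maxᵇʳ A B) (≤-maxᵇˡ (maxᵇ A B) (maxᵇ C D))))
        (upper u l′ (≤-trans (≤-maxᵇˡ C D) (≤-maxᵇʳ (maxᵇ A B) (maxᵇ C D)))) (upper u u′ (≤-trans (≤-maxᵇʳ C D) (≤-maxᵇʳ (maxᵇ A B) (maxᵇ C D))))
      where
      l = lo (enclose F i j k)
      u = hi (enclose F i j k)
      l′ = lo (enclose G i j k)
      u′ = hi (enclose G i j k)
      A = l * l′
      B = l * u′
      C = u * l′
      D = u * u′
      lower : ∀ a b {m} → m ≤ a * b → m * pos n ^ (d ℕ.+ e) ≤ a * pos n ^ d * (b * pos n ^ e)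
      lower a b {m} h = subst (m * pos n ^ (d ℕ.+ e) ≤_) (corner d e a b) (scale-≤ (d ℕ.+ e) h)
      upper : ∀ a b {m} → a * b ≤ m → a * pos n ^ d * (b * pos n ^ e) ≤ m * pos n ^ (d ℕ.+ e)
      upper a b {m} h = subst (_≤ m * pos n ^ (d ℕ.+ e)) (corner d e a b) (scale-≤ (d ℕ.+ e) h)

  -- The norm of x + yρ + zρ², reified so that one expression serves for interval enclosures and for
  -- residues.
  norm-form : Form 3
  norm-form = X *ᶠ (X *ᶠ (X +ᶠ Y +ᶠ Z +ᶠ Z +ᶠ Z) -ᶠ Y *ᶠ (Y +ᶠ Z +ᶠ Z +ᶠ Z +ᶠ Z) -ᶠ Z *ᶠ Z) +ᶠ Y *ᶠ (Y *ᶠ (Y +ᶠ Z) -ᶠ Z *ᶠ Z) +ᶠ Z *ᶠ (Z *ᶠ Z)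

  -- Half the change of `size` under multiplication by ρ and by ρ⁻¹.
  q₁ q₂ : Form 2
  q₁ = Z *ᶠ (Z +ᶠ Z +ᶠ Z +ᶠ Z +ᶠ Z +ᶠ Z +ᶠ Z +ᶠ Z +ᶠ X +ᶠ X +ᶠ X +ᶠ X +ᶠ X +ᶠ Y +ᶠ Y +ᶠ Y +ᶠ Y +ᶠ Y +ᶠ Y +ᶠ Y +ᶠ Y +ᶠ Y) +ᶠ X *ᶠ (Y +ᶠ Y +ᶠ Y +ᶠ Y -ᶠ X) +ᶠ Y *ᶠ Y
  q₂ = X *ᶠ (X +ᶠ X -ᶠ Y -ᶠ Y -ᶠ Y -ᶠ Z -ᶠ Z -ᶠ Z) +ᶠ Y *ᶠ (Y -ᶠ Z -ᶠ Z -ᶠ Z -ᶠ Z) -ᶠ Z *ᶠ Z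

  cell : ℤ → Interval
  cell g = [ g ﹐ g + 1ℤ ]

  -- Every cell of the grid (¼ ℤ)³ has a translate by ℤ³ on which ∣N∣ < 1.
  shifts residues : List ℤ
  shifts = 0ℤ ∷ 1ℤ ∷ - 1ℤ ∷ pos 2 ∷ []
  residues = applyUpTo pos 4

  -- Cells of side ¼ are magnified by 4 and the norm by 64, so the bound 63 keeps the absolute norm
  -- strictly below 1.
  SmallNorm : ℤ → ℤ → ℤ → Set
  SmallNorm x y z = let i = enclose norm-form (cell x) (cell y) (cell z) in T (- pos 63 ≤ᵇ lo i) × T (hi i ≤ᵇ pos 63)

  smallNorm? : ∀ x y z → Dec (SmallNorm x y z)
  smallNorm? x y z = T? _ ×-dec T? _

  Shiftable : ℤ → ℤ → ℤ → Set
  Shiftable g h k = Any (λ s → Any (λ t → Any (λ u → SmallNorm (g - pos 4 * s) (h - pos 4 * t) (k - pos 4 * u)) shifts) shifts) shifts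

  all-shiftable : All (λ g → All (λ h → All (Shiftable g h) residues) residues) residues
  all-shiftable = from-yes (all? (λ g → all? (λ h → all? (λ k → any? (λ s → any? (λ t → any? (λ u →
    smallNorm? (g - pos 4 * s) (h - pos 4 * t) (k - pos 4 * u)) shifts) shifts) shifts) residues) residues) residues)

  -- On the faces of the cube, one of the two quadratic forms is negative or ∣N∣ is bounded below.
  Reducible : Interval → Interval → Interval → Set
  Reducible i j k = T (hi (enclose q₁ i j k) ≤ᵇ - 1ℤ) ⊎ T (hi (enclose q₂ i j k) ≤ᵇ - 1ℤ)
    ⊎ T (pos 126 ≤ᵇ lo (enclose norm-form i j k)) ⊎ T (hi (enclose norm-form i j k) ≤ᵇ - pos 126)

  reducible? : ∀ i j k → Dec (Reducible i j k)
  reducible? i j k = T? _ ⊎-dec T? _ ⊎-dec T? _ ⊎-dec T? _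

  -- Coordinates are magnified so that the largest absolute value K becomes 10; these twenty unit
  -- cells then cover [-10, 10].
  grid : List ℤ
  grid = applyUpTo (λ k → pos k - pos 10) 20

  face : Interval
  face = [ pos 10 ﹐ pos 10 ]

  ReducibleFaces : ℤ → ℤ → Set
  ReducibleFaces g h = Reducible face (cell g) (cell h) × Reducible (cell g) face (cell h) × Reducible (cell g) (cell h) face

  all-reducible : All (λ g → All (ReducibleFaces g) grid) grid
  all-reducible = from-yes (all? (λ g → all? (λ h → reducible? face (cell g) (cell h) ×-dec reducible? (cell g) face (cell h) ×-dec reducible? (cell g) (cell h) face) grid) grid)

-- The ring ℤ[ρ], its norm, and the effect of ρ on the size of an element.

module CubicRing where
  open IntegerArithmetic
  open TernaryForms
  open import Data.Nat using (ℕ; suc; z≤n; s≤s)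
  import Data.Nat as ℕ
  import Data.Nat.Properties as ℕ
  import Data.Nat.Divisibility as ℕ
  open import Data.Integer using (ℤ; 0ℤ; 1ℤ; _+_; _*_; _-_; -_; _<_) renaming (+_ to pos; ∣_∣ to abs)
  import Data.Integer as ℤ hiding (+_)
  open import Data.Integer.Properties
  open import Data.Integer.DivMod using (_/ℕ_; _%ℕ_; n%ℕd<d; a≡a%ℕn+[a/ℕn]*n)
  open import Data.Integer.Divisibility.Signed using (_∣_; divides; _∣?_)
  open import Data.List.Base using (applyUpTo)
  open import Data.List.Relation.Unary.All as All using (All; all?)
  open import Data.List.Membership.Propositional using (_∈_)
  open import Data.List.Membership.Propositional.Properties using (∈-applyUpTo⁺)
  open import Data.Maybe.Base using (Maybe; just; nothing)
  open import Level using (0ℓ)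
  open import Relation.Nullary.Decidable using (from-yes; _×-dec_; _→-dec_)
  open import Algebra.Bundles using (CommutativeRing)
  open ℤS using (solve; con; _:+_; _:*_; _:-_; :-_; _:=_)

  infixl 6 _⊕_
  infixl 7 _⊗_

  -- a + b ρ + c ρ² with ρ³ = ρ² + ρ + 1; this is the ring of integers of the cubic field of discriminant −44.
  record ℤ[ρ] : Set where
    constructor ⟨_,_,_⟩
    field
      co₀ co₁ co₂ : ℤ
  open ℤ[ρ] public

  _⊕_ _⊗_ : ℤ[ρ] → ℤ[ρ] → ℤ[ρ]
  ⟨ a , b , c ⟩ ⊕ ⟨ d , e , f ⟩ = ⟨ a + d , b + e , c + f ⟩
  ⟨ a , b , c ⟩ ⊗ ⟨ d , e , f ⟩ = ⟨ a * d + (b * f + c * e) + c * f , a * e + b * d + (b * f + c * e) + pos 2 * c * f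
                                  , a * f + b * e + c * d + (b * f + c * e) + pos 2 * c * f ⟩

  ⊝_ : ℤ[ρ] → ℤ[ρ]
  ⊝ ⟨ a , b , c ⟩ = ⟨ - a , - b , - c ⟩

  emb : ℤ → ℤ[ρ]
  emb n = ⟨ n , 0ℤ , 0ℤ ⟩

  ρ ρ⁻¹ 𝟙 : ℤ[ρ]
  ρ   = ⟨ 0ℤ , 1ℤ , 0ℤ ⟩
  ρ⁻¹ = ⟨ - 1ℤ , - 1ℤ , 1ℤ ⟩
  𝟙   = emb 1ℤ

  cong₃ : ∀ {a b c a′ b′ c′} → a ≡ a′ → b ≡ b′ → c ≡ c′ → ⟨ a , b , c ⟩ ≡ ⟨ a′ , b′ , c′ ⟩
  cong₃ refl refl refl = refl

  ℤ[ρ]-commutativeRing : CommutativeRing 0ℓ 0ℓ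
  ℤ[ρ]-commutativeRing = record
    { Carrier = ℤ[ρ] ; _≈_ = _≡_ ; _+_ = _⊕_ ; _*_ = _⊗_ ; -_ = ⊝_ ; 0# = emb 0ℤ ; 1# = emb 1ℤ
    ; isCommutativeRing = record
      { isRing = record
        { +-isAbelianGroup = record
          { isGroup = record
            { isMonoid = record
              { isSemigroup = record
                { isMagma = record { isEquivalence = isEquivalence ; ∙-cong = cong₂ _⊕_ }
                ; assoc = λ { ⟨ a , b , c ⟩ ⟨ d , e , f ⟩ ⟨ g , h , i ⟩ → cong₃ (+-assoc a d g) (+-assoc b e h) (+-assoc c f i) } }
              ; identity = (λ { ⟨ a , b , c ⟩ → cong₃ (+-identityˡ a) (+-identityˡ b) (+-identityˡ c) })
                         , (λ { ⟨ a , b , c ⟩ → cong₃ (+-identityʳ a) (+-identityʳ b) (+-identityʳ c) }) }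
            ; inverse = (λ { ⟨ a , b , c ⟩ → cong₃ (+-inverseˡ a) (+-inverseˡ b) (+-inverseˡ c) })
                      , (λ { ⟨ a , b , c ⟩ → cong₃ (+-inverseʳ a) (+-inverseʳ b) (+-inverseʳ c) })
            ; ⁻¹-cong = cong ⊝_ }
          ; comm = λ { ⟨ a , b , c ⟩ ⟨ d , e , f ⟩ → cong₃ (+-comm a d) (+-comm b e) (+-comm c f) } }
        ; *-cong = cong₂ _⊗_
        ; *-assoc = assoc
        ; *-identity = idˡ , (λ x → trans (comm x (emb 1ℤ)) (idˡ x))
        ; distrib = distribˡ , (λ x y z → trans (comm (y ⊕ z) x) (trans (distribˡ x y z) (cong₂ _⊕_ (comm x y) (comm x z)))) }
      ; *-comm = comm } }
    where
    assoc : ∀ x y z → (x ⊗ y) ⊗ z ≡ x ⊗ (y ⊗ z)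
    assoc ⟨ a , b , c ⟩ ⟨ d , e , f ⟩ ⟨ g , h , i ⟩ = cong₃ (l₀ a b c d e f g h i) (l₁ a b c d e f g h i) (l₂ a b c d e f g h i)
      where
      l₀ = solve 9 (λ a b c d e f g h i → let u = a :* d :+ (b :* f :+ c :* e) :+ c :* f ; v = a :* e :+ b :* d :+ (b :* f :+ c :* e) :+ con (pos 2) :* c :* f ; w = a :* f :+ b :* e :+ c :* d :+ (b :* f :+ c :* e) :+ con (pos 2) :* c :* f ; u′ = d :* g :+ (e :* i :+ f :* h) :+ f :* i ; v′ = d :* h :+ e :* g :+ (e :* i :+ f :* h) :+ con (pos 2) :* f :* i ; w′ = d :* i :+ e :* h :+ f :* g :+ (e :* i :+ f :* h) :+ con (pos 2) :* f :* i
        in u :* g :+ (v :* i :+ w :* h) :+ w :* i := a :* u′ :+ (b :* w′ :+ c :* v′) :+ c :* w′) refl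
      l₁ = solve 9 (λ a b c d e f g h i → let u = a :* d :+ (b :* f :+ c :* e) :+ c :* f ; v = a :* e :+ b :* d :+ (b :* f :+ c :* e) :+ con (pos 2) :* c :* f ; w = a :* f :+ b :* e :+ c :* d :+ (b :* f :+ c :* e) :+ con (pos 2) :* c :* f ; u′ = d :* g :+ (e :* i :+ f :* h) :+ f :* i ; v′ = d :* h :+ e :* g :+ (e :* i :+ f :* h) :+ con (pos 2) :* f :* i ; w′ = d :* i :+ e :* h :+ f :* g :+ (e :* i :+ f :* h) :+ con (pos 2) :* f :* i
        in u :* h :+ v :* g :+ (v :* i :+ w :* h) :+ con (pos 2) :* w :* i := a :* v′ :+ b :* u′ :+ (b :* w′ :+ c :* v′) :+ con (pos 2) :* c :* w′) refl
      l₂ = solve 9 (λ a b c d e f g h i → let u = a :* d :+ (b :* f :+ c :* e) :+ c :* f ; v = a :* e :+ b :* d :+ (b :* f :+ c :* e) :+ con (pos 2) :* c :* f ; w = a :* f :+ b :* e :+ c :* d :+ (b :* f :+ c :* e) :+ con (pos 2) :* c :* f ; u′ = d :* g :+ (e :* i :+ f :* h) :+ f :* i ; v′ = d :* h :+ e :* g :+ (e :* i :+ f :* h) :+ con (pos 2) :* f :* i ; w′ = d :* i :+ e :* h :+ f :* g :+ (e :* i :+ f :* h) :+ con (pos 2) :* f :* i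
        in u :* i :+ v :* h :+ w :* g :+ (v :* i :+ w :* h) :+ con (pos 2) :* w :* i := a :* w′ :+ b :* v′ :+ c :* u′ :+ (b :* w′ :+ c :* v′) :+ con (pos 2) :* c :* w′) refl
    comm : ∀ x y → x ⊗ y ≡ y ⊗ x
    comm ⟨ a , b , c ⟩ ⟨ d , e , f ⟩ = cong₃ (l₀ a b c d e f) (l₁ a b c d e f) (l₂ a b c d e f)
      where
      l₀ = solve 6 (λ a b c d e f → a :* d :+ (b :* f :+ c :* e) :+ c :* f := d :* a :+ (e :* c :+ f :* b) :+ f :* c) refl
      l₁ = solve 6 (λ a b c d e f → a :* e :+ b :* d :+ (b :* f :+ c :* e) :+ con (pos 2) :* c :* f := d :* b :+ e :* a :+ (e :* c :+ f :* b) :+ con (pos 2) :* f :* c) refl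
      l₂ = solve 6 (λ a b c d e f → a :* f :+ b :* e :+ c :* d :+ (b :* f :+ c :* e) :+ con (pos 2) :* c :* f := d :* c :+ e :* b :+ f :* a :+ (e :* c :+ f :* b) :+ con (pos 2) :* f :* c) refl
    idˡ : ∀ x → emb 1ℤ ⊗ x ≡ x
    idˡ ⟨ a , b , c ⟩ = cong₃ (l₀ a b c) (l₁ a b c) (l₂ a b c)
      where
      l₀ = solve 3 (λ d e f → con 1ℤ :* d :+ (con 0ℤ :* f :+ con 0ℤ :* e) :+ con 0ℤ :* f := d) refl
      l₁ = solve 3 (λ d e f → con 1ℤ :* e :+ con 0ℤ :* d :+ (con 0ℤ :* f :+ con 0ℤ :* e) :+ con (pos 2) :* con 0ℤ :* f := e) refl
      l₂ = solve 3 (λ d e f → con 1ℤ :* f :+ con 0ℤ :* e :+ con 0ℤ :* d :+ (con 0ℤ :* f :+ con 0ℤ :* e) :+ con (pos 2) :* con 0ℤ :* f := f) refl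
    distribˡ : ∀ x y z → x ⊗ (y ⊕ z) ≡ x ⊗ y ⊕ x ⊗ z
    distribˡ ⟨ a , b , c ⟩ ⟨ d , e , f ⟩ ⟨ g , h , i ⟩ = cong₃ (l₀ a b c d e f g h i) (l₁ a b c d e f g h i) (l₂ a b c d e f g h i)
      where
      l₀ = solve 9 (λ a b c d e f g h i → a :* (d :+ g) :+ (b :* (f :+ i) :+ c :* (e :+ h)) :+ c :* (f :+ i) := a :* d :+ (b :* f :+ c :* e) :+ c :* f :+ (a :* g :+ (b :* i :+ c :* h) :+ c :* i)) refl
      l₁ = solve 9 (λ a b c d e f g h i → a :* (e :+ h) :+ b :* (d :+ g) :+ (b :* (f :+ i) :+ c :* (e :+ h)) :+ con (pos 2) :* c :* (f :+ i)
         := a :* e :+ b :* d :+ (b :* f :+ c :* e) :+ con (pos 2) :* c :* f :+ (a :* h :+ b :* g :+ (b :* i :+ c :* h) :+ con (pos 2) :* c :* i)) refl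
      l₂ = solve 9 (λ a b c d e f g h i → a :* (f :+ i) :+ b :* (e :+ h) :+ c :* (d :+ g) :+ (b :* (f :+ i) :+ c :* (e :+ h)) :+ con (pos 2) :* c :* (f :+ i)
         := a :* f :+ b :* e :+ c :* d :+ (b :* f :+ c :* e) :+ con (pos 2) :* c :* f :+ (a :* i :+ b :* h :+ c :* g :+ (b :* i :+ c :* h) :+ con (pos 2) :* c :* i)) refl

  open import Tactic.RingSolver.Core.AlmostCommutativeRing using (AlmostCommutativeRing; fromCommutativeRing)

  isZero? : ∀ x → Maybe (emb 0ℤ ≡ x)
  isZero? ⟨ pos 0 , pos 0 , pos 0 ⟩ = just refl
  isZero? _ = nothing

  ρ-ring : AlmostCommutativeRing 0ℓ 0ℓ
  ρ-ring = fromCommutativeRing ℤ[ρ]-commutativeRing isZero?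

  ⊗-comm : ∀ x y → x ⊗ y ≡ y ⊗ x
  ⊗-comm = CommutativeRing.*-comm ℤ[ρ]-commutativeRing

  ⊗-assoc : ∀ x y z → (x ⊗ y) ⊗ z ≡ x ⊗ (y ⊗ z)
  ⊗-assoc = CommutativeRing.*-assoc ℤ[ρ]-commutativeRing

  N : ℤ[ρ] → ℤ
  N ⟨ a , b , c ⟩ = a * (a * (a + b + c + c + c) - b * (b + c + c + c + c) - c * c) + b * (b * (b + c) - c * c) + c * (c * c)

  N-⊗ : ∀ x y → N (x ⊗ y) ≡ N x * N y
  N-⊗ ⟨ a , b , c ⟩ ⟨ d , e , f ⟩ = l a b c d e f
    where
    l = solve 6 (λ a b c d e f → let x = a :* d :+ (b :* f :+ c :* e) :+ c :* f ; y = a :* e :+ b :* d :+ (b :* f :+ c :* e) :+ con (pos 2) :* c :* f ; z = a :* f :+ b :* e :+ c :* d :+ (b :* f :+ c :* e) :+ con (pos 2) :* c :* f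
      in x :* (x :* (x :+ y :+ z :+ z :+ z) :- y :* (y :+ z :+ z :+ z :+ z) :- z :* z) :+ y :* (y :* (y :+ z) :- z :* z) :+ z :* (z :* z)
        := (a :* (a :* (a :+ b :+ c :+ c :+ c) :- b :* (b :+ c :+ c :+ c :+ c) :- c :* c) :+ b :* (b :* (b :+ c) :- c :* c) :+ c :* (c :* c))
        :* (d :* (d :* (d :+ e :+ f :+ f :+ f) :- e :* (e :+ f :+ f :+ f :+ f) :- f :* f) :+ e :* (e :* (e :+ f) :- f :* f) :+ f :* (f :* f))) refl

  -- The product of the two other conjugates, written in the basis 1, ρ, ρ².
  adj : ℤ[ρ] → ℤ[ρ]
  adj ⟨ a , b , c ⟩ = ⟨ (a + c) * (a + b + pos 2 * c) - (b + c) * (b + pos 2 * c) , c * (b + pos 2 * c) - b * (a + b + pos 2 * c) , b * (b + c) - c * (a + c) ⟩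

  ⊗-adj : ∀ x → x ⊗ adj x ≡ emb (N x)
  ⊗-adj ⟨ a , b , c ⟩ = cong₃ (l₀ a b c) (l₁ a b c) (l₂ a b c)
    where
    l₀ = solve 3 (λ a b c → let d = (a :+ c) :* (a :+ b :+ con (pos 2) :* c) :- (b :+ c) :* (b :+ con (pos 2) :* c) ; e = c :* (b :+ con (pos 2) :* c) :- b :* (a :+ b :+ con (pos 2) :* c) ; f = b :* (b :+ c) :- c :* (a :+ c)
       in a :* d :+ (b :* f :+ c :* e) :+ c :* f := a :* (a :* (a :+ b :+ c :+ c :+ c) :- b :* (b :+ c :+ c :+ c :+ c) :- c :* c) :+ b :* (b :* (b :+ c) :- c :* c) :+ c :* (c :* c)) refl
    l₁ = solve 3 (λ a b c → let d = (a :+ c) :* (a :+ b :+ con (pos 2) :* c) :- (b :+ c) :* (b :+ con (pos 2) :* c) ; e = c :* (b :+ con (pos 2) :* c) :- b :* (a :+ b :+ con (pos 2) :* c) ; f = b :* (b :+ c) :- c :* (a :+ c)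
       in a :* e :+ b :* d :+ (b :* f :+ c :* e) :+ con (pos 2) :* c :* f := con 0ℤ) refl
    l₂ = solve 3 (λ a b c → let d = (a :+ c) :* (a :+ b :+ con (pos 2) :* c) :- (b :+ c) :* (b :+ con (pos 2) :* c) ; e = c :* (b :+ con (pos 2) :* c) :- b :* (a :+ b :+ con (pos 2) :* c) ; f = b :* (b :+ c) :- c :* (a :+ c)
       in a :* f :+ b :* e :+ c :* d :+ (b :* f :+ c :* e) :+ con (pos 2) :* c :* f := con 0ℤ) refl

  emb-⊗ : ∀ n x → emb n ⊗ x ≡ ⟨ n * co₀ x , n * co₁ x , n * co₂ x ⟩
  emb-⊗ n ⟨ d , e , f ⟩ = cong₃ (l₀ n d e f) (l₁ n d e f) (l₂ n d e f)
    where
    l₀ = solve 4 (λ n d e f → n :* d :+ (con 0ℤ :* f :+ con 0ℤ :* e) :+ con 0ℤ :* f := n :* d) refl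
    l₁ = solve 4 (λ n d e f → n :* e :+ con 0ℤ :* d :+ (con 0ℤ :* f :+ con 0ℤ :* e) :+ con (pos 2) :* con 0ℤ :* f := n :* e) refl
    l₂ = solve 4 (λ n d e f → n :* f :+ con 0ℤ :* e :+ con 0ℤ :* d :+ (con 0ℤ :* f :+ con 0ℤ :* e) :+ con (pos 2) :* con 0ℤ :* f := n :* f) refl

  emb-* : ∀ m n → emb m ⊗ emb n ≡ emb (m * n)
  emb-* m n = trans (emb-⊗ m (emb n)) (cong₃ refl (*-zeroʳ m) (*-zeroʳ m))

  N-emb : ∀ n → N (emb n) ≡ n * n * n
  N-emb = l
    where
    l = solve 1 (λ n → n :* (n :* (n :+ con 0ℤ :+ con 0ℤ :+ con 0ℤ :+ con 0ℤ) :- con 0ℤ :* (con 0ℤ :+ con 0ℤ :+ con 0ℤ :+ con 0ℤ :+ con 0ℤ) :- con 0ℤ :* con 0ℤ) :+ con 0ℤ :* (con 0ℤ :* (con 0ℤ :+ con 0ℤ) :- con 0ℤ :* con 0ℤ) :+ con 0ℤ :* (con 0ℤ :* con 0ℤ) := n :* n :* n) refl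

  ⊗-cancelˡ : ∀ x {y z} → N x ≢ 0ℤ → x ⊗ y ≡ x ⊗ z → y ≡ z
  ⊗-cancelˡ x {y@(⟨ _ , _ , _ ⟩)} {z@(⟨ _ , _ , _ ⟩)} Nx≢0 eq = cong₃ (cancel (cong co₀ scaled)) (cancel (cong co₁ scaled)) (cancel (cong co₂ scaled))
    where
    cancel : ∀ {i j} → N x * i ≡ N x * j → i ≡ j
    cancel {i} {j} = *-cancelˡ-≡ (N x) i j {{ℤ.≢-nonZero Nx≢0}}
    swap : ∀ y → ⟨ N x * co₀ y , N x * co₁ y , N x * co₂ y ⟩ ≡ adj x ⊗ (x ⊗ y)
    swap y = trans (sym (emb-⊗ (N x) y)) (trans (cong (_⊗ y) (sym (trans (⊗-comm (adj x) x) (⊗-adj x)))) (⊗-assoc (adj x) x y))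
    scaled : ⟨ N x * co₀ y , N x * co₁ y , N x * co₂ y ⟩ ≡ ⟨ N x * co₀ z , N x * co₁ z , N x * co₂ z ⟩
    scaled = trans (swap y) (trans (cong (adj x ⊗_) eq) (sym (swap z)))

  infix 4 _∣ρ_
  _∣ρ_ : ℤ[ρ] → ℤ[ρ] → Set
  x ∣ρ y = ∃[ k ] y ≡ k ⊗ x

  ∣ρ⇒N∣ : ∀ {x y} → x ∣ρ y → N x ∣ N y
  ∣ρ⇒N∣ {x} (k , refl) = divides (N k) (N-⊗ k x)

  -- Lets a statement about norms modulo m be decided on the m³ triples of residues.
  eval-cong : ∀ m {d} (F : Form d) {a b c a′ b′ c′} → m ∣ a - a′ → m ∣ b - b′ → m ∣ c - c′ → m ∣ eval F a b c - eval F a′ b′ c′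
  eval-cong m X p q r = p
  eval-cong m Y p q r = q
  eval-cong m Z p q r = r
  eval-cong m (F +ᶠ G) {a} {b} {c} {a′} {b′} {c′} p q r = ∣-combination 1ℤ 1ℤ (l (eval F a b c) (eval G a b c) (eval F a′ b′ c′) (eval G a′ b′ c′)) (eval-cong m F {a} {b} {c} {a′} {b′} {c′} p q r) (eval-cong m G {a} {b} {c} {a′} {b′} {c′} p q r)
    where
    l = solve 4 (λ f g f′ g′ → (f :+ g) :- (f′ :+ g′) := con 1ℤ :* (f :- f′) :+ con 1ℤ :* (g :- g′)) refl
  eval-cong m (F -ᶠ G) {a} {b} {c} {a′} {b′} {c′} p q r = ∣-combination 1ℤ (- 1ℤ) (l (eval F a b c) (eval G a b c) (eval F a′ b′ c′) (eval G a′ b′ c′)) (eval-cong m F {a} {b} {c} {a′} {b′} {c′} p q r) (eval-cong m G {a} {b} {c} {a′} {b′} {c′} p q r)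
    where
    l = solve 4 (λ f g f′ g′ → (f :- g) :- (f′ :- g′) := con 1ℤ :* (f :- f′) :+ :- con 1ℤ :* (g :- g′)) refl
  eval-cong m (F *ᶠ G) {a} {b} {c} {a′} {b′} {c′} p q r = ∣-combination (eval G a b c) (eval F a′ b′ c′) (l (eval F a b c) (eval G a b c) (eval F a′ b′ c′) (eval G a′ b′ c′)) (eval-cong m F {a} {b} {c} {a′} {b′} {c′} p q r) (eval-cong m G {a} {b} {c} {a′} {b′} {c′} p q r)
    where
    l = solve 4 (λ f g f′ g′ → f :* g :- f′ :* g′ := g :* (f :- f′) :+ f′ :* (g :- g′)) refl

  residue : ∀ m .{{_ : ℕ.NonZero m}} a → ∃[ i ] i ∈ applyUpTo pos m × pos m ∣ a - i
  residue m a = pos (a %ℕ m) , ∈-applyUpTo⁺ pos (n%ℕd<d a m) , divides (a /ℕ m) (lin 1ℤ (l a (pos (a %ℕ m)) (a /ℕ m * pos m)) (a≡a%ℕn+[a/ℕn]*n a m))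
    where
    l = solve 3 (λ a r q → (a :- r) :- q := con 1ℤ :* (a :- (r :+ q))) refl

  module _ (P : ℤ → ℤ → ℤ → Set) where
    AllResidues : ℕ → Set
    AllResidues m = All (λ i → All (λ j → All (P i j) (applyUpTo pos m)) (applyUpTo pos m)) (applyUpTo pos m)

  -- The prime 3 is inert: x³ - x² - x - 1 has no root modulo 3.
  N-divisible-by-3 : ∀ a b c → pos 3 ∣ N ⟨ a , b , c ⟩ → pos 3 ∣ a × pos 3 ∣ b × pos 3 ∣ c
  N-divisible-by-3 a b c h = let i , i∈ , a≡i = residue 3 a ; j , j∈ , b≡j = residue 3 b ; k , k∈ , c≡k = residue 3 c
                                 p , q , r = All.lookup (All.lookup (All.lookup checked i∈) j∈) k∈ (difference {N ⟨ a , b , c ⟩} {N ⟨ i , j , k ⟩} (eval-cong (pos 3) norm-form {a} {b} {c} {i} {j} {k} a≡i b≡j c≡k) h)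
                             in back a≡i p , back b≡j q , back c≡k r
    where
    Check : ℤ → ℤ → ℤ → Set
    Check i j k = pos 3 ∣ N ⟨ i , j , k ⟩ → pos 3 ∣ i × pos 3 ∣ j × pos 3 ∣ k
    checked : AllResidues Check 3
    checked = from-yes (all? (λ i → all? (λ j → all? (λ k → (pos 3 ∣? N ⟨ i , j , k ⟩) →-dec ((pos 3 ∣? i) ×-dec (pos 3 ∣? j) ×-dec (pos 3 ∣? k)))
      (applyUpTo pos 3)) (applyUpTo pos 3)) (applyUpTo pos 3))
    difference : ∀ {x y} → pos 3 ∣ x - y → pos 3 ∣ x → pos 3 ∣ y
    difference {x} {y} p q = ∣-combination (- 1ℤ) 1ℤ (l x y) p q
      where
      l = solve 2 (λ x y → y := :- con 1ℤ :* (x :- y) :+ con 1ℤ :* x) refl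
    back : ∀ {x y} → pos 3 ∣ x - y → pos 3 ∣ y → pos 3 ∣ x
    back {x} {y} p q = ∣-combination 1ℤ 1ℤ (l x y) p q
      where
      l = solve 2 (λ x y → x := con 1ℤ :* (x :- y) :+ con 1ℤ :* y) refl

  -- Infinite descent at the inert prime 3: an element of norm zero can be divided by 3 again and
  -- again. This replaces an appeal to ℤ[ρ] being a domain.
  N≡0⇒≡0 : ∀ x → N x ≡ 0ℤ → x ≡ emb 0ℤ
  N≡0⇒≡0 ⟨ a , b , c ⟩ eq = descend (suc (size a b c)) a b c ℕ.≤-refl eq
    where
    size : ℤ → ℤ → ℤ → ℕ
    size a b c = abs a ℕ.+ abs b ℕ.+ abs c
    descend : ∀ fuel a b c → size a b c ℕ.< fuel → N ⟨ a , b , c ⟩ ≡ 0ℤ → ⟨ a , b , c ⟩ ≡ emb 0ℤ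
    descend (suc fuel) a b c size<fuel eq = third (N-divisible-by-3 a b c (divides 0ℤ eq))
      where
      third : pos 3 ∣ a × pos 3 ∣ b × pos 3 ∣ c → ⟨ a , b , c ⟩ ≡ emb 0ℤ
      third (divides i refl , divides j refl , divides k refl) with size i j k ℕ.≟ 0
      ... | yes s≡0 = cong₃ (cong (_* pos 3) (zero-of i (ℕ.m+n≡0⇒m≡0 (abs i) (ℕ.m+n≡0⇒m≡0 (abs i ℕ.+ abs j) s≡0))))
                            (cong (_* pos 3) (zero-of j (ℕ.m+n≡0⇒n≡0 (abs i) (ℕ.m+n≡0⇒m≡0 (abs i ℕ.+ abs j) s≡0))))
                            (cong (_* pos 3) (zero-of k (ℕ.m+n≡0⇒n≡0 (abs i ℕ.+ abs j) s≡0)))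
        where
        zero-of : ∀ x → abs x ≡ 0 → x ≡ 0ℤ
        zero-of x = ∣i∣≡0⇒i≡0 {x}
      ... | no s≢0 = cong (λ x → ⟨ co₀ x * pos 3 , co₁ x * pos 3 , co₂ x * pos 3 ⟩) (descend fuel i j k
            (ℕ.<-≤-trans (subst (size i j k ℕ.<_) (sym size≡) (ℕ.m<m*n (size i j k) 3 {{ℕ.≢-nonZero s≢0}} (s≤s (s≤s z≤n)))) (ℕ.≤-pred size<fuel))
            (*-cancelˡ-≡ (pos 27) _ _ (trans (l i j k) (trans eq refl))))
        where
        size≡ : size (i * pos 3) (j * pos 3) (k * pos 3) ≡ size i j k ℕ.* 3
        size≡ = trans (cong₂ ℕ._+_ (cong₂ ℕ._+_ (abs-* i (pos 3)) (abs-* j (pos 3))) (abs-* k (pos 3)))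
          (sym (trans (ℕ.*-distribʳ-+ 3 (abs i ℕ.+ abs j) (abs k)) (cong (ℕ._+ abs k ℕ.* 3) (ℕ.*-distribʳ-+ 3 (abs i) (abs j)))))
        l = solve 3 (λ i j k → let a = i :* con (pos 3) ; b = j :* con (pos 3) ; c = k :* con (pos 3) in
            con (pos 27) :* (i :* (i :* (i :+ j :+ k :+ k :+ k) :- j :* (j :+ k :+ k :+ k :+ k) :- k :* k) :+ j :* (j :* (j :+ k) :- k :* k) :+ k :* (k :* k))
            := a :* (a :* (a :+ b :+ c :+ c :+ c) :- b :* (b :+ c :+ c :+ c :+ c) :- c :* c) :+ b :* (b :* (b :+ c) :- c :* c) :+ c :* (c :* c)) refl

-- Division with remainder, greatest common divisors and square classes in ℤ[ρ].

module EuclideanDivision where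
  open IntegerArithmetic
  open TernaryForms
  open CubicRing
  open import Data.Nat using (ℕ; zero; suc; z≤n; s≤s)
  import Data.Nat as ℕ
  import Data.Nat.Properties as ℕ
  import Data.Nat.Divisibility as ℕ
  open import Data.Integer using (ℤ; 0ℤ; 1ℤ; _+_; _*_; _-_; -_; _≤_; _<_; _^_; -[1+_]; +≤+; nonNegative) renaming (+_ to pos; ∣_∣ to abs)
  import Data.Integer as ℤ hiding (+_)
  open import Data.Integer.Properties
  open import Data.Integer.DivMod using (_/ℕ_; _%ℕ_; n%ℕd<d; a≡a%ℕn+[a/ℕn]*n)
  open import Data.List.Relation.Unary.All as All using (All)
  open import Data.List.Relation.Unary.Any as Any using (Any)
  open import Data.List.Membership.Propositional using (_∈_)
  open import Data.List.Membership.Propositional.Properties using (∈-applyUpTo⁺)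
  import Tactic.RingSolver as ρSolver
  open ℤS using (solve; con; _:+_; _:*_; _:-_; :-_; _:=_)

  Located : ℕ → ℤ → ℤ → ℤ → Set
  Located m lo x K = ∃[ j ] (j ℕ.< suc m) × (lo + pos j) * K ≤ x × x ≤ (lo + pos j + 1ℤ) * K

  locate : ∀ m lo x K → lo * K ≤ x → x ≤ (lo + pos (suc m)) * K → Located m lo x K
  locate zero lo x K l u = 0 , s≤s z≤n , subst (λ z → z * K ≤ x) (sym (+-identityʳ lo)) l , subst (λ z → x ≤ (z + 1ℤ) * K) (sym (+-identityʳ lo)) u
  locate (suc m) lo x K l u = [ here , there ]′ (≤-total x ((lo + 1ℤ) * K))
    where
    here : x ≤ (lo + 1ℤ) * K → Located (suc m) lo x K
    here h = 0 , s≤s z≤n , subst (λ z → z * K ≤ x) (sym (+-identityʳ lo)) l , subst (λ z → x ≤ (z + 1ℤ) * K) (sym (+-identityʳ lo)) h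
    there : (lo + 1ℤ) * K ≤ x → Located (suc m) lo x K
    there h = let j , j< , l′ , u′ = locate m (lo + 1ℤ) x K h (subst (λ z → x ≤ z * K) (sym (+-assoc lo 1ℤ (pos (suc m)))) u) in
      suc j , s≤s j< , subst (λ z → z * K ≤ x) (+-assoc lo 1ℤ (pos j)) l′ , subst (λ z → x ≤ (z + 1ℤ) * K) (+-assoc lo 1ℤ (pos j)) u′

  private
    shift-cell : ∀ g r K s → r ∈[ cell g ]· K → r - pos 4 * s * K ∈[ cell (g - pos 4 * s) ]· K
    shift-cell g r K s (l , u) = subst (_≤ r - pos 4 * s * K) (l₁ g s K) (+-monoˡ-≤ (- (pos 4 * s * K)) l) ,
                                       subst (r - pos 4 * s * K ≤_) (l₂ g s K) (+-monoˡ-≤ (- (pos 4 * s * K)) u)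
      where
      l₁ = solve 3 (λ g s K → g :* K :+ :- (con (pos 4) :* s :* K) := (g :- con (pos 4) :* s) :* K) refl
      l₂ = solve 3 (λ g s K → (g :+ con 1ℤ) :* K :+ :- (con (pos 4) :* s :* K) := (g :- con (pos 4) :* s :+ con 1ℤ) :* K) refl

    residue-cell : ∀ n .{{_ : ℕ.NonZero n}} v → ∃[ g ] g ∈ residues × pos 4 * (v - v /ℕ n * pos n) ∈[ cell g ]· pos n ^ 1
    residue-cell n v = let j , j<4 , l , u = locate 3 0ℤ (pos 4 * R) (pos n ^ 1) (subst (_≤ pos 4 * R) (sym (*-zeroˡ (pos n ^ 1))) (subst (_≤ pos 4 * R) (*-zeroʳ (pos 4)) (*-monoˡ-≤-nonNeg (pos 4) 0≤R)))
                             (subst (λ z → pos 4 * R ≤ pos 4 * z) (sym (^-identityʳ (pos n))) (*-monoˡ-≤-nonNeg (pos 4) R≤n)) in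
      pos j , ∈-applyUpTo⁺ pos j<4 , subst (λ z → z * pos n ^ 1 ≤ pos 4 * R) (+-identityˡ (pos j)) l , subst (λ z → pos 4 * R ≤ (z + 1ℤ) * pos n ^ 1) (+-identityˡ (pos j)) u
      where
      R = v - v /ℕ n * pos n
      R≡ : R ≡ pos (v %ℕ n)
      R≡ = lin 1ℤ (l v (v /ℕ n * pos n) (pos (v %ℕ n))) (a≡a%ℕn+[a/ℕn]*n v n)
        where
        l = solve 3 (λ v q r → v :- q :- r := con 1ℤ :* (v :- (r :+ q))) refl
      0≤R : 0ℤ ≤ R
      0≤R = subst (0ℤ ≤_) (sym R≡) (+≤+ z≤n)
      R≤n : R ≤ pos n
      R≤n = subst (_≤ pos n) (sym R≡) (+≤+ (ℕ.<⇒≤ (n%ℕd<d v n)))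

  abs≤ : ∀ x (b : ℕ) → - pos b ≤ x → x ≤ pos b → abs x ℕ.≤ b
  abs≤ (pos n) b _ (+≤+ h) = h
  abs≤ -[1+ n ] b l _ = drop‿+≤+ (subst (pos (suc n) ≤_) (neg-involutive (pos b)) (neg-mono-≤ l))

  -- Multiplied by 64, the norm of the chosen remainder is at most 63 n³.
  small-remainder : ∀ n .{{_ : ℕ.NonZero n}} v → ∃[ κ ] (abs (N (v ⊕ ⊝ (emb (pos n) ⊗ κ))) ℕ.< n ℕ.^ 3)
  small-remainder n v@(⟨ a , b , c ⟩) = from-cells (residue-cell n a) (residue-cell n b) (residue-cell n c)
    where
    Goal = ∃[ κ ] (abs (N (v ⊕ ⊝ (emb (pos n) ⊗ κ))) ℕ.< n ℕ.^ 3)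
    from-cells : ∃[ g ] g ∈ residues × pos 4 * (a - a /ℕ n * pos n) ∈[ cell g ]· pos n ^ 1 → ∃[ g ] g ∈ residues × pos 4 * (b - b /ℕ n * pos n) ∈[ cell g ]· pos n ^ 1
               → ∃[ g ] g ∈ residues × pos 4 * (c - c /ℕ n * pos n) ∈[ cell g ]· pos n ^ 1 → Goal
    from-cells (g , g∈ , p) (h , h∈ , q) (k , k∈ , r) = first (Any.satisfied (All.lookup (All.lookup (All.lookup all-shiftable g∈) h∈) k∈))
      where
      first : ∃ _ → Goal
      first (s , found₁) = second (Any.satisfied found₁)
        where
        second : ∃ _ → Goal
        second (t , found₂) = third (Any.satisfied found₂)
          where
          third : ∃ _ → Goal
          third (u , small-lo , small-hi) = κ , ℕ.*-cancelˡ-< 64 _ _ (ℕ.≤-<-trans bound (ℕ.*-monoˡ-< (n ℕ.^ 3) {{ℕ.m^n≢0 n 3}} {63} {64} ℕ.≤-refl))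
            where
            K = pos n ^ 1
            i = enclose norm-form (cell (g - pos 4 * s)) (cell (h - pos 4 * t)) (cell (k - pos 4 * u))
            x = pos 4 * (a - a /ℕ n * pos n) - pos 4 * s * K
            y = pos 4 * (b - b /ℕ n * pos n) - pos 4 * t * K
            z = pos 4 * (c - c /ℕ n * pos n) - pos 4 * u * K
            κ = ⟨ a /ℕ n + s , b /ℕ n + t , c /ℕ n + u ⟩
            enclosed : N ⟨ x , y , z ⟩ ∈[ i ]· pos n ^ 3
            enclosed = enclose-sound n norm-form {cell (g - pos 4 * s)} {cell (h - pos 4 * t)} {cell (k - pos 4 * u)} {x} {y} {z} (shift-cell g (pos 4 * (a - a /ℕ n * pos n)) K s p)
              (shift-cell h (pos 4 * (b - b /ℕ n * pos n)) K t q) (shift-cell k (pos 4 * (c - c /ℕ n * pos n)) K u r)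
            n³ : pos n ^ 3 ≡ pos (n ℕ.^ 3)
            n³ = pos-^ n 3
              where
              pos-^ : ∀ n d → pos n ^ d ≡ pos (n ℕ.^ d)
              pos-^ n zero = refl
              pos-^ n (suc d) = trans (cong (pos n *_) (pos-^ n d)) (sym (pos-* n (n ℕ.^ d)))
            63n³ : pos 63 * pos n ^ 3 ≡ pos (63 ℕ.* n ℕ.^ 3)
            63n³ = trans (cong (pos 63 *_) n³) (sym (pos-* 63 (n ℕ.^ 3)))
            0≤n³ : 0ℤ ≤ pos n ^ 3
            0≤n³ = subst (0ℤ ≤_) (sym n³) (+≤+ z≤n)
            coordinate : ∀ a q s → pos 4 * (a - q * pos n) - pos 4 * s * K ≡ pos 4 * (a + - (pos n * (q + s)))
            coordinate a q s = trans (cong (λ K → pos 4 * (a - q * pos n) - pos 4 * s * K) (^-identityʳ (pos n))) (l a q s (pos n))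
              where
              l = solve 4 (λ a q s n → con (pos 4) :* (a :- q :* n) :- con (pos 4) :* s :* n := con (pos 4) :* (a :+ :- (n :* (q :+ s)))) refl
            64N : N ⟨ x , y , z ⟩ ≡ pos 64 * N (v ⊕ ⊝ (emb (pos n) ⊗ κ))
            64N = trans (cong N (cong₃ (coordinate a (a /ℕ n) s) (coordinate b (b /ℕ n) t) (coordinate c (c /ℕ n) u)))
              (trans (l (a + - (pos n * (a /ℕ n + s))) (b + - (pos n * (b /ℕ n + t))) (c + - (pos n * (c /ℕ n + u)))) (cong (λ w → pos 64 * N (v ⊕ ⊝ w)) (sym (emb-⊗ (pos n) κ))))
              where
              l = solve 3 (λ a b c → let x = con (pos 4) :* a ; y = con (pos 4) :* b ; z = con (pos 4) :* c in
                  x :* (x :* (x :+ y :+ z :+ z :+ z) :- y :* (y :+ z :+ z :+ z :+ z) :- z :* z) :+ y :* (y :* (y :+ z) :- z :* z) :+ z :* (z :* z)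
                  := con (pos 64) :* (a :* (a :* (a :+ b :+ c :+ c :+ c) :- b :* (b :+ c :+ c :+ c :+ c) :- c :* c) :+ b :* (b :* (b :+ c) :- c :* c) :+ c :* (c :* c))) refl
            bound : 64 ℕ.* abs (N (v ⊕ ⊝ (emb (pos n) ⊗ κ))) ℕ.≤ 63 ℕ.* n ℕ.^ 3
            bound = subst (ℕ._≤ 63 ℕ.* n ℕ.^ 3) (trans (cong abs 64N) (abs-* (pos 64) (N (v ⊕ ⊝ (emb (pos n) ⊗ κ))))) (abs≤ (N ⟨ x , y , z ⟩) (63 ℕ.* n ℕ.^ 3)
              (subst (_≤ N ⟨ x , y , z ⟩) (trans (sym (neg-distribˡ-* (pos 63) (pos n ^ 3))) (cong -_ 63n³)) (≤-trans (*-monoʳ-≤-nonNeg (pos n ^ 3) {{nonNegative 0≤n³}} (≤ᵇ⇒≤ { - pos 63} {lo i} small-lo)) (proj₁ enclosed)))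
              (subst (N ⟨ x , y , z ⟩ ≤_) 63n³ (≤-trans (proj₂ enclosed) (*-monoʳ-≤-nonNeg (pos n ^ 3) {{nonNegative 0≤n³}} (≤ᵇ⇒≤ {hi i} {pos 63} small-hi)))))

  private
    neg-⊗ : ∀ x y → x ⊗ (⊝ y) ≡ ⊝ (x ⊗ y)
    neg-⊗ = ρSolver.solve-∀ ρ-ring

    positive-cofactor : ∀ δ → N δ ≢ 0ℤ → ∃[ A ] δ ⊗ A ≡ emb (pos (abs (N δ)))
    positive-cofactor δ Nδ≢0 with N δ in eq
    ... | pos n    = adj δ , trans (⊗-adj δ) (cong emb eq)
    ... | -[1+ n ] = ⊝ adj δ , trans (neg-⊗ δ (adj δ)) (trans (cong ⊝_ (⊗-adj δ)) (cong (λ m → ⊝ emb m) eq))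

  -- With A = ±adj δ one has δA = n > 0, so α/δ = αA/n has an integer denominator. The norm of αA -
  -- nκ is below n³ in absolute value, and it is the norm of α - κδ times N A = ±n².
  divide : ∀ α δ → N δ ≢ 0ℤ → ∃[ κ ] (abs (N (α ⊕ ⊝ (κ ⊗ δ))) ℕ.< abs (N δ))
  divide α δ Nδ≢0 = from (positive-cofactor δ Nδ≢0)
    where
    n = abs (N δ)
    instance
      n-nonZero : ℕ.NonZero n
      n-nonZero = ℕ.≢-nonZero λ n≡0 → Nδ≢0 (∣i∣≡0⇒i≡0 {N δ} n≡0)
    from : ∃[ A ] δ ⊗ A ≡ emb (pos n) → ∃[ κ ] (abs (N (α ⊕ ⊝ (κ ⊗ δ))) ℕ.< abs (N δ))
    from (A , δA≡n) = let κ , small = small-remainder n (α ⊗ A) in κ ,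
      ℕ.*-cancelʳ-< (n ℕ.* n) (abs (N (α ⊕ ⊝ (κ ⊗ δ)))) n (subst₂ ℕ._<_ (norm κ) (cong (n ℕ.*_) (cong (n ℕ.*_) (ℕ.*-identityʳ n))) small)
      where
      NA : abs (N A) ≡ n ℕ.* n
      NA = ℕ.*-cancelˡ-≡ (abs (N A)) (n ℕ.* n) n (trans (sym (abs-* (N δ) (N A))) (trans (cong abs (trans (sym (N-⊗ δ A)) (trans (cong N δA≡n) (N-emb (pos n)))))
        (trans (abs-* (pos n * pos n) (pos n)) (trans (cong (ℕ._* n) (abs-* (pos n) (pos n))) (ℕ.*-comm (n ℕ.* n) n)))))
      norm : ∀ κ → abs (N (α ⊗ A ⊕ ⊝ (emb (pos n) ⊗ κ))) ≡ abs (N (α ⊕ ⊝ (κ ⊗ δ))) ℕ.* (n ℕ.* n)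
      norm κ = trans (cong (λ x → abs (N x)) (trans (cong (λ e → α ⊗ A ⊕ ⊝ (e ⊗ κ)) (sym δA≡n)) (l α A δ κ)))
        (trans (cong abs (N-⊗ (α ⊕ ⊝ (κ ⊗ δ)) A)) (trans (abs-* (N (α ⊕ ⊝ (κ ⊗ δ))) (N A)) (cong (abs (N (α ⊕ ⊝ (κ ⊗ δ))) ℕ.*_) NA)))
        where
        l : ∀ α A δ κ → α ⊗ A ⊕ ⊝ (δ ⊗ A ⊗ κ) ≡ (α ⊕ ⊝ (κ ⊗ δ)) ⊗ A
        l = ρSolver.solve-∀ ρ-ring

  record GCD (α δ : ℤ[ρ]) : Set where
    field
      γ u v  : ℤ[ρ]
      γ∣α    : γ ∣ρ α
      γ∣δ    : γ ∣ρ δ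
      bezout : γ ≡ u ⊗ α ⊕ v ⊗ δ

  gcdρ : ∀ fuel α δ → abs (N δ) ℕ.< fuel → GCD α δ
  gcdρ (suc fuel) α δ Nδ<fuel = cases (N δ ℤ.≟ 0ℤ)
    where
    cases : Dec (N δ ≡ 0ℤ) → GCD α δ
    cases (yes Nδ≡0) = record { γ = α ; u = 𝟙 ; v = 𝟙 ; γ∣α = 𝟙 , l₁ α ; γ∣δ = emb 0ℤ , trans δ≡0 (l₀ α)
                              ; bezout = trans (l α) (cong (λ z → 𝟙 ⊗ α ⊕ 𝟙 ⊗ z) (sym δ≡0)) }
      where
      δ≡0 = N≡0⇒≡0 δ Nδ≡0
      l₁ : ∀ α → α ≡ 𝟙 ⊗ α
      l₁ = ρSolver.solve-∀ ρ-ring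
      l₀ : ∀ α → emb 0ℤ ≡ emb 0ℤ ⊗ α
      l₀ = ρSolver.solve-∀ ρ-ring
      l : ∀ α → α ≡ 𝟙 ⊗ α ⊕ 𝟙 ⊗ emb 0ℤ
      l = ρSolver.solve-∀ ρ-ring
    cases (no Nδ≢0) = step (divide α δ Nδ≢0)
      where
      step : ∃[ κ ] (abs (N (α ⊕ ⊝ (κ ⊗ δ))) ℕ.< abs (N δ)) → GCD α δ
      step (κ , small) = extend (gcdρ fuel δ (α ⊕ ⊝ (κ ⊗ δ)) (ℕ.<-≤-trans small (ℕ.≤-pred Nδ<fuel)))
        where
        extend : GCD δ (α ⊕ ⊝ (κ ⊗ δ)) → GCD α δ
        extend G = record { γ = γ ; u = v ; v = u ⊕ ⊝ (v ⊗ κ) ; γ∣α = α-divided γ∣δ γ∣α ; γ∣δ = γ∣α ; bezout = trans bezout (l u v α δ κ) }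
          where
          open GCD G
          l : ∀ u v α δ κ → u ⊗ δ ⊕ v ⊗ (α ⊕ ⊝ (κ ⊗ δ)) ≡ v ⊗ α ⊕ (u ⊕ ⊝ (v ⊗ κ)) ⊗ δ
          l = ρSolver.solve-∀ ρ-ring
          α-divided : γ ∣ρ (α ⊕ ⊝ (κ ⊗ δ)) → γ ∣ρ δ → γ ∣ρ α
          α-divided (j , eq₁) (k , eq₂) = j ⊕ κ ⊗ k , trans (l₁ α κ δ) (trans (cong₂ (λ x y → x ⊕ κ ⊗ y) eq₁ eq₂) (l₂ j κ k γ))
            where
            l₁ : ∀ α κ δ → α ≡ (α ⊕ ⊝ (κ ⊗ δ)) ⊕ κ ⊗ δ
            l₁ = ρSolver.solve-∀ ρ-ring
            l₂ : ∀ j κ k γ → j ⊗ γ ⊕ κ ⊗ (k ⊗ γ) ≡ (j ⊕ κ ⊗ k) ⊗ γ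
            l₂ = ρSolver.solve-∀ ρ-ring

  -- If N β = s², then β is a square up to a common divisor of β, its cofactor and s.
  record SquareUpTo (β : ℤ[ρ]) (s : ℤ) : Set where
    field
      δ β₁  : ℤ[ρ]
      β≡    : β ≡ δ ⊗ (β₁ ⊗ β₁)
      δ∣adj : δ ∣ρ adj β
      δ∣s   : δ ∣ρ emb s

  -- Let γ = gcd(β, s), β = β₁γ and s = yγ, so that β₁ and y are coprime. From β · adj β = s²
  -- follows β₁ · adj β = y²γ, hence β₁ ∣ γ; with γ = β₁δ this gives β = δβ₁² and adj β = y²δ.
  square-up-to : ∀ β s → s ≢ 0ℤ → N β ≡ s * s → SquareUpTo β s
  square-up-to β s s≢0 Nβ≡s² = from (gcdρ _ β (emb s) ℕ.≤-refl)
    where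
    from : GCD β (emb s) → SquareUpTo β s
    from record { γ = γ ; u = u ; v = v ; γ∣α = β₁ , β≡β₁γ ; γ∣δ = y , s≡yγ ; bezout = bezout } = record
      { δ = δ ; β₁ = β₁
      ; β≡ = trans β≡β₁γ (trans (cong (β₁ ⊗_) γ≡) (l₁ β₁ δ))
      ; δ∣adj = y ⊗ y , ⊗-cancelˡ β₁ Nβ₁≢0 (trans β₁adj (trans (cong (y ⊗ y ⊗_) γ≡) (l₂ y β₁ δ)))
      ; δ∣s = y ⊗ β₁ , trans s≡yγ (trans (cong (y ⊗_) γ≡) (sym (⊗-assoc y β₁ δ))) }
      where
      l₁ : ∀ b d → b ⊗ (b ⊗ d) ≡ d ⊗ (b ⊗ b)
      l₁ = ρSolver.solve-∀ ρ-ring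
      l₂ : ∀ y b d → y ⊗ y ⊗ (b ⊗ d) ≡ b ⊗ (y ⊗ y ⊗ d)
      l₂ = ρSolver.solve-∀ ρ-ring
      NβNγ : N β₁ * N γ ≡ s * s
      NβNγ = trans (sym (N-⊗ β₁ γ)) (trans (cong N (sym β≡β₁γ)) Nβ≡s²)
      s²≢0 : s * s ≢ 0ℤ
      s²≢0 eq = s≢0 (x*x≡0⇒x≡0 s eq)
      Nγ≢0 : N γ ≢ 0ℤ
      Nγ≢0 eq = s²≢0 (trans (sym NβNγ) (trans (cong (N β₁ *_) eq) (*-zeroʳ (N β₁))))
      Nβ₁≢0 : N β₁ ≢ 0ℤ
      Nβ₁≢0 eq = s²≢0 (trans (sym NβNγ) (cong (_* N γ) eq))
      one : 𝟙 ≡ u ⊗ β₁ ⊕ v ⊗ y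
      one = ⊗-cancelˡ γ Nγ≢0 (trans (⊗-comm γ 𝟙) (trans (l γ) (trans bezout (trans (cong₂ (λ a b → u ⊗ a ⊕ v ⊗ b) β≡β₁γ s≡yγ) (l′ u v β₁ y γ)))))
        where
        l : ∀ γ → 𝟙 ⊗ γ ≡ γ
        l = ρSolver.solve-∀ ρ-ring
        l′ : ∀ u v β y γ → u ⊗ (β ⊗ γ) ⊕ v ⊗ (y ⊗ γ) ≡ γ ⊗ (u ⊗ β ⊕ v ⊗ y)
        l′ = ρSolver.solve-∀ ρ-ring
      β₁adj : β₁ ⊗ adj β ≡ y ⊗ y ⊗ γ
      β₁adj = ⊗-cancelˡ γ Nγ≢0 (trans (l γ β₁ (adj β)) (trans (cong (_⊗ adj β) (sym β≡β₁γ)) (trans (⊗-adj β) (trans (cong emb Nβ≡s²)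
        (trans (sym (emb-* s s)) (trans (cong₂ _⊗_ s≡yγ s≡yγ) (l′ y γ)))))))
        where
        l : ∀ γ β a → γ ⊗ (β ⊗ a) ≡ β ⊗ γ ⊗ a
        l = ρSolver.solve-∀ ρ-ring
        l′ : ∀ y γ → y ⊗ γ ⊗ (y ⊗ γ) ≡ γ ⊗ (y ⊗ y ⊗ γ)
        l′ = ρSolver.solve-∀ ρ-ring
      P = u ⊗ β₁
      Q = v ⊗ y
      -- The quotient γ/β₁, read off from γ = γ(P + Q)² with P + Q = 1: the terms with P contain β₁,
      -- and γQ² = v²y²γ = v²β₁ · adj β.
      δ = γ ⊗ (u ⊗ (P ⊕ Q ⊕ Q)) ⊕ v ⊗ v ⊗ adj β
      γ≡ : γ ≡ β₁ ⊗ δ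
      γ≡ = trans (l γ) (trans (cong (λ z → γ ⊗ (z ⊗ z)) one) (trans (l₃ γ P Q) (trans (cong₂ _⊕_ (l₄ γ u β₁ (P ⊕ Q ⊕ Q)) (l₅ γ v y))
        (trans (cong (λ z → β₁ ⊗ (γ ⊗ (u ⊗ (P ⊕ Q ⊕ Q))) ⊕ v ⊗ v ⊗ z) (sym β₁adj)) (l₆ β₁ (γ ⊗ (u ⊗ (P ⊕ Q ⊕ Q))) v (adj β))))))
        where
        l : ∀ γ → γ ≡ γ ⊗ (𝟙 ⊗ 𝟙)
        l = ρSolver.solve-∀ ρ-ring
        l₃ : ∀ γ P Q → γ ⊗ ((P ⊕ Q) ⊗ (P ⊕ Q)) ≡ γ ⊗ (P ⊗ (P ⊕ Q ⊕ Q)) ⊕ γ ⊗ (Q ⊗ Q)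
        l₃ = ρSolver.solve-∀ ρ-ring
        l₄ : ∀ γ u β S → γ ⊗ (u ⊗ β ⊗ S) ≡ β ⊗ (γ ⊗ (u ⊗ S))
        l₄ = ρSolver.solve-∀ ρ-ring
        l₅ : ∀ γ v y → γ ⊗ (v ⊗ y ⊗ (v ⊗ y)) ≡ v ⊗ v ⊗ (y ⊗ y ⊗ γ)
        l₅ = ρSolver.solve-∀ ρ-ring
        l₆ : ∀ β d v a → β ⊗ d ⊕ v ⊗ v ⊗ (β ⊗ a) ≡ β ⊗ (d ⊕ v ⊗ v ⊗ a)
        l₆ = ρSolver.solve-∀ ρ-ring

  -- Only the class modulo squares matters for the descent, so exponents of ρ never have to be
  -- recorded.
  SquareClass : ℤ[ρ] → Set
  SquareClass w = ∃[ v ] (w ≡ v ⊗ v ⊎ w ≡ ρ ⊗ (v ⊗ v))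

  module _ where
    class-ρ : ∀ {w} → SquareClass (ρ ⊗ w) → SquareClass w
    class-ρ {w} (v , inj₁ eq) = ρ⁻¹ ⊗ v , inj₂ (trans (l w) (trans (cong (ρ⁻¹ ⊗_) eq) (l′ v)))
      where
      l : ∀ w → w ≡ ρ⁻¹ ⊗ (ρ ⊗ w)
      l = ρSolver.solve-∀ ρ-ring
      l′ : ∀ v → ρ⁻¹ ⊗ (v ⊗ v) ≡ ρ ⊗ (ρ⁻¹ ⊗ v ⊗ (ρ⁻¹ ⊗ v))
      l′ = ρSolver.solve-∀ ρ-ring
    class-ρ {w} (v , inj₂ eq) = v , inj₁ (⊗-cancelˡ ρ (λ ()) eq)

    class-ρ⁻¹ : ∀ {w} → SquareClass (ρ⁻¹ ⊗ w) → SquareClass w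
    class-ρ⁻¹ {w} (v , inj₁ eq) = v , inj₂ (trans (l w) (cong (ρ ⊗_) eq))
      where
      l : ∀ w → w ≡ ρ ⊗ (ρ⁻¹ ⊗ w)
      l = ρSolver.solve-∀ ρ-ring
    class-ρ⁻¹ {w} (v , inj₂ eq) = ρ ⊗ v , inj₁ (trans (l w) (trans (cong (ρ ⊗_) eq) (l′ v)))
      where
      l : ∀ w → w ≡ ρ ⊗ (ρ⁻¹ ⊗ w)
      l = ρSolver.solve-∀ ρ-ring
      l′ : ∀ v → ρ ⊗ (ρ ⊗ (v ⊗ v)) ≡ ρ ⊗ v ⊗ (ρ ⊗ v)
      l′ = ρSolver.solve-∀ ρ-ring

  -- An approximation of twice the sum of the squared absolute values of the conjugates of ρ w.
  size : ℤ[ρ] → ℤ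
  size ⟨ a , b , c ⟩ = (a + a - b) * (a + a - b) + (b + c + c) * (b + c + c) + (a + c) * (a + c) + (a * a + a * a + a * a) + (b + b) * (b + b) + (c * c + c * c + c * c)

  module _ where
    0≤size : ∀ w → 0ℤ ≤ size w
    0≤size ⟨ a , b , c ⟩ = +-mono-≤ (+-mono-≤ (+-mono-≤ (+-mono-≤ (+-mono-≤ (0≤x*x (a + a - b)) (0≤x*x (b + c + c))) (0≤x*x (a + c)))
      (+-mono-≤ (+-mono-≤ (0≤x*x a) (0≤x*x a)) (0≤x*x a))) (0≤x*x (b + b))) (+-mono-≤ (+-mono-≤ (0≤x*x c) (0≤x*x c)) (0≤x*x c))

    Q₁ Q₂ : ℤ[ρ] → ℤ
    Q₁ ⟨ a , b , c ⟩ = eval q₁ a b c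
    Q₂ ⟨ a , b , c ⟩ = eval q₂ a b c

    ρ⊗ : ∀ a b c → ρ ⊗ ⟨ a , b , c ⟩ ≡ ⟨ c , a + c , b + c ⟩
    ρ⊗ a b c = cong₃ (l₀ a b c) (l₁ a b c) (l₂ a b c)
      where
      l₀ = solve 3 (λ d e f → con 0ℤ :* d :+ (con 1ℤ :* f :+ con 0ℤ :* e) :+ con 0ℤ :* f := f) refl
      l₁ = solve 3 (λ d e f → con 0ℤ :* e :+ con 1ℤ :* d :+ (con 1ℤ :* f :+ con 0ℤ :* e) :+ con (pos 2) :* con 0ℤ :* f := d :+ f) refl
      l₂ = solve 3 (λ d e f → con 0ℤ :* f :+ con 1ℤ :* e :+ con 0ℤ :* d :+ (con 1ℤ :* f :+ con 0ℤ :* e) :+ con (pos 2) :* con 0ℤ :* f := e :+ f) refl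

    ρ⁻¹⊗ : ∀ a b c → ρ⁻¹ ⊗ ⟨ a , b , c ⟩ ≡ ⟨ b - a , c - a , a ⟩
    ρ⁻¹⊗ a b c = cong₃ (l₀ a b c) (l₁ a b c) (l₂ a b c)
      where
      l₀ = solve 3 (λ d e f → :- con 1ℤ :* d :+ (:- con 1ℤ :* f :+ con 1ℤ :* e) :+ con 1ℤ :* f := e :- d) refl
      l₁ = solve 3 (λ d e f → :- con 1ℤ :* e :+ :- con 1ℤ :* d :+ (:- con 1ℤ :* f :+ con 1ℤ :* e) :+ con (pos 2) :* con 1ℤ :* f := f :- d) refl
      l₂ = solve 3 (λ d e f → :- con 1ℤ :* f :+ :- con 1ℤ :* e :+ con 1ℤ :* d :+ (:- con 1ℤ :* f :+ con 1ℤ :* e) :+ con (pos 2) :* con 1ℤ :* f := d) refl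

    size-ρ : ∀ w → size (ρ ⊗ w) ≡ size w + (Q₁ w + Q₁ w)
    size-ρ ⟨ a , b , c ⟩ = trans (cong size (ρ⊗ a b c)) (l a b c)
      where
      l = solve 3 (λ a b c → let x = c ; y = a :+ c ; z = b :+ c ; q = c :* (c :+ c :+ c :+ c :+ c :+ c :+ c :+ c :+ a :+ a :+ a :+ a :+ a :+ b :+ b :+ b :+ b :+ b :+ b :+ b :+ b :+ b) :+ a :* (b :+ b :+ b :+ b :- a) :+ b :* b in
          (x :+ x :- y) :* (x :+ x :- y) :+ (y :+ z :+ z) :* (y :+ z :+ z) :+ (x :+ z) :* (x :+ z) :+ (x :* x :+ x :* x :+ x :* x) :+ (y :+ y) :* (y :+ y) :+ (z :* z :+ z :* z :+ z :* z)
        := (a :+ a :- b) :* (a :+ a :- b) :+ (b :+ c :+ c) :* (b :+ c :+ c) :+ (a :+ c) :* (a :+ c) :+ (a :* a :+ a :* a :+ a :* a) :+ (b :+ b) :* (b :+ b) :+ (c :* c :+ c :* c :+ c :* c) :+ (q :+ q)) refl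

    size-ρ⁻¹ : ∀ w → size (ρ⁻¹ ⊗ w) ≡ size w + (Q₂ w + Q₂ w)
    size-ρ⁻¹ ⟨ a , b , c ⟩ = trans (cong size (ρ⁻¹⊗ a b c)) (l a b c)
      where
      l = solve 3 (λ a b c → let x = b :- a ; y = c :- a ; z = a ; q = a :* (a :+ a :- b :- b :- b :- c :- c :- c) :+ b :* (b :- c :- c :- c :- c) :- c :* c in
          (x :+ x :- y) :* (x :+ x :- y) :+ (y :+ z :+ z) :* (y :+ z :+ z) :+ (x :+ z) :* (x :+ z) :+ (x :* x :+ x :* x :+ x :* x) :+ (y :+ y) :* (y :+ y) :+ (z :* z :+ z :* z :+ z :* z)
        := (a :+ a :- b) :* (a :+ a :- b) :+ (b :+ c :+ c) :* (b :+ c :+ c) :+ (a :+ c) :* (a :+ c) :+ (a :* a :+ a :* a :+ a :* a) :+ (b :+ b) :* (b :+ b) :+ (c :* c :+ c :* c :+ c :* c) :+ (q :+ q)) refl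

-- Units of ℤ[ρ] modulo squares, and the prime above 2.

module CubicUnits where
  open IntegerArithmetic
  open IntegralModels using (prime-divisor)
  open TernaryForms
  open CubicRing
  open EuclideanDivision
  open import Data.Nat using (ℕ; zero; suc; z≤n; s≤s)
  import Data.Nat as ℕ
  import Data.Nat.Properties as ℕ
  import Data.Nat.Divisibility as ℕ
  open import Data.Nat.Primality using (Prime; prime[2])
  open import Data.Bool using (T)
  open import Data.Integer using (ℤ; 0ℤ; 1ℤ; _+_; _*_; _-_; -_; _≤_; _<_; _≤ᵇ_; _^_; -[1+_]; +≤+; -≤+; -≤-; +<+; nonNegative) renaming (+_ to pos; ∣_∣ to abs)
  import Data.Integer as ℤ hiding (+_)
  open import Data.Integer.Properties
  open import Data.Integer.Divisibility.Signed using (_∣_; divides; ∣ᵤ⇒∣; _∣?_)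
  open import Data.List.Base using (List; []; _∷_; applyUpTo)
  open import Data.List.Relation.Unary.All as All using (All; all?)
  open import Data.List.Relation.Unary.Any as Any using (Any; any?; here; there)
  open import Data.List.Membership.Propositional using (_∈_)
  open import Data.List.Membership.Propositional.Properties using (∈-applyUpTo⁺)
  open import Relation.Nullary.Decidable using (from-yes; map′; _×-dec_; _⊎-dec_; _→-dec_)
  open import Data.Integer.Tactic.RingSolver using (solve-∀)
  import Tactic.RingSolver as ρSolver
  open ℤS using (solve; con; _:+_; _:*_; _:-_; :-_; _:=_)

  Bounded : ℕ → ℤ → Set
  Bounded K v = - pos K ≤ v × v ≤ pos K

  -- 10 v = K x with x in a cell of the grid.
  grid-cell : ∀ K v → Bounded K v → ∃[ g ] g ∈ grid × pos 10 * v ∈[ cell g ]· pos K ^ 1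
  grid-cell K v (l , u) = from (locate 19 (- pos 10) (pos 10 * v) (pos K ^ 1)
      (subst (_≤ pos 10 * v) (trans (l₁ (pos K)) (cong (- pos 10 *_) (sym (^-identityʳ (pos K))))) (*-monoˡ-≤-nonNeg (pos 10) l))
      (subst (pos 10 * v ≤_) (cong (pos 10 *_) (sym (^-identityʳ (pos K)))) (*-monoˡ-≤-nonNeg (pos 10) u)))
    where
    l₁ = solve 1 (λ k → con (pos 10) :* :- k := :- con (pos 10) :* k) refl
    from : Located 19 (- pos 10) (pos 10 * v) (pos K ^ 1) → ∃[ g ] g ∈ grid × pos 10 * v ∈[ cell g ]· pos K ^ 1
    from (j , j<20 , lo , up) = pos j - pos 10 , ∈-applyUpTo⁺ (λ k → pos k - pos 10) j<20 ,
      subst (λ g → g * pos K ^ 1 ≤ pos 10 * v) (+-comm (- pos 10) (pos j)) lo ,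
      subst (λ g → pos 10 * v ≤ (g + 1ℤ) * pos K ^ 1) (+-comm (- pos 10) (pos j)) up

  on-face : ∀ K → pos 10 * pos K ∈[ face ]· pos K ^ 1
  on-face K = ≤-reflexive (cong (pos 10 *_) (^-identityʳ (pos K))) , ≤-reflexive (cong (pos 10 *_) (sym (^-identityʳ (pos K))))

  -- With K the largest absolute coordinate: ρ or ρ⁻¹ lowers the size, or the norm is at least 0.126
  -- K³ in absolute value, which a unit can only afford for small K.
  Outcome : ℕ → ℤ → ℤ → ℤ → Set
  Outcome K a b c = eval q₁ a b c < 0ℤ ⊎ eval q₂ a b c < 0ℤ ⊎ 126 ℕ.* K ℕ.^ 3 ℕ.≤ 1000 ℕ.* abs (N ⟨ a , b , c ⟩)

  private
    pos-^ : ∀ n d → pos n ^ d ≡ pos (n ℕ.^ d)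
    pos-^ n zero = refl
    pos-^ n (suc d) = trans (cong (pos n *_) (pos-^ n d)) (sym (pos-* n (n ℕ.^ d)))

    ≤-abs : ∀ m x → pos m ≤ x → m ℕ.≤ abs x
    ≤-abs m (pos n) (+≤+ h) = h

    negative-form : ∀ K {x y h} → K ≢ 0 → T (h ≤ᵇ - 1ℤ) → x ≤ h * pos K ^ 2 → x ≡ pos 100 * y → y < 0ℤ
    negative-form K {x} {y} {h} K≢0 h<0 x≤ x≡ = *-cancelˡ-<-nonNeg (pos 100) (subst (_< 0ℤ) x≡
      (≤-<-trans x≤ (≤-<-trans (*-monoʳ-≤-nonNeg (pos K ^ 2) {{nonNegative (<⇒≤ 0<K²)}} (≤ᵇ⇒≤ {h} {ℤ.- 1ℤ} h<0))
        (subst (_< 0ℤ) (sym (-1*i≡-i (pos K ^ 2))) (neg-mono-< 0<K²)))))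
      where
      0<K² : 0ℤ < pos K ^ 2
      0<K² = subst (0ℤ <_) (sym (pos-^ K 2)) (+<+ (ℕ.m^n>0 K {{ℕ.≢-nonZero K≢0}} 2))

    outcome : ∀ K a b c i j k → K ≢ 0 → Reducible i j k → pos 10 * a ∈[ i ]· pos K ^ 1 → pos 10 * b ∈[ j ]· pos K ^ 1 → pos 10 * c ∈[ k ]· pos K ^ 1 → Outcome K a b c
    outcome K a b c i j k K≢0 red p q r = cases red
      where
      x = pos 10 * a
      y = pos 10 * b
      z = pos 10 * c
      E = enclose norm-form i j k
      in-N : eval norm-form x y z ∈[ E ]· pos K ^ 3
      in-N = enclose-sound K norm-form {i} {j} {k} {x} {y} {z} p q r
      in-q₁ : eval q₁ x y z ∈[ enclose q₁ i j k ]· pos K ^ 2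
      in-q₁ = enclose-sound K q₁ {i} {j} {k} {x} {y} {z} p q r
      in-q₂ : eval q₂ x y z ∈[ enclose q₂ i j k ]· pos K ^ 2
      in-q₂ = enclose-sound K q₂ {i} {j} {k} {x} {y} {z} p q r
      l₁ = solve 3 (λ a b c → let x = con (pos 10) :* a ; y = con (pos 10) :* b ; z = con (pos 10) :* c in
           z :* (z :+ z :+ z :+ z :+ z :+ z :+ z :+ z :+ x :+ x :+ x :+ x :+ x :+ y :+ y :+ y :+ y :+ y :+ y :+ y :+ y :+ y) :+ x :* (y :+ y :+ y :+ y :- x) :+ y :* y
           := con (pos 100) :* (c :* (c :+ c :+ c :+ c :+ c :+ c :+ c :+ c :+ a :+ a :+ a :+ a :+ a :+ b :+ b :+ b :+ b :+ b :+ b :+ b :+ b :+ b) :+ a :* (b :+ b :+ b :+ b :- a) :+ b :* b)) refl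
      l₂ = solve 3 (λ a b c → let x = con (pos 10) :* a ; y = con (pos 10) :* b ; z = con (pos 10) :* c in
           x :* (x :+ x :- y :- y :- y :- z :- z :- z) :+ y :* (y :- z :- z :- z :- z) :- z :* z := con (pos 100) :* (a :* (a :+ a :- b :- b :- b :- c :- c :- c) :+ b :* (b :- c :- c :- c :- c) :- c :* c)) refl
      l₃ = solve 3 (λ a b c → let x = con (pos 10) :* a ; y = con (pos 10) :* b ; z = con (pos 10) :* c in
           x :* (x :* (x :+ y :+ z :+ z :+ z) :- y :* (y :+ z :+ z :+ z :+ z) :- z :* z) :+ y :* (y :* (y :+ z) :- z :* z) :+ z :* (z :* z)
           := con (pos 1000) :* (a :* (a :* (a :+ b :+ c :+ c :+ c) :- b :* (b :+ c :+ c :+ c :+ c) :- c :* c) :+ b :* (b :* (b :+ c) :- c :* c) :+ c :* (c :* c))) refl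
      0≤K³ : 0ℤ ≤ pos K ^ 3
      0≤K³ = subst (0ℤ ≤_) (sym (pos-^ K 3)) (+≤+ z≤n)
      126K³ : pos 126 * pos K ^ 3 ≡ pos (126 ℕ.* K ℕ.^ 3)
      126K³ = trans (cong (pos 126 *_) (pos-^ K 3)) (sym (pos-* 126 (K ℕ.^ 3)))
      abs-1000 : abs (eval norm-form x y z) ≡ 1000 ℕ.* abs (N ⟨ a , b , c ⟩)
      abs-1000 = trans (cong abs (l₃ a b c)) (abs-* (pos 1000) (N ⟨ a , b , c ⟩))
      cases : Reducible i j k → Outcome K a b c
      cases (inj₁ h) = inj₁ (negative-form K {h = hi (enclose q₁ i j k)} K≢0 h (proj₂ in-q₁) (l₁ a b c))
      cases (inj₂ (inj₁ h)) = inj₂ (inj₁ (negative-form K {h = hi (enclose q₂ i j k)} K≢0 h (proj₂ in-q₂) (l₂ a b c)))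
      cases (inj₂ (inj₂ (inj₁ h))) = inj₂ (inj₂ (subst (126 ℕ.* K ℕ.^ 3 ℕ.≤_) abs-1000 (≤-abs _ _
        (subst (_≤ eval norm-form x y z) 126K³ (≤-trans (*-monoʳ-≤-nonNeg (pos K ^ 3) {{nonNegative 0≤K³}} (≤ᵇ⇒≤ {pos 126} {lo E} h)) (proj₁ in-N))))))
      cases (inj₂ (inj₂ (inj₂ h))) = inj₂ (inj₂ (subst (126 ℕ.* K ℕ.^ 3 ℕ.≤_) (trans (∣-i∣≡∣i∣ (eval norm-form x y z)) abs-1000) (≤-abs _ _
        (subst (_≤ - eval norm-form x y z) (trans (l (pos K ^ 3)) 126K³) (neg-mono-≤ (≤-trans (proj₂ in-N) (*-monoʳ-≤-nonNeg (pos K ^ 3) {{nonNegative 0≤K³}} (≤ᵇ⇒≤ {hi E} { - pos 126} h))))))))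
        where
        l = solve 1 (λ w → :- (:- con (pos 126) :* w) := con (pos 126) :* w) refl

  Face : ℕ → ℤ → ℤ → ℤ → Set
  Face K a b c = a ≡ pos K ⊎ b ≡ pos K ⊎ c ≡ pos K

  face-outcome : ∀ K a b c → K ≢ 0 → Bounded K a → Bounded K b → Bounded K c → Face K a b c → Outcome K a b c
  face-outcome K a b c K≢0 Ba Bb Bc = [ first , [ second , third ]′ ]′
    where
    Cell : ℤ → Set
    Cell v = ∃[ g ] g ∈ grid × pos 10 * v ∈[ cell g ]· pos K ^ 1
    pick : ∀ {g h} → g ∈ grid → h ∈ grid → ReducibleFaces g h
    pick g∈ h∈ = All.lookup (All.lookup all-reducible g∈) h∈
    on : ∀ {v} → v ≡ pos K → pos 10 * v ∈[ face ]· pos K ^ 1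
    on refl = on-face K
    first : a ≡ pos K → Outcome K a b c
    first a≡ = go (grid-cell K b Bb) (grid-cell K c Bc)
      where
      go : Cell b → Cell c → Outcome K a b c
      go (g , g∈ , p) (h , h∈ , q) = outcome K a b c face (cell g) (cell h) K≢0 (proj₁ (pick g∈ h∈)) (on a≡) p q
    second : b ≡ pos K → Outcome K a b c
    second b≡ = go (grid-cell K a Ba) (grid-cell K c Bc)
      where
      go : Cell a → Cell c → Outcome K a b c
      go (g , g∈ , p) (h , h∈ , q) = outcome K a b c (cell g) face (cell h) K≢0 (proj₁ (proj₂ (pick g∈ h∈))) p (on b≡) q
    third : c ≡ pos K → Outcome K a b c
    third c≡ = go (grid-cell K a Ba) (grid-cell K b Bb)
      where
      go : Cell a → Cell b → Outcome K a b c
      go (g , g∈ , p) (h , h∈ , q) = outcome K a b c (cell g) (cell h) face K≢0 (proj₂ (proj₂ (pick g∈ h∈))) p q (on c≡)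

  private
    bounded-neg : ∀ {K v} → Bounded K v → Bounded K (- v)
    bounded-neg {K} {v} (l , u) = neg-mono-≤ u , subst (- v ≤_) (neg-involutive (pos K)) (neg-mono-≤ l)

    bounded-abs : ∀ {K} v → abs v ℕ.≤ K → Bounded K v
    bounded-abs (pos n) h = ≤-trans (neg-≤-pos {_} {0}) (+≤+ z≤n) , +≤+ h
    bounded-abs {suc K} -[1+ n ] (s≤s h) = -≤- h , -≤+

    signed-abs : ∀ v → v ≡ pos (abs v) ⊎ - v ≡ pos (abs v)
    signed-abs (pos n)  = inj₁ refl
    signed-abs -[1+ n ] = inj₂ refl

    -- The quadratic forms are even and the norm is odd, so faces with a coordinate -K need no
    -- enclosures of their own.
    negate : ∀ K a b c → Outcome K (- a) (- b) (- c) → Outcome K a b c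
    negate K a b c (inj₁ h) = inj₁ (subst (_< 0ℤ) (l a b c) h)
      where
      l = solve 3 (λ a b c → let x = :- a ; y = :- b ; z = :- c in
           z :* (z :+ z :+ z :+ z :+ z :+ z :+ z :+ z :+ x :+ x :+ x :+ x :+ x :+ y :+ y :+ y :+ y :+ y :+ y :+ y :+ y :+ y) :+ x :* (y :+ y :+ y :+ y :- x) :+ y :* y
           := c :* (c :+ c :+ c :+ c :+ c :+ c :+ c :+ c :+ a :+ a :+ a :+ a :+ a :+ b :+ b :+ b :+ b :+ b :+ b :+ b :+ b :+ b) :+ a :* (b :+ b :+ b :+ b :- a) :+ b :* b) refl
    negate K a b c (inj₂ (inj₁ h)) = inj₂ (inj₁ (subst (_< 0ℤ) (l a b c) h))
      where
      l = solve 3 (λ a b c → let x = :- a ; y = :- b ; z = :- c in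
           x :* (x :+ x :- y :- y :- y :- z :- z :- z) :+ y :* (y :- z :- z :- z :- z) :- z :* z := a :* (a :+ a :- b :- b :- b :- c :- c :- c) :+ b :* (b :- c :- c :- c :- c) :- c :* c) refl
    negate K a b c (inj₂ (inj₂ h)) = inj₂ (inj₂ (subst (λ m → 126 ℕ.* K ℕ.^ 3 ℕ.≤ 1000 ℕ.* m) (trans (cong abs (l a b c)) (∣-i∣≡∣i∣ (N ⟨ a , b , c ⟩))) h))
      where
      l = solve 3 (λ a b c → let x = :- a ; y = :- b ; z = :- c in
           x :* (x :* (x :+ y :+ z :+ z :+ z) :- y :* (y :+ z :+ z :+ z :+ z) :- z :* z) :+ y :* (y :* (y :+ z) :- z :* z) :+ z :* (z :* z)
           := :- (a :* (a :* (a :+ b :+ c :+ c :+ c) :- b :* (b :+ c :+ c :+ c :+ c) :- c :* c) :+ b :* (b :* (b :+ c) :- c :* c) :+ c :* (c :* c))) refl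

  any-outcome : ∀ a b c → let K = abs a ℕ.⊔ abs b ℕ.⊔ abs c in K ≢ 0 → Outcome K a b c
  any-outcome a b c K≢0 = [ (λ h → signed a h inj₁ inj₁) , [ (λ h → signed b h (λ e → inj₂ (inj₁ e)) (λ e → inj₂ (inj₁ e)))
                          , (λ h → signed c h (λ e → inj₂ (inj₂ e)) (λ e → inj₂ (inj₂ e))) ]′ ]′ maximal
    where
    K = abs a ℕ.⊔ abs b ℕ.⊔ abs c
    Ba : Bounded K a
    Ba = bounded-abs a (ℕ.≤-trans (ℕ.m≤m⊔n (abs a) (abs b)) (ℕ.m≤m⊔n _ (abs c)))
    Bb : Bounded K b
    Bb = bounded-abs b (ℕ.≤-trans (ℕ.m≤n⊔m (abs a) (abs b)) (ℕ.m≤m⊔n _ (abs c)))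
    Bc : Bounded K c
    Bc = bounded-abs c (ℕ.m≤n⊔m (abs a ℕ.⊔ abs b) (abs c))
    maximal : abs a ≡ K ⊎ abs b ≡ K ⊎ abs c ≡ K
    maximal with ℕ.⊔-sel (abs a ℕ.⊔ abs b) (abs c)
    ... | inj₂ e = inj₂ (inj₂ (sym e))
    ... | inj₁ e with ℕ.⊔-sel (abs a) (abs b)
    ...   | inj₁ e′ = inj₁ (sym (trans e e′))
    ...   | inj₂ e′ = inj₂ (inj₁ (sym (trans e e′)))
    signed : ∀ v → abs v ≡ K → (v ≡ pos K → Face K a b c) → (- v ≡ pos K → Face K (- a) (- b) (- c)) → Outcome K a b c
    signed v v≡K plus minus = [ (λ e → face-outcome K a b c K≢0 Ba Bb Bc (plus (trans e (cong pos v≡K)))) ,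
      (λ e → negate K a b c (face-outcome K (- a) (- b) (- c) K≢0 (bounded-neg Ba) (bounded-neg Bb) (bounded-neg Bc) (minus (trans e (cong pos v≡K))))) ]′ (signed-abs v)

  box : List ℤ
  box = - 1ℤ ∷ 0ℤ ∷ 1ℤ ∷ []

  ∈-box : ∀ v → abs v ℕ.≤ 1 → v ∈ box
  ∈-box (pos 0) _ = there (here refl)
  ∈-box (pos 1) _ = there (there (here refl))
  ∈-box (pos (suc (suc n))) (s≤s ())
  ∈-box -[1+ 0 ] _ = here refl
  ∈-box -[1+ suc n ] (s≤s ())

  private
    infix 4 _≟ρ_
    _≟ρ_ : ∀ (x y : ℤ[ρ]) → Dec (x ≡ y)
    ⟨ a , b , c ⟩ ≟ρ ⟨ d , e , f ⟩ = map′ (λ (p , q , r) → cong₃ p q r) (λ e → cong co₀ e , cong co₁ e , cong co₂ e) ((a ℤ.≟ d) ×-dec (b ℤ.≟ e) ×-dec (c ℤ.≟ f))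

    roots : List ℤ[ρ]
    roots = 𝟙 ∷ ρ ∷ ρ⁻¹ ∷ ρ ⊗ ρ ∷ ρ⁻¹ ⊗ ρ⁻¹ ∷ []

    SmallClass : ℤ → ℤ → ℤ → Set
    SmallClass a b c = N ⟨ a , b , c ⟩ ≡ 1ℤ → Any (λ v → ⟨ a , b , c ⟩ ≡ v ⊗ v ⊎ ⟨ a , b , c ⟩ ≡ ρ ⊗ (v ⊗ v)) roots

    small-classes : All (λ a → All (λ b → All (SmallClass a b) box) box) box
    small-classes = from-yes (all? (λ a → all? (λ b → all? (λ c → (N ⟨ a , b , c ⟩ ℤ.≟ 1ℤ) →-dec any? (λ v → (⟨ a , b , c ⟩ ≟ρ v ⊗ v) ⊎-dec (⟨ a , b , c ⟩ ≟ρ ρ ⊗ (v ⊗ v))) roots) box) box) box)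

  -- Multiplication by ρ±¹ decreases the size of a unit until its coordinates are at most 1.
  unit-class : ∀ fuel w → abs (size w) ℕ.< fuel → N w ≡ 1ℤ → SquareClass w
  unit-class (suc fuel) w@(⟨ a , b , c ⟩) size<fuel Nw≡1 = by-size ((abs a ℕ.⊔ abs b ℕ.⊔ abs c) ℕ.≤? 1)
    where
    K = abs a ℕ.⊔ abs b ℕ.⊔ abs c
    smaller : ∀ {w′ q} → size w′ ≡ size w + (q + q) → q < 0ℤ → abs (size w′) ℕ.< fuel
    smaller {w′} {q} eq q<0 = ℕ.<-≤-trans (drop‿+<+ (subst₂ _<_ (sym (0≤i⇒+∣i∣≡i (0≤size w′))) (sym (0≤i⇒+∣i∣≡i (0≤size w)))
      (subst₂ _<_ (sym eq) (+-identityʳ (size w)) (+-monoʳ-< (size w) (+-mono-< q<0 q<0))))) (ℕ.≤-pred size<fuel)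
    N-ρ : N (ρ ⊗ w) ≡ 1ℤ
    N-ρ = trans (N-⊗ ρ w) (trans (*-identityˡ (N w)) Nw≡1)
    N-ρ⁻¹ : N (ρ⁻¹ ⊗ w) ≡ 1ℤ
    N-ρ⁻¹ = trans (N-⊗ ρ⁻¹ w) (trans (*-identityˡ (N w)) Nw≡1)
    by-size : Dec (K ℕ.≤ 1) → SquareClass w
    by-size (yes K≤1) = Any.satisfied (All.lookup (All.lookup (All.lookup small-classes
      (∈-box a (ℕ.≤-trans (ℕ.m≤m⊔n (abs a) (abs b)) (ℕ.≤-trans (ℕ.m≤m⊔n _ (abs c)) K≤1))))
      (∈-box b (ℕ.≤-trans (ℕ.m≤n⊔m (abs a) (abs b)) (ℕ.≤-trans (ℕ.m≤m⊔n _ (abs c)) K≤1))))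
      (∈-box c (ℕ.≤-trans (ℕ.m≤n⊔m (abs a ℕ.⊔ abs b) (abs c)) K≤1)) Nw≡1)
    by-size (no K≰1) = by-outcome (any-outcome a b c (λ K≡0 → K≰1 (subst (ℕ._≤ 1) (sym K≡0) z≤n)))
      where
      by-outcome : Outcome K a b c → SquareClass w
      by-outcome (inj₁ h) = class-ρ (unit-class fuel (ρ ⊗ w) (smaller {ρ ⊗ w} {Q₁ w} (size-ρ w) h) N-ρ)
      by-outcome (inj₂ (inj₁ h)) = class-ρ⁻¹ (unit-class fuel (ρ⁻¹ ⊗ w) (smaller {ρ⁻¹ ⊗ w} {Q₂ w} (size-ρ⁻¹ w) h) N-ρ⁻¹)
      -- For a unit the bound reads 126 K³ ≤ 1000, while K ≥ 2 gives at least 126 · 8 = 1008.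
      by-outcome (inj₂ (inj₂ h)) = contradiction (ℕ.≤-trans (ℕ.*-monoʳ-≤ 126 (ℕ.^-monoˡ-≤ 3 (ℕ.≰⇒> K≰1)))
        (subst (λ m → 126 ℕ.* K ℕ.^ 3 ℕ.≤ 1000 ℕ.* abs m) Nw≡1 h)) (ℕ.<⇒≱ (ℕ.m≤m+n 1001 7))

  φ : ℤ[ρ]
  φ = ⟨ - 1ℤ , 1ℤ , 0ℤ ⟩

  private
    EvenCheck : ℤ → ℤ → ℤ → Set
    EvenCheck i j k = pos 2 ∣ N ⟨ i , j , k ⟩ → pos 2 ∣ i + j + k

    even-checked : AllResidues EvenCheck 2
    even-checked = from-yes (all? (λ i → all? (λ j → all? (λ k → (pos 2 ∣? N ⟨ i , j , k ⟩) →-dec (pos 2 ∣? (i + j + k)))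
      (applyUpTo pos 2)) (applyUpTo pos 2)) (applyUpTo pos 2))

  -- φ is the prime above 2: a + b ρ + c ρ² ≡ a + b + c modulo φ, and 2 = φ² (φ + 2).
  even-norm : ∀ x → pos 2 ∣ N x → φ ∣ρ x
  even-norm ⟨ a , b , c ⟩ h = from (residue 2 a) (residue 2 b) (residue 2 c)
    where
    Residue : ℤ → Set
    Residue a = ∃[ i ] i ∈ applyUpTo pos 2 × pos 2 ∣ a - i
    divisible : pos 2 ∣ a + b + c → φ ∣ρ ⟨ a , b , c ⟩
    divisible (divides k e) = ⟨ b + c - k , c , k ⟩ , cong₃ (lin 1ℤ (l₀ a b c k) e) (l₁ b c k) (l₂ b c k)
      where
      l₀ = solve 4 (λ a b c k → a :- ((b :+ c :- k) :* :- con 1ℤ :+ (c :* con 0ℤ :+ k :* con 1ℤ) :+ k :* con 0ℤ) := con 1ℤ :* (a :+ b :+ c :- k :* con (pos 2))) refl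
      l₁ = solve 3 (λ b c k → b := (b :+ c :- k) :* con 1ℤ :+ c :* :- con 1ℤ :+ (c :* con 0ℤ :+ k :* con 1ℤ) :+ con (pos 2) :* k :* con 0ℤ) refl
      l₂ = solve 3 (λ b c k → c := (b :+ c :- k) :* con 0ℤ :+ c :* con 1ℤ :+ k :* :- con 1ℤ :+ (c :* con 0ℤ :+ k :* con 1ℤ) :+ con (pos 2) :* k :* con 0ℤ) refl
    from : Residue a → Residue b → Residue c → φ ∣ρ ⟨ a , b , c ⟩
    from (i , i∈ , p) (j , j∈ , q) (k , k∈ , r) = divisible (∣-combination 1ℤ 1ℤ (l a b c i j k) (∣-combination 1ℤ 1ℤ refl p (∣-combination 1ℤ 1ℤ refl q r))
      (All.lookup (All.lookup (All.lookup even-checked i∈) j∈) k∈ (∣-combination 1ℤ (- 1ℤ) (l′ (N ⟨ a , b , c ⟩) (N ⟨ i , j , k ⟩)) h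
        (eval-cong (pos 2) norm-form {a} {b} {c} {i} {j} {k} p q r))))
      where
      l = solve 6 (λ a b c i j k → a :+ b :+ c := con 1ℤ :* (con 1ℤ :* (a :- i) :+ con 1ℤ :* (con 1ℤ :* (b :- j) :+ con 1ℤ :* (c :- k))) :+ con 1ℤ :* (i :+ j :+ k)) refl
      l′ = solve 2 (λ x y → y := con 1ℤ :* x :+ :- con 1ℤ :* (x :- y)) refl

  -- Irrationality of √2 by descent; it excludes an unpaired factor φ in an element whose norm is a
  -- nonzero square.
  no-√2 : ∀ fuel s t → abs s ℕ.< fuel → t * t + t * t ≡ s * s → s ≡ 0ℤ
  no-√2 (suc fuel) s t s<fuel eq = halve (s ℤ.≟ 0ℤ) (2∣⇒even (euclid² prime[2] s (even⇒2∣ (t * t) (sym eq))))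
    where
    halve : Dec (s ≡ 0ℤ) → ∃[ k ] s ≡ k + k → s ≡ 0ℤ
    halve (yes s≡0) _ = s≡0
    halve (no s≢0) (k , s≡) = halve′ (2∣⇒even (euclid² prime[2] t (even⇒2∣ (k * k) t²≡)))
      where
      t²≡ : t * t ≡ k * k + k * k
      t²≡ = *-cancelˡ-≡ (pos 2) _ _ (trans (l t) (trans eq (trans (cong (λ s → s * s) s≡) (l′ k))))
        where
        l = solve 1 (λ t → con (pos 2) :* (t :* t) := t :* t :+ t :* t) refl
        l′ = solve 1 (λ k → (k :+ k) :* (k :+ k) := con (pos 2) :* (k :* k :+ k :* k)) refl
      halve′ : ∃[ j ] t ≡ j + j → s ≡ 0ℤ
      halve′ (j , t≡) = trans s≡ (cong (λ k → k + k) (no-√2 fuel k j k<fuel (*-cancelˡ-≡ (pos 2) _ _ (trans (l j) (trans (cong (λ t → t * t) (sym t≡)) (trans t²≡ (l′ k)))))))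
        where
        l = solve 1 (λ t → con (pos 2) :* (t :* t :+ t :* t) := (t :+ t) :* (t :+ t)) refl
        l′ = solve 1 (λ k → k :* k :+ k :* k := con (pos 2) :* (k :* k)) refl
        abs-s : abs s ≡ abs k ℕ.* 2
        abs-s = trans (cong abs (trans s≡ (l″ k))) (abs-* k (pos 2))
          where
          l″ = solve 1 (λ k → k :+ k := k :* con (pos 2)) refl
        k<fuel : abs k ℕ.< fuel
        k<fuel = ℕ.<-≤-trans (subst (abs k ℕ.<_) (sym abs-s) (ℕ.m<m*n (abs k) 2 {{ℕ.≢-nonZero (λ e → s≢0 (trans s≡ (cong (λ k → k + k) (∣i∣≡0⇒i≡0 {k} e))))}} (s≤s (s≤s z≤n)))) (ℕ.≤-pred s<fuel)

  private
    regroup : ∀ w τ b → w ⊗ (τ ⊗ τ) ⊗ (b ⊗ b) ≡ w ⊗ (τ ⊗ b ⊗ (τ ⊗ b))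
    regroup = ρSolver.solve-∀ ρ-ring

  OnlyTwo : ℤ[ρ] → Set
  OnlyTwo δ = ∀ {q} → Prime q → pos q ∣ N δ → q ≡ 2

  record Stripped (δ : ℤ[ρ]) : Set where
    constructor stripped
    field
      w τ    : ℤ[ρ]
      unit   : abs (N w) ≡ 1
      factor : δ ≡ w ⊗ (τ ⊗ τ) ⊎ δ ≡ φ ⊗ (w ⊗ (τ ⊗ τ))

  -- An even norm means a factor φ, whose removal halves the norm as N φ = 2. Pairs of factors φ are
  -- collected in τ, so at most one remains outside.
  strip : ∀ fuel δ → abs (N δ) ℕ.< fuel → N δ ≢ 0ℤ → OnlyTwo δ → Stripped δ
  strip (suc fuel) δ Nδ<fuel Nδ≢0 only-2 = cases (abs (N δ) ℕ.≟ 1)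
    where
    cases : Dec (abs (N δ) ≡ 1) → Stripped δ
    cases (yes unit) = stripped δ 𝟙 unit (inj₁ (l δ))
      where
      l : ∀ δ → δ ≡ δ ⊗ (𝟙 ⊗ 𝟙)
      l = ρSolver.solve-∀ ρ-ring
    cases (no ≢1) = from-prime (prime-divisor (abs (N δ)) {{ℕ.≢-nonZero (λ e → Nδ≢0 (∣i∣≡0⇒i≡0 {N δ} e))}} ≢1)
      where
      from-prime : ∃[ q ] Prime q × q ℕ.∣ abs (N δ) → Stripped δ
      from-prime (q , isPrime , q∣N) = divided (even-norm δ (subst (λ q → pos q ∣ N δ) (only-2 isPrime (∣ᵤ⇒∣ {pos q} q∣N)) (∣ᵤ⇒∣ {pos q} q∣N)))
        where
        divided : φ ∣ρ δ → Stripped δ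
        divided (δ′ , δ≡) = recombine (strip fuel δ′ smaller Nδ′≢0 λ isPrime′ h → only-2 isPrime′ (∣-multiple (pos 2) (trans Nδ≡ (*-comm (N δ′) (pos 2))) h))
          where
          Nδ≡ : N δ ≡ N δ′ * pos 2
          Nδ≡ = trans (cong N δ≡) (N-⊗ δ′ φ)
          Nδ′≢0 : N δ′ ≢ 0ℤ
          Nδ′≢0 e = Nδ≢0 (trans Nδ≡ (cong (_* pos 2) e))
          smaller : abs (N δ′) ℕ.< fuel
          smaller = ℕ.<-≤-trans (subst (abs (N δ′) ℕ.<_) (sym (trans (cong abs Nδ≡) (abs-* (N δ′) (pos 2))))
            (ℕ.m<m*n (abs (N δ′)) 2 {{ℕ.≢-nonZero (λ e → Nδ′≢0 (∣i∣≡0⇒i≡0 {N δ′} e))}} (s≤s (s≤s z≤n)))) (ℕ.≤-pred Nδ<fuel)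
          recombine : Stripped δ′ → Stripped δ
          recombine (stripped w τ unit (inj₁ e)) = stripped w τ unit (inj₂ (trans δ≡ (trans (⊗-comm δ′ φ) (cong (φ ⊗_) e))))
          recombine (stripped w τ unit (inj₂ e)) = stripped w (φ ⊗ τ) unit (inj₁ (trans δ≡ (trans (cong (_⊗ φ) e) (l φ w τ))))
            where
            l : ∀ p w τ → p ⊗ (w ⊗ (τ ⊗ τ)) ⊗ p ≡ w ⊗ (p ⊗ τ ⊗ (p ⊗ τ))
            l p w τ = trans (cong (_⊗ p) (⊗-comm p (w ⊗ (τ ⊗ τ)))) (trans (⊗-assoc (w ⊗ (τ ⊗ τ)) p p)
              (trans (regroup w τ p) (cong (λ z → w ⊗ (z ⊗ z)) (⊗-comm τ p))))

  -- An element whose norm is a square, and which shares only primes above 2 with its cofactor and the root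
  -- of its norm, is σ² or ρ σ².
  square-class : ∀ β s → s ≢ 0ℤ → N β ≡ s * s → (∀ {δ} → δ ∣ρ β → δ ∣ρ adj β → δ ∣ρ emb s → OnlyTwo δ) → SquareClass β
  square-class β s s≢0 Nβ≡s² only-2 = from (square-up-to β s s≢0 Nβ≡s²)
    where
    sum-zero : ∀ m x → 0ℤ ≤ m → m + x * x ≡ 0ℤ → x ≡ 0ℤ
    sum-zero (pos m) x _ eq = x*x≡0⇒x≡0 x (nonneg-zero (x * x) (0≤x*x x) eq)
      where
      nonneg-zero : ∀ y → 0ℤ ≤ y → pos m + y ≡ 0ℤ → y ≡ 0ℤ
      nonneg-zero (pos y) _ e = cong pos (ℕ.m+n≡0⇒n≡0 m (+-injective e))
    from : SquareUpTo β s → SquareClass β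
    from S = stripped-case (strip _ δ ℕ.≤-refl Nδ≢0 (only-2 (β₁ ⊗ β₁ , trans β≡ (⊗-comm δ (β₁ ⊗ β₁))) δ∣adj δ∣s))
      where
      open SquareUpTo S
      Nδ≢0 : N δ ≢ 0ℤ
      Nδ≢0 e = s≢0 (x*x≡0⇒x≡0 s (trans (sym Nβ≡s²) (trans (cong N β≡) (trans (N-⊗ δ (β₁ ⊗ β₁)) (cong (_* N (β₁ ⊗ β₁)) e)))))
      stripped-case : Stripped δ → SquareClass β
      stripped-case (stripped w τ unit factor) = [ even-case , odd-case ]′ factor
        where
        t = N (τ ⊗ β₁)
        N-square : ∀ w → N (w ⊗ (τ ⊗ β₁ ⊗ (τ ⊗ β₁))) ≡ N w * (t * t)
        N-square w = trans (N-⊗ w (τ ⊗ β₁ ⊗ (τ ⊗ β₁))) (cong (N w *_) (N-⊗ (τ ⊗ β₁) (τ ⊗ β₁)))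
        sign : N w ≡ 1ℤ ⊎ N w ≡ - 1ℤ
        sign = signs (N w) unit
          where
          signs : ∀ x → abs x ≡ 1 → x ≡ 1ℤ ⊎ x ≡ - 1ℤ
          signs (pos 1) refl = inj₁ refl
          signs -[1+ 0 ] refl = inj₂ refl
        even-case : δ ≡ w ⊗ (τ ⊗ τ) → SquareClass β
        -- A unit part of norm -1 would mean s² = -t².
        even-case e = [ plus , (λ m → contradiction (minus m) s≢0) ]′ sign
          where
          β-square : β ≡ w ⊗ (τ ⊗ β₁ ⊗ (τ ⊗ β₁))
          β-square = trans β≡ (trans (cong (_⊗ (β₁ ⊗ β₁)) e) (regroup w τ β₁))
          minus : N w ≡ - 1ℤ → s ≡ 0ℤ
          minus m = sum-zero (t * t) s (0≤x*x t) (lin (- 1ℤ) (l t s) (trans (cong (_* (t * t)) (sym m)) (trans (sym (N-square w)) (trans (cong N (sym β-square)) Nβ≡s²))))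
            where
            l = solve 2 (λ t s → t :* t :+ s :* s :- con 0ℤ := :- con 1ℤ :* (:- con 1ℤ :* (t :* t) :- s :* s)) refl
          plus : N w ≡ 1ℤ → SquareClass β
          plus m = classes (unit-class _ w ℕ.≤-refl m)
            where
            l : ∀ v x → v ⊗ v ⊗ (x ⊗ x) ≡ v ⊗ x ⊗ (v ⊗ x)
            l = ρSolver.solve-∀ ρ-ring
            l′ : ∀ v x → ρ ⊗ (v ⊗ v) ⊗ (x ⊗ x) ≡ ρ ⊗ (v ⊗ x ⊗ (v ⊗ x))
            l′ = ρSolver.solve-∀ ρ-ring
            classes : SquareClass w → SquareClass β
            classes (v , inj₁ e) = v ⊗ (τ ⊗ β₁) , inj₁ (trans β-square (trans (cong (_⊗ (τ ⊗ β₁ ⊗ (τ ⊗ β₁))) e) (l v (τ ⊗ β₁))))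
            classes (v , inj₂ e) = v ⊗ (τ ⊗ β₁) , inj₂ (trans β-square (trans (cong (_⊗ (τ ⊗ β₁ ⊗ (τ ⊗ β₁))) e) (l′ v (τ ⊗ β₁))))
        odd-case : δ ≡ φ ⊗ (w ⊗ (τ ⊗ τ)) → SquareClass β
        -- An unpaired φ would mean s² = ±2t².
        odd-case e = contradiction ([ (λ m → no-√2 _ s t ℕ.≤-refl (trans (l₁ t) (trans (cong (λ n → pos 2 * (n * (t * t))) (sym m)) Nβ)))
          , (λ m → sum-zero (t * t + t * t) s (+-mono-≤ (0≤x*x t) (0≤x*x t)) (lin (- 1ℤ) (l₂ t s) (trans (cong (λ n → pos 2 * (n * (t * t))) (sym m)) Nβ))) ]′ sign) s≢0
          where
          Nβ : pos 2 * (N w * (t * t)) ≡ s * s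
          Nβ = trans (cong (pos 2 *_) (sym (N-square w))) (trans (sym (N-⊗ φ (w ⊗ (τ ⊗ β₁ ⊗ (τ ⊗ β₁)))))
            (trans (cong N (sym (trans β≡ (trans (cong (_⊗ (β₁ ⊗ β₁)) e) (l φ w τ β₁))))) Nβ≡s²))
            where
            l : ∀ p w τ b → p ⊗ (w ⊗ (τ ⊗ τ)) ⊗ (b ⊗ b) ≡ p ⊗ (w ⊗ (τ ⊗ b ⊗ (τ ⊗ b)))
            l p w τ b = trans (⊗-assoc p (w ⊗ (τ ⊗ τ)) (b ⊗ b)) (cong (p ⊗_) (regroup w τ b))
          l₁ = solve 1 (λ t → t :* t :+ t :* t := con (pos 2) :* (con 1ℤ :* (t :* t))) refl
          l₂ = solve 2 (λ t s → t :* t :+ t :* t :+ s :* s :- con 0ℤ := :- con 1ℤ :* (con (pos 2) :* (:- con 1ℤ :* (t :* t)) :- s :* s)) refl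

-- Halving points of y² = u³ - 4u² + 16, and the drop in height.

module TwoDescent where
  open IntegerArithmetic
  open CubicRing
  open EuclideanDivision
  open CubicUnits
  open import Data.Nat using (ℕ; zero; suc; z≤n; s≤s)
  import Data.Nat as ℕ
  import Data.Nat.Properties as ℕ
  import Data.Nat.Divisibility as ℕ
  open import Data.Nat.Primality using (Prime; prime?; prime[2]; prime⇒irreducible; prime⇒nonTrivial)
  open import Data.Integer using (ℤ; 0ℤ; 1ℤ; _+_; _*_; _-_; -_; _≤_; _<_; -[1+_]; +≤+; -≤+; +<+) renaming (+_ to pos; ∣_∣ to abs)
  open import Data.Integer.Properties
  open import Data.Integer.Divisibility.Signed using (_∣_; divides; ∣⇒∣ᵤ)
  open import Relation.Nullary.Decidable using (from-yes)
  open import Data.Integer.Tactic.RingSolver using (solve-∀)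
  import Tactic.RingSolver as ρSolver
  open ℤS using (solve; con; _:+_; _:*_; _:-_; :-_; _:=_)

  infixr 6 _⊞_
  infixr 7 _⊠_

  _⊞_ : ∀ {x y} → 0ℤ ≤ x → 0ℤ ≤ y → 0ℤ ≤ x + y
  _⊞_ = +-mono-≤

  _⊠_ : ∀ {x y} → 0ℤ ≤ x → 0ℤ ≤ y → 0ℤ ≤ x * y
  _⊠_ {pos m} {pos n} _ _ = subst (0ℤ ≤_) (pos-* m n) (+≤+ z≤n)

  nn : ∀ {n} → 0ℤ ≤ pos n
  nn = +≤+ z≤n

  -- The two ways in which a point u = r / t² is twice the point u′ = −4n/m, respectively u′ = −2n/m.
  data Halved (r T : ℤ) : Set where
    halved₁ : ∀ m n → m ≢ 0 → r ≡ pos 4 * (pos m * pos m * (pos m * pos m) + pos 2 * (pos m * pos m * pos m * n) + n * n * (n * n))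
            → T ≡ pos m * pos m * (pos m * pos m) - pos 4 * (pos m * pos m * (n * n)) - pos 4 * (pos m * (n * n * n)) → Halved r T
    halved₂ : ∀ m n → m ≢ 0 → r ≡ pos 16 * (pos m * pos m * (pos m * pos m)) + pos 16 * (pos m * pos m * pos m * n) + n * n * (n * n)
            → T ≡ pos 4 * (pos m * pos m * (pos m * pos m)) - pos 4 * (pos m * pos m * (n * n)) - pos 2 * (pos m * (n * n * n)) → Halved r T

  module Halving (r t s : ℤ) (t≢0 : t ≢ 0ℤ) (r⊥t : Coprimeℤ r t)
    (eq : s * s ≡ r * r * r - pos 4 * (r * r * (t * t)) + pos 16 * (t * t * (t * t) * (t * t))) where

    T : ℤ
    T = t * t

    -- r − θ T, where θ = 2 − 2ρ is a root of x³ − 4x² + 16.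
    β : ℤ[ρ]
    β = ⟨ r - (T + T) , T + T , 0ℤ ⟩

    Nβ : N β ≡ s * s
    Nβ = trans (l r T) (sym eq)
      where
      l = solve 2 (λ r T → let a = r :- (T :+ T) ; b = T :+ T in
          a :* (a :* (a :+ b :+ con 0ℤ :+ con 0ℤ :+ con 0ℤ) :- b :* (b :+ con 0ℤ :+ con 0ℤ :+ con 0ℤ :+ con 0ℤ) :- con 0ℤ :* con 0ℤ) :+ b :* (b :* (b :+ con 0ℤ) :- con 0ℤ :* con 0ℤ) :+ con 0ℤ :* (con 0ℤ :* con 0ℤ)
          := r :* r :* r :- con (pos 4) :* (r :* r :* T) :+ con (pos 16) :* (T :* T :* T)) refl

    x+x≡0⇒x≡0 : ∀ {x} → x + x ≡ 0ℤ → x ≡ 0ℤ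
    x+x≡0⇒x≡0 {x} e = *-cancelˡ-≡ (pos 2) x 0ℤ (trans (l x) e)
      where
      l = solve 1 (λ x → con (pos 2) :* x := x :+ x) refl

    s≢0 : s ≢ 0ℤ
    s≢0 refl = t≢0 (x*x≡0⇒x≡0 t (x+x≡0⇒x≡0 (cong co₁ (N≡0⇒≡0 β Nβ))))

    i₁ i₂ : ℤ
    i₁ = r * (pos 3 * r - pos 8 * T)
    i₂ = pos 4 * (pos 12 * (T * T) - r * r)

    -- The derivatives of r³ − 4r²T + 16T³ with respect to r and T lie in the ideal (β, adj β).
    i₁≡ : emb i₁ ≡ adj β ⊕ β ⊗ ⟨ r + r - (T + T) , - (T + T) , 0ℤ ⟩
    i₁≡ = cong₃ (l₀ r T) (l₁ r T) (l₂ r T)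
      where
      l₀ = solve 2 (λ r T → let a = r :- (T :+ T) ; b = T :+ T ; c = con 0ℤ ; d = r :+ r :- (T :+ T) ; e = :- (T :+ T) ; f = con 0ℤ in
        r :* (con (pos 3) :* r :- con (pos 8) :* T) := (a :+ c) :* (a :+ b :+ con (pos 2) :* c) :- (b :+ c) :* (b :+ con (pos 2) :* c) :+ (a :* d :+ (b :* f :+ c :* e) :+ c :* f)) refl
      l₁ = solve 2 (λ r T → let a = r :- (T :+ T) ; b = T :+ T ; c = con 0ℤ ; d = r :+ r :- (T :+ T) ; e = :- (T :+ T) ; f = con 0ℤ in
        con 0ℤ := c :* (b :+ con (pos 2) :* c) :- b :* (a :+ b :+ con (pos 2) :* c) :+ (a :* e :+ b :* d :+ (b :* f :+ c :* e) :+ con (pos 2) :* c :* f)) refl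
      l₂ = solve 2 (λ r T → let a = r :- (T :+ T) ; b = T :+ T ; c = con 0ℤ ; d = r :+ r :- (T :+ T) ; e = :- (T :+ T) ; f = con 0ℤ in
        con 0ℤ := b :* (b :+ c) :- c :* (a :+ c) :+ (a :* f :+ b :* e :+ c :* d :+ (b :* f :+ c :* e) :+ con (pos 2) :* c :* f)) refl

    i₂≡ : emb i₂ ≡ ⟨ - pos 2 , pos 2 , 0ℤ ⟩ ⊗ adj β ⊕ β ⊗ ⟨ - pos 2 * r - pos 8 * T , - pos 2 * r , pos 8 * T ⟩
    i₂≡ = cong₃ (l₀ r T) (l₁ r T) (l₂ r T)
      where
      l₀ = solve 2 (λ r T → let a = r :- (T :+ T) ; b = T :+ T ; c = con 0ℤ ; d = :- con (pos 2) :* r :- con (pos 8) :* T ; e = :- con (pos 2) :* r ; f = con (pos 8) :* T ; x = (a :+ c) :* (a :+ b :+ con (pos 2) :* c) :- (b :+ c) :* (b :+ con (pos 2) :* c) ; y = c :* (b :+ con (pos 2) :* c) :- b :* (a :+ b :+ con (pos 2) :* c) ; z = b :* (b :+ c) :- c :* (a :+ c) in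
        con (pos 4) :* (con (pos 12) :* (T :* T) :- r :* r) := (:- con (pos 2) :* x :+ (con (pos 2) :* z :+ con 0ℤ :* y) :+ con 0ℤ :* z) :+ (a :* d :+ (b :* f :+ c :* e) :+ c :* f)) refl
      l₁ = solve 2 (λ r T → let a = r :- (T :+ T) ; b = T :+ T ; c = con 0ℤ ; d = :- con (pos 2) :* r :- con (pos 8) :* T ; e = :- con (pos 2) :* r ; f = con (pos 8) :* T ; x = (a :+ c) :* (a :+ b :+ con (pos 2) :* c) :- (b :+ c) :* (b :+ con (pos 2) :* c) ; y = c :* (b :+ con (pos 2) :* c) :- b :* (a :+ b :+ con (pos 2) :* c) ; z = b :* (b :+ c) :- c :* (a :+ c) in
        con 0ℤ := (:- con (pos 2) :* y :+ con (pos 2) :* x :+ (con (pos 2) :* z :+ con 0ℤ :* y) :+ con (pos 2) :* con 0ℤ :* z) :+ (a :* e :+ b :* d :+ (b :* f :+ c :* e) :+ con (pos 2) :* c :* f)) refl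
      l₂ = solve 2 (λ r T → let a = r :- (T :+ T) ; b = T :+ T ; c = con 0ℤ ; d = :- con (pos 2) :* r :- con (pos 8) :* T ; e = :- con (pos 2) :* r ; f = con (pos 8) :* T ; x = (a :+ c) :* (a :+ b :+ con (pos 2) :* c) :- (b :+ c) :* (b :+ con (pos 2) :* c) ; y = c :* (b :+ con (pos 2) :* c) :- b :* (a :+ b :+ con (pos 2) :* c) ; z = b :* (b :+ c) :- c :* (a :+ c) in
        con 0ℤ := (:- con (pos 2) :* z :+ con (pos 2) :* y :+ con 0ℤ :* x :+ (con (pos 2) :* z :+ con 0ℤ :* y) :+ con (pos 2) :* con 0ℤ :* z) :+ (a :* f :+ b :* e :+ c :* d :+ (b :* f :+ c :* e) :+ con (pos 2) :* c :* f)) refl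

    ∣small⇒≡ : ∀ {p q} → Prime p → Prime q → pos q ∣ pos p → q ≡ p
    ∣small⇒≡ isPrime-p isPrime h = [ (λ q≡1 → contradiction q≡1 (ℕ.nonTrivial⇒≢1 {{prime⇒nonTrivial isPrime}})) , (λ e → e) ]′
      (prime⇒irreducible isPrime-p (∣⇒∣ᵤ h))

    -- A prime q dividing N δ divides every integer that δ divides, hence s and both partial
    -- derivatives of r³ - 4r²T + 16T³. For coprime r and t this leaves the discriminant primes 2
    -- and 11, and 11 is excluded through s.
    only-2 : ∀ {δ} → δ ∣ρ β → δ ∣ρ adj β → δ ∣ρ emb s → OnlyTwo δ
    only-2 {δ} (k , β≡) (j , adj≡) s∈ {q} isPrime q∣Nδ = [ (λ h → h) , (λ q≢2 → ⊥-elim (contra q≢2)) ]′ (two? (q ℕ.≟ 2))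
      where
      two? : Dec (q ≡ 2) → q ≡ 2 ⊎ q ≢ 2
      two? (yes e) = inj₁ e
      two? (no e)  = inj₂ e
      q∣emb : ∀ {x} → δ ∣ρ emb x → pos q ∣ x
      q∣emb {x} h = [ euclid² isPrime x , (λ h → h) ]′ (euclid isPrime (x * x) x (subst (pos q ∣_) (N-emb x) (∣-trans′ q∣Nδ (∣ρ⇒N∣ {δ} {emb x} h))))
        where
        ∣-trans′ : ∀ {a b c} → a ∣ b → b ∣ c → a ∣ c
        ∣-trans′ {a} (divides j refl) (divides k refl) = divides (k * j) (sym (*-assoc k j a))
      q∣s = q∣emb s∈
      q∣i₁ : pos q ∣ i₁
      q∣i₁ = q∣emb (j ⊕ γ ⊗ k , trans i₁≡ (trans (cong₂ (λ x y → x ⊕ y ⊗ γ) adj≡ β≡) (l j k γ δ)))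
        where
        γ = ⟨ r + r - (T + T) , - (T + T) , 0ℤ ⟩
        l : ∀ j k γ δ → j ⊗ δ ⊕ k ⊗ δ ⊗ γ ≡ (j ⊕ γ ⊗ k) ⊗ δ
        l = ρSolver.solve-∀ ρ-ring
      q∣i₂ : pos q ∣ i₂
      q∣i₂ = q∣emb (η ⊗ j ⊕ γ ⊗ k , trans i₂≡ (trans (cong₂ (λ x y → η ⊗ x ⊕ y ⊗ γ) adj≡ β≡) (l j k γ δ η)))
        where
        η = ⟨ - pos 2 , pos 2 , 0ℤ ⟩
        γ = ⟨ - pos 2 * r - pos 8 * T , - pos 2 * r , pos 8 * T ⟩
        l : ∀ j k γ δ η → η ⊗ (j ⊗ δ) ⊕ k ⊗ δ ⊗ γ ≡ (η ⊗ j ⊕ γ ⊗ k) ⊗ δ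
        l = ρSolver.solve-∀ ρ-ring
      contra : q ≢ 2 → ⊥
      contra q≢2 = [ q∣r-case , q∣3r-8T-case ]′ (euclid isPrime r (pos 3 * r - pos 8 * T) q∣i₁)
        where
        q∤2 : ¬ pos q ∣ pos 2
        q∤2 h = q≢2 (∣small⇒≡ prime[2] isPrime h)
        odd : ∀ x y → pos q ∣ x * y → (pos q ∣ x → ⊥) → pos q ∣ y
        odd x y h ∤x = [ (λ h → ⊥-elim (∤x h)) , (λ h → h) ]′ (euclid isPrime x y h)
        q∤4 : ¬ pos q ∣ pos 4
        q∤4 h = q∤2 (euclid² isPrime (pos 2) h)
        q∤16 : ¬ pos q ∣ pos 16
        q∤16 h = q∤4 (euclid² isPrime (pos 4) h)
        D = pos 12 * (T * T) - r * r
        q∣D : pos q ∣ D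
        q∣D = odd (pos 4) D q∣i₂ q∤4
        q∣T⇒q∣t : pos q ∣ T → pos q ∣ t
        q∣T⇒q∣t = euclid² isPrime t
        q∣r-case : pos q ∣ r → ⊥
        q∣r-case q∣r = r⊥t isPrime q∣r (q∣T⇒q∣t (cube (odd (pos 16) (T * T * T) (∣-combination (pos 1 * s) (- (r * r - pos 4 * (r * T))) (lin 1ℤ (l r s T) (sym eq)) q∣s q∣r) q∤16)))
          where
          l = solve 3 (λ r s T → con (pos 16) :* (T :* T :* T) :- (con (pos 1) :* s :* s :+ :- (r :* r :- con (pos 4) :* (r :* T)) :* r) := con 1ℤ :* (r :* r :* r :- con (pos 4) :* (r :* r :* T) :+ con (pos 16) :* (T :* T :* T) :- s :* s)) refl
          cube : pos q ∣ T * T * T → pos q ∣ T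
          cube h = [ euclid² isPrime T , (λ h → h) ]′ (euclid isPrime (T * T) T h)
        q∣T-case : pos q ∣ T → ⊥
        q∣T-case q∣T = r⊥t isPrime (euclid² isPrime r (∣-combination (pos 12 * T) (- 1ℤ) (l r T) q∣T q∣D)) (q∣T⇒q∣t q∣T)
          where
          l = solve 2 (λ r T → r :* r := con (pos 12) :* T :* T :+ :- con 1ℤ :* (con (pos 12) :* (T :* T) :- r :* r)) refl
        q∣3r-8T-case : pos q ∣ pos 3 * r - pos 8 * T → ⊥
        q∣3r-8T-case h@(divides k 3r≡) = [ q∣11-case , (λ h → q∣T-case (euclid² isPrime T h)) ]′ (euclid isPrime (pos 11) (T * T)
            (odd (pos 4) (pos 11 * (T * T)) (∣-combination (pos 9) (pos 3 * r + pos 8 * T) (l r T) q∣D h) q∤4))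
          where
          l = solve 2 (λ r T → con (pos 4) :* (con (pos 11) :* (T :* T)) := con (pos 9) :* (con (pos 12) :* (T :* T) :- r :* r) :+ (con (pos 3) :* r :+ con (pos 8) :* T) :* (con (pos 3) :* r :- con (pos 8) :* T)) refl
          q∣11-case : pos q ∣ pos 11 → ⊥
          q∣11-case q∣11 = eleven (∣small⇒≡ (from-yes (prime? 11)) isPrime q∣11) q∣s
            where
            eleven : q ≡ 11 → pos q ∣ s → ⊥
            -- For 3r = 8T + 11k one has 27s² = 11 · 16T³ + 12T(11k)² + (11k)³, the term linear in k
            -- being absent because 8/3 is a double root modulo 11. Since 121 ∣ s², it follows that
            -- 11 ∣ 16T³.
            eleven refl (divides j s≡) = q∣T-case (cube (odd (pos 16) (T * T * T) (divides (pos 27 * (j * j) - pos 12 * (T * (k * k)) - pos 11 * (k * k * k))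
                (*-cancelˡ-≡ (pos 11) _ _ (lin₂ (- pos 27) ((pos 3 * r) * (pos 3 * r) + pos 3 * r * (pos 8 * T + k * pos 11) + (pos 8 * T + k * pos 11) * (pos 8 * T + k * pos 11)
                  - pos 12 * T * (pos 3 * r + (pos 8 * T + k * pos 11))) (l₁ r T k j) (trans (cong (λ s → s * s) (sym s≡)) eq) (3r′ 3r≡)))) q∤16))
              where
              cube : pos q ∣ T * T * T → pos q ∣ T
              cube h = [ euclid² isPrime T , (λ h → h) ]′ (euclid isPrime (T * T) T h)
              3r′ : pos 3 * r - pos 8 * T ≡ k * pos 11 → pos 8 * T + k * pos 11 ≡ pos 3 * r
              3r′ e = lin (- 1ℤ) (l₂ r T (k * pos 11)) e
                where
                l₂ = solve 3 (λ r T k → con (pos 8) :* T :+ k :- con (pos 3) :* r := :- con 1ℤ :* (con (pos 3) :* r :- con (pos 8) :* T :- k)) refl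
              l₁ = solve 4 (λ r T k j → let w = con (pos 8) :* T :+ k :* con (pos 11) in
                con (pos 11) :* (con (pos 16) :* (T :* T :* T)) :- con (pos 11) :* ((con (pos 27) :* (j :* j) :- con (pos 12) :* (T :* (k :* k)) :- con (pos 11) :* (k :* k :* k)) :* con (pos 11))
                := :- con (pos 27) :* (j :* con (pos 11) :* (j :* con (pos 11)) :- (r :* r :* r :- con (pos 4) :* (r :* r :* T) :+ con (pos 16) :* (T :* T :* T)))
                :+ (con (pos 3) :* r :* (con (pos 3) :* r) :+ con (pos 3) :* r :* w :+ w :* w :- con (pos 12) :* T :* (con (pos 3) :* r :+ w)) :* (w :- con (pos 3) :* r)) refl

    -- A parity argument: β has no ρ²-coordinate and an even ρ-coordinate, which forces all
    -- coordinates of σ to be even, and then r and t are both even.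
    ρσ²-impossible : ∀ σ → β ≢ ρ ⊗ (σ ⊗ σ)
    ρσ²-impossible σ@(⟨ a , b , c ⟩) β≡ = with-b (2∣⇒even (euclid² prime[2] b 2∣b²))
      where
      s₀ s₁ s₂ : ℤ
      s₀ = a * a + (b * c + c * b) + c * c
      s₁ = a * b + b * a + (b * c + c * b) + pos 2 * c * c
      s₂ = a * c + b * b + c * a + (b * c + c * b) + pos 2 * c * c
      coords : β ≡ ⟨ s₂ , s₀ + s₂ , s₁ + s₂ ⟩
      coords = trans β≡ (ρ⊗ s₀ s₁ s₂)
      e₀ : r - (T + T) ≡ s₂
      e₀ = cong co₀ coords
      e₁ : T + T ≡ s₀ + s₂
      e₁ = cong co₁ coords
      e₂ : 0ℤ ≡ s₁ + s₂
      e₂ = cong co₂ coords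
      2∣b² : pos 2 ∣ b * b
      2∣b² = divides (- (a * b + a * c + pos 2 * (b * c) + pos 2 * (c * c))) (lin (- 1ℤ) (l a b c) e₂)
        where
        l = solve 3 (λ a b c → b :* b :- (:- (a :* b :+ a :* c :+ con (pos 2) :* (b :* c) :+ con (pos 2) :* (c :* c))) :* con (pos 2)
          := :- con 1ℤ :* (con 0ℤ :- (a :* b :+ b :* a :+ (b :* c :+ c :* b) :+ con (pos 2) :* c :* c :+ (a :* c :+ b :* b :+ c :* a :+ (b :* c :+ c :* b) :+ con (pos 2) :* c :* c)))) refl
      with-b : ∃[ k ] b ≡ k + k → ⊥
      with-b (b′ , b≡) = both (euclid prime[2] a c 2∣ac)
        where
        2∣ac : pos 2 ∣ a * c
        2∣ac = divides (- (b′ * b′ + a * b′ + pos 2 * (b′ * c) + c * c)) (*-cancelˡ-≡ (pos 2) _ _ (lin (- 1ℤ) (l a b′ c)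
          (subst (λ b → 0ℤ ≡ a * b + b * a + (b * c + c * b) + pos 2 * c * c + (a * c + b * b + c * a + (b * c + c * b) + pos 2 * c * c)) b≡ e₂)))
          where
          l = solve 3 (λ a b′ c → let b = b′ :+ b′ in con (pos 2) :* (a :* c) :- con (pos 2) :* (:- (b′ :* b′ :+ a :* b′ :+ con (pos 2) :* (b′ :* c) :+ c :* c) :* con (pos 2))
            := :- con 1ℤ :* (con 0ℤ :- (a :* b :+ b :* a :+ (b :* c :+ c :* b) :+ con (pos 2) :* c :* c :+ (a :* c :+ b :* b :+ c :* a :+ (b :* c :+ c :* b) :+ con (pos 2) :* c :* c)))) refl
        2∣a+c : pos 2 ∣ a + c
        2∣a+c = euclid² prime[2] (a + c) (divides (T - (c * c + pos 2 * (b′ * b′) + pos 4 * (b′ * c))) (lin (- 1ℤ) (l a b′ c T)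
          (subst (λ b → T + T ≡ a * a + (b * c + c * b) + c * c + (a * c + b * b + c * a + (b * c + c * b) + pos 2 * c * c)) b≡ e₁)))
          where
          l = solve 4 (λ a b′ c T → let b = b′ :+ b′ in (a :+ c) :* (a :+ c) :- (T :- (c :* c :+ con (pos 2) :* (b′ :* b′) :+ con (pos 4) :* (b′ :* c))) :* con (pos 2)
            := :- con 1ℤ :* (T :+ T :- (a :* a :+ (b :* c :+ c :* b) :+ c :* c :+ (a :* c :+ b :* b :+ c :* a :+ (b :* c :+ c :* b) :+ con (pos 2) :* c :* c)))) refl
        all-even : pos 2 ∣ a → pos 2 ∣ c → ⊥
        all-even 2∣a 2∣c = r⊥t prime[2] 2∣r 2∣t
          where
          a′ = proj₁ (2∣⇒even 2∣a)
          a≡ = proj₂ (2∣⇒even 2∣a)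
          c′ = proj₁ (2∣⇒even 2∣c)
          c≡ = proj₂ (2∣⇒even 2∣c)
          2∣t : pos 2 ∣ t
          2∣t = euclid² prime[2] t (divides (a′ * a′ + pos 4 * (b′ * c′) + pos 3 * (c′ * c′) + pos 2 * (a′ * c′) + b′ * b′) (*-cancelˡ-≡ (pos 2) _ _
            (lin 1ℤ (l a′ b′ c′ T) (trans e₁ (cong₃′ (λ a b c → a * a + (b * c + c * b) + c * c + (a * c + b * b + c * a + (b * c + c * b) + pos 2 * c * c)) a≡ b≡ c≡)))))
            where
            cong₃′ : ∀ (f : ℤ → ℤ → ℤ → ℤ) {a b c a′ b′ c′} → a ≡ a′ → b ≡ b′ → c ≡ c′ → f a b c ≡ f a′ b′ c′
            cong₃′ f refl refl refl = refl
            l = solve 4 (λ a′ b′ c′ T → let a = a′ :+ a′ ; b = b′ :+ b′ ; c = c′ :+ c′ in con (pos 2) :* T :- con (pos 2) :* ((a′ :* a′ :+ con (pos 4) :* (b′ :* c′) :+ con (pos 3) :* (c′ :* c′) :+ con (pos 2) :* (a′ :* c′) :+ b′ :* b′) :* con (pos 2))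
              := con 1ℤ :* (T :+ T :- (a :* a :+ (b :* c :+ c :* b) :+ c :* c :+ (a :* c :+ b :* b :+ c :* a :+ (b :* c :+ c :* b) :+ con (pos 2) :* c :* c)))) refl
          2∣r : pos 2 ∣ r
          2∣r = ∣-combination (a + pos 2 * b + pos 2 * c) 1ℤ (lin 1ℤ (l r T a b c) e₀) 2∣c (∣-combination (pos 2) 1ℤ (l′ a b c T) (∣-multiple t refl 2∣t) (∣-combination c b refl 2∣a (even⇒2∣ b′ b≡)))
            where
            l = solve 5 (λ r T a b c → r :- ((a :+ con (pos 2) :* b :+ con (pos 2) :* c) :* c :+ con 1ℤ :* (T :+ T :+ (c :* a :+ b :* b))) := con 1ℤ :* (r :- (T :+ T) :- (a :* c :+ b :* b :+ c :* a :+ (b :* c :+ c :* b) :+ con (pos 2) :* c :* c))) refl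
            l′ = solve 4 (λ a b c T → T :+ T :+ (c :* a :+ b :* b) := con (pos 2) :* T :+ con 1ℤ :* (c :* a :+ b :* b)) refl
        both : pos 2 ∣ a ⊎ pos 2 ∣ c → ⊥
        both (inj₁ 2∣a) = all-even 2∣a (∣-combination 1ℤ (- 1ℤ) (l a c) 2∣a+c 2∣a)
          where
          l = solve 2 (λ a c → c := con 1ℤ :* (a :+ c) :+ :- con 1ℤ :* a) refl
        both (inj₂ 2∣c) = all-even (∣-combination 1ℤ (- 1ℤ) (l a c) 2∣a+c 2∣c) 2∣c
          where
          l = solve 2 (λ a c → a := con 1ℤ :* (a :+ c) :+ :- con 1ℤ :* c) refl

    abs-square : ∀ x k → x * x ≡ pos k * pos k → x ≡ pos k ⊎ x ≡ - pos k
    abs-square (pos n) k e = inj₁ (equal-squares (pos n) (pos k) nn nn e)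
    abs-square -[1+ n ] k e = inj₂ (trans refl (cong -_ (equal-squares (pos (suc n)) (pos k) nn nn e)))

    -- The vanishing ρ²-coordinate of the square forces b = 2b′ and cE = 2b′² with E = -(a + c +
    -- 2b′). Here c and E are coprime and, with the sign chosen so that c ≥ 0, nonnegative; so they
    -- are m² and 2n², or 2m² and n². These are the two forms of `Halved`.
    halve-with : ∀ a b c → 0ℤ ≤ c → β ≡ ⟨ a , b , c ⟩ ⊗ ⟨ a , b , c ⟩ → Halved r T
    halve-with a b c 0≤c β≡ = with-b (2∣⇒even (euclid² prime[2] b 2∣b²))
      where
      s₀ s₁ s₂ : ℤ
      s₀ = a * a + (b * c + c * b) + c * c
      s₁ = a * b + b * a + (b * c + c * b) + pos 2 * c * c
      s₂ = a * c + b * b + c * a + (b * c + c * b) + pos 2 * c * c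
      e₀ : r - (T + T) ≡ s₀
      e₀ = cong co₀ β≡
      e₁ : T + T ≡ s₁
      e₁ = cong co₁ β≡
      e₂ : 0ℤ ≡ s₂
      e₂ = cong co₂ β≡
      T≡ : T ≡ a * b + b * c + c * c
      T≡ = *-cancelˡ-≡ (pos 2) _ _ (lin 1ℤ (l a b c T) e₁)
        where
        l = solve 4 (λ a b c T → con (pos 2) :* T :- con (pos 2) :* (a :* b :+ b :* c :+ c :* c) := con 1ℤ :* (T :+ T :- (a :* b :+ b :* a :+ (b :* c :+ c :* b) :+ con (pos 2) :* c :* c))) refl
      r≡ : r ≡ pos 2 * (a * b + b * c + c * c) + (a * a + pos 2 * (b * c) + c * c)
      r≡ = lin₂ 1ℤ (pos 2) (l r T a b c) e₀ T≡
        where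
        l = solve 5 (λ r T a b c → r :- (con (pos 2) :* (a :* b :+ b :* c :+ c :* c) :+ (a :* a :+ con (pos 2) :* (b :* c) :+ c :* c))
          := con 1ℤ :* (r :- (T :+ T) :- (a :* a :+ (b :* c :+ c :* b) :+ c :* c)) :+ con (pos 2) :* (T :- (a :* b :+ b :* c :+ c :* c))) refl
      2∣b² : pos 2 ∣ b * b
      2∣b² = divides (- (a * c + b * c + c * c)) (lin (- 1ℤ) (l a b c) e₂)
        where
        l = solve 3 (λ a b c → b :* b :- :- (a :* c :+ b :* c :+ c :* c) :* con (pos 2) := :- con 1ℤ :* (con 0ℤ :- (a :* c :+ b :* b :+ c :* a :+ (b :* c :+ c :* b) :+ con (pos 2) :* c :* c))) refl
      with-b : ∃[ k ] b ≡ k + k → Halved r T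
      with-b (b′ , b≡) = by-parity (euclid prime[2] c E (divides (b′ * b′) (trans cE (*-comm (pos 2) (b′ * b′)))))
        where
        E : ℤ
        E = - (a + c + pos 2 * b′)
        cE : c * E ≡ pos 2 * (b′ * b′)
        cE = *-cancelˡ-≡ (pos 2) _ _ (lin 1ℤ (l a b′ c) (subst (λ b → 0ℤ ≡ a * c + b * b + c * a + (b * c + c * b) + pos 2 * c * c) b≡ e₂))
          where
          l = solve 3 (λ a b′ c → let b = b′ :+ b′ in con (pos 2) :* (c :* :- (a :+ c :+ con (pos 2) :* b′)) :- con (pos 2) :* (con (pos 2) :* (b′ :* b′))
            := con 1ℤ :* (con 0ℤ :- (a :* c :+ b :* b :+ c :* a :+ (b :* c :+ c :* b) :+ con (pos 2) :* c :* c))) refl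
        c⊥E : Coprimeℤ c E
        c⊥E {q} isPrime q∣c q∣E = r⊥t isPrime q∣r (euclid² isPrime t q∣T)
          where
          q∣b′ : pos q ∣ b′
          q∣b′ = [ two , euclid² isPrime b′ ]′ (euclid isPrime (pos 2) (b′ * b′) (subst (pos q ∣_) cE (∣-multiple E (*-comm c E) q∣c)))
            where
            two : pos q ∣ pos 2 → pos q ∣ b′
            two q∣2 = with-two (∣small⇒≡ prime[2] isPrime q∣2) q∣c q∣E
              where
              with-two : q ≡ 2 → pos q ∣ c → pos q ∣ E → pos q ∣ b′
              with-two refl (divides j c≡) (divides k E≡) = euclid² isPrime b′ (divides (j * k) (*-cancelˡ-≡ (pos 2) _ _ (trans (sym cE) (trans (cong₂ _*_ c≡ E≡) (l j k)))))
                where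
                l = solve 2 (λ j k → j :* con (pos 2) :* (k :* con (pos 2)) := con (pos 2) :* (j :* k :* con (pos 2))) refl
          q∣a : pos q ∣ a
          q∣a = ∣-combination (- 1ℤ) 1ℤ (l a b′ c) q∣E (∣-combination (- 1ℤ) (- pos 2) refl q∣c q∣b′)
            where
            l = solve 3 (λ a b′ c → a := :- con 1ℤ :* :- (a :+ c :+ con (pos 2) :* b′) :+ con 1ℤ :* (:- con 1ℤ :* c :+ :- con (pos 2) :* b′)) refl
          q∣T : pos q ∣ T
          q∣T = ∣-combination b (b + c) (trans T≡ (l a b c)) q∣a q∣c
            where
            l = solve 3 (λ a b c → a :* b :+ b :* c :+ c :* c := b :* a :+ (b :+ c) :* c) refl
          q∣r : pos q ∣ r
          q∣r = ∣-combination (pos 2 * b + a) (pos 4 * b + pos 3 * c) (trans r≡ (l a b c)) q∣a q∣c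
            where
            l = solve 3 (λ a b c → con (pos 2) :* (a :* b :+ b :* c :+ c :* c) :+ (a :* a :+ con (pos 2) :* (b :* c) :+ c :* c) := (con (pos 2) :* b :+ a) :* a :+ (con (pos 4) :* b :+ con (pos 3) :* c) :* c) refl
        c≢0 : c ≢ 0ℤ
        c≢0 refl = t≢0 (x*x≡0⇒x≡0 t (trans T≡ (trans (cong (λ b → a * b + b * 0ℤ + 0ℤ * 0ℤ) b≡0) (l a))))
          where
          b′≡0 : b′ ≡ 0ℤ
          b′≡0 = x*x≡0⇒x≡0 b′ (*-cancelˡ-≡ (pos 2) _ _ (sym cE))
          b≡0 : b ≡ 0ℤ
          b≡0 = trans b≡ (cong (λ k → k + k) b′≡0)
          l = solve 1 (λ a → a :* con 0ℤ :+ con 0ℤ :* con 0ℤ :+ con 0ℤ :* con 0ℤ := con 0ℤ) refl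
        0<c : 0ℤ < c
        0<c = ≤∧≢⇒< 0≤c (λ e → c≢0 (sym e))
        0≤E : 0ℤ ≤ E
        0≤E = nonneg-cofactor c E 0<c (subst (0ℤ ≤_) (sym cE) (nn {2} ⊠ 0≤x*x b′))
        a≡ : a ≡ - E - c - pos 2 * b′
        a≡ = l a b′ c
          where
          l = solve 3 (λ a b′ c → a := :- :- (a :+ c :+ con (pos 2) :* b′) :- c :- con (pos 2) :* b′) refl
        by-parity : pos 2 ∣ c ⊎ pos 2 ∣ E → Halved r T
        by-parity (inj₂ (divides E′ E≡)) = with-squares (coprime-squares c E′ b′ 0≤c 0≤E′
            (λ isPrime h h′ → c⊥E isPrime h (∣-multiple (pos 2) (trans E≡ (*-comm E′ (pos 2))) h′)) cE′)
          where
          0≤E′ : 0ℤ ≤ E′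
          0≤E′ = nonneg-cofactor (pos 2) E′ (+<+ (s≤s z≤n)) (subst (0ℤ ≤_) (trans E≡ (*-comm E′ (pos 2))) 0≤E)
          cE′ : c * E′ ≡ b′ * b′
          cE′ = *-cancelˡ-≡ (pos 2) _ _ (trans (l c E′) (trans (cong (c *_) (sym E≡)) cE))
            where
            l = solve 2 (λ c e → con (pos 2) :* (c :* e) := c :* (e :* con (pos 2))) refl
          with-squares : ∃[ m ] ∃[ n ] c ≡ pos m * pos m × E′ ≡ pos n * pos n → Halved r T
          with-squares (m , n₀ , c≡ , E′≡) = [ (λ e → conclude (pos n₀) E′≡ (trans e (pos-* m n₀)))
              , (λ e → conclude (- pos n₀) (trans E′≡ (l₁ (pos n₀))) (trans e (trans (cong -_ (pos-* m n₀)) (l₂ (pos m) (pos n₀))))) ]′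
            (abs-square b′ (m ℕ.* n₀) (trans (sym cE′) (trans (cong₂ _*_ c≡ E′≡) (trans (l₃ (pos m) (pos n₀)) (sym (cong₂ _*_ (pos-* m n₀) (pos-* m n₀)))))))
            where
            l₁ = solve 1 (λ n → n :* n := :- n :* :- n) refl
            l₂ = solve 2 (λ m n → :- (m :* n) := m :* :- n) refl
            l₃ = solve 2 (λ m n → m :* m :* (n :* n) := m :* n :* (m :* n)) refl
            m≢0 : m ≢ 0
            m≢0 refl = c≢0 c≡
            conclude : ∀ n → E′ ≡ n * n → b′ ≡ pos m * n → Halved r T
            conclude n E′≡n² b′≡ = halved₁ m n m≢0 (trans r≡ (trans (cong₃ᶠ (λ a b c → pos 2 * (a * b + b * c + c * c) + (a * a + pos 2 * (b * c) + c * c)) a≡′ b≡′ c≡) (lᵣ (pos m) n)))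
              (trans T≡ (trans (cong₃ᶠ (λ a b c → a * b + b * c + c * c) a≡′ b≡′ c≡) (lₜ (pos m) n)))
              where
              cong₃ᶠ : ∀ (f : ℤ → ℤ → ℤ → ℤ) {a b c a′ b′ c′} → a ≡ a′ → b ≡ b′ → c ≡ c′ → f a b c ≡ f a′ b′ c′
              cong₃ᶠ f refl refl refl = refl
              b≡′ : b ≡ pos m * n + pos m * n
              b≡′ = trans b≡ (cong (λ k → k + k) b′≡)
              a≡′ : a ≡ - (n * n * pos 2) - pos m * pos m - pos 2 * (pos m * n)
              a≡′ = trans a≡ (cong₃ᶠ (λ E c b → - E - c - pos 2 * b) (trans E≡ (cong (_* pos 2) E′≡n²)) c≡ b′≡)
              lₜ = solve 2 (λ m n → let a = :- (n :* n :* con (pos 2)) :- m :* m :- con (pos 2) :* (m :* n) ; b = m :* n :+ m :* n ; c = m :* m in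
                   a :* b :+ b :* c :+ c :* c := m :* m :* (m :* m) :- con (pos 4) :* (m :* m :* (n :* n)) :- con (pos 4) :* (m :* (n :* n :* n))) refl
              lᵣ = solve 2 (λ m n → let a = :- (n :* n :* con (pos 2)) :- m :* m :- con (pos 2) :* (m :* n) ; b = m :* n :+ m :* n ; c = m :* m in
                   con (pos 2) :* (a :* b :+ b :* c :+ c :* c) :+ (a :* a :+ con (pos 2) :* (b :* c) :+ c :* c) := con (pos 4) :* (m :* m :* (m :* m) :+ con (pos 2) :* (m :* m :* m :* n) :+ n :* n :* (n :* n))) refl
        by-parity (inj₁ (divides c′ c≡2c′)) = with-squares (coprime-squares c′ E b′ 0≤c′ 0≤E
            (λ isPrime h h′ → c⊥E isPrime (∣-multiple (pos 2) (trans c≡2c′ (*-comm c′ (pos 2))) h) h′) c′E)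
          where
          0≤c′ : 0ℤ ≤ c′
          0≤c′ = nonneg-cofactor (pos 2) c′ (+<+ (s≤s z≤n)) (subst (0ℤ ≤_) (trans c≡2c′ (*-comm c′ (pos 2))) 0≤c)
          c′E : c′ * E ≡ b′ * b′
          c′E = *-cancelˡ-≡ (pos 2) _ _ (trans (l c′ E) (trans (cong (_* E) (sym c≡2c′)) cE))
            where
            l = solve 2 (λ c e → con (pos 2) :* (c :* e) := c :* con (pos 2) :* e) refl
          with-squares : ∃[ m ] ∃[ n ] c′ ≡ pos m * pos m × E ≡ pos n * pos n → Halved r T
          with-squares (m , n₀ , c≡ , E≡) = [ (λ e → conclude (pos n₀) E≡ (trans e (pos-* m n₀)))
              , (λ e → conclude (- pos n₀) (trans E≡ (l₁ (pos n₀))) (trans e (trans (cong -_ (pos-* m n₀)) (l₂ (pos m) (pos n₀))))) ]′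
            (abs-square b′ (m ℕ.* n₀) (trans (sym c′E) (trans (cong₂ _*_ c≡ E≡) (trans (l₃ (pos m) (pos n₀)) (sym (cong₂ _*_ (pos-* m n₀) (pos-* m n₀)))))))
            where
            l₁ = solve 1 (λ n → n :* n := :- n :* :- n) refl
            l₂ = solve 2 (λ m n → :- (m :* n) := m :* :- n) refl
            l₃ = solve 2 (λ m n → m :* m :* (n :* n) := m :* n :* (m :* n)) refl
            m≢0 : m ≢ 0
            m≢0 refl = c≢0 (trans c≡2c′ (cong (_* pos 2) c≡))
            conclude : ∀ n → E ≡ n * n → b′ ≡ pos m * n → Halved r T
            conclude n E≡n² b′≡ = halved₂ m n m≢0 (trans r≡ (trans (cong₃ᶠ (λ a b c → pos 2 * (a * b + b * c + c * c) + (a * a + pos 2 * (b * c) + c * c)) a≡′ b≡′ c≡′) (lᵣ (pos m) n)))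
              (trans T≡ (trans (cong₃ᶠ (λ a b c → a * b + b * c + c * c) a≡′ b≡′ c≡′) (lₜ (pos m) n)))
              where
              cong₃ᶠ : ∀ (f : ℤ → ℤ → ℤ → ℤ) {a b c a′ b′ c′} → a ≡ a′ → b ≡ b′ → c ≡ c′ → f a b c ≡ f a′ b′ c′
              cong₃ᶠ f refl refl refl = refl
              b≡′ : b ≡ pos m * n + pos m * n
              b≡′ = trans b≡ (cong (λ k → k + k) b′≡)
              c≡′ : c ≡ pos m * pos m * pos 2
              c≡′ = trans c≡2c′ (cong (_* pos 2) c≡)
              a≡′ : a ≡ - (n * n) - pos m * pos m * pos 2 - pos 2 * (pos m * n)
              a≡′ = trans a≡ (cong₃ᶠ (λ E c b → - E - c - pos 2 * b) E≡n² c≡′ b′≡)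
              lₜ = solve 2 (λ m n → let a = :- (n :* n) :- m :* m :* con (pos 2) :- con (pos 2) :* (m :* n) ; b = m :* n :+ m :* n ; c = m :* m :* con (pos 2) in
                   a :* b :+ b :* c :+ c :* c := con (pos 4) :* (m :* m :* (m :* m)) :- con (pos 4) :* (m :* m :* (n :* n)) :- con (pos 2) :* (m :* (n :* n :* n))) refl
              lᵣ = solve 2 (λ m n → let a = :- (n :* n) :- m :* m :* con (pos 2) :- con (pos 2) :* (m :* n) ; b = m :* n :+ m :* n ; c = m :* m :* con (pos 2) in
                   con (pos 2) :* (a :* b :+ b :* c :+ c :* c) :+ (a :* a :+ con (pos 2) :* (b :* c) :+ c :* c) := con (pos 16) :* (m :* m :* (m :* m)) :+ con (pos 16) :* (m :* m :* m :* n) :+ n :* n :* (n :* n)) refl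

    halve : Halved r T
    halve = from (square-class β s s≢0 Nβ only-2)
      where
      negated : ∀ a b c → ⟨ a , b , c ⟩ ⊗ ⟨ a , b , c ⟩ ≡ ⟨ - a , - b , - c ⟩ ⊗ ⟨ - a , - b , - c ⟩
      negated a b c = l ⟨ a , b , c ⟩
        where
        l : ∀ x → x ⊗ x ≡ (⊝ x) ⊗ (⊝ x)
        l = ρSolver.solve-∀ ρ-ring
      from : SquareClass β → Halved r T
      from (σ , inj₂ e) = ⊥-elim (ρσ²-impossible σ e)
      from (⟨ a , b , c ⟩ , inj₁ e) = [ (λ 0≤c → halve-with a b c 0≤c e) , (λ c≤0 → halve-with (- a) (- b) (- c) (neg-mono-≤ c≤0) (trans e (negated a b c))) ]′ (≤-total 0ℤ c)

  private
    0≤⇒< : ∀ x y → 0ℤ ≤ y - x - 1ℤ → x < y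
    0≤⇒< x y h = subst₂ _<_ (+-identityʳ x) (l x y) (+-monoʳ-< x (+-mono-<-≤ {0ℤ} {1ℤ} (+<+ (s≤s z≤n)) h))
      where
      l = solve 2 (λ x y → x :+ (con 1ℤ :+ (y :- x :- con 1ℤ)) := y) refl

    ≤-pos-abs : ∀ x → x ≤ pos (abs x)
    ≤-pos-abs (pos n)  = ≤-refl
    ≤-pos-abs -[1+ n ] = -≤+

    by-r : ∀ {B r T} → 0ℤ ≤ T → B < r → B < pos (abs r) + T
    by-r {B} {r} {T} 0≤T h = <-≤-trans h (≤-trans (≤-pos-abs r) (subst (_≤ pos (abs r) + T) (+-identityʳ (pos (abs r))) (+-monoʳ-≤ (pos (abs r)) 0≤T)))

    by-T : ∀ {B r T} → B < T → B < pos (abs r) + T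
    by-T {B} {r} {T} h = <-≤-trans h (subst (_≤ pos (abs r) + T) (+-identityˡ T) (+-monoˡ-≤ T (nn {abs r})))

    nn₁ : ∀ n → 0ℤ ≤ pos n + 1ℤ
    nn₁ n = nn {n} ⊞ nn {1}

    pos-suc : ∀ n → pos (suc n) ≡ pos n + 1ℤ
    pos-suc n = +-comm 1ℤ (pos n)

  -- The left side bounds the height of u′ = -4n/m. For n > 0 or ∣n∣ > m already r exceeds it, for
  -- -m < n < 0 already T does. In each case the difference is rewritten as a sum of products of
  -- nonnegative slack variables and squares. The values n = 0 and n = -m belong to u = 4 and u = 0.
  decrease₁ : ∀ m n {r T} → m ≢ 0 → n ≢ 0ℤ → n ≢ - pos m → 0ℤ ≤ T
    → r ≡ pos 4 * (pos m * pos m * (pos m * pos m) + pos 2 * (pos m * pos m * pos m * n) + n * n * (n * n))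
    → T ≡ pos m * pos m * (pos m * pos m) - pos 4 * (pos m * pos m * (n * n)) - pos 4 * (pos m * (n * n * n))
    → pos 4 * pos (abs n) + pos m < pos (abs r) + T
  decrease₁ zero n m≢0 _ _ _ _ _ = contradiction refl m≢0
  decrease₁ (suc j) (pos zero) _ n≢0 _ _ _ _ = contradiction refl n≢0
  decrease₁ (suc j) (pos (suc k)) {r} {T} _ _ _ 0≤T r≡ _ = by-r {r = r} 0≤T (0≤⇒< _ r (subst (0ℤ ≤_)
      (sym (trans (cong₂ (λ r z → r - (pos 4 * proj₁ z + proj₂ z) - 1ℤ) (trans r≡ (cong₂ (λ m n → pos 4 * (m * m * (m * m) + pos 2 * (m * m * m * n) + n * n * (n * n))) (pos-suc j) (pos-suc k)))
        (cong₂ _,_ (pos-suc k) (pos-suc j))) (l (pos j) (pos k))))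
      (nn {4} ⊠ m ⊠ c ⊞ nn {3} ⊠ nn {j} ⊞ nn {2} ⊞ nn {8} ⊠ n ⊠ c ⊞ nn {4} ⊠ n ⊞ nn {4} ⊠ (n ⊠ n) ⊠ n ⊠ n)))
    where
    m = nn₁ j
    n = nn₁ k
    c = nn {j} ⊠ (nn {j} ⊠ nn {j} ⊞ nn {3} ⊠ nn {j} ⊞ nn {3})
    l = solve 2 (λ J K → let m = J :+ con 1ℤ ; n = K :+ con 1ℤ ; c = J :* (J :* J :+ (con (pos 3) :* J :+ con (pos 3))) in
        con (pos 4) :* (m :* m :* (m :* m) :+ con (pos 2) :* (m :* m :* m :* n) :+ n :* n :* (n :* n)) :- (con (pos 4) :* n :+ m) :- con 1ℤ
        := con (pos 4) :* (m :* c) :+ (con (pos 3) :* J :+ (con (pos 2) :+ (con (pos 8) :* (n :* c) :+ (con (pos 4) :* n :+ con (pos 4) :* (n :* n :* (n :* n))))))) refl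
  decrease₁ (suc j) -[1+ v ] {r} {T} _ _ n≢-m 0≤T r≡ T≡ = by-order (ℕ.<-cmp (suc j) (suc v))
    where
    open import Relation.Binary.Definitions using (tri<; tri≈; tri>; Tri)
    Goal = pos 4 * pos (suc v) + pos (suc j) < pos (abs r) + T
    by-order : Tri (suc j ℕ.< suc v) (suc j ≡ suc v) (suc v ℕ.< suc j) → Goal
    by-order (tri≈ _ e _) = contradiction (cong (λ m → - pos m) (sym e)) n≢-m
    by-order (tri< m<ν _ _) = from (ℕ.m≤n⇒∃[o]m+o≡n m<ν)
      where
      from : ∃[ D ] suc (suc j) ℕ.+ D ≡ suc v → Goal
      from (D , e) = by-r {r = r} 0≤T (0≤⇒< _ r (subst (0ℤ ≤_)
          (sym (trans (cong₂ (λ r z → r - (pos 4 * proj₁ z + proj₂ z) - 1ℤ) (trans r≡ (cong₂ (λ m ν → pos 4 * (m * m * (m * m) + pos 2 * (m * m * m * - ν) + - ν * - ν * (- ν * - ν))) (pos-suc j) ν≡))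
            (cong₂ _,_ ν≡ (pos-suc j))) (l (pos j) (pos D))))
          (nn {8} ⊠ m ⊠ p ⊞ nn {3} ⊠ m ⊞ nn {24} ⊠ d ⊠ p ⊞ nn {20} ⊠ nn {D} ⊞ nn {19} ⊞ nn {16} ⊠ m ⊠ d ⊠ d ⊠ d ⊞ nn {4} ⊠ d ⊠ d ⊠ d ⊠ d)))
        where
        ν≡ : pos (suc v) ≡ pos j + 1ℤ + (pos D + 1ℤ)
        ν≡ = trans (cong pos (sym e)) (trans (pos-+ (suc (suc j)) D) (trans (cong (_+ pos D) (trans (pos-suc (suc j)) (cong (_+ 1ℤ) (pos-suc j)))) (l₀ (pos j) (pos D))))
          where
          l₀ = solve 2 (λ j D → j :+ con 1ℤ :+ con 1ℤ :+ D := j :+ con 1ℤ :+ (D :+ con 1ℤ)) refl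
        m = nn₁ j
        d = nn₁ D
        p = nn {j} ⊠ (nn {j} ⊞ nn {2}) ⊠ d ⊞ nn {D}
        l = solve 2 (λ J D → let m = J :+ con 1ℤ ; d = D :+ con 1ℤ ; ν = m :+ d ; p = J :* ((J :+ con (pos 2)) :* d) :+ D in
            con (pos 4) :* (m :* m :* (m :* m) :+ con (pos 2) :* (m :* m :* m :* :- ν) :+ :- ν :* :- ν :* (:- ν :* :- ν)) :- (con (pos 4) :* ν :+ m) :- con 1ℤ
            := con (pos 8) :* (m :* p) :+ (con (pos 3) :* m :+ (con (pos 24) :* (d :* p) :+ (con (pos 20) :* D :+ (con (pos 19) :+ (con (pos 16) :* (m :* (d :* (d :* d))) :+ con (pos 4) :* (d :* (d :* (d :* d))))))))) refl
    by-order (tri> _ _ ν<m) = from (ℕ.m≤n⇒∃[o]m+o≡n ν<m)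
      where
      from : ∃[ D ] suc (suc v) ℕ.+ D ≡ suc j → Goal
      from (D , e) = by-T {r = r} (0≤⇒< _ T (subst (0ℤ ≤_)
          (sym (trans (cong₂ (λ r z → r - (pos 4 * proj₁ z + proj₂ z) - 1ℤ) (trans T≡ (cong₂ (λ m ν → m * m * (m * m) - pos 4 * (m * m * (- ν * - ν)) - pos 4 * (m * (- ν * - ν * - ν))) m≡ (pos-suc v)))
            (cong₂ _,_ (pos-suc v) m≡)) (l (pos v) (pos D))))
          ((ν ⊞ d) ⊠ (ν ⊠ 0≤x*x (pos v + 1ℤ - (pos D + 1ℤ)) ⊞ ν ⊠ (nn {v} ⊠ d ⊞ nn {D} ⊞ nn {2} ⊠ nn {D} ⊠ (nn {D} ⊞ nn {2})) ⊞ nn {D} ⊠ (nn {D} ⊠ nn {D} ⊞ nn {3} ⊠ nn {D} ⊞ nn {3}))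
            ⊞ nn {3} ⊠ ν ⊠ nn {v} ⊞ nn {3} ⊠ ν ⊠ nn {D} ⊞ nn {2} ⊠ nn {v} ⊞ nn {1})))
        where
        m≡ : pos (suc j) ≡ pos v + 1ℤ + (pos D + 1ℤ)
        m≡ = trans (cong pos (sym e)) (trans (pos-+ (suc (suc v)) D) (trans (cong (_+ pos D) (trans (pos-suc (suc v)) (cong (_+ 1ℤ) (pos-suc v)))) (l₀ (pos v) (pos D))))
          where
          l₀ = solve 2 (λ j D → j :+ con 1ℤ :+ con 1ℤ :+ D := j :+ con 1ℤ :+ (D :+ con 1ℤ)) refl
        ν = nn₁ v
        d = nn₁ D
        l = solve 2 (λ V D → let ν = V :+ con 1ℤ ; d = D :+ con 1ℤ ; m = ν :+ d in
            m :* m :* (m :* m) :- con (pos 4) :* (m :* m :* (:- ν :* :- ν)) :- con (pos 4) :* (m :* (:- ν :* :- ν :* :- ν)) :- (con (pos 4) :* ν :+ m) :- con 1ℤ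
            := (ν :+ d) :* (ν :* ((ν :- d) :* (ν :- d)) :+ (ν :* (V :* d :+ (D :+ con (pos 2) :* (D :* (D :+ con (pos 2))))) :+ D :* (D :* D :+ (con (pos 3) :* D :+ con (pos 3)))))
              :+ (con (pos 3) :* (ν :* V) :+ (con (pos 3) :* (ν :* D) :+ (con (pos 2) :* V :+ con 1ℤ)))) refl

  -- As for the first form, with r decisive for n > 0 and T for n < 0. At m = 1, n = -1 the two
  -- sides are equal, with r = 1 and T = 2; there T is not a square.
  decrease₂ : ∀ m n {r T} → m ≢ 0 → n ≢ 0ℤ → n ≢ - pos (m ℕ.+ m) → 0ℤ ≤ T → T ≢ pos 2
    → r ≡ pos 16 * (pos m * pos m * (pos m * pos m)) + pos 16 * (pos m * pos m * pos m * n) + n * n * (n * n)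
    → T ≡ pos 4 * (pos m * pos m * (pos m * pos m)) - pos 4 * (pos m * pos m * (n * n)) - pos 2 * (pos m * (n * n * n))
    → pos 2 * pos (abs n) + pos m < pos (abs r) + T
  decrease₂ zero n m≢0 _ _ _ _ _ _ = contradiction refl m≢0
  decrease₂ (suc j) (pos zero) _ n≢0 _ _ _ _ _ = contradiction refl n≢0
  decrease₂ (suc j) (pos (suc k)) {r} {T} _ _ _ 0≤T _ r≡ _ = by-r {r = r} 0≤T (0≤⇒< _ r (subst (0ℤ ≤_)
      (sym (trans (cong₂ (λ r z → r - (pos 2 * proj₁ z + proj₂ z) - 1ℤ) (trans r≡ (cong₂ (λ m n → pos 16 * (m * m * (m * m)) + pos 16 * (m * m * m * n) + n * n * (n * n)) (pos-suc j) (pos-suc k)))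
        (cong₂ _,_ (pos-suc k) (pos-suc j))) (l (pos j) (pos k))))
      (nn {16} ⊠ m ⊠ c ⊞ nn {15} ⊠ nn {j} ⊞ nn {14} ⊞ nn {16} ⊠ n ⊠ c ⊞ nn {14} ⊠ n ⊞ n ⊠ n ⊠ n ⊠ n)))
    where
    m = nn₁ j
    n = nn₁ k
    c = nn {j} ⊠ (nn {j} ⊠ nn {j} ⊞ nn {3} ⊠ nn {j} ⊞ nn {3})
    l = solve 2 (λ J K → let m = J :+ con 1ℤ ; n = K :+ con 1ℤ ; c = J :* (J :* J :+ (con (pos 3) :* J :+ con (pos 3))) in
        con (pos 16) :* (m :* m :* (m :* m)) :+ con (pos 16) :* (m :* m :* m :* n) :+ n :* n :* (n :* n) :- (con (pos 2) :* n :+ m) :- con 1ℤ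
        := con (pos 16) :* (m :* c) :+ (con (pos 15) :* J :+ (con (pos 14) :+ (con (pos 16) :* (n :* c) :+ (con (pos 14) :* n :+ n :* (n :* (n :* n))))))) refl
  decrease₂ (suc j) -[1+ v ] {r} {T} _ _ n≢-2m 0≤T T≢2 r≡ T≡ = by-order (ℕ.<-cmp (suc j ℕ.+ suc j) (suc v))
    where
    open import Relation.Binary.Definitions using (tri<; tri≈; tri>; Tri)
    Goal = pos 2 * pos (suc v) + pos (suc j) < pos (abs r) + T
    2m≡ : pos (suc j ℕ.+ suc j) ≡ pos (suc j) + pos (suc j)
    2m≡ = pos-+ (suc j) (suc j)
    by-order : Tri (suc j ℕ.+ suc j ℕ.< suc v) (suc j ℕ.+ suc j ≡ suc v) (suc v ℕ.< suc j ℕ.+ suc j) → Goal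
    by-order (tri≈ _ e _) = contradiction (cong (λ m → - pos m) (sym e)) n≢-2m
    by-order (tri< m<ν _ _) = from (ℕ.m≤n⇒∃[o]m+o≡n m<ν)
      where
      from : ∃[ D ] suc (suc j ℕ.+ suc j) ℕ.+ D ≡ suc v → Goal
      from (D , e) = by-T {r = r} (0≤⇒< _ T (subst (0ℤ ≤_)
          (sym (trans (cong₂ (λ r z → r - (pos 2 * proj₁ z + proj₂ z) - 1ℤ) (trans T≡ (cong₂ (λ m ν → pos 4 * (m * m * (m * m)) - pos 4 * (m * m * (- ν * - ν)) - pos 2 * (m * (- ν * - ν * - ν))) (pos-suc j) ν≡))
            (cong₂ _,_ ν≡ (pos-suc j))) (l (pos j) (pos D))))
          (nn {2} ⊠ ν ⊠ (ν ⊠ (nn {j} ⊠ d ⊞ nn {D}) ⊞ nn {2} ⊠ m ⊞ nn {D}) ⊞ nn {4} ⊠ m ⊠ c ⊞ nn {3} ⊠ nn {j} ⊞ nn {2})))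
        where
        ν≡ : pos (suc v) ≡ (pos j + 1ℤ) + (pos j + 1ℤ) + (pos D + 1ℤ)
        ν≡ = trans (cong pos (sym e)) (trans (pos-+ (suc (suc j ℕ.+ suc j)) D) (trans (cong (_+ pos D) (trans (pos-suc (suc j ℕ.+ suc j)) (cong (_+ 1ℤ) (trans 2m≡ (cong₂ _+_ (pos-suc j) (pos-suc j)))))) (l₀ (pos j) (pos D))))
          where
          l₀ = solve 2 (λ j D → j :+ con 1ℤ :+ (j :+ con 1ℤ) :+ con 1ℤ :+ D := j :+ con 1ℤ :+ (j :+ con 1ℤ) :+ (D :+ con 1ℤ)) refl
        m = nn₁ j
        d = nn₁ D
        ν = (m ⊞ m) ⊞ d
        c = nn {j} ⊠ (nn {j} ⊠ nn {j} ⊞ nn {3} ⊠ nn {j} ⊞ nn {3})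
        l = solve 2 (λ J D → let m = J :+ con 1ℤ ; d = D :+ con 1ℤ ; ν = m :+ m :+ d ; c = J :* (J :* J :+ (con (pos 3) :* J :+ con (pos 3))) in
            con (pos 4) :* (m :* m :* (m :* m)) :- con (pos 4) :* (m :* m :* (:- ν :* :- ν)) :- con (pos 2) :* (m :* (:- ν :* :- ν :* :- ν)) :- (con (pos 2) :* ν :+ m) :- con 1ℤ
            := con (pos 2) :* (ν :* (ν :* (J :* d :+ D) :+ (con (pos 2) :* m :+ D))) :+ (con (pos 4) :* (m :* c) :+ (con (pos 3) :* J :+ con (pos 2)))) refl
    by-order (tri> _ _ ν<m) = from (ℕ.m≤n⇒∃[o]m+o≡n ν<m)
      where
      from : ∃[ D ] suc (suc v) ℕ.+ D ≡ suc j ℕ.+ suc j → Goal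
      -- After multiplication by 4 the inequality involves m only through 2m = ν + d, where d = D +
      -- 1 > 0, so ν and d serve as free variables.
      from (D , e) = by-T {r = r} (*-cancelˡ-<-nonNeg (pos 4) (0≤⇒< _ (pos 4 * T) (by-size D v refl refl)))
        where
        M V : ℤ
        M = pos (suc j)
        V = pos (suc v)
        2M≡ : M + M ≡ V + (pos D + 1ℤ)
        2M≡ = trans (sym 2m≡) (trans (cong pos (sym e)) (trans (pos-+ (suc (suc v)) D) (trans (cong (_+ pos D) (pos-suc (suc v))) (l₀ (pos (suc v)) (pos D)))))
          where
          l₀ = solve 2 (λ j D → j :+ con 1ℤ :+ D := j :+ (D :+ con 1ℤ)) refl
        bracket : ℤ → ℤ → ℤ
        bracket ν d = ν * ((ν - d) * (ν - d)) + ν * (ν * d + pos 2 * (d * d)) + d * d * d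
        reduced : pos 4 * T - pos 4 * (pos 2 * V + M) - 1ℤ ≡ (V + (pos D + 1ℤ)) * bracket V (pos D + 1ℤ) - (pos 10 * V + pos 2 * (pos D + 1ℤ)) - 1ℤ
        reduced = trans (cong (λ T → pos 4 * T - pos 4 * (pos 2 * V + M) - 1ℤ) T≡) (trans (l M V)
            (trans (cong (λ S → (S * S * S * S - pos 4 * (S * S * (V * V)) + pos 4 * (S * (V * V * V))) - pos 8 * V - pos 2 * S - 1ℤ) 2M≡) (l′ V (pos D + 1ℤ))))
          where
          l = solve 2 (λ m ν → con (pos 4) :* (con (pos 4) :* (m :* m :* (m :* m)) :- con (pos 4) :* (m :* m :* (:- ν :* :- ν)) :- con (pos 2) :* (m :* (:- ν :* :- ν :* :- ν))) :- con (pos 4) :* (con (pos 2) :* ν :+ m) :- con 1ℤ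
            := ((m :+ m) :* (m :+ m) :* (m :+ m) :* (m :+ m) :- con (pos 4) :* ((m :+ m) :* (m :+ m) :* (ν :* ν)) :+ con (pos 4) :* ((m :+ m) :* (ν :* ν :* ν))) :- con (pos 8) :* ν :- con (pos 2) :* (m :+ m) :- con 1ℤ) refl
          l′ = solve 2 (λ ν d → let S = ν :+ d in (S :* S :* S :* S :- con (pos 4) :* (S :* S :* (ν :* ν)) :+ con (pos 4) :* (S :* (ν :* ν :* ν))) :- con (pos 8) :* ν :- con (pos 2) :* S :- con 1ℤ
             := (ν :+ d) :* (ν :* ((ν :- d) :* (ν :- d)) :+ ν :* (ν :* d :+ con (pos 2) :* (d :* d)) :+ d :* d :* d) :- (con (pos 10) :* ν :+ con (pos 2) :* d) :- con 1ℤ) refl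
        by-size : ∀ D′ v′ → D ≡ D′ → v ≡ v′ → 0ℤ ≤ pos 4 * T - pos 4 * (pos 2 * V + M) - 1ℤ
        by-size zero zero refl refl = contradiction (*-cancelˡ-≡ (pos 8) _ _ (trans (cong (pos 8 *_) T≡) (trans (l M) (cong (λ S → pos 2 * (S * S * S * S) - pos 8 * (S * S) + pos 8 * S) 2M≡)))) T≢2
          where
          l = solve 1 (λ m → con (pos 8) :* (con (pos 4) :* (m :* m :* (m :* m)) :- con (pos 4) :* (m :* m :* (:- con 1ℤ :* :- con 1ℤ)) :- con (pos 2) :* (m :* (:- con 1ℤ :* :- con 1ℤ :* :- con 1ℤ)))
            := con (pos 2) :* ((m :+ m) :* (m :+ m) :* (m :+ m) :* (m :+ m)) :- con (pos 8) :* ((m :+ m) :* (m :+ m)) :+ con (pos 8) :* (m :+ m)) refl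
        by-size zero (suc V′) refl refl = subst (0ℤ ≤_) (sym (trans reduced (trans (cong (λ ν → (ν + (0ℤ + 1ℤ)) * bracket ν (0ℤ + 1ℤ) - (pos 10 * ν + pos 2 * (0ℤ + 1ℤ)) - 1ℤ) ν≡) (l (pos V′)))))
            ((nn {V′} ⊞ nn {3}) ⊠ ν ⊠ (nn {V′} ⊠ nn {V′} ⊞ nn {3} ⊠ nn {V′}) ⊞ nn {5} ⊠ ν ⊠ nn {V′} ⊞ nn {6} ⊠ nn {V′} ⊞ nn {10})
          where
          ν = nn {V′} ⊞ nn {2}
          ν≡ : pos (suc (suc V′)) ≡ pos V′ + pos 2
          ν≡ = +-comm (pos 2) (pos V′)
          l = solve 1 (λ V → let ν = V :+ con (pos 2) ; d = con 0ℤ :+ con 1ℤ in (ν :+ d) :* (ν :* ((ν :- d) :* (ν :- d)) :+ ν :* (ν :* d :+ con (pos 2) :* (d :* d)) :+ d :* d :* d) :- (con (pos 10) :* ν :+ con (pos 2) :* d) :- con 1ℤ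
            := (V :+ con (pos 3)) :* (ν :* (V :* V :+ con (pos 3) :* V)) :+ (con (pos 5) :* (ν :* V) :+ (con (pos 6) :* V :+ con (pos 10)))) refl
        by-size (suc D′) v′ refl refl = subst (0ℤ ≤_) (sym (trans reduced (trans (cong₂ (λ ν d → (ν + d) * bracket ν d - (pos 10 * ν + pos 2 * d) - 1ℤ) (pos-suc v) d≡) (l (pos v) (pos D′)))))
            ((ν ⊞ d) ⊠ (ν ⊠ 0≤x*x (pos v + 1ℤ - (pos D′ + pos 2)) ⊞ ν ⊠ (nn {v} ⊠ d ⊞ nn {D′} ⊞ nn {2} ⊠ nn {D′} ⊠ (nn {D′} ⊞ nn {4})) ⊞ nn {D′} ⊠ (nn {D′} ⊠ nn {D′} ⊞ nn {6} ⊠ nn {D′} ⊞ nn {12}))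
             ⊞ nn {10} ⊠ ν ⊠ nn {v} ⊞ nn {8} ⊠ ν ⊞ nn {10} ⊠ ν ⊠ d ⊞ nn {6} ⊠ nn {D′} ⊞ nn {11})
          where
          ν = nn₁ v
          d = nn {D′} ⊞ nn {2}
          d≡ : pos (suc D′) + 1ℤ ≡ pos D′ + pos 2
          d≡ = trans (cong (_+ 1ℤ) (pos-suc D′)) (+-assoc (pos D′) 1ℤ 1ℤ)
          l = solve 2 (λ V D → let ν = V :+ con 1ℤ ; d = D :+ con (pos 2) in (ν :+ d) :* (ν :* ((ν :- d) :* (ν :- d)) :+ ν :* (ν :* d :+ con (pos 2) :* (d :* d)) :+ d :* d :* d) :- (con (pos 10) :* ν :+ con (pos 2) :* d) :- con 1ℤ
            := (ν :+ d) :* (ν :* ((ν :- d) :* (ν :- d)) :+ (ν :* (V :* d :+ (D :+ con (pos 2) :* (D :* (D :+ con (pos 4))))) :+ D :* (D :* D :+ (con (pos 6) :* D :+ con (pos 12)))))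
              :+ (con (pos 10) :* (ν :* V) :+ (con (pos 8) :* ν :+ (con (pos 10) :* (ν :* d) :+ (con (pos 6) :* D :+ con (pos 11)))))) refl

-- Rational points of y² = u³ - 4u² + 16 by descent on the height.

module Curve11 where
  open Rationals using (ring)
  open IntegersInℚ
  open IntegerArithmetic
  open TwoDescent
  open import Data.Nat using (ℕ; suc)
  import Data.Nat as ℕ
  import Data.Nat.Properties as ℕ
  import Data.Nat.Divisibility as ℕ
  open import Data.Nat.Coprimality as Coprime using (Coprime; coprime-divisor)
  open import Data.Integer using (ℤ; 0ℤ; _+_; _*_; _-_; -_; _≤_; _<_) renaming (+_ to pos; ∣_∣ to abs)
  import Data.Integer as ℤ hiding (+_)
  open import Data.Integer.Properties
  open import Data.Integer.Divisibility.Signed using (_∣_)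
  open import Data.Rational using (ℚ; 0ℚ; 1ℚ)
  import Data.Rational as ℚ
  import Data.Rational.Properties as ℚ
  open import Data.Integer.Tactic.RingSolver using (solve-∀)
  import Tactic.RingSolver as ℚSolver

  ℚ2 ℚ4 : ℚ
  ℚ2 = 1ℚ ℚ.+ 1ℚ
  ℚ4 = ℚ2 ℚ.+ ℚ2

  Curve11 : ℚ → ℚ → Set
  Curve11 u y = y ℚ.* y ≡ u ℚ.* u ℚ.* u ℚ.+ ι (- pos 4) ℚ.* (u ℚ.* u) ℚ.+ ι 0ℤ ℚ.* u ℚ.+ ι (pos 16)

  Integral : ℚ → Set
  Integral = IntegralPoint (- pos 4) 0ℤ (pos 16)

  private
    -- u′ = K/m with u′ = r′/t′² in lowest terms.
    height-bound : ∀ {u} m K → m ≢ 0 → u ℚ.* ι (pos m) ≡ ι K → (P : Integral u) → abs (IntegralPoint.r P) ℕ.+ IntegralPoint.t P ℕ.* IntegralPoint.t P ℕ.≤ abs K ℕ.+ m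
    height-bound {u} m K m≢0 um≡K P = ℕ.+-mono-≤ r≤K T≤m
      where
      open IntegralPoint P
      T′ = t ℕ.* t
      T′≢0 : T′ ≢ 0
      T′≢0 e = t≢0 (x*x≡0⇒x≡0 (pos t) (trans (sym (pos-* t t)) (cong pos e)))
      instance
        T′-nonZero : ℕ.NonZero T′
        T′-nonZero = ℕ.≢-nonZero T′≢0
      cross : r * pos m ≡ K * (pos t * pos t)
      cross = ι-injective (trans (ι-* r (pos m)) (trans (cong (ℚ._* ι (pos m)) (sym u*t²≡r)) (trans (l u (ι (pos t * pos t)) (ι (pos m)))
        (trans (cong (ℚ._* ι (pos t * pos t)) um≡K) (sym (ι-* K (pos t * pos t)))))))
        where
        l : ∀ u T m → u ℚ.* T ℚ.* m ≡ u ℚ.* m ℚ.* T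
        l = ℚSolver.solve-∀ ring
      crossℕ : abs r ℕ.* m ≡ abs K ℕ.* T′
      crossℕ = trans (sym (abs-* r (pos m))) (trans (cong abs (trans cross (cong (K *_) (sym (pos-* t t))))) (abs-* K (pos T′)))
      T′⊥r : Coprime T′ (abs r)
      T′⊥r = Coprime.sym (coprimeℤ⇒coprime {r} {pos T′} (λ {q} isPrime h h′ → coprime isPrime h (euclid² isPrime (pos t) (subst (pos q ∣_) (pos-* t t) h′))))
      T′∣m : T′ ℕ.∣ m
      T′∣m = coprime-divisor T′⊥r (ℕ.divides (abs K) crossℕ)
      T≤m : T′ ℕ.≤ m
      T≤m = ℕ.∣⇒≤ {{ℕ.≢-nonZero m≢0}} T′∣m
      r≤K : abs r ℕ.≤ abs K
      r≤K = ℕ.*-cancelʳ-≤ (abs r) (abs K) T′ (subst (abs r ℕ.* T′ ℕ.≤_) crossℕ (ℕ.*-monoʳ-≤ (abs r) T≤m))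

    integral : ∀ u y → Curve11 u y → Integral u
    integral u y on = integral-point (- pos 4) 0ℤ (pos 16) u y on

    ι4 : ι (pos 4) ≡ ℚ4
    ι4 = ι≡mkℚ (pos 4)

    ι2 : ι (pos 2) ≡ ℚ2
    ι2 = ι≡mkℚ (pos 2)

    curve11 : ∀ {u y} → y ℚ.* y ≡ u ℚ.* u ℚ.* u ℚ.- ℚ4 ℚ.* (u ℚ.* u) ℚ.+ ℚ4 ℚ.* ℚ4 → Curve11 u y
    curve11 {u} on = trans on (trans (l u) (sym (cong₂ (λ a b → a ℚ.+ b) (cong₂ (λ a b → u ℚ.* u ℚ.* u ℚ.+ a ℚ.* (u ℚ.* u) ℚ.+ b ℚ.* u)
        (trans (ι-neg (pos 4)) (cong ℚ.-_ ι4)) ι-0) (ι⟨*⟩ {pos 4} {pos 4} ι4 ι4))))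
      where
      l : ∀ u → u ℚ.* u ℚ.* u ℚ.- ℚ4 ℚ.* (u ℚ.* u) ℚ.+ ℚ4 ℚ.* ℚ4 ≡ u ℚ.* u ℚ.* u ℚ.+ ℚ.- ℚ4 ℚ.* (u ℚ.* u) ℚ.+ 0ℚ ℚ.* u ℚ.+ ℚ4 ℚ.* ℚ4
      l = ℚSolver.solve-∀ ring

    t²≢2 : ∀ t → pos t * pos t ≢ pos 2
    t²≢2 (suc (suc t)) e = impossible (ℕ.m+n≡0⇒n≡0 t (ℕ.suc-injective (ℕ.suc-injective (+-injective (trans (pos-* (suc (suc t)) (suc (suc t))) e)))))
      where
      impossible : ∀ {n} → suc n ≢ 0
      impossible ()

  -- Unless u is 0 or 4, its half u′ is smaller, so u′ is 0 or 4 by induction. But these values of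
  -- u′ are n = 0 and n = -m (n = -2m in the second form), which were already seen to give u = 4 and
  -- u = 0.
  curve11-descent : ∀ fuel u → (P : Integral u) → abs (IntegralPoint.r P) ℕ.+ IntegralPoint.t P ℕ.* IntegralPoint.t P ℕ.< fuel → u ≡ 0ℚ ⊎ u ≡ ι (pos 4)
  curve11-descent (suc fuel) u P size<fuel = from (Halving.halve r τ s t≢0 coprime (trans eq (l₀ r (τ * τ))))
    where
    open IntegralPoint P
    τ = pos t
    T = τ * τ
    Goal = u ≡ 0ℚ ⊎ u ≡ ι (pos 4)
    l₀ : ∀ r T → r * r * r + - pos 4 * (r * r) * T + 0ℤ * r * (T * T) + pos 16 * (T * T * T) ≡ r * r * r - pos 4 * (r * r * T) + pos 16 * (T * T * T)
    l₀ = solve-∀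
    T≢0 : ι T ≢ 0ℚ
    T≢0 e = t≢0 (x*x≡0⇒x≡0 τ (ι-injective (trans e (sym ι-0))))
    u≡ : ∀ k → r ≡ k * T → u ≡ ι k
    u≡ k r≡ = Rationals.*-cancelˡ (ι T) T≢0 (trans (ℚ.*-comm (ι T) u) (trans u*t²≡r (trans (cong ι r≡) (trans (ι-* k T) (ℚ.*-comm (ι k) (ι T))))))
    u≡0 : r ≡ 0ℤ → Goal
    u≡0 r≡0 = inj₁ (trans (u≡ 0ℤ (trans r≡0 (sym (*-zeroˡ T)))) ι-0)
    0≤T : 0ℤ ≤ T
    0≤T = 0≤x*x τ
    below : ∀ {K m} → pos K + pos m < pos (abs r) + T → K ℕ.+ m ℕ.< fuel
    below {K} {m} h = ℕ.<-≤-trans (drop‿+<+ (subst₂ _<_ (sym (pos-+ K m)) (trans (cong (pos (abs r) +_) (sym (pos-* t t))) (sym (pos-+ (abs r) (t ℕ.* t)))) h)) (ℕ.≤-pred size<fuel)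
    module Half (m : ℕ) (m≢0 : m ≢ 0) where
      M = ι (pos m)
      i = inv M
      M≢0 : M ≢ 0ℚ
      M≢0 e = m≢0 (+-injective (ι-injective (trans e (sym ι-0))))
      Mi≡1 : M ℚ.* i ≡ 1ℚ
      Mi≡1 = Rationals.inv-inverseʳ M M≢0
      u′m : ∀ K → K ℚ.* i ℚ.* M ≡ K
      u′m K = trans (l K i M) (trans (cong (K ℚ.*_) Mi≡1) (ℚ.*-identityʳ K))
        where
        l : ∀ K i M → K ℚ.* i ℚ.* M ≡ K ℚ.* (M ℚ.* i)
        l = ℚSolver.solve-∀ ring
    descend : ∀ m K (m≢0 : m ≢ 0) y → Curve11 (ι K ℚ.* Half.i m m≢0) y → pos (abs K) + pos m < pos (abs r) + T → (K ≡ 0ℤ → Goal) → (K ≡ pos 4 * pos m → Goal) → Goal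
    descend m K m≢0 y on small zero-case four-case = [ (λ e → zero-case (ι-injective (trans (sym (u′m (ι K))) (trans (cong (ℚ._* M) e) (trans (ℚ.*-zeroˡ M) (sym ι-0))))))
        , (λ e → four-case (ι-injective (trans (sym (u′m (ι K))) (trans (cong (ℚ._* M) e) (sym (ι-* (pos 4) (pos m))))))) ]′
      (curve11-descent fuel u′ P′ (ℕ.≤-<-trans (height-bound m K m≢0 (u′m (ι K)) P′) (below {abs K} {m} small)))
      where
      open Half m m≢0
      u′ = ι K ℚ.* i
      P′ = integral u′ y on
    from : Halved r T → Goal
    from (halved₁ m n m≢0 r≡ T≡) = by-n (n ℤ.≟ 0ℤ) (n ℤ.≟ - pos m)
      where
      open Half m m≢0
      by-n : Dec (n ≡ 0ℤ) → Dec (n ≡ - pos m) → Goal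
      by-n (yes refl) _ = inj₂ (u≡ (pos 4) (trans r≡ (trans (l (pos m)) (cong (pos 4 *_) (sym T≡)))))
        where
        l : ∀ m → pos 4 * (m * m * (m * m) + pos 2 * (m * m * m * 0ℤ) + 0ℤ * 0ℤ * (0ℤ * 0ℤ)) ≡ pos 4 * (m * m * (m * m) - pos 4 * (m * m * (0ℤ * 0ℤ)) - pos 4 * (m * (0ℤ * 0ℤ * 0ℤ)))
        l = solve-∀
      by-n (no _) (yes refl) = u≡0 (trans r≡ (l (pos m)))
        where
        l : ∀ m → pos 4 * (m * m * (m * m) + pos 2 * (m * m * m * - m) + - m * - m * (- m * - m)) ≡ 0ℤ
        l = solve-∀
      -- That T is the square t² says exactly that (-4n/m, 4t/m²) lies on the curve again.
      by-n (no n≢0) (no n≢-m) = descend m (- pos 4 * n) m≢0 (ℚ4 ℚ.* ι τ ℚ.* i ℚ.* i) on′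
          (subst (λ k → k + pos m < pos (abs r) + T) (trans (sym (pos-* 4 (abs n))) (cong pos (sym (abs-* (- pos 4) n)))) (decrease₁ m n m≢0 n≢0 n≢-m 0≤T r≡ T≡))
          (λ e → contradiction (*-cancelˡ-≡ (- pos 4) n 0ℤ e) n≢0) (λ e → contradiction (*-cancelˡ-≡ (- pos 4) n (- pos m) (trans e (l (pos m)))) n≢-m)
        where
        l : ∀ m → pos 4 * m ≡ - pos 4 * - m
        l = solve-∀
        N = ι n
        Tℚ : ι τ ℚ.* ι τ ≡ M ℚ.* M ℚ.* (M ℚ.* M) ℚ.- ℚ4 ℚ.* (M ℚ.* M ℚ.* (N ℚ.* N)) ℚ.- ℚ4 ℚ.* (M ℚ.* (N ℚ.* N ℚ.* N))
        Tℚ = trans (sym (ι-* τ τ)) (trans (cong ι T≡) (ι⟨-⟩ (ι⟨-⟩ (ι⟨*⟩ (ι⟨*⟩ refl refl) (ι⟨*⟩ refl refl)) (ι⟨*⟩ ι4 (ι⟨*⟩ (ι⟨*⟩ refl refl) (ι⟨*⟩ refl refl)))) (ι⟨*⟩ ι4 (ι⟨*⟩ refl (ι⟨*⟩ (ι⟨*⟩ refl refl) refl)))))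
        K≡ : ι (- pos 4 * n) ≡ ℚ.- ℚ4 ℚ.* N
        K≡ = ι⟨*⟩ (trans (ι-neg (pos 4)) (cong ℚ.-_ ι4)) refl
        on′ : Curve11 (ι (- pos 4 * n) ℚ.* i) (ℚ4 ℚ.* ι τ ℚ.* i ℚ.* i)
        on′ = curve11 {ι (- pos 4 * n) ℚ.* i} {ℚ4 ℚ.* ι τ ℚ.* i ℚ.* i} (trans (e₁ (ι τ) i) (trans (cong (λ T → ℚ4 ℚ.* ℚ4 ℚ.* (i ℚ.* i ℚ.* (i ℚ.* i)) ℚ.* T) Tℚ) (trans (e₂ M i N)
          (trans (cong (λ w → ℚ4 ℚ.* ℚ4 ℚ.* (w ℚ.* w ℚ.* (w ℚ.* w) ℚ.- ℚ4 ℚ.* (w ℚ.* w ℚ.* (N ℚ.* i ℚ.* (N ℚ.* i))) ℚ.- ℚ4 ℚ.* (w ℚ.* (N ℚ.* i ℚ.* (N ℚ.* i) ℚ.* (N ℚ.* i))))) Mi≡1)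
          (trans (e₃ i N) (sym (cong (λ k → k ℚ.* i ℚ.* (k ℚ.* i) ℚ.* (k ℚ.* i) ℚ.- ℚ4 ℚ.* (k ℚ.* i ℚ.* (k ℚ.* i)) ℚ.+ ℚ4 ℚ.* ℚ4) K≡)))))))
          where
          e₁ : ∀ t i → ℚ4 ℚ.* t ℚ.* i ℚ.* i ℚ.* (ℚ4 ℚ.* t ℚ.* i ℚ.* i) ≡ ℚ4 ℚ.* ℚ4 ℚ.* (i ℚ.* i ℚ.* (i ℚ.* i)) ℚ.* (t ℚ.* t)
          e₁ = ℚSolver.solve-∀ ring
          e₂ : ∀ M i N → ℚ4 ℚ.* ℚ4 ℚ.* (i ℚ.* i ℚ.* (i ℚ.* i)) ℚ.* (M ℚ.* M ℚ.* (M ℚ.* M) ℚ.- ℚ4 ℚ.* (M ℚ.* M ℚ.* (N ℚ.* N)) ℚ.- ℚ4 ℚ.* (M ℚ.* (N ℚ.* N ℚ.* N)))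
            ≡ let w = M ℚ.* i ; v = N ℚ.* i in ℚ4 ℚ.* ℚ4 ℚ.* (w ℚ.* w ℚ.* (w ℚ.* w) ℚ.- ℚ4 ℚ.* (w ℚ.* w ℚ.* (v ℚ.* v)) ℚ.- ℚ4 ℚ.* (w ℚ.* (v ℚ.* v ℚ.* v)))
          e₂ = ℚSolver.solve-∀ ring
          e₃ : ∀ i N → let w = 1ℚ ; v = N ℚ.* i ; u = ℚ.- ℚ4 ℚ.* N ℚ.* i in
            ℚ4 ℚ.* ℚ4 ℚ.* (w ℚ.* w ℚ.* (w ℚ.* w) ℚ.- ℚ4 ℚ.* (w ℚ.* w ℚ.* (v ℚ.* v)) ℚ.- ℚ4 ℚ.* (w ℚ.* (v ℚ.* v ℚ.* v)))
            ≡ u ℚ.* u ℚ.* u ℚ.- ℚ4 ℚ.* (u ℚ.* u) ℚ.+ ℚ4 ℚ.* ℚ4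
          e₃ = ℚSolver.solve-∀ ring
    from (halved₂ m n m≢0 r≡ T≡) = by-n (n ℤ.≟ 0ℤ) (n ℤ.≟ - pos (m ℕ.+ m))
      where
      open Half m m≢0
      by-n : Dec (n ≡ 0ℤ) → Dec (n ≡ - pos (m ℕ.+ m)) → Goal
      by-n (yes refl) _ = inj₂ (u≡ (pos 4) (trans r≡ (trans (l (pos m)) (cong (pos 4 *_) (sym T≡)))))
        where
        l : ∀ m → pos 16 * (m * m * (m * m)) + pos 16 * (m * m * m * 0ℤ) + 0ℤ * 0ℤ * (0ℤ * 0ℤ) ≡ pos 4 * (pos 4 * (m * m * (m * m)) - pos 4 * (m * m * (0ℤ * 0ℤ)) - pos 2 * (m * (0ℤ * 0ℤ * 0ℤ)))
        l = solve-∀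
      by-n (no _) (yes n≡) = u≡0 (trans r≡ (trans (cong (λ n → pos 16 * (pos m * pos m * (pos m * pos m)) + pos 16 * (pos m * pos m * pos m * n) + n * n * (n * n)) (trans n≡ (cong -_ (pos-+ m m)))) (l (pos m))))
        where
        l : ∀ m → pos 16 * (m * m * (m * m)) + pos 16 * (m * m * m * - (m + m)) + - (m + m) * - (m + m) * (- (m + m) * - (m + m)) ≡ 0ℤ
        l = solve-∀
      by-n (no n≢0) (no n≢-2m) = descend m (- pos 2 * n) m≢0 (ℚ2 ℚ.* ι τ ℚ.* i ℚ.* i) on′
          (subst (λ k → k + pos m < pos (abs r) + T) (trans (sym (pos-* 2 (abs n))) (cong pos (sym (abs-* (- pos 2) n)))) (decrease₂ m n m≢0 n≢0 n≢-2m 0≤T (t²≢2 t) r≡ T≡))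
          (λ e → contradiction (*-cancelˡ-≡ (- pos 2) n 0ℤ e) n≢0)
          (λ e → contradiction (trans (*-cancelˡ-≡ (- pos 2) n (- (pos m + pos m)) (trans e (l (pos m)))) (cong -_ (sym (pos-+ m m)))) n≢-2m)
        where
        l : ∀ m → pos 4 * m ≡ - pos 2 * - (m + m)
        l = solve-∀
        N = ι n
        Tℚ : ι τ ℚ.* ι τ ≡ ℚ4 ℚ.* (M ℚ.* M ℚ.* (M ℚ.* M)) ℚ.- ℚ4 ℚ.* (M ℚ.* M ℚ.* (N ℚ.* N)) ℚ.- ℚ2 ℚ.* (M ℚ.* (N ℚ.* N ℚ.* N))
        Tℚ = trans (sym (ι-* τ τ)) (trans (cong ι T≡) (ι⟨-⟩ (ι⟨-⟩ (ι⟨*⟩ ι4 (ι⟨*⟩ (ι⟨*⟩ refl refl) (ι⟨*⟩ refl refl))) (ι⟨*⟩ ι4 (ι⟨*⟩ (ι⟨*⟩ refl refl) (ι⟨*⟩ refl refl)))) (ι⟨*⟩ ι2 (ι⟨*⟩ refl (ι⟨*⟩ (ι⟨*⟩ refl refl) refl)))))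
        K≡ : ι (- pos 2 * n) ≡ ℚ.- ℚ2 ℚ.* N
        K≡ = ι⟨*⟩ (trans (ι-neg (pos 2)) (cong ℚ.-_ ι2)) refl
        on′ : Curve11 (ι (- pos 2 * n) ℚ.* i) (ℚ2 ℚ.* ι τ ℚ.* i ℚ.* i)
        on′ = curve11 {ι (- pos 2 * n) ℚ.* i} {ℚ2 ℚ.* ι τ ℚ.* i ℚ.* i} (trans (e₁ (ι τ) i) (trans (cong (λ T → ℚ2 ℚ.* ℚ2 ℚ.* (i ℚ.* i ℚ.* (i ℚ.* i)) ℚ.* T) Tℚ) (trans (e₂ M i N)
          (trans (cong (λ w → ℚ2 ℚ.* ℚ2 ℚ.* (ℚ4 ℚ.* (w ℚ.* w ℚ.* (w ℚ.* w)) ℚ.- ℚ4 ℚ.* (w ℚ.* w ℚ.* (N ℚ.* i ℚ.* (N ℚ.* i))) ℚ.- ℚ2 ℚ.* (w ℚ.* (N ℚ.* i ℚ.* (N ℚ.* i) ℚ.* (N ℚ.* i))))) Mi≡1)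
          (trans (e₃ i N) (sym (cong (λ k → k ℚ.* i ℚ.* (k ℚ.* i) ℚ.* (k ℚ.* i) ℚ.- ℚ4 ℚ.* (k ℚ.* i ℚ.* (k ℚ.* i)) ℚ.+ ℚ4 ℚ.* ℚ4) K≡)))))))
          where
          e₁ : ∀ t i → ℚ2 ℚ.* t ℚ.* i ℚ.* i ℚ.* (ℚ2 ℚ.* t ℚ.* i ℚ.* i) ≡ ℚ2 ℚ.* ℚ2 ℚ.* (i ℚ.* i ℚ.* (i ℚ.* i)) ℚ.* (t ℚ.* t)
          e₁ = ℚSolver.solve-∀ ring
          e₂ : ∀ M i N → ℚ2 ℚ.* ℚ2 ℚ.* (i ℚ.* i ℚ.* (i ℚ.* i)) ℚ.* (ℚ4 ℚ.* (M ℚ.* M ℚ.* (M ℚ.* M)) ℚ.- ℚ4 ℚ.* (M ℚ.* M ℚ.* (N ℚ.* N)) ℚ.- ℚ2 ℚ.* (M ℚ.* (N ℚ.* N ℚ.* N)))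
            ≡ let w = M ℚ.* i ; v = N ℚ.* i in ℚ2 ℚ.* ℚ2 ℚ.* (ℚ4 ℚ.* (w ℚ.* w ℚ.* (w ℚ.* w)) ℚ.- ℚ4 ℚ.* (w ℚ.* w ℚ.* (v ℚ.* v)) ℚ.- ℚ2 ℚ.* (w ℚ.* (v ℚ.* v ℚ.* v)))
          e₂ = ℚSolver.solve-∀ ring
          e₃ : ∀ i N → let w = 1ℚ ; v = N ℚ.* i ; u = ℚ.- ℚ2 ℚ.* N ℚ.* i in
            ℚ2 ℚ.* ℚ2 ℚ.* (ℚ4 ℚ.* (w ℚ.* w ℚ.* (w ℚ.* w)) ℚ.- ℚ4 ℚ.* (w ℚ.* w ℚ.* (v ℚ.* v)) ℚ.- ℚ2 ℚ.* (w ℚ.* (v ℚ.* v ℚ.* v)))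
            ≡ u ℚ.* u ℚ.* u ℚ.- ℚ4 ℚ.* (u ℚ.* u) ℚ.+ ℚ4 ℚ.* ℚ4
          e₃ = ℚSolver.solve-∀ ring

  curve11-points : ∀ u y → y ℚ.* y ≡ u ℚ.* u ℚ.* u ℚ.- ℚ4 ℚ.* (u ℚ.* u) ℚ.+ ℚ4 ℚ.* ℚ4 → u ≡ 0ℚ ⊎ u ≡ ℚ4
  curve11-points u y on = [ inj₁ , (λ e → inj₂ (trans e ι4)) ]′ (curve11-descent _ u P ℕ.≤-refl)
    where
    P = integral u y (curve11 {u} {y} on)

-- Identification of the given curve with a twist, and the two exceptional ratios.

module Twists where
  open Rationals
  open IntegersInℚ
  open Scaling
  open IntegralModels using (numerator-coprime)
  open TwistFamily
  open Curve20 using (curve20-points)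
  open Curve11 using (curve11-points; ℚ4)
  open import Data.Nat using (s≤s; z≤n)
  open import Data.Integer using (ℤ; 0ℤ) renaming (+_ to pos)
  import Data.Integer as ℤ hiding (+_)
  import Data.Integer.Properties as ℤ
  open import Data.Rational using (ℚ; 0ℚ; 1ℚ; _+_; _*_; _-_; -_; _/_; ↥_; ↧_)
  open import Data.Rational.Properties
  open import Tactic.RingSolver using (solve-∀)

  private
    _⁴ _⁶ : ℚ → ℚ
    x ⁴ = x * x * x * x
    x ⁶ = x * x * x * x * x * x

  -- With q = ac / b², the curve is the twist by bc of a curve depending on q alone.
  E3A-twist : ∀ {a b c q} → a * c ≡ q * (b * b) → E3A a b c ≡ - (pos 3 / 1 * (q * q)) * (b * c) ⁴
  E3A-twist {a} {b} {c} {q} ac≡ = trans (e₁ a c) (trans (cong (λ x → - (pos 3 / 1 * (x * x)) * (c * c * c * c)) ac≡) (e₂ b c q))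
    where
    e₁ : ∀ a c → - (pos 3 / 1 * (a * a) * (c * (c * (c * (c * (c * (c * 1ℚ))))))) ≡ - (pos 3 / 1 * (a * c * (a * c))) * (c * c * c * c)
    e₁ = solve-∀ ring
    e₂ : ∀ b c q → - (pos 3 / 1 * (q * (b * b) * (q * (b * b)))) * (c * c * c * c) ≡ - (pos 3 / 1 * (q * q)) * (b * c * (b * c) * (b * c) * (b * c))
    e₂ = solve-∀ ring

  E3B-twist : ∀ {a b c q} → a * c ≡ q * (b * b) → E3B a b c ≡ q * q * (1ℚ - (q + q)) * (b * c) ⁶
  E3B-twist {a} {b} {c} {q} ac≡ = trans (e₁ a b c) (trans (cong (λ x → - (x * x * (c * c * c * c * c * c) * (pos 2 / 1 * x - b * b))) ac≡) (e₂ b c q))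
    where
    e₁ : ∀ a b c → - (a * a * (c * (c * (c * (c * (c * (c * (c * (c * 1ℚ)))))))) * (pos 2 / 1 * a * c - b * b))
       ≡ - (a * c * (a * c) * (c * c * c * c * c * c) * (pos 2 / 1 * (a * c) - b * b))
    e₁ = solve-∀ ring
    e₂ : ∀ b c q → - (q * (b * b) * (q * (b * b)) * (c * c * c * c * c * c) * (pos 2 / 1 * (q * (b * b)) - b * b))
       ≡ q * q * (1ℚ - (q + q)) * (b * c * (b * c) * (b * c) * (b * c) * (b * c) * (b * c))
    e₂ = solve-∀ ring

  square-root : ∀ d Y → Y * Y ≡ d * d → Y ≡ d ⊎ Y ≡ - d
  square-root d Y eq = [ (λ h → inj₁ (p-q≡0⇒p≡q h)) , (λ h → inj₂ (linear 1ℚ (e₂ Y d) h)) ]′ (x*y≡0 (Y - d) (Y + d) (linear 1ℚ (e₁ Y d) eq))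
    where
    e₁ : ∀ Y d → (Y - d) * (Y + d) - 0ℚ ≡ 1ℚ * (Y * Y - d * d)
    e₁ = solve-∀ ring
    e₂ : ∀ Y d → Y - - d ≡ 1ℚ * (Y + d - 0ℚ)
    e₂ = solve-∀ ring

  private
    torsion-± : ∀ A B {d X Y} → Torsion A B (aff X d) → Torsion A B (aff X (- d)) → Y ≡ d ⊎ Y ≡ - d → Torsion A B (aff X Y)
    torsion-± A B t _ (inj₁ refl) = t
    torsion-± A B _ t (inj₂ refl) = t

  -- X = 9u + 3 and Y = 27y turn the curve into y² = u³ + u² - u, whose few points are then
  -- multiplied out by evaluation.
  rankZero-20 : RankZero (- (pos 108 / 1)) (pos 297 / 1)
  rankZero-20 O _ = 0 , refl
  rankZero-20 (aff X Y) on = [ at-0 , [ at-1 , at--1 ]′ ]′ (curve20-points u (pos 1 / 27 * Y) (linear (pos 1 / 729) (e X Y) on))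
    where
    Goal = Torsion (- (pos 108 / 1)) (pos 297 / 1) (aff X Y)
    u = pos 1 / 9 * (X - pos 3 / 1)
    e : ∀ X Y → let u = pos 1 / 9 * (X - pos 3 / 1) ; y = pos 1 / 27 * Y in
      y * y - (u * u * u + u * u - u) ≡ pos 1 / 729 * (Y * Y - (X * X * X + - (pos 108 / 1) * X + pos 297 / 1))
    e = solve-∀ ring
    X≡ : ∀ {v} → u ≡ v → X ≡ pos 9 / 1 * v + pos 3 / 1
    X≡ {v} eq = linear (pos 9 / 1) (l X v) eq
      where
      l : ∀ X v → X - (pos 9 / 1 * v + pos 3 / 1) ≡ pos 9 / 1 * (pos 1 / 9 * (X - pos 3 / 1) - v)
      l = solve-∀ ring
    at : ∀ {v} d → u ≡ v → let x = pos 9 / 1 * v + pos 3 / 1 in x * x * x + - (pos 108 / 1) * x + pos 297 / 1 ≡ d * d →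
      Torsion (- (pos 108 / 1)) (pos 297 / 1) (aff x d) → Torsion (- (pos 108 / 1)) (pos 297 / 1) (aff x (- d)) → Goal
    at {v} d eq d² t t′ = subst (λ x → Torsion (- (pos 108 / 1)) (pos 297 / 1) (aff x Y)) (sym (X≡ eq))
      (torsion-± (- (pos 108 / 1)) (pos 297 / 1) {d} {_} {Y} t t′ (square-root d Y (trans (trans on (cong (λ x → x * x * x + - (pos 108 / 1) * x + pos 297 / 1) (X≡ eq))) d²)))
    at-0 : u ≡ 0ℚ → Goal
    -- `Torsion` counts from one, so the witness 5 asserts that six times the point is O; six works
    -- for all the points at once.
    at-0 eq = at 0ℚ eq refl (5 , refl) (5 , refl)
    at-1 : u ≡ 1ℚ → Goal
    at-1 eq = at (pos 27 / 1) eq refl (5 , refl) (5 , refl)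
    at--1 : u ≡ - 1ℚ → Goal
    at--1 eq = at (pos 27 / 1) eq refl (5 , refl) (5 , refl)

  -- Here X = 9u - 12 and Y = 27y, and all affine points have order 5, which the witness 4 of
  -- `Torsion` expresses.
  rankZero-11 : RankZero (- (pos 432 / 1)) (pos 8208 / 1)
  rankZero-11 O _ = 0 , refl
  rankZero-11 (aff X Y) on = [ at (pos 108 / 1) refl (4 , refl) (4 , refl) , at (pos 108 / 1) refl (4 , refl) (4 , refl) ]′
      (curve11-points u (pos 1 / 27 * Y) (linear (pos 1 / 729) (e X Y) on))
    where
    Goal = Torsion (- (pos 432 / 1)) (pos 8208 / 1) (aff X Y)
    u = pos 1 / 9 * (X + pos 12 / 1)
    e : ∀ X Y → let u = pos 1 / 9 * (X + pos 12 / 1) ; y = pos 1 / 27 * Y in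
      y * y - (u * u * u - ℚ4 * (u * u) + ℚ4 * ℚ4) ≡ pos 1 / 729 * (Y * Y - (X * X * X + - (pos 432 / 1) * X + pos 8208 / 1))
    e = solve-∀ ring
    X≡ : ∀ {v} → u ≡ v → X ≡ pos 9 / 1 * v - pos 12 / 1
    X≡ {v} eq = linear (pos 9 / 1) (l X v) eq
      where
      l : ∀ X v → X - (pos 9 / 1 * v - pos 12 / 1) ≡ pos 9 / 1 * (pos 1 / 9 * (X + pos 12 / 1) - v)
      l = solve-∀ ring
    at : ∀ {v} d → let x = pos 9 / 1 * v - pos 12 / 1 in x * x * x + - (pos 432 / 1) * x + pos 8208 / 1 ≡ d * d →
      Torsion (- (pos 432 / 1)) (pos 8208 / 1) (aff x d) → Torsion (- (pos 432 / 1)) (pos 8208 / 1) (aff x (- d)) → u ≡ v → Goal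
    at {v} d d² t t′ eq = subst (λ x → Torsion (- (pos 432 / 1)) (pos 8208 / 1) (aff x Y)) (sym (X≡ eq))
      (torsion-± (- (pos 432 / 1)) (pos 8208 / 1) {d} {_} {Y} t t′ (square-root d Y (trans (trans on (cong (λ x → x * x * x + - (pos 432 / 1) * x + pos 8208 / 1) (X≡ eq))) d²)))

  module _ (a b c : ℚ) (abc≢0 : a * b * c ≢ 0ℚ) where
    a≢0 : a ≢ 0ℚ
    a≢0 refl = abc≢0 (e b c)
      where
      e : ∀ b c → 0ℚ * b * c ≡ 0ℚ
      e = solve-∀ ring
    b≢0 : b ≢ 0ℚ
    b≢0 refl = abc≢0 (e a c)
      where
      e : ∀ a c → a * 0ℚ * c ≡ 0ℚ
      e = solve-∀ ring
    c≢0 : c ≢ 0ℚ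
    c≢0 refl = abc≢0 (*-zeroʳ (a * b))
    ac≢0 : a * c ≢ 0ℚ
    ac≢0 = p≢0∧q≢0⇒p*q≢0 a≢0 c≢0
    bc≢0 : b * c ≢ 0ℚ
    bc≢0 = p≢0∧q≢0⇒p*q≢0 b≢0 c≢0

    -- The factor 1/(bc) undoes the twist, and `s` clears the denominators that q leaves in the
    -- coefficients; for q = 8/27 and 4/27 the values 9/2 and 9 lead to the models with known
    -- points.
    E3-rankZero : ∀ {A B} q s → s ≢ 0ℚ → a * c ≡ q * (b * b) → - (pos 3 / 1 * (q * q)) * s ⁴ ≡ A → q * q * (1ℚ - (q + q)) * s ⁶ ≡ B →
      RankZero A B → RankZero (E3A a b c) (E3B a b c)
    E3-rankZero q s s≢0 ac≡ refl refl = rankZero-unscale (s * j) sj≢0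
        (sym (trans (cong (sj⁴ *_) (E3A-twist {a} {b} {c} {q} ac≡)) (trans (e₁ (- (pos 3 / 1 * (q * q))) s j (b * c)) (trans (cong (λ w → - (pos 3 / 1 * (q * q)) * s ⁴ * w ⁴) bcj≡1) (*-identityʳ _)))))
        (sym (trans (cong (sj⁶ *_) (E3B-twist {a} {b} {c} {q} ac≡)) (trans (e₂ (q * q * (1ℚ - (q + q))) s j (b * c)) (trans (cong (λ w → q * q * (1ℚ - (q + q)) * s ⁶ * w ⁶) bcj≡1) (*-identityʳ _)))))
      where
      j = inv (b * c)
      sj⁴ = (s * j) ⁴
      sj⁶ = (s * j) ⁶
      bcj≡1 : b * c * j ≡ 1ℚ
      bcj≡1 = inv-inverseʳ (b * c) bc≢0
      j≢0 : j ≢ 0ℚ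
      j≢0 j≡0 = 1≢0 (trans (sym bcj≡1) (trans (cong (b * c *_) j≡0) (*-zeroʳ (b * c))))
      sj≢0 : s * j ≢ 0ℚ
      sj≢0 = p≢0∧q≢0⇒p*q≢0 s≢0 j≢0
      e₁ : ∀ A s j x → s * j * (s * j) * (s * j) * (s * j) * (A * (x * x * x * x)) ≡ A * (s * s * s * s) * (x * j * (x * j) * (x * j) * (x * j))
      e₁ = solve-∀ ring
      e₂ : ∀ A s j x → s * j * (s * j) * (s * j) * (s * j) * (s * j) * (s * j) * (A * (x * x * x * x * x * x))
         ≡ A * (s * s * s * s * s * s) * (x * j * (x * j) * (x * j) * (x * j) * (x * j) * (x * j))
      e₂ = solve-∀ ring

    -- With m/n the reduced form of b²/(ac), scaling by bc/m carries the integral family to the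
    -- given curve. The three excluded ratios 4, 27/4 and 27/8 become the conditions on m and n.
    E3-positiveRank : (pos 4 / 1) * a * c - b * b ≢ 0ℚ → b * b ≢ (pos 27 / 8) * a * c → b * b ≢ (pos 27 / 4) * a * c → PositiveRank (E3A a b c) (E3B a b c)
    E3-positiveRank Δ≢0 b²≢27/8 b²≢27/4 = positiveRank-scale (b * c * i) bci≢0
        (trans (E3A-twist {a} {b} {c} {q} ac≡) (sym (trans (e₁ M N i (b * c)) (trans (cong (λ w → - (pos 3 / 1 * (q * q)) * (b * c) ⁴ * (w * w)) Mi≡1) (*-identityʳ _)))))
        (trans (E3B-twist {a} {b} {c} {q} ac≡) (sym (trans (e₂ M N i (b * c)) (trans (cong (λ w → q * q * (w - (q + q)) * (b * c) ⁶ * (w * w * w)) Mi≡1) (*-identityʳ _)))))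
        (family-positiveRank m n m≢0 (ℤ.+<+ (s≤s z≤n)) (numerator-coprime k) m≢4n 4m≢27n 8m≢27n)
      where
      k = b * b * inv (a * c)
      m = ↥ k
      n = ↧ k
      M = ι m
      N = ι n
      i = inv M
      q = N * i
      k*ac : k * (a * c) ≡ b * b
      k*ac = trans (e (b * b) (a * c) (inv (a * c))) (trans (cong (b * b *_) (inv-inverseʳ (a * c) ac≢0)) (*-identityʳ _))
        where
        e : ∀ x y i → x * i * y ≡ x * (y * i)
        e = solve-∀ ring
      kN≡M : k * N ≡ M
      kN≡M = x*↧x≡↥x k
      N≢0 : N ≢ 0ℚ
      N≢0 = ι≢0 λ ()
      k≢0 : k ≢ 0ℚ
      k≢0 k≡0 = p≢0∧q≢0⇒p*q≢0 b≢0 b≢0 (trans (sym k*ac) (trans (cong (_* (a * c)) k≡0) (*-zeroˡ (a * c))))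
      M≢0 : M ≢ 0ℚ
      M≢0 M≡0 = p≢0∧q≢0⇒p*q≢0 k≢0 N≢0 (trans kN≡M M≡0)
      Mi≡1 : M * i ≡ 1ℚ
      Mi≡1 = inv-inverseʳ M M≢0
      i≢0 : i ≢ 0ℚ
      i≢0 i≡0 = 1≢0 (trans (sym Mi≡1) (trans (cong (M *_) i≡0) (*-zeroʳ M)))
      bci≢0 : b * c * i ≢ 0ℚ
      bci≢0 = p≢0∧q≢0⇒p*q≢0 bc≢0 i≢0
      m≢0 : m ≢ 0ℤ
      m≢0 m≡0 = M≢0 (trans (cong ι m≡0) ι-0)
      ac≡ : a * c ≡ q * (b * b)
      ac≡ = sym (trans (cong (q *_) (sym k*ac)) (trans (e N i k (a * c)) (trans (cong (λ w → w * i * (a * c)) kN≡M) (trans (cong (_* (a * c)) Mi≡1) (*-identityˡ _)))))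
        where
        e : ∀ N i k x → N * i * (k * x) ≡ k * N * i * x
        e = solve-∀ ring
      -- p m = p′ n means b² = (p′ / p) a c.
      ratio : ∀ p p′ → p ℤ.* m ≡ p′ ℤ.* n → ι p * (b * b) ≡ ι p′ * (a * c)
      ratio p p′ eq = trans (cong (ι p *_) (sym k*ac)) (trans (sym (*-assoc (ι p) k (a * c))) (cong (_* (a * c)) (Rationals.*-cancelˡ N N≢0 (trans (e N (ι p) k)
          (trans (cong (ι p *_) kN≡M) (trans (sym (ι-* p m)) (trans (cong ι eq) (trans (ι-* p′ n) (*-comm (ι p′) N)))))))))
        where
        e : ∀ N p k → N * (p * k) ≡ p * (k * N)
        e = solve-∀ ring
      ratio′ : ∀ p p′ {x y} → ι p ≡ x → ι p′ ≡ y → p ℤ.* m ≡ p′ ℤ.* n → x * (b * b) ≡ y * (a * c)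
      ratio′ p p′ refl refl = ratio p p′
      m≢4n : m ≢ pos 4 ℤ.* n
      m≢4n eq = Δ≢0 (linear (- 1ℚ) (e a b c) (ratio′ (pos 1) (pos 4) {1ℚ} {pos 4 / 1} ι-1 (ι≡mkℚ (pos 4)) (trans (ℤ.*-identityˡ m) eq)))
        where
        e : ∀ a b c → (pos 4 / 1) * a * c - b * b - 0ℚ ≡ - 1ℚ * (1ℚ * (b * b) - (pos 4 / 1) * (a * c))
        e = solve-∀ ring
      4m≢27n : pos 4 ℤ.* m ≢ pos 27 ℤ.* n
      4m≢27n eq = b²≢27/4 (linear (pos 1 / 4) (e a b c) (ratio′ (pos 4) (pos 27) {pos 4 / 1} {pos 27 / 1} (ι≡mkℚ (pos 4)) (ι≡mkℚ (pos 27)) eq))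
        where
        e : ∀ a b c → b * b - (pos 27 / 4) * a * c ≡ pos 1 / 4 * (pos 4 / 1 * (b * b) - pos 27 / 1 * (a * c))
        e = solve-∀ ring
      8m≢27n : pos 8 ℤ.* m ≢ pos 27 ℤ.* n
      8m≢27n eq = b²≢27/8 (linear (pos 1 / 8) (e a b c) (ratio′ (pos 8) (pos 27) {pos 8 / 1} {pos 27 / 1} (ι≡mkℚ (pos 8)) (ι≡mkℚ (pos 27)) eq))
        where
        e : ∀ a b c → b * b - (pos 27 / 8) * a * c ≡ pos 1 / 8 * (pos 8 / 1 * (b * b) - pos 27 / 1 * (a * c))
        e = solve-∀ ring
      e₁ : ∀ M N i x → let l = x * i ; q = N * i ; w = M * i in l * l * l * l * - (M * M * (N * N) + M * M * (N * N) + M * M * (N * N))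
         ≡ - (pos 3 / 1 * (q * q)) * (x * x * x * x) * (w * w)
      e₁ = solve-∀ ring
      e₂ : ∀ M N i x → let l = x * i ; q = N * i ; w = M * i in l * l * l * l * l * l * (M * M * M * (M - (N + N)) * (N * N))
         ≡ q * q * (w - (q + q)) * (x * x * x * x * x * x) * (w * w * w)
      e₂ = solve-∀ ring

    E3-rankZero-27/8 : b * b ≡ (pos 27 / 8) * a * c → RankZero (E3A a b c) (E3B a b c)
    E3-rankZero-27/8 eq = E3-rankZero (pos 8 / 27) (pos 9 / 2) (λ ()) (linear (- (pos 8 / 27)) (e a b c) eq) refl refl rankZero-20
      where
      e : ∀ a b c → a * c - pos 8 / 27 * (b * b) ≡ - (pos 8 / 27) * (b * b - (pos 27 / 8) * a * c)
      e = solve-∀ ring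

    E3-rankZero-27/4 : b * b ≡ (pos 27 / 4) * a * c → RankZero (E3A a b c) (E3B a b c)
    E3-rankZero-27/4 eq = E3-rankZero (pos 4 / 27) (pos 9 / 1) (λ ()) (linear (- (pos 4 / 27)) (e a b c) eq) refl refl rankZero-11
      where
      e : ∀ a b c → a * c - pos 4 / 27 * (b * b) ≡ - (pos 4 / 27) * (b * b - (pos 27 / 4) * a * c)
      e = solve-∀ ring

open Twists using (E3-positiveRank; E3-rankZero-27/8; E3-rankZero-27/4)
open import Data.Integer using (+_)
open import Data.Rational using (ℚ; 0ℚ; _*_; _-_; _/_)

theorem2p6 : (a b c : ℚ) → a * b * c ≢ 0ℚ → (+ 4 / 1) * a * c - b * b ≢ 0ℚ →
    ((b * b ≢ (+ 27 / 8) * a * c → b * b ≢ (+ 27 / 4) * a * c → PositiveRank (E3A a b c) (E3B a b c))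
    × (b * b ≡ (+ 27 / 8) * a * c ⊎ b * b ≡ (+ 27 / 4) * a * c → RankZero (E3A a b c) (E3B a b c)))
theorem2p6 a b c abc≢0 Δ≢0 = E3-positiveRank a b c abc≢0 Δ≢0 , [ E3-rankZero-27/8 a b c abc≢0 , E3-rankZero-27/4 a b c abc≢0 ]′
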